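{- Let $x$, $y$, $z$, $k$ be non-negative integers, $k\leq x,y,z$, and assume that $x$, $z$, and $k$ have parity opposite to the parity of $y$. Then \begin{align*} \operatorname{M}_{\odot}(B'_{x,y,z,k})={}&P\left(\tfrac{y+k+1}{2},\tfrac{z-k}{2},k\right) \prod_{i=1}^{(y-k-1)/2}\frac{\left(\frac{x-k}{2}+i\right)_k}{(i)_k} \\ &\times\prod_{i=1}^{(z-k)/2}\frac{\left(\frac{x+k}{2}+i\right)_{(y-k-1)/2}}{(k+i)_{(y-k-1)/2}} \frac{\left(\frac{x+k}{2}+i\right)_{(y+k+1)/2}}{(k+i)_{(y+k+1)/2}}. \end{align*}
   Context: $P(x,y,z)=\prod_{i=1}^x\prod_{j=1}^y\prod_{k=1}^z \frac{i+j+k-1}{i+j+k-2}$, and $(a)_k$ is the Pochhammer symbol (rising factorial). For $x,z$ of the same parity and $y$ of the opposite parity, the center of the hexagon $H_{x,y,z}$ (side-lengths $x,y,z,x,y,z$ in cyclic order on the triangular lattice) is the midpoint of a lattice segment $s$ parallel to the polar direction $2\pi/3$; $B'_{x,y,z,k}$ is obtained from $H_{x,y,z}$ by removing a ``disconnected bowtie'' consisting of two equilateral triangles of side-length $k$ placed so that $s$ joins their closest vertices (the triangles' edges not incident to those vertices being parallel to the sides of length $z$). $\operatorname{M}_{\odot}(R)$ denotes the number of centrally symmetric lozenge tilings of the region $R$. -}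

module Defs where

open import Data.Bool using (Bool; true; false; _∧_; _∨_; not; if_then_else_)
open import Data.Nat as ℕ using (ℕ; zero; suc)
open import Data.Integer as ℤ using (ℤ; +_; _≤ᵇ_)
open import Data.Fin using (Fin; zero; suc)
open import Data.List using (List; []; _∷_; map; concatMap; filter; length; upTo; zip; foldr)
open import Data.Bool.ListAction using (all; any)
open import Data.Maybe using (Maybe; just; nothing)
open import Data.Product using (_×_; _,_; proj₁; proj₂)
open import Data.Rational as ℚ using (ℚ; 1ℚ; 0ℚ)
open import Relation.Nullary.Decidable using (⌊_⌋)

-- Triangular lattice.  A lattice point is a·e₁ + b·e₂ with
-- e₁ = unit vector of direction 0 and e₂ = unit vector of direction π/3,
-- written as the pair (a , b) of integers.
--
-- Unit triangles are named by a pair (a , b):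
--   up-triangle   (a , b) has vertices (a,b), (a+1,b), (a,b+1);
--   down-triangle (a , b) has vertices (a+1,b), (a,b+1), (a+1,b+1).
-- A lozenge is the union of an up-triangle and an adjacent down-triangle;
-- up-triangle (a,b) is adjacent (shares an edge) exactly with the
-- down-triangles (a,b), (a-1,b) and (a,b-1).

Pt : Set
Pt = ℤ × ℤ

_==ℤ_ : ℤ → ℤ → Bool
m ==ℤ n = ⌊ m ℤ.≟ n ⌋

_==P_ : Pt → Pt → Bool
(a , b) ==P (c , d) = (a ==ℤ c) ∧ (b ==ℤ d)

upVerts : Pt → List Pt
upVerts (a , b) = (a , b) ∷ (a ℤ.+ ℤ.1ℤ , b) ∷ (a , b ℤ.+ ℤ.1ℤ) ∷ []

downVerts : Pt → List Pt
downVerts (a , b) =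
  (a ℤ.+ ℤ.1ℤ , b) ∷ (a , b ℤ.+ ℤ.1ℤ) ∷ (a ℤ.+ ℤ.1ℤ , b ℤ.+ ℤ.1ℤ) ∷ []

neighbour : Pt → Fin 3 → Pt
neighbour (a , b) zero             = (a , b)
neighbour (a , b) (suc zero)       = (a ℤ.- ℤ.1ℤ , b)
neighbour (a , b) (suc (suc zero)) = (a , b ℤ.- ℤ.1ℤ)

-- The hexagon H_{x,y,z}.  Its sides, in counterclockwise order, have
-- directions 0, π/3, 2π/3, π, 4π/3, 5π/3 and lengths x, y, z, x, y, z.
-- (This is the paper's picture rotated by -π/3, so the y-sides and the
-- segment s are parallel to e₂ and the z-sides to direction 2π/3.)
-- Vertices: (z,0), (x+z,0), (x+z,y), (x,y+z), (0,y+z), (0,z); i.e.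
--   H = { (a,b) : 0 ≤ a ≤ x+z, 0 ≤ b ≤ y+z, z ≤ a+b ≤ x+y+z }.

inHex : ℕ → ℕ → ℕ → Pt → Bool
inHex x y z (a , b) =
  (+ 0 ≤ᵇ a) ∧ (a ≤ᵇ + (x ℕ.+ z)) ∧ (+ 0 ≤ᵇ b) ∧ (b ≤ᵇ + (y ℕ.+ z)) ∧
  (+ z ≤ᵇ a ℤ.+ b) ∧ (a ℤ.+ b ≤ᵇ + (x ℕ.+ y ℕ.+ z))

-- With x, z of equal parity and y of the other parity, the centre of H is
-- (c , d + 1/2) with c = (x+z)/2, d = (y+z-1)/2: the midpoint of the
-- lattice segment s from (c,d) to (c,d+1).
cx : ℕ → ℕ → ℕ → ℤ
cx x y z = + ((x ℕ.+ z) ℕ./ 2)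

cy : ℕ → ℕ → ℕ → ℤ
cy x y z = + ((y ℕ.+ z ℕ.∸ 1) ℕ./ 2)

-- The disconnected bowtie: the triangle T₁ with vertices (c,d), (c-k,d),
-- (c,d-k) and the triangle T₂ with vertices (c,d+1), (c+k,d+1), (c,d+1+k).
-- s joins their closest vertices (c,d) and (c,d+1); the sides not
-- incident to these vertices are parallel to (-1,1), i.e. to the z-sides.
inT1 : ℕ → ℕ → ℕ → ℕ → Pt → Bool
inT1 x y z k (a , b) =
  (a ≤ᵇ cx x y z) ∧ (b ≤ᵇ cy x y z) ∧ (cx x y z ℤ.+ cy x y z ℤ.- + k ≤ᵇ a ℤ.+ b)

inT2 : ℕ → ℕ → ℕ → ℕ → Pt → Bool
inT2 x y z k (a , b) =
  (cx x y z ≤ᵇ a) ∧ (cy x y z ℤ.+ ℤ.1ℤ ≤ᵇ b) ∧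
  (a ℤ.+ b ≤ᵇ cx x y z ℤ.+ cy x y z ℤ.+ ℤ.1ℤ ℤ.+ + k)

-- a unit triangle (given by its vertex list) is contained in a convex set
-- iff all its vertices are
inside : (Pt → Bool) → List Pt → Bool
inside S vs = all S vs

triInRegion : ℕ → ℕ → ℕ → ℕ → List Pt → Bool
triInRegion x y z k vs =
  inside (inHex x y z) vs ∧ not (inside (inT1 x y z k) vs) ∧ not (inside (inT2 x y z k) vs)

box : ℕ → ℕ → ℕ → List Pt
box x y z = concatMap (λ a → map (λ b → (+ a , + b)) (upTo (suc (y ℕ.+ z))))
                      (upTo (suc (x ℕ.+ z)))

upTris : ℕ → ℕ → ℕ → ℕ → List Pt
upTris x y z k = filter (λ p → triInRegion x y z k (upVerts p) Data.Bool.≟ true) (box x y z)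
  where import Data.Bool

downTris : ℕ → ℕ → ℕ → ℕ → List Pt
downTris x y z k = filter (λ p → triInRegion x y z k (downVerts p) Data.Bool.≟ true) (box x y z)
  where import Data.Bool

memP : Pt → List Pt → Bool
memP p ps = any (_==P p) ps

countP : Pt → List Pt → ℕ
countP p ps = length (filter (λ q → (q ==P p) Data.Bool.≟ true) ps)
  where import Data.Bool

-- Lozenge tilings = perfect matchings of the dual graph.
-- A candidate is a choice, for each up-triangle of the region (in the
-- order of the list upTris), of one of its three adjacent down-triangles.
-- It is a tiling iff every chosen down-triangle lies in the region and
-- every down-triangle of the region is chosen exactly once.

choices : ℕ → List (List (Fin 3))
choices zero    = [] ∷ []
choices (suc n) = concatMap (λ c → map (c ∷_) (choices n))
                            (zero ∷ suc zero ∷ suc (suc zero) ∷ [])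

pairsOf : List Pt → List (Fin 3) → List (Pt × Pt)
pairsOf ups cs = zip ups (zipNb ups cs)
  where
  zipNb : List Pt → List (Fin 3) → List Pt
  zipNb (u ∷ us) (c ∷ cs) = neighbour u c ∷ zipNb us cs
  zipNb _ _ = []

isTiling : ℕ → ℕ → ℕ → ℕ → List (Pt × Pt) → Bool
isTiling x y z k prs =
  all (λ pr → memP (proj₂ pr) (downTris x y z k)) prs ∧
  all (λ d → countP d (map proj₂ prs) ℕ.≡ᵇ 1) (downTris x y z k)

-- rotation by π about the centre (c , d + 1/2): (a,b) ↦ (2c-a, 2d+1-b).
-- It maps up-triangle (a,b) to down-triangle (2c-a-1, 2d-b) and
-- down-triangle (a,b) to up-triangle (2c-a-1, 2d-b).
rotTri : ℕ → ℕ → ℕ → Pt → Pt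
rotTri x y z (a , b) =
  ((cx x y z ℤ.+ cx x y z ℤ.- ℤ.1ℤ) ℤ.- a , (cy x y z ℤ.+ cy x y z) ℤ.- b)

partnerOf : List (Pt × Pt) → Pt → Maybe Pt
partnerOf [] u = nothing
partnerOf ((v , d) ∷ prs) u = if v ==P u then just d else partnerOf prs u

eqMaybeP : Maybe Pt → Maybe Pt → Bool
eqMaybeP (just p) (just q) = p ==P q
eqMaybeP nothing  nothing  = true
eqMaybeP _        _        = false

-- the tiling (set of lozenges {u,d}) is invariant under the rotation:
-- each lozenge {u,d} is sent to the lozenge {rot d, rot u}
isSymmetric : ℕ → ℕ → ℕ → List (Pt × Pt) → Bool
isSymmetric x y z prs =
  all (λ pr → eqMaybeP (partnerOf prs (rotTri x y z (proj₂ pr)))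
                       (just (rotTri x y z (proj₁ pr)))) prs

McsBowtie : ℕ → ℕ → ℕ → ℕ → ℕ
McsBowtie x y z k =
  length (filter (λ cs → (isTiling x y z k (pairsOf ups cs) ∧
                          isSymmetric x y z (pairsOf ups cs)) Data.Bool.≟ true)
                 (choices (length ups)))
  where
  import Data.Bool
  ups = upTris x y z k

-- n / d as a rational (only used with d ≠ 0; d = 0 gives 0)
_//_ : ℕ → ℕ → ℚ
n // zero  = 0ℚ
n // suc d = (+ n) ℚ./ suc d

prodQ : ℕ → (ℕ → ℚ) → ℚ
prodQ zero    f = 1ℚ
prodQ (suc n) f = prodQ n f ℚ.* f (suc n)

poch : ℕ → ℕ → ℕ
poch a zero    = 1
poch a (suc k) = poch a k ℕ.* (a ℕ.+ k)

P : ℕ → ℕ → ℕ → ℚ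
P x y z = prodQ x (λ i → prodQ y (λ j → prodQ z (λ k →
            (i ℕ.+ j ℕ.+ k ℕ.∸ 1) // (i ℕ.+ j ℕ.+ k ℕ.∸ 2))))

{-# OPTIONS --safe #-}
module Submission where

-- Cut the region along the line a = c through its centre. The lozenges that cross the lines
-- a = 0, …, c of the left half form a Gelfand–Tsetlin pattern whose top row, on the line a = c, is
-- symmetric about the centre, and the symmetry rebuilds the right half of the tiling from the left
-- one. The top row consists of the k positions hidden by the removed triangle, of forced positions
-- at one end, and of m pairs of positions symmetric about the centre, indexed by an m-subset C. The
-- number of patterns with a given top row is its Vandermonde product over a superfactorial, so the
-- number of tilings is a constant times Σ_C det(p_j(c))² ∏ w(c), where p_j is the Newton basis of a
-- quadratic lattice and w a Racah weight. The discrete Pearson equation of w (Rodrigues' formula)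
-- reduces this sum to the one for m − 1 with shifted parameters, hence its closed form.

-- The two determinants in the summand are used in opposite directions. One is expanded downwards,
-- as a sum over the rows T interlacing C. After the two summations are exchanged, the other one,
-- together with the weights, is summed over all C that T can interlace; a discrete primitive turns
-- this sum into a single determinant bordered by the two end points. What is left is again a
-- squared determinant with weights, one size smaller. Closed forms are kept as products over the
-- integers, each denominator standing on the other side.
--
-- The geometric obstacle is that the left half of the region is not a trapezoid: a corner is cut
-- off when x and z differ, and the removed triangle makes a dent. Both are filled by declaring
-- every position outside the region occupied. Interlacing hands runs of occupied positions down
-- from row to row, so the last row alone records the region, and ordinary Gelfand-Tsetlin patterns
-- remain. A tiling is a direction for each up-triangle; by the rotation, the down-triangles of the
-- left half are read off the up-triangles of the right half.

module Determinant where

  open import Data.Integer using (ℤ; 0ℤ; 1ℤ; -1ℤ; _+_; _*_; _-_; -_)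
  open import Data.Integer.Properties using (+-identityʳ; +-identityˡ; *-zeroʳ; *-identityˡ; *-assoc; *-comm)
  open import Data.Integer.Tactic.RingSolver using (solve-∀)
  open import Data.List using (List; []; _∷_; _++_; map; length)
  open import Data.List.Properties using (map-++; ++-assoc; map-∘)
  open import Data.List.Relation.Binary.Pointwise as Pw using (Pointwise; []; _∷_)
  open import Data.List.Relation.Unary.All using (All; []; _∷_)
  open import Data.Nat using (ℕ; zero; suc)
  open import Function using (_∘_)
  open import Relation.Binary.PropositionalEquality using (_≡_; refl; sym; trans; cong; cong₂; module ≡-Reasoning)

  -- Determinants of matrices given as lists of rows

  Row : Set
  Row = ℕ → ℤ

  infix 4 _≗ᵣ_
  _≗ᵣ_ : Row → Row → Set
  r ≗ᵣ s = ∀ j → r j ≡ s j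

  -- The alternating sum of `F r R` over all ways to take one row `r` out of the list, `R` being the
  -- others in their order. With `F` left abstract, each property of the determinant becomes an
  -- induction on this expansion.
  lap : (Row → List Row → ℤ) → List Row → ℤ
  lap F []       = 0ℤ
  lap F (r ∷ rs) = F r rs - lap (λ q R → F q (r ∷ R)) rs

  shift : Row → Row
  shift r j = r (suc j)

  -- det n rs is the determinant of the first n columns of n rows, expanded along the
  -- first column; it is set to 0 when there are more than n rows, so that it stays
  -- multilinear and alternating for every list of rows.
  det : ℕ → List Row → ℤ
  det zero    []      = 1ℤ
  det zero    (_ ∷ _) = 0ℤ
  det (suc n)         = lap (λ r R → r 0 * det n (map shift R))

  lap-cong₂ : ∀ {F G} → (∀ {q q′ R R′} → q ≗ᵣ q′ → Pointwise _≗ᵣ_ R R′ → F q R ≡ G q′ R′) →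
              ∀ {rs rs′} → Pointwise _≗ᵣ_ rs rs′ → lap F rs ≡ lap G rs′
  lap-cong₂ h []       = refl
  lap-cong₂ h (e ∷ es) = cong₂ _-_ (h e es) (lap-cong₂ (λ e′ es′ → h e′ (e ∷ es′)) es)

  lap-cong : ∀ {F G} → (∀ q R → F q R ≡ G q R) → ∀ rs → lap F rs ≡ lap G rs
  lap-cong h []       = refl
  lap-cong h (r ∷ rs) = cong₂ _-_ (h r rs) (lap-cong (λ q R → h q (r ∷ R)) rs)

  det-cong : ∀ n {rs rs′} → Pointwise _≗ᵣ_ rs rs′ → det n rs ≡ det n rs′
  det-cong zero    []      = refl
  det-cong zero    (_ ∷ _) = refl
  det-cong (suc n) es      =
    lap-cong₂ (λ e es′ → cong₂ _*_ (e 0) (det-cong n (Pw.map⁺ shift shift (Pw.map (λ f j → f (suc j)) es′)))) es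

  map-pointwise : ∀ {A : Set} {f g : A → Row} → (∀ t → f t ≗ᵣ g t) → ∀ ts → Pointwise _≗ᵣ_ (map f ts) (map g ts)
  map-pointwise h []       = []
  map-pointwise h (t ∷ ts) = h t ∷ map-pointwise h ts

  det-map-cong : ∀ n {A : Set} {f g : A → Row} → (∀ t → f t ≗ᵣ g t) → ∀ ts → det n (map f ts) ≡ det n (map g ts)
  det-map-cong n h ts = det-cong n (map-pointwise h ts)

  pointwise-refl : ∀ {rs} → Pointwise _≗ᵣ_ rs rs
  pointwise-refl = Pw.refl (λ _ → refl)

  -- Additivity and homogeneity in one operation, so that multilinearity takes a single induction.
  comb : ℤ → Row → Row → Row
  comb a r s j = a * r j + s j

  lap-linear : ∀ a F G rs → lap (λ q R → a * F q R + G q R) rs ≡ a * lap F rs + lap G rs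
  lap-linear a F G []       = sym (trans (+-identityʳ (a * 0ℤ)) (*-zeroʳ a))
  lap-linear a F G (r ∷ rs) =
    trans (cong (λ t → a * F r rs + G r rs - t) (lap-linear a (λ q R → F q (r ∷ R)) (λ q R → G q (r ∷ R)) rs))
          (regroup a (F r rs) (G r rs) _ _)
    where
    regroup : ∀ a f g x y → a * f + g - (a * x + y) ≡ a * (f - x) + (g - y)
    regroup = solve-∀

  lap-comb : ∀ a r s F → (∀ R → F (comb a r s) R ≡ a * F r R + F s R) →
             (∀ q xs ys → F q (xs ++ comb a r s ∷ ys) ≡ a * F q (xs ++ r ∷ ys) + F q (xs ++ s ∷ ys)) →
             ∀ xs ys → lap F (xs ++ comb a r s ∷ ys) ≡ a * lap F (xs ++ r ∷ ys) + lap F (xs ++ s ∷ ys)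
  lap-comb a r s F h₁ h₂ [] ys =
    trans (cong₂ _-_ (h₁ ys) (trans (lap-cong (λ q R → h₂ q [] R) ys)
                                    (lap-linear a (λ q R → F q (r ∷ R)) (λ q R → F q (s ∷ R)) ys)))
          (regroup a (F r ys) (F s ys) _ _)
    where
    regroup : ∀ a f g x y → a * f + g - (a * x + y) ≡ a * (f - x) + (g - y)
    regroup = solve-∀
  lap-comb a r s F h₁ h₂ (x ∷ xs) ys =
    trans (cong₂ _-_ (h₂ x xs ys)
             (lap-comb a r s (λ q R → F q (x ∷ R)) (λ R → h₂′ R) (λ q xs′ ys′ → h₂ q (x ∷ xs′) ys′) xs ys))
          (regroup a _ _ _ _)
    where
    regroup : ∀ a f g x y → a * f + g - (a * x + y) ≡ a * (f - x) + (g - y)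
    regroup = solve-∀
    h₂′ : ∀ R → F (comb a r s) (x ∷ R) ≡ a * F r (x ∷ R) + F s (x ∷ R)
    h₂′ R = h₁ (x ∷ R)

  det-comb : ∀ n a r s xs ys → det n (xs ++ comb a r s ∷ ys) ≡ a * det n (xs ++ r ∷ ys) + det n (xs ++ s ∷ ys)
  det-comb zero a r s []      ys = sym (trans (+-identityʳ (a * 0ℤ)) (*-zeroʳ a))
  det-comb zero a r s (_ ∷ _) ys = sym (trans (+-identityʳ (a * 0ℤ)) (*-zeroʳ a))
  det-comb (suc n) a r s xs ys =
    lap-comb a r s (λ r R → r 0 * det n (map shift R)) (λ R → distr a (r 0) (s 0) (det n (map shift R))) inner xs ys
    where
    distr : ∀ a x y d → (a * x + y) * d ≡ a * (x * d) + y * d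
    distr = solve-∀
    distr′ : ∀ a q x y → q * (a * x + y) ≡ a * (q * x) + q * y
    distr′ = solve-∀
    inner : ∀ q xs ys → q 0 * det n (map shift (xs ++ comb a r s ∷ ys))
                      ≡ a * (q 0 * det n (map shift (xs ++ r ∷ ys))) + q 0 * det n (map shift (xs ++ s ∷ ys))
    inner q xs ys rewrite map-++ shift xs (comb a r s ∷ ys) | map-++ shift xs (r ∷ ys) | map-++ shift xs (s ∷ ys) =
      trans (cong (q 0 *_) (det-comb n a (shift r) (shift s) (map shift xs) (map shift ys))) (distr′ a (q 0) _ _)

  pointwise-mid : ∀ {r s} xs {ys} → r ≗ᵣ s → Pointwise _≗ᵣ_ (xs ++ r ∷ ys) (xs ++ s ∷ ys)
  pointwise-mid xs e = Pw.++⁺ (pointwise-refl {xs}) (e ∷ pointwise-refl)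

  -- The row equals its own combination -r + r, so by multilinearity the determinant d equals -d +
  -- d.
  det-zeroRow : ∀ n {r} xs ys → (∀ j → r j ≡ 0ℤ) → det n (xs ++ r ∷ ys) ≡ 0ℤ
  det-zeroRow n {r} xs ys z =
    trans (det-cong n (pointwise-mid xs (λ j → trans (z j) (sym (trans (cong₂ _+_ (cong (-1ℤ *_) (z j)) (z j)) refl)))))
          (trans (det-comb n -1ℤ r r xs ys) (cancel (det n (xs ++ r ∷ ys))))
    where
    cancel : ∀ d → -1ℤ * d + d ≡ 0ℤ
    cancel = solve-∀

  det-scaleRow : ∀ n a r xs ys → det n (xs ++ (λ j → a * r j) ∷ ys) ≡ a * det n (xs ++ r ∷ ys)
  det-scaleRow n a r xs ys =
    trans (det-cong n (pointwise-mid xs (λ j → sym (+-identityʳ (a * r j)))))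
          (trans (det-comb n a r (λ _ → 0ℤ) xs ys)
                 (trans (cong (a * det n (xs ++ r ∷ ys) +_) (det-zeroRow n xs ys (λ _ → refl))) (+-identityʳ _)))

  -- Taking out either copy of `r` leaves the same list, with opposite signs; all other terms vanish
  -- by the hypothesis on `F`.
  lap-alternating : ∀ r F → (∀ q xs ys → F q (xs ++ r ∷ r ∷ ys) ≡ 0ℤ) → ∀ xs ys → lap F (xs ++ r ∷ r ∷ ys) ≡ 0ℤ
  lap-zero : ∀ F → (∀ q R → F q R ≡ 0ℤ) → ∀ rs → lap F rs ≡ 0ℤ
  lap-zero F h []       = refl
  lap-zero F h (r ∷ rs) = cong₂ _-_ (h r rs) (lap-zero (λ q R → F q (r ∷ R)) (λ q R → h q (r ∷ R)) rs)
  lap-alternating r F h [] ys =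
    trans (cong (λ t → F r (r ∷ ys) - (F r (r ∷ ys) - t)) (lap-zero (λ q R → F q (r ∷ r ∷ R)) (λ q R → h q [] R) ys))
          (cancel (F r (r ∷ ys)))
    where
    cancel : ∀ f → f - (f - 0ℤ) ≡ 0ℤ
    cancel = solve-∀
  lap-alternating r F h (x ∷ xs) ys =
    cong₂ _-_ (h x xs ys) (lap-alternating r (λ q R → F q (x ∷ R)) (λ q xs′ ys′ → h q (x ∷ xs′) ys′) xs ys)

  det-alternating : ∀ n r xs ys → det n (xs ++ r ∷ r ∷ ys) ≡ 0ℤ
  det-alternating zero r []      ys = refl
  det-alternating zero r (_ ∷ _) ys = refl
  det-alternating (suc n) r xs ys = lap-alternating r (λ r R → r 0 * det n (map shift R)) inner xs ys
    where
    inner : ∀ q xs ys → q 0 * det n (map shift (xs ++ r ∷ r ∷ ys)) ≡ 0ℤ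
    inner q xs ys rewrite map-++ shift xs (r ∷ r ∷ ys) =
      trans (cong (q 0 *_) (det-alternating n (shift r) (map shift xs) (map shift ys))) (*-zeroʳ (q 0))

  -- Two rows taken out in the two possible orders give opposite signs and, `H` being symmetric,
  -- equal values. This is the column counterpart of `lap-alternating`: two equal columns.
  lap-lap-symmetric : ∀ (H : Row → Row → List Row → ℤ) → (∀ q r R → H q r R ≡ H r q R) →
                      ∀ rs → lap (λ q R → lap (λ r R′ → H q r R′) R) rs ≡ 0ℤ
  lap-lap-symmetric H sy [] = refl
  lap-lap-symmetric H sy (x ∷ rs) =
    trans (cong (λ t → lap (H x) rs - t)
            (trans (lap-cong (λ q R → trans (cong (_- lap (λ r R′ → H q r (x ∷ R′)) R) (sy q x R)) (as-linear (H x q R) _)) rs)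
                   (trans (lap-linear 1ℤ (H x) (λ q R → - lap (λ r R′ → H q r (x ∷ R′)) R) rs)
                          (cong (1ℤ * lap (H x) rs +_)
                            (trans (lap-cong (λ q R → as-neg (lap (λ r R′ → H q r (x ∷ R′)) R)) rs)
                              (trans (lap-linear -1ℤ (λ q R → lap (λ r R′ → H q r (x ∷ R′)) R) (λ _ _ → 0ℤ) rs)
                                (cong₂ (λ u w → -1ℤ * u + w) (lap-lap-symmetric (λ q r R → H q r (x ∷ R)) (λ q r R → sy q r (x ∷ R)) rs)
                                  (lap-zero (λ _ _ → 0ℤ) (λ _ _ → refl) rs))))))))
          (cancel (lap (H x) rs))
    where
    as-linear : ∀ h l → h - l ≡ 1ℤ * h + - l
    as-linear = solve-∀
    as-neg : ∀ l → - l ≡ -1ℤ * l + 0ℤ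
    as-neg = solve-∀
    cancel : ∀ h → h - (1ℤ * h + (-1ℤ * 0ℤ + 0ℤ)) ≡ 0ℤ
    cancel = solve-∀

  addFirstColumn : ℤ → Row → Row
  addFirstColumn κ r zero          = r 0
  addFirstColumn κ r (suc zero)    = r 1 + κ * r 0
  addFirstColumn κ r (suc (suc j)) = r (suc (suc j))

  lap-map : ∀ F (f : Row → Row) rs → lap F (map f rs) ≡ lap (λ q R → F (f q) (map f R)) rs
  lap-map F f []       = refl
  lap-map F f (r ∷ rs) = cong (λ t → F (f r) (map f rs) - t) (lap-map (λ q R → F q (f r ∷ R)) f rs)

  map-map : ∀ (f g : Row → Row) rs → map f (map g rs) ≡ map (f ∘ g) rs
  map-map f g rs = sym (map-∘ rs)

  -- Expanded along the first two columns, the added multiple contributes a double expansion whose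
  -- summand is symmetric in the two rows, hence zero.
  det-addFirstColumn : ∀ n κ rs → det n (map (addFirstColumn κ) rs) ≡ det n rs
  det-addFirstColumn zero κ []      = refl
  det-addFirstColumn zero κ (_ ∷ _) = refl
  det-addFirstColumn (suc zero) κ rs =
    trans (lap-map _ (addFirstColumn κ) rs) (lap-cong same rs)
    where
    same : ∀ q R → q 0 * det 0 (map shift (map (addFirstColumn κ) R)) ≡ q 0 * det 0 (map shift R)
    same q []      = refl
    same q (_ ∷ _) = refl
  det-addFirstColumn (suc (suc n)) κ rs = begin
    det (suc (suc n)) (map (addFirstColumn κ) rs)
      ≡⟨ lap-map _ (addFirstColumn κ) rs ⟩
    lap (λ q R → q 0 * det (suc n) (map shift (map (addFirstColumn κ) R))) rs
      ≡⟨ lap-cong (λ q R → trans (cong (λ X → q 0 * det (suc n) X) (map-map shift (addFirstColumn κ) R)) (expand q R)) rs ⟩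
    lap (λ q R → κ * lap (λ r R′ → q 0 * r 0 * D R′) R + lap (λ r R′ → q 0 * (r 1 * D R′)) R) rs
      ≡⟨ lap-linear κ (λ q R → lap (λ r R′ → q 0 * r 0 * D R′) R) (λ q R → lap (λ r R′ → q 0 * (r 1 * D R′)) R) rs ⟩
    κ * lap (λ q R → lap (λ r R′ → q 0 * r 0 * D R′) R) rs + lap (λ q R → lap (λ r R′ → q 0 * (r 1 * D R′)) R) rs
      ≡⟨ cong (λ t → κ * t + lap (λ q R → lap (λ r R′ → q 0 * (r 1 * D R′)) R) rs)
              (lap-lap-symmetric (λ q r R′ → q 0 * r 0 * D R′) (λ q r R′ → cong (_* D R′) (*-comm (q 0) (r 0))) rs) ⟩
    κ * 0ℤ + lap (λ q R → lap (λ r R′ → q 0 * (r 1 * D R′)) R) rs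
      ≡⟨ trans (cong (_+ lap (λ q R → lap (λ r R′ → q 0 * (r 1 * D R′)) R) rs) (*-zeroʳ κ)) (+-identityˡ _) ⟩
    lap (λ q R → lap (λ r R′ → q 0 * (r 1 * D R′)) R) rs
      ≡⟨ lap-cong (λ q R → trans (pull (q 0) (λ r R′ → r 1 * D R′) R) (cong (q 0 *_) (unshift R))) rs ⟩
    det (suc (suc n)) rs ∎
    where
    open ≡-Reasoning
    D : List Row → ℤ
    D R = det n (map (λ r j → r (suc (suc j))) R)
    pull : ∀ a G R → lap (λ r R′ → a * G r R′) R ≡ a * lap G R
    pull a G R = trans (lap-cong (λ r R′ → sym (+-identityʳ (a * G r R′))) R)
                   (trans (lap-linear a G (λ _ _ → 0ℤ) R)
                     (trans (cong (a * lap G R +_) (lap-zero (λ _ _ → 0ℤ) (λ _ _ → refl) R)) (+-identityʳ _)))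
    unshift : ∀ R → lap (λ r R′ → r 1 * D R′) R ≡ det (suc n) (map shift R)
    unshift R = sym (trans (lap-map _ shift R) (lap-cong (λ r R′ → cong (λ X → r 1 * det n X) (map-map shift shift R′)) R))
    distr : ∀ a x y k d → a * ((y + k * x) * d) ≡ k * (a * x * d) + a * (y * d)
    distr = solve-∀
    expand : ∀ q R → q 0 * det (suc n) (map (shift ∘ addFirstColumn κ) R)
             ≡ κ * lap (λ r R′ → q 0 * r 0 * D R′) R + lap (λ r R′ → q 0 * (r 1 * D R′)) R
    expand q R =
      trans (cong (q 0 *_) (lap-map _ (shift ∘ addFirstColumn κ) R))
      (trans (sym (pull (q 0) _ R))
      (trans (lap-cong (λ r R′ → trans (cong (λ X → q 0 * ((r 1 + κ * r 0) * det n X)) (map-map shift (shift ∘ addFirstColumn κ) R′))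
                                       (distr (q 0) (r 0) (r 1) κ (D R′))) R)
             (lap-linear κ (λ r R′ → q 0 * r 0 * D R′) (λ r R′ → q 0 * (r 1 * D R′)) R)))

  prodTo : ℕ → (ℕ → ℤ) → ℤ
  prodTo zero    f = 1ℤ
  prodTo (suc n) f = f 0 * prodTo n (f ∘ suc)

  -- Right multiplication by an upper bidiagonal matrix with diagonal `β` and superdiagonal `κ`. The
  -- changes of Newton basis below have this shape.
  bidiagonal : (ℕ → ℤ) → (ℕ → ℤ) → Row → Row
  bidiagonal β κ r zero    = β 0 * r 0
  bidiagonal β κ r (suc j) = β (suc j) * r (suc j) + κ j * r j

  -- The matrix is a product of column operations: first those on the later columns, then the
  -- addition of the first column to the second, at last the scaling of the first. The order
  -- matters, since the column to be added is the unscaled one.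
  det-bidiagonal : ∀ n β κ rs → det n (map (bidiagonal β κ) rs) ≡ prodTo n β * det n rs
  det-bidiagonal zero β κ []      = refl
  det-bidiagonal zero β κ (_ ∷ _) = refl
  det-bidiagonal (suc n) β κ rs = begin
    det (suc n) (map (bidiagonal β κ) rs)
      ≡⟨ det-map-cong (suc n) split rs ⟩
    det (suc n) (map (scaleFirst ∘ added) rs)
      ≡⟨ lap-map _ (scaleFirst ∘ added) rs ⟩
    lap (λ q R → β 0 * q 0 * det n (map shift (map (scaleFirst ∘ added) R))) rs
      ≡⟨ lap-cong (λ q R → trans (cong (λ X → β 0 * q 0 * det n X) (trans (map-map shift (scaleFirst ∘ added) R) (sym (map-map shift added R))))
                                 (regroup (β 0) (q 0) (det n (map shift (map added R))))) rs ⟩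
    lap (λ q R → β 0 * (q 0 * det n (map shift (map added R))) + 0ℤ) rs
      ≡⟨ trans (lap-linear (β 0) (λ q R → q 0 * det n (map shift (map added R))) (λ _ _ → 0ℤ) rs)
               (trans (cong (λ t → β 0 * lap (λ q R → q 0 * det n (map shift (map added R))) rs + t) (lap-zero (λ _ _ → 0ℤ) (λ _ _ → refl) rs))
                      (+-identityʳ _)) ⟩
    β 0 * lap (λ q R → q 0 * det n (map shift (map added R))) rs
      ≡⟨ cong (β 0 *_) (sym (lap-map _ added rs)) ⟩
    β 0 * det (suc n) (map added rs)
      ≡⟨ cong (λ X → β 0 * det (suc n) X) (sym (map-map (addFirstColumn (κ 0)) later rs)) ⟩
    β 0 * det (suc n) (map (addFirstColumn (κ 0)) (map later rs))
      ≡⟨ cong (β 0 *_) (det-addFirstColumn (suc n) (κ 0) (map later rs)) ⟩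
    β 0 * det (suc n) (map later rs)
      ≡⟨ cong (β 0 *_) (lap-map _ later rs) ⟩
    β 0 * lap (λ q R → q 0 * det n (map shift (map later R))) rs
      ≡⟨ cong (β 0 *_) (lap-cong (λ q R → trans (cong (q 0 *_)
                (trans (cong (det n) (trans (map-map shift later R) (sym (map-map (bidiagonal (β ∘ suc) (κ ∘ suc)) shift R))))
                       (det-bidiagonal n (β ∘ suc) (κ ∘ suc) (map shift R))))
              (regroup′ (q 0) (prodTo n (β ∘ suc)) (det n (map shift R)))) rs) ⟩
    β 0 * lap (λ q R → prodTo n (β ∘ suc) * (q 0 * det n (map shift R)) + 0ℤ) rs
      ≡⟨ cong (β 0 *_) (trans (lap-linear (prodTo n (β ∘ suc)) (λ q R → q 0 * det n (map shift R)) (λ _ _ → 0ℤ) rs)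
           (trans (cong (prodTo n (β ∘ suc) * det (suc n) rs +_) (lap-zero (λ _ _ → 0ℤ) (λ _ _ → refl) rs)) (+-identityʳ _))) ⟩
    β 0 * (prodTo n (β ∘ suc) * det (suc n) rs)
      ≡⟨ sym (*-assoc (β 0) (prodTo n (β ∘ suc)) (det (suc n) rs)) ⟩
    prodTo (suc n) β * det (suc n) rs ∎
    where
    open ≡-Reasoning
    later : Row → Row
    later r zero    = r 0
    later r (suc j) = bidiagonal (β ∘ suc) (κ ∘ suc) (shift r) j
    added : Row → Row
    added r = addFirstColumn (κ 0) (later r)
    scaleFirst : Row → Row
    scaleFirst r zero    = β 0 * r 0
    scaleFirst r (suc j) = r (suc j)
    split : ∀ r → bidiagonal β κ r ≗ᵣ scaleFirst (added r)
    split r zero          = refl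
    split r (suc zero)    = refl
    split r (suc (suc j)) = refl
    regroup : ∀ b q d → b * q * d ≡ b * (q * d) + 0ℤ
    regroup = solve-∀
    regroup′ : ∀ q p d → q * (p * d) ≡ p * (q * d) + 0ℤ
    regroup′ = solve-∀

  prodTo-one : ∀ n → prodTo n (λ _ → 1ℤ) ≡ 1ℤ
  prodTo-one zero    = refl
  prodTo-one (suc n) = trans (*-identityˡ _) (prodTo-one n)

  det-scaleColumns : ∀ n β rs → det n (map (λ r j → β j * r j) rs) ≡ prodTo n β * det n rs
  det-scaleColumns n β rs = trans (det-map-cong n same rs) (det-bidiagonal n β (λ _ → 0ℤ) rs)
    where
    same : ∀ r → (λ j → β j * r j) ≗ᵣ bidiagonal β (λ _ → 0ℤ) r
    same r zero    = refl
    same r (suc j) = sym (+-identityʳ (β (suc j) * r (suc j)))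

  prodOver : ∀ {A : Set} → (A → ℤ) → List A → ℤ
  prodOver f []       = 1ℤ
  prodOver f (t ∷ ts) = f t * prodOver f ts

  det-scaleRows : ∀ n {A : Set} (f : A → ℤ) (ρ : A → Row) xs ts →
                  det n (xs ++ map (λ t j → f t * ρ t j) ts) ≡ prodOver f ts * det n (xs ++ map ρ ts)
  det-scaleRows n f ρ xs []       = sym (*-identityˡ _)
  det-scaleRows n f ρ xs (t ∷ ts) = begin
    det n (xs ++ (λ j → f t * ρ t j) ∷ map (λ t j → f t * ρ t j) ts)
      ≡⟨ det-scaleRow n (f t) (ρ t) xs _ ⟩
    f t * det n (xs ++ ρ t ∷ map (λ t j → f t * ρ t j) ts)
      ≡⟨ cong (λ X → f t * det n X) (sym (++-assoc xs (ρ t ∷ []) _)) ⟩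
    f t * det n ((xs ++ ρ t ∷ []) ++ map (λ t j → f t * ρ t j) ts)
      ≡⟨ cong (f t *_) (det-scaleRows n f ρ (xs ++ ρ t ∷ []) ts) ⟩
    f t * (prodOver f ts * det n ((xs ++ ρ t ∷ []) ++ map ρ ts))
      ≡⟨ cong (λ X → f t * (prodOver f ts * det n X)) (++-assoc xs (ρ t ∷ []) _) ⟩
    f t * (prodOver f ts * det n (xs ++ ρ t ∷ map ρ ts))
      ≡⟨ sym (*-assoc (f t) (prodOver f ts) _) ⟩
    f t * prodOver f ts * det n (xs ++ map ρ (t ∷ ts)) ∎
    where open ≡-Reasoning

  differences : Row → List Row → List Row
  differences v []       = []
  differences v (w ∷ ws) = (λ j → w j - v j) ∷ differences w ws

  -- The subtractions proceed from the last row backwards, so that each subtracted row is still an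
  -- original one.
  det-differences : ∀ n xs v vs → det n (xs ++ v ∷ vs) ≡ det n (xs ++ v ∷ differences v vs)
  det-differences n xs v []       = refl
  det-differences n xs v (w ∷ ws) = begin
    det n (xs ++ v ∷ w ∷ ws)                        ≡⟨ cong (det n) (sym (++-assoc xs (v ∷ []) _)) ⟩
    det n ((xs ++ v ∷ []) ++ w ∷ ws)                ≡⟨ det-differences n (xs ++ v ∷ []) w ws ⟩
    det n ((xs ++ v ∷ []) ++ w ∷ differences w ws)
      ≡⟨ sym (trans (det-cong n (pointwise-mid (xs ++ v ∷ []) (λ j → minus (v j) (w j))))
           (trans (det-comb n -1ℤ v w (xs ++ v ∷ []) (differences w ws))
             (trans (cong (λ t → -1ℤ * t + det n ((xs ++ v ∷ []) ++ w ∷ differences w ws))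
                       (trans (cong (det n) (++-assoc xs (v ∷ []) _)) (det-alternating n v xs (differences w ws))))
                    (+-identityˡ _)))) ⟩
    det n ((xs ++ v ∷ []) ++ differences v (w ∷ ws)) ≡⟨ cong (det n) (++-assoc xs (v ∷ []) _) ⟩
    det n (xs ++ v ∷ differences v (w ∷ ws)) ∎
    where
    open ≡-Reasoning
    minus : ∀ a b → b - a ≡ -1ℤ * a + b
    minus = solve-∀

  lap-firstColumn : ∀ F r rs → (∀ q R → q 0 ≡ 0ℤ → F q R ≡ 0ℤ) → All (λ q → q 0 ≡ 0ℤ) rs → lap F (r ∷ rs) ≡ F r rs
  lap-firstColumn F r rs h zs = trans (cong (λ t → F r rs - t) (vanish (λ q R → F q (r ∷ R)) (λ q R → h q (r ∷ R)) zs)) (+-identityʳ _)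
    where
    vanish : ∀ G → (∀ q R → q 0 ≡ 0ℤ → G q R ≡ 0ℤ) → ∀ {rs} → All (λ q → q 0 ≡ 0ℤ) rs → lap G rs ≡ 0ℤ
    vanish G h []       = refl
    vanish G h (z ∷ zs) = cong₂ _-_ (h _ _ z) (vanish (λ q R → G q (_ ∷ R)) (λ q R → h q (_ ∷ R)) zs)

  det-firstColumn : ∀ n r rs → All (λ q → q 0 ≡ 0ℤ) rs → det (suc n) (r ∷ rs) ≡ r 0 * det n (map shift rs)
  det-firstColumn n r rs zs =
    lap-firstColumn (λ r R → r 0 * det n (map shift R)) r rs (λ q R z → cong (_* det n (map shift R)) z) zs

  det-firstRow : ∀ n r rs → (∀ j → r (suc j) ≡ 0ℤ) → det (suc n) (r ∷ rs) ≡ r 0 * det n (map shift rs)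
  det-firstRow n r rs z =
    trans (cong (λ t → r 0 * det n (map shift rs) - t)
                (lap-zero _ (λ q R → trans (cong (q 0 *_) (det-zeroRow n [] (map shift R) z)) (*-zeroʳ (q 0))) rs))
          (+-identityʳ _)

  sgn : ℕ → ℤ
  sgn zero    = 1ℤ
  sgn (suc n) = - sgn n

  lap-lastRow : ∀ F z → (∀ q ys → F q (ys ++ z ∷ []) ≡ 0ℤ) → ∀ xs → lap F (xs ++ z ∷ []) ≡ sgn (length xs) * F z xs
  lap-lastRow F z h []       = trans (+-identityʳ _) (sym (*-identityˡ _))
  lap-lastRow F z h (x ∷ xs) =
    trans (cong₂ _-_ (h x xs) (lap-lastRow (λ q R → F q (x ∷ R)) z (λ q ys → h q (x ∷ ys)) xs)) (negate (sgn (length xs)) (F z (x ∷ xs)))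
    where
    negate : ∀ s f → 0ℤ - s * f ≡ - s * f
    negate = solve-∀

  -- Every minor that keeps the last row has a zero row once its first column is gone. The sign
  -- counts the rows passed over.
  det-lastRow : ∀ n z xs → (∀ j → z (suc j) ≡ 0ℤ) →
                det (suc n) (xs ++ z ∷ []) ≡ sgn (length xs) * (z 0 * det n (map shift xs))
  det-lastRow n z xs h = lap-lastRow (λ r R → r 0 * det n (map shift R)) z vanish xs
    where
    vanish : ∀ q ys → q 0 * det n (map shift (ys ++ z ∷ [])) ≡ 0ℤ
    vanish q ys rewrite map-++ shift ys (z ∷ []) =
      trans (cong (q 0 *_) (det-zeroRow n (map shift ys) [] h)) (*-zeroʳ (q 0))

-- Sums over lists, interlacing rows and increasing subsets

module Summation where

  open import Data.Integer using (ℤ; 0ℤ; _+_; _*_; _-_)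
  open import Data.Integer.Properties using (+-assoc; +-identityˡ; *-distribˡ-+; *-zeroʳ)
  open import Data.Integer.Tactic.RingSolver using (solve-∀)
  open import Data.List using (List; []; _∷_; _++_; map; concatMap)
  open import Data.List.Relation.Unary.All using (All; []; _∷_)
  open import Data.Nat as ℕ using (ℕ; zero; suc; _∸_; _≤_)
  import Data.Nat.Properties as ℕₚ
  open import Function using (_∘_)
  open import Relation.Binary.PropositionalEquality using (_≡_; refl; sym; trans; cong; cong₂)

  sumOver : ∀ {A : Set} → (A → ℤ) → List A → ℤ
  sumOver f []       = 0ℤ
  sumOver f (t ∷ ts) = f t + sumOver f ts

  module _ {A : Set} where

    sum-cong : ∀ {f g : A → ℤ} → (∀ t → f t ≡ g t) → ∀ ts → sumOver f ts ≡ sumOver g ts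
    sum-cong h []       = refl
    sum-cong h (t ∷ ts) = cong₂ _+_ (h t) (sum-cong h ts)

    sum-cong-All : ∀ {f g : A → ℤ} {ts} → All (λ t → f t ≡ g t) ts → sumOver f ts ≡ sumOver g ts
    sum-cong-All []       = refl
    sum-cong-All (h ∷ hs) = cong₂ _+_ h (sum-cong-All hs)

    sum-++ : ∀ (f : A → ℤ) ts us → sumOver f (ts ++ us) ≡ sumOver f ts + sumOver f us
    sum-++ f []       us = sym (+-identityˡ _)
    sum-++ f (t ∷ ts) us = trans (cong (f t +_) (sum-++ f ts us)) (sym (+-assoc (f t) _ _))

    sum-map : ∀ {B : Set} (f : A → ℤ) (g : B → A) ts → sumOver f (map g ts) ≡ sumOver (f ∘ g) ts
    sum-map f g []       = refl
    sum-map f g (t ∷ ts) = cong (f (g t) +_) (sum-map f g ts)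

    sum-* : ∀ a (f : A → ℤ) ts → sumOver (λ t → a * f t) ts ≡ a * sumOver f ts
    sum-* a f []       = sym (*-zeroʳ a)
    sum-* a f (t ∷ ts) = trans (cong (a * f t +_) (sum-* a f ts)) (sym (*-distribˡ-+ a (f t) _))

    sum-+ : ∀ (f g : A → ℤ) ts → sumOver (λ t → f t + g t) ts ≡ sumOver f ts + sumOver g ts
    sum-+ f g []       = refl
    sum-+ f g (t ∷ ts) = trans (cong (f t + g t +_) (sum-+ f g ts)) (interchange (f t) (g t) _ _)
      where
      interchange : ∀ a b c d → a + b + (c + d) ≡ a + c + (b + d)
      interchange = solve-∀

  ival : ℕ → ℕ → List ℕ
  ival lo zero    = []
  ival lo (suc n) = lo ∷ ival (suc lo) n

  range : ℕ → ℕ → List ℕ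
  range a b = ival a (b ∸ a)

  consAll : ∀ {A : Set} → List A → (A → List (List A)) → List (List A)
  consAll ts g = concatMap (λ t → map (t ∷_) (g t)) ts

  sum-consAll : ∀ {A : Set} (f : List A → ℤ) ts g →
                sumOver f (consAll ts g) ≡ sumOver (λ t → sumOver (f ∘ (t ∷_)) (g t)) ts
  sum-consAll f []       g = refl
  sum-consAll f (t ∷ ts) g =
    trans (sum-++ f (map (t ∷_) (g t)) (consAll ts g)) (cong₂ _+_ (sum-map f (t ∷_) (g t)) (sum-consAll f ts g))

  telescope-ival : ∀ (F : ℕ → ℤ) a n → sumOver (λ t → F (suc t) - F t) (ival a n) ≡ F (n ℕ.+ a) - F a
  telescope-ival F a zero    = zero-diff (F a)
    where
    zero-diff : ∀ x → 0ℤ ≡ x - x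
    zero-diff = solve-∀
  telescope-ival F a (suc n) =
    trans (cong (F (suc a) - F a +_) (trans (telescope-ival F (suc a) n) (cong (λ i → F i - F (suc a)) (ℕₚ.+-suc n a))))
          (join (F a) (F (suc a)) (F (suc n ℕ.+ a)))
    where
    join : ∀ x y z → y - x + (z - y) ≡ z - x
    join = solve-∀

  telescope : ∀ (F : ℕ → ℤ) {a b} → a ≤ b → sumOver (λ t → F (suc t) - F t) (range a b) ≡ F b - F a
  telescope F {a} {b} a≤b = trans (telescope-ival F a (b ∸ a)) (cong (λ i → F i - F a) (ℕₚ.m∸n+n≡m a≤b))

  -- Rows with s_i ≤ t_i < s_(i+1). Half-open ranges make the sums telescope from one entry to the
  -- next and force the interlacing row to increase strictly. Nothing interlaces the empty row.
  inter : List ℕ → List (List ℕ)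
  inter []           = []
  inter (s ∷ [])     = [] ∷ []
  inter (s ∷ s′ ∷ r) = consAll (range s s′) (λ _ → inter (s′ ∷ r))

  subs : ℕ → ℕ → ℕ → List (List ℕ)
  subs zero    l h = [] ∷ []
  subs (suc m) l h = consAll (range l h) (λ c → subs m (suc c) h)

-- A determinant as a sum over interlacing rows

module Interlacing where

  open Determinant
  open Summation
  open import Data.Integer using (0ℤ; 1ℤ; _+_; _*_; _-_)
  open import Data.Integer.Properties using (+-identityʳ; *-identityˡ)
  open import Data.List using ([]; _∷_; _++_; map)
  open import Data.List.Properties using (++-assoc)
  open import Data.List.Relation.Binary.Pointwise using ([]; _∷_)
  open import Data.List.Relation.Unary.All using (All; []; _∷_)
  open import Data.List.Relation.Unary.Linked using (Linked; []; _∷_)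
  open import Data.Nat using (ℕ; suc; _≤_)
  open import Relation.Binary.PropositionalEquality using (_≡_; refl; sym; trans; cong; cong₂; module ≡-Reasoning)

  det-sumRow : ∀ n (φ : ℕ → Row) xs ts ys →
               det n (xs ++ (λ j → sumOver (λ t → φ t j) ts) ∷ ys) ≡ sumOver (λ t → det n (xs ++ φ t ∷ ys)) ts
  det-sumRow n φ xs [] ys       = det-zeroRow n xs ys (λ _ → refl)
  det-sumRow n φ xs (t ∷ ts) ys =
    trans (det-cong n (pointwise-mid xs (λ j → cong (_+ sumOver (λ t → φ t j) ts) (sym (*-identityˡ (φ t j))))))
    (trans (det-comb n 1ℤ (φ t) (λ j → sumOver (λ t → φ t j) ts) xs ys)
           (cong₂ _+_ (*-identityˡ (det n (xs ++ φ t ∷ ys))) (det-sumRow n φ xs ts ys)))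

  module _ (Φ φ : ℕ → Row) (Φ₀ : ∀ t → Φ t 0 ≡ 1ℤ) (ΔΦ : ∀ t j → Φ (suc t) (suc j) - Φ t (suc j) ≡ φ t j) where

    -- Each difference of consecutive rows of `Φ` is a telescoping sum of rows of `φ`.
    -- Multilinearity pulls these sums out one after the other; the prefix `xs` holds the rows
    -- already expanded.
    det-interlacing-rows : ∀ n xs s ss → Linked _≤_ (s ∷ ss) →
      det n (xs ++ map shift (differences (Φ s) (map Φ ss))) ≡ sumOver (λ t → det n (xs ++ map φ t)) (inter (s ∷ ss))
    det-interlacing-rows n xs s []        _         = sym (+-identityʳ _)
    det-interlacing-rows n xs s (s′ ∷ ss) (le ∷ ls) = begin
      det n (xs ++ (λ j → Φ s′ (suc j) - Φ s (suc j)) ∷ R)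
        ≡⟨ det-cong n (pointwise-mid xs (λ j → sym (trans (sum-cong (λ t → sym (ΔΦ t j)) (range s s′))
                                                         (telescope (λ t → Φ t (suc j)) le)))) ⟩
      det n (xs ++ (λ j → sumOver (λ t → φ t j) (range s s′)) ∷ R)
        ≡⟨ det-sumRow n φ xs (range s s′) R ⟩
      sumOver (λ t → det n (xs ++ φ t ∷ R)) (range s s′)
        ≡⟨ sum-cong (λ t → trans (cong (det n) (sym (++-assoc xs (φ t ∷ []) R)))
                          (trans (det-interlacing-rows n (xs ++ φ t ∷ []) s′ ss ls)
                                 (sum-cong (λ ts → cong (det n) (++-assoc xs (φ t ∷ []) (map φ ts))) (inter (s′ ∷ ss)))))
                    (range s s′) ⟩
      sumOver (λ t → sumOver (λ ts → det n (xs ++ map φ (t ∷ ts))) (inter (s′ ∷ ss))) (range s s′)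
        ≡⟨ sym (sum-consAll (λ ts → det n (xs ++ map φ ts)) (range s s′) (λ _ → inter (s′ ∷ ss))) ⟩
      sumOver (λ t → det n (xs ++ map φ t)) (inter (s ∷ s′ ∷ ss)) ∎
      where
      open ≡-Reasoning
      R = map shift (differences (Φ s′) (map Φ ss))

    -- Differences of consecutive rows kill the constant first column below its top entry. This
    -- lowers the size by one and replaces `Φ` by its forward difference.
    det-interlacing : ∀ n s ss → Linked _≤_ (s ∷ ss) →
      det (suc n) (map Φ (s ∷ ss)) ≡ sumOver (λ t → det n (map φ t)) (inter (s ∷ ss))
    det-interlacing n s ss ls = begin
      det (suc n) (Φ s ∷ map Φ ss)                          ≡⟨ det-differences (suc n) [] (Φ s) (map Φ ss) ⟩
      det (suc n) (Φ s ∷ differences (Φ s) (map Φ ss))      ≡⟨ det-firstColumn n (Φ s) _ (zeros s ss) ⟩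
      Φ s 0 * det n (map shift (differences (Φ s) (map Φ ss))) ≡⟨ trans (cong (_* det n D) (Φ₀ s)) (*-identityˡ (det n D)) ⟩
      det n (map shift (differences (Φ s) (map Φ ss)))      ≡⟨ det-interlacing-rows n [] s ss ls ⟩
      sumOver (λ t → det n (map φ t)) (inter (s ∷ ss)) ∎
      where
      open ≡-Reasoning
      D = map shift (differences (Φ s) (map Φ ss))
      zeros : ∀ s ss → All (λ q → q 0 ≡ 0ℤ) (differences (Φ s) (map Φ ss))
      zeros s []        = []
      zeros s (s′ ∷ ss) = cong₂ _-_ (Φ₀ s′) (Φ₀ s) ∷ zeros s′ ss

-- Vandermonde products as determinants in a Newton basis

module Vandermonde where

  open Determinant
  open import Data.Integer using (ℤ; 0ℤ; 1ℤ; _+_; _*_; _-_)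
  open import Data.Integer.Properties using (*-identityˡ; *-assoc; *-zeroˡ; +-inverseʳ)
  open import Data.Integer.Tactic.RingSolver using (solve-∀)
  open import Data.List using (List; []; _∷_; map; length)
  open import Data.List.Properties using (map-∘)
  open import Data.Nat using (ℕ; zero; suc)
  open import Function using (_∘_)
  open import Relation.Binary.PropositionalEquality using (_≡_; refl; sym; trans; cong; module ≡-Reasoning)

  newton : (ℕ → ℤ) → ℤ → Row
  newton a u zero    = 1ℤ
  newton a u (suc j) = (u - a 0) * newton (a ∘ suc) u j

  newton-last : ∀ a u j → newton a u (suc j) ≡ newton a u j * (u - a j)
  newton-last a u zero    = swap (u - a 0)
    where
    swap : ∀ x → x * 1ℤ ≡ 1ℤ * x
    swap = solve-∀
  newton-last a u (suc j) = trans (cong ((u - a 0) *_) (newton-last (a ∘ suc) u j)) (sym (*-assoc (u - a 0) _ _))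

  infixr 5 _◂_
  _◂_ : ℤ → (ℕ → ℤ) → ℕ → ℤ
  (h ◂ a) zero    = h
  (h ◂ a) (suc j) = a j

  -- Since (u - h) N_j = N_(j+1) + (a_j - h) N_j, the two Newton bases differ by a bidiagonal matrix
  -- with ones on the diagonal.
  det-newton-prepend : ∀ n h a us → det n (map (newton (h ◂ a)) us) ≡ det n (map (newton a) us)
  det-newton-prepend n h a us =
    trans (det-map-cong n step us)
    (trans (cong (det n) (map-∘ us))
    (trans (det-bidiagonal n (λ _ → 1ℤ) (λ j → a j - h) (map (newton a) us))
           (trans (cong (_* det n (map (newton a) us)) (prodTo-one n)) (*-identityˡ _))))
    where
    regroup : ∀ u h a x → (u - h) * x ≡ 1ℤ * (x * (u - a)) + (a - h) * x
    regroup = solve-∀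
    step : ∀ u → newton (h ◂ a) u ≗ᵣ bidiagonal (λ _ → 1ℤ) (λ j → a j - h) (newton a u)
    step u zero    = refl
    step u (suc j) = trans (regroup u h (a j) (newton a u j))
                           (cong (λ X → 1ℤ * X + (a j - h) * newton a u j) (sym (newton-last a u j)))

  vandermonde : List ℤ → ℤ
  vandermonde []       = 1ℤ
  vandermonde (u ∷ us) = prodOver (λ w → w - u) us * vandermonde us

  -- The value does not depend on the nodes, so u itself may be taken as the first node:
  -- then the row of u is (1, 0, 0, …).
  det-newton : ∀ a us → det (length us) (map (newton a) us) ≡ vandermonde us
  det-newton a []       = refl
  det-newton a (u ∷ us) = begin
    det (suc n) (map (newton a) (u ∷ us))             ≡⟨ sym (det-newton-prepend (suc n) u a (u ∷ us)) ⟩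
    det (suc n) (map (newton (u ◂ a)) (u ∷ us))       ≡⟨ det-firstRow n (newton (u ◂ a) u) rest vanish ⟩
    1ℤ * det n (map shift rest)                       ≡⟨ *-identityˡ _ ⟩
    det n (map shift rest)                            ≡⟨ cong (det n) (sym (map-∘ us)) ⟩
    det n (map (λ w j → (w - u) * newton a w j) us)   ≡⟨ det-scaleRows n (λ w → w - u) (newton a) [] us ⟩
    prodOver (λ w → w - u) us * det n (map (newton a) us) ≡⟨ cong (prodOver (λ w → w - u) us *_) (det-newton a us) ⟩
    vandermonde (u ∷ us) ∎
    where
    open ≡-Reasoning
    n = length us
    rest = map (newton (u ◂ a)) us
    vanish : ∀ j → (u - u) * newton a u j ≡ 0ℤ
    vanish j = trans (cong (_* newton a u j) (+-inverseʳ u)) (*-zeroˡ (newton a u j))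

-- Exchanging the summations over two interlacing rows

module Exchange where

  open Summation
  open import Data.Integer using (ℤ; 0ℤ; _+_)
  open import Data.Integer.Properties using (+-identityʳ; +-identityˡ)
  open import Data.List using (List; []; _∷_; _++_; map)
  open import Data.List.Relation.Unary.All as All using (All; []; _∷_)
  open import Data.Nat as ℕ using (ℕ; zero; suc; _∸_; _≤_; _<_; s≤s)
  import Data.Nat.Properties as ℕₚ
  open import Data.Sum using (inj₁; inj₂)
  open import Relation.Binary.PropositionalEquality using (_≡_; refl; sym; trans; cong; cong₂; module ≡-Reasoning)

  ival-lower : ∀ {a} b n → a ≤ b → All (a ≤_) (ival b n)
  ival-lower b zero    le = []
  ival-lower b (suc n) le = le ∷ ival-lower (suc b) n (ℕₚ.m≤n⇒m≤1+n le)

  range-first : ∀ {a c} → a < c → range a c ≡ a ∷ range (suc a) c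
  range-first {a} {suc c} (s≤s le) rewrite ℕₚ.+-∸-assoc 1 le = refl

  ival-map-suc : ∀ a n → ival (suc a) n ≡ map suc (ival a n)
  ival-map-suc a zero    = refl
  ival-map-suc a (suc n) = cong (suc a ∷_) (ival-map-suc (suc a) n)

  ival-snoc : ∀ a n → ival a (suc n) ≡ ival a n ++ (n ℕ.+ a) ∷ []
  ival-snoc a zero    = refl
  ival-snoc a (suc n) = cong (a ∷_) (trans (ival-snoc (suc a) n) (cong (λ i → ival (suc a) n ++ i ∷ []) (ℕₚ.+-suc n a)))

  range-empty : ∀ {a b} → b ≤ a → range a b ≡ []
  range-empty le rewrite ℕₚ.m≤n⇒m∸n≡0 le = refl

  range-snoc : ∀ {a b} → a ≤ b → range a (suc b) ≡ range a b ++ b ∷ []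
  range-snoc {a} {b} le =
    trans (cong (ival a) (ℕₚ.+-∸-assoc 1 le))
          (trans (ival-snoc a (b ∸ a)) (cong (λ i → range a b ++ i ∷ []) (ℕₚ.m∸n+n≡m le)))

  -- Both sides sum over the pairs a ≤ b < c ≤ d + a; the terms with b = a are split off and the
  -- rest is the triangle starting at a + 1.
  triangle-ival : ∀ (g : ℕ → ℕ → ℤ) a d →
    sumOver (λ c → sumOver (λ b → g b c) (range a c)) (ival (suc a) d)
    ≡ sumOver (λ b → sumOver (g b) (range (suc b) (suc (d ℕ.+ a)))) (ival a d)
  triangle-ival g a zero    = refl
  triangle-ival g a (suc d) = begin
    sumOver (λ c → sumOver (λ b → g b c) (range a c)) (ival (suc a) (suc d))
      ≡⟨ sum-cong-All (All.map (λ {c} lt → cong (sumOver (λ b → g b c)) (range-first lt)) (ival-lower (suc a) (suc d) ℕₚ.≤-refl)) ⟩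
    sumOver (λ c → g a c + sumOver (λ b → g b c) (range (suc a) c)) (ival (suc a) (suc d))
      ≡⟨ sum-+ (g a) (λ c → sumOver (λ b → g b c) (range (suc a) c)) (ival (suc a) (suc d)) ⟩
    sumOver (g a) (ival (suc a) (suc d)) + (sumOver (λ b → g b (suc a)) (range (suc a) (suc a))
      + sumOver (λ c → sumOver (λ b → g b c) (range (suc a) c)) (ival (suc (suc a)) d))
      ≡⟨ cong (λ t → sumOver (g a) (ival (suc a) (suc d)) + t)
              (trans (cong (_+ sumOver (λ c → sumOver (λ b → g b c) (range (suc a) c)) (ival (suc (suc a)) d))
                           (cong (sumOver (λ b → g b (suc a))) (range-empty {suc a} ℕₚ.≤-refl)))
                     (trans (+-identityˡ _) (triangle-ival g (suc a) d))) ⟩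
    sumOver (g a) (ival (suc a) (suc d)) + sumOver (λ b → sumOver (g b) (range (suc b) (suc (d ℕ.+ suc a)))) (ival (suc a) d)
      ≡⟨ cong₂ _+_ (cong (λ n → sumOver (g a) (ival (suc a) n)) (sym (ℕₚ.m+n∸n≡m (suc d) a)))
                   (cong (λ n → sumOver (λ b → sumOver (g b) (range (suc b) (suc n))) (ival (suc a) d)) (ℕₚ.+-suc d a)) ⟩
    sumOver (λ b → sumOver (g b) (range (suc b) (suc (suc d ℕ.+ a)))) (ival a (suc d)) ∎
    where open ≡-Reasoning

  triangle : ∀ (g : ℕ → ℕ → ℤ) a h →
    sumOver (λ c → sumOver (λ b → g b c) (range a c)) (range (suc a) (suc h))
    ≡ sumOver (λ b → sumOver (g b) (range (suc b) (suc h))) (range a h)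
  triangle g a h with ℕₚ.≤-total a h
  ... | inj₁ le = trans (triangle-ival g a (h ∸ a))
        (cong (λ n → sumOver (λ b → sumOver (g b) (range (suc b) (suc n))) (range a h)) (ℕₚ.m∸n+n≡m le))
  ... | inj₂ ge rewrite ℕₚ.m≤n⇒m∸n≡0 ge = refl

  -- The substitution of b + 1 for b makes the weak inequality c ≤ b strict and reduces the claim to
  -- `triangle`. The extra value c = h has an empty range of b.
  triangle′ : ∀ (g : ℕ → ℕ → ℤ) l h →
    sumOver (λ c → sumOver (λ b → g c b) (range c h)) (range l (suc h))
    ≡ sumOver (λ b → sumOver (λ c → g c b) (range l (suc b))) (range l h)
  triangle′ g l h = begin
    sumOver F (range l (suc h))
      ≡⟨ last-empty ⟩
    sumOver F (range l h)
      ≡⟨ sum-cong (λ c → trans (sym (sum-map (λ b → g c (ℕ.pred b)) suc (range c h)))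
                              (cong (sumOver (λ b → g c (ℕ.pred b))) (sym (ival-map-suc c (h ∸ c))))) (range l h) ⟩
    sumOver (λ c → sumOver (λ b → g c (ℕ.pred b)) (range (suc c) (suc h))) (range l h)
      ≡⟨ sym (triangle (λ c b → g c (ℕ.pred b)) l h) ⟩
    sumOver (λ b → sumOver (λ c → g c (ℕ.pred b)) (range l b)) (range (suc l) (suc h))
      ≡⟨ trans (cong (sumOver (λ b → sumOver (λ c → g c (ℕ.pred b)) (range l b))) (ival-map-suc l (h ∸ l)))
               (sum-map (λ b → sumOver (λ c → g c (ℕ.pred b)) (range l b)) suc (range l h)) ⟩
    sumOver (λ b → sumOver (λ c → g c b) (range l (suc b))) (range l h) ∎
    where
    open ≡-Reasoning
    F : ℕ → ℤ
    F c = sumOver (λ b → g c b) (range c h)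
    last-empty : sumOver F (range l (suc h)) ≡ sumOver F (range l h)
    last-empty with ℕₚ.<-≤-connex h l
    ... | inj₁ gt rewrite range-empty gt | range-empty (ℕₚ.<⇒≤ gt) = refl
    ... | inj₂ le =
          trans (cong (sumOver F) (range-snoc le))
          (trans (sum-++ F (range l h) (h ∷ []))
                (trans (cong (λ ts → sumOver F (range l h) + (sumOver (g h) ts + 0ℤ)) (range-empty {h} ℕₚ.≤-refl)) (+-identityʳ _)))

  -- Both sides run over the chains l ≤ c₀ ≤ b₀ < c₁ ≤ b₁ < … ≤ h.
  sum-exchange : ∀ m l h (f : List ℕ → List ℕ → ℤ) →
    sumOver (λ C → sumOver (f C) (inter C)) (subs (suc m) l (suc h))
    ≡ sumOver (λ B → sumOver (λ C → f C B) (inter (l ∷ map suc B ++ suc h ∷ []))) (subs m l h)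
  sum-exchange zero l h f = begin
    sumOver (λ C → sumOver (f C) (inter C)) (consAll (range l (suc h)) (λ _ → [] ∷ []))
      ≡⟨ sum-consAll (λ C → sumOver (f C) (inter C)) (range l (suc h)) (λ _ → [] ∷ []) ⟩
    sumOver (λ c → (f (c ∷ []) [] + 0ℤ) + 0ℤ) (range l (suc h))
      ≡⟨ sum-cong (λ c → +-identityʳ _) (range l (suc h)) ⟩
    sumOver (λ c → f (c ∷ []) [] + 0ℤ) (range l (suc h))
      ≡⟨ sym (trans (+-identityʳ _) (sum-consAll (λ C → f C []) (range l (suc h)) (λ _ → [] ∷ []))) ⟩
    sumOver (λ C → f C []) (inter (l ∷ suc h ∷ [])) + 0ℤ ∎
    where open ≡-Reasoning
  sum-exchange (suc m) l h f = begin
    sumOver (λ C → sumOver (f C) (inter C)) (subs (suc (suc m)) l (suc h))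
      ≡⟨ sum-consAll (λ C → sumOver (f C) (inter C)) (range l (suc h)) (λ c → subs (suc m) (suc c) (suc h)) ⟩
    sumOver (λ c₀ → sumOver (λ C → sumOver (f (c₀ ∷ C)) (inter (c₀ ∷ C))) (subs (suc m) (suc c₀) (suc h))) (range l (suc h))
      ≡⟨ sum-cong (λ c₀ → trans (sum-consAll (λ C → sumOver (f (c₀ ∷ C)) (inter (c₀ ∷ C))) (range (suc c₀) (suc h)) (λ c → subs m (suc c) (suc h)))
                                (sum-cong (λ c₁ → trans (sum-cong (λ C → sum-consAll (f (c₀ ∷ c₁ ∷ C)) (range c₀ c₁) (λ _ → inter (c₁ ∷ C))) (subs m (suc c₁) (suc h)))
                                                        (swap-sums (λ C b → sumOver (λ B → f (c₀ ∷ c₁ ∷ C) (b ∷ B)) (inter (c₁ ∷ C))) (subs m (suc c₁) (suc h)) (range c₀ c₁)))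
                                          (range (suc c₀) (suc h)))) (range l (suc h)) ⟩
    sumOver (λ c₀ → sumOver (λ c₁ → sumOver (λ b → X c₀ b c₁) (range c₀ c₁)) (range (suc c₀) (suc h))) (range l (suc h))
      -- The entry b between c₀ and c₁ is moved in front of c₁ and then, by `triangle′`, in front of
      -- c₀. What remains to its right is the same exchange with lower bound b + 1.
      ≡⟨ sum-cong (λ c₀ → triangle (X c₀) c₀ h) (range l (suc h)) ⟩
    sumOver (λ c₀ → sumOver (λ b → sumOver (X c₀ b) (range (suc b) (suc h))) (range c₀ h)) (range l (suc h))
      ≡⟨ triangle′ (λ c₀ b → sumOver (X c₀ b) (range (suc b) (suc h))) l h ⟩
    sumOver (λ b → sumOver (λ c₀ → sumOver (X c₀ b) (range (suc b) (suc h))) (range l (suc b))) (range l h)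
      ≡⟨ sum-cong (λ b → trans (sum-cong (λ c₀ → trans (sym (sum-consAll (λ C → sumOver (λ B → f (c₀ ∷ C) (b ∷ B)) (inter C)) (range (suc b) (suc h)) (λ c → subs m (suc c) (suc h))))
                                                       (sum-exchange m (suc b) h (λ C B → f (c₀ ∷ C) (b ∷ B)))) (range l (suc b)))
                         (trans (swap-sums (λ c₀ B → sumOver (λ C → f (c₀ ∷ C) (b ∷ B)) (inter (suc b ∷ map suc B ++ suc h ∷ []))) (range l (suc b)) (subs m (suc b) h))
                                (sum-cong (λ B → sym (sum-consAll (λ C → f C (b ∷ B)) (range l (suc b)) (λ _ → inter (suc b ∷ map suc B ++ suc h ∷ [])))) (subs m (suc b) h))))
                  (range l h) ⟩
    sumOver (λ b → sumOver (λ B → sumOver (λ C → f C (b ∷ B)) (inter (l ∷ map suc (b ∷ B) ++ suc h ∷ []))) (subs m (suc b) h)) (range l h)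
      ≡⟨ sym (sum-consAll (λ B → sumOver (λ C → f C B) (inter (l ∷ map suc B ++ suc h ∷ []))) (range l h) (λ b → subs m (suc b) h)) ⟩
    sumOver (λ B → sumOver (λ C → f C B) (inter (l ∷ map suc B ++ suc h ∷ []))) (subs (suc m) l h) ∎
    where
    open ≡-Reasoning
    X : ℕ → ℕ → ℕ → ℤ
    X c₀ b c₁ = sumOver (λ C → sumOver (λ B → f (c₀ ∷ c₁ ∷ C) (b ∷ B)) (inter (c₁ ∷ C))) (subs m (suc c₁) (suc h))
    swap-sums : ∀ {A B : Set} (g : A → B → ℤ) as bs →
                sumOver (λ a → sumOver (g a) bs) as ≡ sumOver (λ b → sumOver (λ a → g a b) as) bs
    swap-sums g []       bs = sym (zeros bs)
      where
      zeros : ∀ {B : Set} (bs : List B) → sumOver (λ _ → 0ℤ) bs ≡ 0ℤ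
      zeros []       = refl
      zeros (b ∷ bs) = trans (+-identityˡ _) (zeros bs)
    swap-sums g (a ∷ as) bs = trans (cong (sumOver (g a) bs +_) (swap-sums g as bs))
                                    (sym (sum-+ (g a) (λ b → sumOver (λ a → g a b) as) bs))

-- Membership in the enumerated lists

module Enumeration where

  open Summation
  open Exchange
  open import Data.List using (List; []; _∷_; map; length)
  open import Data.List.Membership.Propositional using (_∈_)
  open import Data.List.Membership.Propositional.Properties using (∈-map⁺; ∈-map⁻; ∈-++⁺ˡ; ∈-++⁺ʳ; ∈-++⁻)
  open import Data.List.Relation.Unary.All as All using (All; []; _∷_)
  open import Data.List.Relation.Unary.Any using (here; there)
  open import Data.List.Relation.Unary.Linked using (Linked; []; [-]; _∷_)
  open import Data.Nat using (ℕ; zero; suc; _+_; _∸_; _≤_; _<_; s≤s)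
  open import Data.Nat.Properties
  open import Data.Product using (∃; _×_; _,_; proj₁; proj₂)
  open import Data.Sum using (inj₁; inj₂)
  open import Relation.Binary.PropositionalEquality using (_≡_; refl; sym; cong; subst)

  ∈-consAll⁻ : ∀ {A : Set} {r : List A} ts {g} → r ∈ consAll ts g →
               ∃ λ t → ∃ λ r′ → t ∈ ts × r′ ∈ g t × r ≡ t ∷ r′
  ∈-consAll⁻ (t ∷ ts) {g} p with ∈-++⁻ (map (t ∷_) (g t)) p
  ... | inj₁ q with ∈-map⁻ (t ∷_) q
  ...   | r′ , r′∈ , refl = t , r′ , here refl , r′∈ , refl
  ∈-consAll⁻ (t ∷ ts) p | inj₂ q with ∈-consAll⁻ ts q
  ...   | t′ , r′ , t∈ , r∈ , eq = t′ , r′ , there t∈ , r∈ , eq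

  ∈-consAll⁺ : ∀ {A : Set} {t : A} {r ts g} → t ∈ ts → r ∈ g t → (t ∷ r) ∈ consAll ts g
  ∈-consAll⁺ {t = t} (here refl) r∈ = ∈-++⁺ˡ (∈-map⁺ (t ∷_) r∈)
  ∈-consAll⁺ {ts = t′ ∷ _} {g} (there t∈) r∈ = ∈-++⁺ʳ (map (t′ ∷_) (g t′)) (∈-consAll⁺ t∈ r∈)

  ∈-ival⁻ : ∀ {i} a n → i ∈ ival a n → a ≤ i × i < n + a
  ∈-ival⁻ a (suc n) (here refl) = ≤-refl , s≤s (m≤n+m a n)
  ∈-ival⁻ {i} a (suc n) (there p) with ∈-ival⁻ (suc a) n p
  ... | le , lt = <⇒≤ le , subst (i <_) (+-suc n a) lt

  ∈-ival⁺ : ∀ {i} a n → a ≤ i → i < n + a → i ∈ ival a n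
  ∈-ival⁺ {i} a zero    le lt with () ← <⇒≱ lt le
  ∈-ival⁺ {i} a (suc n) le lt with m≤n⇒m<n∨m≡n le
  ... | inj₂ refl = here refl
  ... | inj₁ le′  = there (∈-ival⁺ (suc a) n le′ (subst (i <_) (sym (+-suc n a)) lt))

  ∈-range⁻ : ∀ {i} a b → i ∈ range a b → a ≤ i × i < b
  ∈-range⁻ {i} a b p with ≤-total a b
  ... | inj₁ le = let q = ∈-ival⁻ a (b ∸ a) p in proj₁ q , subst (i <_) (m∸n+n≡m le) (proj₂ q)
  ... | inj₂ ge with () ← subst (i ∈_) (range-empty ge) p

  ∈-range⁺ : ∀ {i} a b → a ≤ i → i < b → i ∈ range a b
  ∈-range⁺ {i} a b le lt = ∈-ival⁺ a (b ∸ a) le (subst (i <_) (sym (m∸n+n≡m (≤-trans le (<⇒≤ lt)))) lt)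

  Sorted : List ℕ → Set
  Sorted = Linked _<_

  subs-sound : ∀ m l h {C} → C ∈ subs m l h → length C ≡ m × Sorted C × All (λ c → l ≤ c × c < h) C
  subs-sound zero    l h (here refl) = refl , [] , []
  subs-sound (suc m) l h p with ∈-consAll⁻ (range l h) p
  ... | c , C , c∈ , C∈ , refl with ∈-range⁻ l h c∈ | subs-sound m (suc c) h C∈
  ...   | l≤c , c<h | len , so , al =
          cong suc len , link so (All.map proj₁ al) , (l≤c , c<h) ∷ All.map (λ q → ≤-trans l≤c (<⇒≤ (proj₁ q)) , proj₂ q) al
    where
    link : ∀ {C} → Sorted C → All (suc c ≤_) C → Sorted (c ∷ C)
    link []           _        = [-]
    link [-]          (lt ∷ _) = lt ∷ [-]
    link (lt ∷ ls) (lt′ ∷ _) = lt′ ∷ lt ∷ ls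

  inter-sound : ∀ s ss {t} → t ∈ inter (s ∷ ss) → length t ≡ length ss × Sorted t × All (s ≤_) t
  inter-sound s []        (here refl) = refl , [] , []
  inter-sound s (s′ ∷ ss) p with ∈-consAll⁻ (range s s′) p
  ... | t , r , t∈ , r∈ , refl with ∈-range⁻ s s′ t∈ | inter-sound s′ ss r∈
  ...   | s≤t , t<s′ | len , so , al = cong suc len , link so al , s≤t ∷ All.map (λ q → ≤-trans s≤t (≤-trans (<⇒≤ t<s′) q)) al
    where
    link : ∀ {r} → Sorted r → All (s′ ≤_) r → Sorted (t ∷ r)
    link []        _        = [-]
    link [-]       (le ∷ _) = <-≤-trans t<s′ le ∷ [-]
    link (lt ∷ ls) (le ∷ _) = <-≤-trans t<s′ le ∷ lt ∷ ls

-- Counting Gelfand-Tsetlin patterns with a given top row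

module GelfandTsetlin where

  open Determinant
  open Summation
  open Interlacing
  open Vandermonde
  open Enumeration
  open import Data.Integer using (ℤ; +_; 0ℤ; 1ℤ; _+_; _*_; _-_)
  open import Data.Integer.Properties using (+-identityʳ; *-identityˡ; *-identityʳ; *-assoc; pos-*; pos-+)
  open import Data.Integer.Tactic.RingSolver using (solve-∀)
  open import Data.List using (List; []; _∷_; map; length)
  open import Data.List.Properties using (map-∘; length-map)
  open import Data.List.Relation.Unary.All as All using (All; []; _∷_)
  open import Data.List.Relation.Unary.Linked as Linked using (Linked; []; _∷_)
  open import Data.Nat as ℕ using (ℕ; zero; suc; _!; _≤_)
  import Data.Nat.Properties as ℕₚ
  open import Data.Product using (proj₁; proj₂)
  open import Function using (_∘_)
  open import Relation.Binary.PropositionalEquality using (_≡_; refl; sym; trans; cong; cong₂; module ≡-Reasoning)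

  -- The Gelfand–Tsetlin patterns with the given top row s of length n, without that row.
  patterns : ℕ → List ℕ → List (List (List ℕ))
  patterns zero    s = [] ∷ []
  patterns (suc n) s = consAll (inter s) (patterns n)

  superfactorial : ℕ → ℕ
  superfactorial zero    = 1
  superfactorial (suc n) = n ! ℕ.* superfactorial n

  cast : ℕ → ℤ
  cast n = + n

  newton-cong : ∀ {a b u w} → (∀ l → u - a l ≡ w - b l) → newton a u ≗ᵣ newton b w
  newton-cong h zero    = refl
  newton-cong h (suc j) = cong₂ _*_ (h 0) (newton-cong (h ∘ suc) j)

  length-sum : ∀ {A : Set} (ts : List A) → + length ts ≡ sumOver (λ _ → 1ℤ) ts
  length-sum []       = refl
  length-sum (t ∷ ts) = trans (pos-+ 1 (length ts)) (cong (λ x → 1ℤ + x) (length-sum ts))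

  -- With the nodes 0, 1, 2, ... the Newton basis consists of the falling factorials, which
  -- differences treat as derivatives treat powers.
  falling-difference : ∀ t j → newton cast (+ suc t) (suc j) - newton cast (+ t) (suc j) ≡ + suc j * newton cast (+ t) j
  falling-difference t j = begin
    (+ suc t - 0ℤ) * newton (cast ∘ suc) (+ suc t) j - newton cast (+ t) (suc j)
      ≡⟨ cong₂ (λ x y → (+ suc t - 0ℤ) * x - y) (newton-cong (λ l → translate (+ t) (+ l)) j) (newton-last cast (+ t) j) ⟩
    (+ suc t - 0ℤ) * N - N * (+ t - + j)  ≡⟨ collect (+ t) (+ j) N ⟩
    + suc j * N ∎
    where
    open ≡-Reasoning
    N = newton cast (+ t) j
    translate : ∀ u l → (1ℤ + u) - (1ℤ + l) ≡ u - l
    translate = solve-∀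
    collect : ∀ t j n → (1ℤ + t - 0ℤ) * n - n * (t - j) ≡ (1ℤ + j) * n
    collect = solve-∀

  prodTo-cong : ∀ n {f g} → (∀ j → f j ≡ g j) → prodTo n f ≡ prodTo n g
  prodTo-cong zero    h = refl
  prodTo-cong (suc n) h = cong₂ _*_ (h 0) (prodTo-cong n (h ∘ suc))

  prodTo-suc : ∀ n i → prodTo n (λ j → + suc (j ℕ.+ i)) * + (i !) ≡ + ((n ℕ.+ i) !)
  prodTo-suc zero    i = *-identityˡ _
  prodTo-suc (suc n) i = begin
    + suc i * prodTo n (λ j → + suc (suc j ℕ.+ i)) * + (i !)
      ≡⟨ swap (+ suc i) (prodTo n (λ j → + suc (suc j ℕ.+ i))) (+ (i !)) ⟩
    prodTo n (λ j → + suc (suc j ℕ.+ i)) * (+ suc i * + (i !))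
      ≡⟨ cong₂ _*_ (prodTo-cong n (λ j → cong (cast ∘ suc) (sym (ℕₚ.+-suc j i)))) (sym (pos-* (suc i) (i !))) ⟩
    prodTo n (λ j → + suc (j ℕ.+ suc i)) * + (suc i !)
      ≡⟨ prodTo-suc n (suc i) ⟩
    + ((n ℕ.+ suc i) !)
      ≡⟨ cong (λ k → + (k !)) (ℕₚ.+-suc n i) ⟩
    + ((suc n ℕ.+ i) !) ∎
    where
    open ≡-Reasoning
    swap : ∀ x y z → x * y * z ≡ y * (x * z)
    swap = solve-∀

  prodTo-factorial : ∀ n → prodTo n (λ j → + suc j) ≡ + (n !)
  prodTo-factorial n = trans (sym (*-identityʳ _))
    (trans (cong (λ f → f * 1ℤ) (prodTo-cong n (λ j → cong (cast ∘ suc) (sym (ℕₚ.+-identityʳ j)))))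
           (trans (prodTo-suc n 0) (cong (λ k → + (k !)) (ℕₚ.+-identityʳ n))))

  -- This is `det-interlacing` for the falling factorials. The factors j + 1 from their differences
  -- are column factors and multiply up to the factorial.
  vandermonde-step : ∀ s ss → Linked _≤_ (s ∷ ss) →
    vandermonde (map cast (s ∷ ss)) ≡ + (length ss !) * sumOver (λ t → vandermonde (map cast t)) (inter (s ∷ ss))
  vandermonde-step s ss ls = begin
    vandermonde (map cast (s ∷ ss))
      ≡⟨ sym (trans (cong (det (suc n)) (rows-∘ (s ∷ ss)))
             (trans (cong (λ l → det (suc l) (map (newton cast) (map cast (s ∷ ss)))) (sym (length-map cast ss))) (det-newton cast (map cast (s ∷ ss))))) ⟩
    det (suc n) (map Φ (s ∷ ss))
      ≡⟨ det-interlacing Φ φ (λ _ → refl) falling-difference n s ss ls ⟩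
    sumOver (λ t → det n (map φ t)) (inter (s ∷ ss))
      ≡⟨ sum-cong-All (All.tabulate (λ {t} t∈ → step t (proj₁ (inter-sound s ss t∈)))) ⟩
    sumOver (λ t → + (n !) * vandermonde (map cast t)) (inter (s ∷ ss))
      ≡⟨ sum-* (+ (n !)) (λ t → vandermonde (map cast t)) (inter (s ∷ ss)) ⟩
    + (n !) * sumOver (λ t → vandermonde (map cast t)) (inter (s ∷ ss)) ∎
    where
    open ≡-Reasoning
    n = length ss
    Φ φ : ℕ → Row
    Φ t = newton cast (+ t)
    φ t j = + suc j * newton cast (+ t) j
    rows-∘ : ∀ ts → map Φ ts ≡ map (newton cast) (map cast ts)
    rows-∘ = map-∘ {g = newton cast} {f = cast}
    step : ∀ t → length t ≡ n → det n (map φ t) ≡ + (n !) * vandermonde (map cast t)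
    step t len = begin
      det n (map φ t)                                            ≡⟨ cong (det n) (map-∘ {g = λ r j → + suc j * r j} {f = Φ} t) ⟩
      det n (map (λ r j → + suc j * r j) (map Φ t))              ≡⟨ det-scaleColumns n (λ j → + suc j) (map Φ t) ⟩
      prodTo n (λ j → + suc j) * det n (map Φ t)                 ≡⟨ cong₂ _*_ (prodTo-factorial n) (cong (det n) (rows-∘ t)) ⟩
      + (n !) * det n (map (newton cast) (map cast t))               ≡⟨ cong (λ l → + (n !) * det l (map (newton cast) (map cast t))) (sym (trans (length-map cast t) len)) ⟩
      + (n !) * det (length (map cast t)) (map (newton cast) (map cast t)) ≡⟨ cong (+ (n !) *_) (det-newton cast (map cast t)) ⟩
      + (n !) * vandermonde (map cast t) ∎

  -- The Weyl dimension formula in its Vandermonde form. Each row removed from the top accounts for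
  -- one factorial of the superfactorial.
  pattern-count : ∀ n s → length s ≡ n → Sorted s →
    + superfactorial n * + length (patterns n s) ≡ vandermonde (map cast s)
  pattern-count zero    []       _   _  = refl
  pattern-count (suc n) (s ∷ ss) len so = begin
    + superfactorial (suc n) * + length (patterns (suc n) (s ∷ ss))
      ≡⟨ cong₂ _*_ (pos-* (n !) (superfactorial n)) (trans (length-sum (patterns (suc n) (s ∷ ss)))
            (trans (sum-consAll (λ _ → 1ℤ) (inter (s ∷ ss)) (patterns n)) (sum-cong (λ t → sym (length-sum (patterns n t))) (inter (s ∷ ss))))) ⟩
    + (n !) * + superfactorial n * sumOver (λ t → + length (patterns n t)) (inter (s ∷ ss))
      ≡⟨ trans (*-assoc (+ (n !)) _ _) (cong (+ (n !) *_) (sym (sum-* (+ superfactorial n) (λ t → + length (patterns n t)) (inter (s ∷ ss))))) ⟩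
    + (n !) * sumOver (λ t → + superfactorial n * + length (patterns n t)) (inter (s ∷ ss))
      ≡⟨ cong (+ (n !) *_) (sum-cong-All (All.tabulate (λ {t} t∈ → let q = inter-sound s ss t∈ in
                 pattern-count n t (trans (proj₁ q) (ℕₚ.suc-injective len)) (proj₁ (proj₂ q))))) ⟩
    + (n !) * sumOver (λ t → vandermonde (map cast t)) (inter (s ∷ ss))
      ≡⟨ cong (λ l → + (l !) * sumOver (λ t → vandermonde (map cast t)) (inter (s ∷ ss))) (sym (ℕₚ.suc-injective len)) ⟩
    + (length ss !) * sumOver (λ t → vandermonde (map cast t)) (inter (s ∷ ss))
      ≡⟨ sym (vandermonde-step s ss (Linked.map ℕₚ.<⇒≤ so)) ⟩
    vandermonde (map cast (s ∷ ss)) ∎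
    where open ≡-Reasoning

-- The Rodrigues ladder on the quadratic lattice

module Ladder where

  open Determinant
  open Summation
  open Exchange
  open Enumeration
  open Interlacing
  open Vandermonde
  open GelfandTsetlin using (prodTo-factorial; prodTo-cong)
  open import Data.Integer using (ℤ; +_; 0ℤ; 1ℤ; _+_; _*_; _-_; -_)
  open import Data.Integer.Properties using (+-identityʳ; +-identityˡ; *-identityˡ; *-identityʳ; *-assoc; *-comm; *-zeroˡ; *-zeroʳ)
  open import Data.Integer.Tactic.RingSolver using (solve-∀)
  open import Data.List using (List; []; _∷_; map; length; _++_)
  open import Data.List.Properties using (map-∘; map-++; length-map)
  open import Data.List.Relation.Unary.All as All using (All; []; _∷_)
  open import Data.List.Relation.Unary.Linked as Linked using (Linked; []; [-]; _∷_)
  open import Data.Nat as ℕ using (ℕ; zero; suc; _!; _≤_; _<_; z≤n)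
  import Data.Nat.Properties as ℕₚ
  open import Data.Product using (_×_; _,_; proj₁; proj₂)
  open import Function using (_∘_)
  open import Relation.Binary.PropositionalEquality using (_≡_; refl; sym; trans; cong; cong₂; module ≡-Reasoning)

  -- The quadratic lattice: with c = i + L/2, its points are c² up to a constant.
  node : ℤ → ℤ → ℤ
  node L i = i * (i + L)

  nw : ℤ → ℤ → Row
  nw L i = newton (λ l → node L (+ l)) (node L i)

  nw-last : ∀ L i j → nw L i (suc j) ≡ nw L i j * ((i - + j) * (i + + j + L))
  nw-last L i j = trans (newton-last (λ l → node L (+ l)) (node L i) j) (factor L i (+ j) (nw L i j))
    where
    factor : ∀ L i j x → x * (i * (i + L) - j * (j + L)) ≡ x * ((i - j) * (i + j + L))
    factor = solve-∀

  -- The factors i + l + L and i + l + 1 + L with l < j form overlapping runs that differ only in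
  -- the end factors L + i and L + i + j. In `nw-right` the same happens to the factors i - l.
  nw-left : ∀ L i j → (L + i) * nw (1ℤ + L) i j ≡ (L + i + + j) * nw L i j
  nw-left L i zero    = cong (_* 1ℤ) (sym (+-identityʳ (L + i)))
  nw-left L i (suc j) = begin
    (L + i) * nw (1ℤ + L) i (suc j)                                        ≡⟨ cong ((L + i) *_) (nw-last (1ℤ + L) i j) ⟩
    (L + i) * (nw (1ℤ + L) i j * ((i - + j) * (i + + j + (1ℤ + L))))        ≡⟨ sym (*-assoc (L + i) (nw (1ℤ + L) i j) _) ⟩
    (L + i) * nw (1ℤ + L) i j * ((i - + j) * (i + + j + (1ℤ + L)))          ≡⟨ cong (_* ((i - + j) * (i + + j + (1ℤ + L)))) (nw-left L i j) ⟩
    (L + i + + j) * nw L i j * ((i - + j) * (i + + j + (1ℤ + L)))           ≡⟨ regroup L i (+ j) (nw L i j) ⟩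
    (L + i + (1ℤ + + j)) * (nw L i j * ((i - + j) * (i + + j + L)))         ≡⟨ cong ((L + i + (1ℤ + + j)) *_) (sym (nw-last L i j)) ⟩
    (L + i + + suc j) * nw L i (suc j) ∎
    where
    open ≡-Reasoning
    regroup : ∀ L i j x → (L + i + j) * x * ((i - j) * (i + j + (1ℤ + L))) ≡ (L + i + (1ℤ + j)) * (x * ((i - j) * (i + j + L)))
    regroup = solve-∀

  nw-right : ∀ L i j → i * nw (1ℤ + L) (i - 1ℤ) j ≡ (i - + j) * nw L i j
  nw-right L i zero    = cong (_* 1ℤ) (sym (+-identityʳ i))
  nw-right L i (suc j) = begin
    i * nw (1ℤ + L) (i - 1ℤ) (suc j)                                          ≡⟨ cong (i *_) (nw-last (1ℤ + L) (i - 1ℤ) j) ⟩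
    i * (N * ((i - 1ℤ - + j) * (i - 1ℤ + + j + (1ℤ + L))))                    ≡⟨ sym (*-assoc i N _) ⟩
    i * N * ((i - 1ℤ - + j) * (i - 1ℤ + + j + (1ℤ + L)))                      ≡⟨ cong (_* ((i - 1ℤ - + j) * (i - 1ℤ + + j + (1ℤ + L)))) (nw-right L i j) ⟩
    (i - + j) * nw L i j * ((i - 1ℤ - + j) * (i - 1ℤ + + j + (1ℤ + L)))       ≡⟨ regroup L i (+ j) (nw L i j) ⟩
    (i - (1ℤ + + j)) * (nw L i j * ((i - + j) * (i + + j + L)))               ≡⟨ cong ((i - (1ℤ + + j)) *_) (sym (nw-last L i j)) ⟩
    (i - + suc j) * nw L i (suc j) ∎
    where
    open ≡-Reasoning
    N = nw (1ℤ + L) (i - 1ℤ) j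
    regroup : ∀ L i j x → (i - j) * x * ((i - 1ℤ - j) * (i - 1ℤ + j + (1ℤ + L))) ≡ (i - (1ℤ + j)) * (x * ((i - j) * (i + j + L)))
    regroup = solve-∀

  suc-pred : ∀ t → (1ℤ + t) - 1ℤ ≡ t
  suc-pred = solve-∀

  -- A difference lowers the degree by one and passes to the lattice with `L` raised by one; the
  -- factor 1 + L + 2t is the distance of the consecutive nodes.
  nw-difference : ∀ L t j → nw L (1ℤ + t) (suc j) - nw L t (suc j) ≡ (1ℤ + + j) * ((1ℤ + L + (t + t)) * nw (1ℤ + L) t j)
  nw-difference L t j = begin
    nw L (1ℤ + t) (suc j) - nw L t (suc j)
      ≡⟨ cong₂ _-_ (nw-last L (1ℤ + t) j) (nw-last L t j) ⟩
    N₁ * ((1ℤ + t - + j) * (1ℤ + t + + j + L)) - N₀ * ((t - + j) * (t + + j + L))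
      ≡⟨ cong₂ _-_ (reorder N₁ (1ℤ + t - + j) (1ℤ + t + + j + L)) (reorder′ N₀ t (+ j) L) ⟩
    (1ℤ + t - + j) * N₁ * (1ℤ + t + + j + L) - (L + t + + j) * N₀ * (t - + j)
      ≡⟨ cong₂ (λ x y → x * (1ℤ + t + + j + L) - y * (t - + j))
               (trans (sym (nw-right L (1ℤ + t) j)) (cong (λ i → (1ℤ + t) * nw (1ℤ + L) i j) (suc-pred t))) (sym (nw-left L t j)) ⟩
    (1ℤ + t) * N * (1ℤ + t + + j + L) - (L + t) * N * (t - + j)
      ≡⟨ collect L t (+ j) N ⟩
    (1ℤ + + j) * ((1ℤ + L + (t + t)) * N) ∎
    where
    open ≡-Reasoning
    N₁ = nw L (1ℤ + t) j
    N₀ = nw L t j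
    N  = nw (1ℤ + L) t j
    reorder : ∀ n x y → n * (x * y) ≡ x * n * y
    reorder = solve-∀
    reorder′ : ∀ n t j L → n * ((t - j) * (t + j + L)) ≡ (L + t + j) * n * (t - j)
    reorder′ = solve-∀
    collect : ∀ L t j n → (1ℤ + t) * n * (1ℤ + t + j + L) - (L + t) * n * (t - j) ≡ (1ℤ + j) * ((1ℤ + L + (t + t)) * n)
    collect = solve-∀

  -- The quotient of `up` at i by `down` at i + 1 is the ratio of consecutive weights. On the points
  -- 0, ..., h - 1, `down` vanishes at the first and `up` at the last, which removes the boundary
  -- terms of every summation.
  up down : (L A B h i : ℤ) → ℤ
  up   L A B h i = (L + i) * (A + i) * (h - 1ℤ - i) * (B + i)
  down L A B h i = i * (L - A + i) * (L + (h - 1ℤ) + i) * (B - L - i)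

  -- The discrete Pearson equation of the Racah weights on the points 0, …, h − 1.
  Pearson : (ℕ → ℤ) → (L A B : ℤ) → ℕ → Set
  Pearson v L A B h = ∀ i → v i * up L A B (+ h) (+ i) ≡ v (suc i) * down L A B (+ h) (1ℤ + + i)

  hat : (ℕ → ℤ) → (L A B : ℤ) → ℕ → ℕ → ℤ
  hat v L A B h i = v i * up L A B (+ h) (+ i)

  up-shift : ∀ L A B h i → up (1ℤ + L) (1ℤ + A) (1ℤ + B) h i ≡ up L A B (1ℤ + h) (1ℤ + i)
  up-shift L A B h i = cong₂ _*_ (cong₂ _*_ (cong₂ _*_ (plus L i) (plus A i)) (minus h i)) (plus B i)
    where
    plus : ∀ a i → 1ℤ + a + i ≡ a + (1ℤ + i)
    plus = solve-∀
    minus : ∀ h i → h - 1ℤ - i ≡ 1ℤ + h - 1ℤ - (1ℤ + i)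
    minus = solve-∀

  down-shift : ∀ L A B h i → down L A B (1ℤ + h) i ≡ down (1ℤ + L) (1ℤ + A) (1ℤ + B) h i
  down-shift L A B h i = cong₂ _*_ (cong₂ _*_ (cong (i *_) (cong (_+ i) (diff L A))) (plus L h i)) (cong (_- i) (diff B L))
    where
    diff : ∀ a b → a - b ≡ 1ℤ + a - (1ℤ + b)
    diff = solve-∀
    plus : ∀ L h i → L + (1ℤ + h - 1ℤ) + i ≡ 1ℤ + L + (h - 1ℤ) + i
    plus = solve-∀

  -- Raising `L`, `A`, `B` and lowering `h` by one turns `up` at i into `up` at i + 1 and leaves
  -- `down` unchanged. So the new equation is the old one multiplied by `up` at i + 1.
  pearson-hat : ∀ {v L A B h} → Pearson v L A B (suc h) → Pearson (hat v L A B (suc h)) (1ℤ + L) (1ℤ + A) (1ℤ + B) h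
  pearson-hat {v} {L} {A} {B} {h} pe i =
    trans (cong₂ _*_ (pe i) (up-shift L A B (+ h) (+ i)))
    (trans (cong (λ d → v (suc i) * d * up L A B (+ suc h) (+ suc i)) (down-shift L A B (+ h) (1ℤ + + i)))
           (swap (v (suc i)) (down (1ℤ + L) (1ℤ + A) (1ℤ + B) (+ h) (1ℤ + + i)) (up L A B (+ suc h) (+ suc i))))
    where
    swap : ∀ v d u → v * d * u ≡ v * u * d
    swap = solve-∀

  -- The factor L + 2i, the derivative of the quadratic lattice, is kept apart from `v`: one level
  -- higher it comes from the node differences in `nw-difference`, while `v` is replaced by `hat v`.
  weight : (ℕ → ℤ) → ℤ → ℕ → ℤ
  weight v L i = (L + (+ i + + i)) * v i

  mass : (ℕ → ℤ) → ℤ → ℕ → ℤ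
  mass v L h = sumOver (weight v L) (ival 0 h)

  DN : ℤ → ℕ → List ℕ → ℤ
  DN L m C = det m (map (λ i → nw L (+ i)) C)

  -- A discrete Selberg-type sum: the partition function of m particles on the quadratic lattice
  -- that repel by the squared Vandermonde product of their nodes.
  J : ℕ → (ℕ → ℤ) → ℤ → ℕ → ℤ
  J m v L h = sumOver (λ C → prodOver (weight v L) C * (DN L m C * DN L m C)) (subs m 0 h)

  DN-interlacing : ∀ m L s ss → length ss ≡ m → Linked _≤_ (s ∷ ss) →
    DN L (suc m) (s ∷ ss) ≡ + (m !) * sumOver (λ t → prodOver (λ i → 1ℤ + L + (+ i + + i)) t * DN (1ℤ + L) m t) (inter (s ∷ ss))
  DN-interlacing m L s ss len ls = begin
    DN L (suc m) (s ∷ ss)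
      ≡⟨ det-interlacing Φ φ (λ _ → refl) (λ t j → nw-difference L (+ t) j) m s ss ls ⟩
    sumOver (λ t → det m (map φ t)) (inter (s ∷ ss))
      ≡⟨ sum-cong step (inter (s ∷ ss)) ⟩
    sumOver (λ t → + (m !) * (prodOver b t * DN (1ℤ + L) m t)) (inter (s ∷ ss))
      ≡⟨ sum-* (+ (m !)) (λ t → prodOver b t * DN (1ℤ + L) m t) (inter (s ∷ ss)) ⟩
    + (m !) * sumOver (λ t → prodOver b t * DN (1ℤ + L) m t) (inter (s ∷ ss)) ∎
    where
    open ≡-Reasoning
    b : ℕ → ℤ
    b i = 1ℤ + L + (+ i + + i)
    Φ φ χ : ℕ → Row
    Φ t = nw L (+ t)
    χ t j = b t * nw (1ℤ + L) (+ t) j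
    φ t j = + suc j * χ t j
    step : ∀ t → det m (map φ t) ≡ + (m !) * (prodOver b t * DN (1ℤ + L) m t)
    step t = trans (cong (det m) (map-∘ {g = λ r j → + suc j * r j} {f = χ} t))
             (trans (det-scaleColumns m (λ j → + suc j) (map χ t))
                    (cong₂ _*_ (prodTo-factorial m) (det-scaleRows m b (λ i → nw (1ℤ + L) (+ i)) [] t)))

  module _ (v : ℕ → ℤ) (L A B : ℤ) (h : ℕ) (pe : Pearson v L A B (suc h)) where

    private
      w v̂ : ℕ → ℤ
      w = weight v L
      v̂ = hat v L A B (suc h)

      -- `E` and `K` are the coefficients of the Rodrigues operator in the Newton basis: applied to
      -- degree j one level higher it yields -(E + j) times degree j + 1 plus `K j` times degree j,
      -- as `Φ-difference` shows.
      E : ℤ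
      E = A + B - L - + h

      K β : ℕ → ℤ
      K j = (+ h - + j) * (A + + j) * (B + + j)
      β zero    = 1ℤ
      β (suc j) = - (E + + j)

      -- Φ is a primitive of ψ; its columns from the third on vanish at both ends 0 and h + 1
      -- (Rodrigues' formula).
      Φ ψ : ℕ → Row
      Φ t       zero          = 1ℤ
      Φ t       (suc zero)    = sumOver w (ival 0 t)
      Φ zero    (suc (suc j)) = 0ℤ
      Φ (suc i) (suc (suc j)) = v̂ i * nw (1ℤ + L) (+ i) j
      ψ i = bidiagonal β K (λ j → w i * nw L (+ i) j)

    -- The Pearson equation rewrites the value at i - 1 so that it carries `v i`. At i = 0 the
    -- factor `down` vanishes, in agreement with the zero in the definition of `Φ`.
    Φ-down : ∀ i j → Φ i (suc (suc j)) ≡ v i * down L A B (+ suc h) (+ i) * nw (1ℤ + L) (+ i - 1ℤ) j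
    Φ-down zero    j = sym (trans (cong (_* nw (1ℤ + L) (0ℤ - 1ℤ) j) (*-zeroʳ (v 0))) (*-zeroˡ (nw (1ℤ + L) (0ℤ - 1ℤ) j)))
    Φ-down (suc i) j = cong₂ _*_ (pe i) (cong (λ t → nw (1ℤ + L) t j) (sym (suc-pred (+ i))))

    -- By `Φ-down` both values carry the factor `v i`, and the ladder relations express both basis
    -- functions by the one of level `L`. The remaining polynomial is L + 2i times a combination of
    -- two neighbouring degrees.
    Φ-difference : ∀ i j → Φ (suc i) (suc j) - Φ i (suc j) ≡ ψ i j
    Φ-difference i zero = begin
      sumOver w (ival 0 (suc i)) - sumOver w (ival 0 i)
        ≡⟨ cong (_- sumOver w (ival 0 i)) (trans (cong (sumOver w) (ival-snoc 0 i)) (sum-++ w (ival 0 i) (i ℕ.+ 0 ∷ []))) ⟩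
      sumOver w (ival 0 i) + (w (i ℕ.+ 0) + 0ℤ) - sumOver w (ival 0 i)
        ≡⟨ cancel (sumOver w (ival 0 i)) (w (i ℕ.+ 0)) ⟩
      1ℤ * (w (i ℕ.+ 0) * 1ℤ)
        ≡⟨ cong (λ k → 1ℤ * (w k * 1ℤ)) (ℕₚ.+-identityʳ i) ⟩
      ψ i 0 ∎
      where
      open ≡-Reasoning
      cancel : ∀ s x → s + (x + 0ℤ) - s ≡ 1ℤ * (x * 1ℤ)
      cancel = solve-∀
    Φ-difference i (suc j) = begin
      v i * up L A B (+ suc h) (+ i) * nw (1ℤ + L) (+ i) j - Φ i (suc (suc j))
        ≡⟨ cong (λ t → v i * up L A B (+ suc h) (+ i) * nw (1ℤ + L) (+ i) j - t) (Φ-down i j) ⟩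
      v i * up L A B (+ suc h) (+ i) * N₁ - v i * down L A B (+ suc h) (+ i) * N₂
        ≡⟨ isolate (v i) L A B (+ h) (+ i) N₁ N₂ ⟩
      v i * ((A + + i) * (+ h - + i) * (B + + i)) * ((L + + i) * N₁) - v i * ((L - A + + i) * (L + + h + + i) * (B - L - + i)) * (+ i * N₂)
        ≡⟨ cong₂ (λ x y → v i * ((A + + i) * (+ h - + i) * (B + + i)) * x - v i * ((L - A + + i) * (L + + h + + i) * (B - L - + i)) * y)
                 (nw-left L (+ i) j) (nw-right L (+ i) j) ⟩
      v i * ((A + + i) * (+ h - + i) * (B + + i)) * ((L + + i + + j) * N) - v i * ((L - A + + i) * (L + + h + + i) * (B - L - + i)) * ((+ i - + j) * N)
        ≡⟨ collect (v i) L A B (+ h) (+ i) (+ j) N ⟩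
      - (E + + j) * (w i * (N * ((+ i - + j) * (+ i + + j + L)))) + K j * (w i * N)
        ≡⟨ cong (λ x → - (E + + j) * (w i * x) + K j * (w i * N)) (sym (nw-last L (+ i) j)) ⟩
      ψ i (suc j) ∎
      where
      open ≡-Reasoning
      N₁ = nw (1ℤ + L) (+ i) j
      N₂ = nw (1ℤ + L) (+ i - 1ℤ) j
      N  = nw L (+ i) j
      isolate : ∀ v L A B h i x y →
        v * ((L + i) * (A + i) * ((1ℤ + h) - 1ℤ - i) * (B + i)) * x - v * (i * (L - A + i) * (L + ((1ℤ + h) - 1ℤ) + i) * (B - L - i)) * y
        ≡ v * ((A + i) * (h - i) * (B + i)) * ((L + i) * x) - v * ((L - A + i) * (L + h + i) * (B - L - i)) * (i * y)
      isolate = solve-∀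
      collect : ∀ v L A B h i j x →
        v * ((A + i) * (h - i) * (B + i)) * ((L + i + j) * x) - v * ((L - A + i) * (L + h + i) * (B - L - i)) * ((i - j) * x)
        ≡ - (A + B - L - h + j) * ((L + (i + i)) * v * (x * ((i - j) * (i + j + L)))) + (h - j) * (A + j) * (B + j) * ((L + (i + i)) * v * x)
      collect = solve-∀

    v̂-end : v̂ h ≡ 0ℤ
    v̂-end = vanish (v h) L A B (+ h)
      where
      vanish : ∀ v L A B h → v * ((L + h) * (A + h) * ((1ℤ + h) - 1ℤ - h) * (B + h)) ≡ 0ℤ
      vanish = solve-∀

    -- The column 1 of `ψ` sums to zero, because its primitive vanishes at both ends; this relates
    -- the total mass to the first moment of the nodes. The node of 0 is zero, so that moment is the
    -- mass of a weight on one point fewer, with `L` raised by two.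
    mass-contiguous : mass v L (suc h) * (+ h * A * B) ≡ E * mass (λ i → v (suc i) * node L (1ℤ + + i)) (1ℤ + (1ℤ + L)) h
    mass-contiguous = begin
      mass v L (suc h) * (+ h * A * B)
        ≡⟨ isolate (mass v L (suc h)) (+ h) A B E S ⟩
      (- (E + 0ℤ) * S + K 0 * mass v L (suc h)) + E * S
        ≡⟨ cong (_+ E * S) (trans (sym expand) total) ⟩
      0ℤ + E * S
        ≡⟨ trans (+-identityˡ _) (cong (E *_) drop-first) ⟩
      E * mass (λ i → v (suc i) * node L (1ℤ + + i)) (1ℤ + (1ℤ + L)) h ∎
      where
      open ≡-Reasoning
      S = sumOver (λ i → w i * nw L (+ i) 1) (ival 0 (suc h))
      isolate : ∀ M h A B E S → M * (h * A * B) ≡ (- (E + 0ℤ) * S + (h - 0ℤ) * (A + 0ℤ) * (B + 0ℤ) * M) + E * S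
      isolate = solve-∀
      total : sumOver (λ i → ψ i 1) (ival 0 (suc h)) ≡ 0ℤ
      total = trans (sum-cong (λ i → sym (Φ-difference i 1)) (ival 0 (suc h)))
             (trans (telescope (λ t → Φ t 2) {0} {suc h} z≤n)
                    (cong (_- 0ℤ) (cong (_* 1ℤ) v̂-end)))
      expand : sumOver (λ i → ψ i 1) (ival 0 (suc h)) ≡ - (E + 0ℤ) * S + K 0 * mass v L (suc h)
      expand = trans (sum-+ (λ i → - (E + 0ℤ) * (w i * nw L (+ i) 1)) (λ i → K 0 * (w i * 1ℤ)) (ival 0 (suc h)))
               (cong₂ _+_ (sum-* (- (E + 0ℤ)) (λ i → w i * nw L (+ i) 1) (ival 0 (suc h)))
                          (trans (sum-* (K 0) (λ i → w i * 1ℤ) (ival 0 (suc h)))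
                                 (cong (K 0 *_) (sum-cong (λ i → *-identityʳ (w i)) (ival 0 (suc h))))))
      shape : ∀ L i x → (L + ((1ℤ + i) + (1ℤ + i))) * x * (((1ℤ + i) * ((1ℤ + i) + L) - 0ℤ * (0ℤ + L)) * 1ℤ)
                        ≡ (1ℤ + (1ℤ + L) + (i + i)) * (x * ((1ℤ + i) * ((1ℤ + i) + L)))
      shape = solve-∀
      first : ∀ x L → x * ((0ℤ * (0ℤ + L) - 0ℤ * (0ℤ + L)) * 1ℤ) ≡ 0ℤ
      first = solve-∀
      drop-first : S ≡ mass (λ i → v (suc i) * node L (1ℤ + + i)) (1ℤ + (1ℤ + L)) h
      drop-first =
        trans (cong₂ _+_ (first (w 0) L)
                 (trans (cong (sumOver (λ i → w i * nw L (+ i) 1)) (ival-map-suc 0 h))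
                 (trans (sum-map (λ i → w i * nw L (+ i) 1) suc (ival 0 h))
                        (sum-cong (λ i → shape L (+ i) (v (suc i))) (ival 0 h)))))
              (+-identityˡ _)

    -- The row of 0 is (1, 0, 0, ...) and the row of h + 1 is (1, mass, 0, ...). Expanding along
    -- both leaves the total mass times the weighted determinant of the next level on `T`.
    det-bordered : ∀ m T → length T ≡ m →
      det (suc (suc m)) (map Φ (0 ∷ map suc T ++ suc h ∷ [])) ≡ sgn m * (mass v L (suc h) * (prodOver v̂ T * DN (1ℤ + L) m T))
    det-bordered m T len = begin
      det (suc (suc m)) (Φ 0 ∷ map Φ (map suc T ++ suc h ∷ []))
        ≡⟨ det-firstRow (suc m) (Φ 0) (map Φ (map suc T ++ suc h ∷ [])) (λ { zero → refl ; (suc j) → refl }) ⟩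
      1ℤ * det (suc m) (map shift (map Φ (map suc T ++ suc h ∷ [])))
        ≡⟨ trans (*-identityˡ _) (cong (det (suc m)) rows) ⟩
      det (suc m) (R ++ shift (Φ (suc h)) ∷ [])
        ≡⟨ det-lastRow m (shift (Φ (suc h))) R (λ j → trans (cong (_* nw (1ℤ + L) (+ h) j) v̂-end) (*-zeroˡ (nw (1ℤ + L) (+ h) j))) ⟩
      sgn (length R) * (mass v L (suc h) * det m (map shift R))
        ≡⟨ cong₂ (λ l x → sgn l * (mass v L (suc h) * x)) (trans (length-map _ T) len)
             (trans (cong (det m) (sym (map-∘ {g = shift} {f = λ t → shift (Φ (suc t))} T)))
                    (det-scaleRows m v̂ (λ i → nw (1ℤ + L) (+ i)) [] T)) ⟩
      sgn m * (mass v L (suc h) * (prodOver v̂ T * DN (1ℤ + L) m T)) ∎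
      where
      open ≡-Reasoning
      R = map (λ t → shift (Φ (suc t))) T
      rows : map shift (map Φ (map suc T ++ suc h ∷ [])) ≡ R ++ shift (Φ (suc h)) ∷ []
      rows = trans (sym (map-∘ {g = shift} {f = Φ} (map suc T ++ suc h ∷ [])))
             (trans (map-++ (shift ∘ Φ) (map suc T) (suc h ∷ []))
                    (cong (_++ shift (Φ (suc h)) ∷ []) (sym (map-∘ {g = shift ∘ Φ} {f = suc} T))))

    det-ψ : ∀ m C → det m (map ψ C) ≡ prodTo m β * (prodOver w C * DN L m C)
    det-ψ m C =
      trans (cong (det m) (map-∘ {g = bidiagonal β K} {f = λ i j → w i * nw L (+ i) j} C))
      (trans (det-bidiagonal m β K (map (λ i j → w i * nw L (+ i) j) C))
             (cong (prodTo m β *_) (det-scaleRows m w (λ i → nw L (+ i)) [] C)))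

    linked-bordered : ∀ {l T} → Sorted T → All (λ c → l ≤ c × c < h) T → l ≤ suc h → Linked _≤_ (l ∷ map suc T ++ suc h ∷ [])
    linked-bordered []  [] le = le ∷ [-]
    linked-bordered [-] ((le , lt) ∷ []) _ = ℕₚ.m≤n⇒m≤1+n le ∷ ℕₚ.m≤n⇒m≤1+n lt ∷ [-]
    linked-bordered {T = c ∷ c′ ∷ T} (lt ∷ ls) ((le , ch) ∷ al@((_ , c′h) ∷ _)) _ =
      ℕₚ.m≤n⇒m≤1+n le ∷ linked-bordered ls (restrict ls (lt , c′h) al) (ℕₚ.m≤n⇒m≤1+n ch)
      where
      restrict : ∀ {c l x T} → Sorted (x ∷ T) → c < x × x < h → All (λ c → l ≤ c × c < h) (x ∷ T) → All (λ y → suc c ≤ y × y < h) (x ∷ T)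
      restrict [-]       (cx , xh) _               = (cx , xh) ∷ []
      restrict (q ∷ ls) (cx , xh) (_ ∷ al@((_ , yh) ∷ _)) = (cx , xh) ∷ restrict ls (ℕₚ.<-trans cx q , yh) al

    -- This is `det-interlacing` for the primitive `Φ`: the sum over C collapses to the bordered
    -- determinant. The product of `β` is the price of passing from `ψ` to the Newton basis.
    sum-above : ∀ m T → length T ≡ m → Sorted T → All (λ c → 0 ≤ c × c < h) T →
      prodTo (suc m) β * sumOver (λ C → prodOver w C * DN L (suc m) C) (inter (0 ∷ map suc T ++ suc h ∷ []))
      ≡ sgn m * (mass v L (suc h) * (prodOver v̂ T * DN (1ℤ + L) m T))
    sum-above m T len so al = begin
      prodTo (suc m) β * sumOver (λ C → prodOver w C * DN L (suc m) C) I
        ≡⟨ sym (sum-* (prodTo (suc m) β) (λ C → prodOver w C * DN L (suc m) C) I) ⟩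
      sumOver (λ C → prodTo (suc m) β * (prodOver w C * DN L (suc m) C)) I
        ≡⟨ sum-cong (λ C → sym (det-ψ (suc m) C)) I ⟩
      sumOver (λ C → det (suc m) (map ψ C)) I
        ≡⟨ sym (det-interlacing Φ ψ (λ _ → refl) Φ-difference (suc m) 0 _ (linked-bordered so al z≤n)) ⟩
      det (suc (suc m)) (map Φ (0 ∷ map suc T ++ suc h ∷ []))
        ≡⟨ det-bordered m T len ⟩
      sgn m * (mass v L (suc h) * (prodOver v̂ T * DN (1ℤ + L) m T)) ∎
      where
      open ≡-Reasoning
      I = inter (0 ∷ map suc T ++ suc h ∷ [])

    prodTo-negate : ∀ m → prodTo (suc m) β ≡ sgn m * prodTo m (λ j → E + + j)
    prodTo-negate m = trans (*-identityˡ _) (go m (λ j → E + + j))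
      where
      swap : ∀ x s p → - x * (s * p) ≡ - s * (x * p)
      swap = solve-∀
      go : ∀ m f → prodTo m (λ j → - f j) ≡ sgn m * prodTo m f
      go zero    f = refl
      go (suc m) f = trans (cong (- f 0 *_) (go m (f ∘ suc))) (swap (f 0) (sgn m) (prodTo m (f ∘ suc)))

    sgn-square : ∀ m x → sgn m * (sgn m * x) ≡ x
    sgn-square zero    x = trans (*-identityˡ _) (*-identityˡ _)
    sgn-square (suc m) x = trans (neg-neg (sgn m) x) (sgn-square m x)
      where
      neg-neg : ∀ s x → - s * (- s * x) ≡ s * (s * x)
      neg-neg = solve-∀

    -- The factorial stems from the downward expansion of one determinant, the mass from the upward
    -- summation of the other. The sign of the bordered determinant cancels against that of the
    -- product of `β`.
    J-step : ∀ m → J (suc m) v L (suc h) * prodTo m (λ j → E + + j) ≡ mass v L (suc h) * + (m !) * J m v̂ (1ℤ + L) h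
    J-step m = begin
      J (suc m) v L (suc h) * Π
        ≡⟨ cong (_* Π) (sum-cong-All (All.tabulate (λ {C} C∈ → lower C (subs-sound (suc m) 0 (suc h) C∈)))) ⟩
      sumOver (λ C → sumOver (λ T → + (m !) * (G C * F T)) (inter C)) (subs (suc m) 0 (suc h)) * Π
        -- From here on `T` ranges over all m-subsets of the h points, and C over the rows
        -- interlacing T + 1 bordered by 0 and h + 1, as `sum-above` requires.
        ≡⟨ cong (_* Π) (sum-exchange m 0 h (λ C T → + (m !) * (G C * F T))) ⟩
      sumOver (λ T → sumOver (λ C → + (m !) * (G C * F T)) (inter (0 ∷ map suc T ++ suc h ∷ []))) (subs m 0 h) * Π
        ≡⟨ trans (*-comm _ Π) (sym (sum-* Π _ (subs m 0 h))) ⟩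
      sumOver (λ T → Π * sumOver (λ C → + (m !) * (G C * F T)) (inter (0 ∷ map suc T ++ suc h ∷ []))) (subs m 0 h)
        ≡⟨ sum-cong-All (All.tabulate (λ {T} T∈ → let q = subs-sound m 0 h T∈ in upper T (proj₁ q) (proj₁ (proj₂ q)) (proj₂ (proj₂ q)))) ⟩
      sumOver (λ T → mass v L (suc h) * + (m !) * (prodOver (weight v̂ (1ℤ + L)) T * (DN (1ℤ + L) m T * DN (1ℤ + L) m T))) (subs m 0 h)
        ≡⟨ sum-* (mass v L (suc h) * + (m !)) _ (subs m 0 h) ⟩
      mass v L (suc h) * + (m !) * J m v̂ (1ℤ + L) h ∎
      where
      open ≡-Reasoning
      Π = prodTo m (λ j → E + + j)
      b : ℕ → ℤ
      b i = 1ℤ + L + (+ i + + i)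
      F G : List ℕ → ℤ
      F T = prodOver b T * DN (1ℤ + L) m T
      G C = prodOver w C * DN L (suc m) C
      lower : ∀ C → length C ≡ suc m × Sorted C × All (λ c → 0 ≤ c × c < suc h) C →
              prodOver w C * (DN L (suc m) C * DN L (suc m) C) ≡ sumOver (λ T → + (m !) * (G C * F T)) (inter C)
      lower (s ∷ ss) (len , so , _) = begin
        prodOver w C * (DN L (suc m) C * DN L (suc m) C)
          ≡⟨ cong (λ x → prodOver w C * (DN L (suc m) C * x)) (DN-interlacing m L s ss (ℕₚ.suc-injective len) (Linked.map ℕₚ.<⇒≤ so)) ⟩
        prodOver w C * (DN L (suc m) C * (+ (m !) * sumOver F (inter C)))
          ≡⟨ regroup (prodOver w C) (DN L (suc m) C) (+ (m !)) (sumOver F (inter C)) ⟩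
        + (m !) * (G C * sumOver F (inter C))
          ≡⟨ cong (+ (m !) *_) (sym (sum-* (G C) F (inter C))) ⟩
        + (m !) * sumOver (λ T → G C * F T) (inter C)
          ≡⟨ sym (sum-* (+ (m !)) (λ T → G C * F T) (inter C)) ⟩
        sumOver (λ T → + (m !) * (G C * F T)) (inter C) ∎
        where
        C = s ∷ ss
        regroup : ∀ p d m s → p * (d * (m * s)) ≡ m * (p * d * s)
        regroup = solve-∀
      upper : ∀ T → length T ≡ m → Sorted T → All (λ c → 0 ≤ c × c < h) T →
              Π * sumOver (λ C → + (m !) * (G C * F T)) (inter (0 ∷ map suc T ++ suc h ∷ []))
              ≡ mass v L (suc h) * + (m !) * (prodOver (weight v̂ (1ℤ + L)) T * (DN (1ℤ + L) m T * DN (1ℤ + L) m T))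
      upper T len so al = begin
        Π * sumOver (λ C → + (m !) * (G C * F T)) I
          ≡⟨ cong (Π *_) (trans (sum-cong (λ C → swap (+ (m !)) (G C) (F T)) I) (sum-* (+ (m !) * F T) G I)) ⟩
        Π * (+ (m !) * F T * sumOver G I)
          ≡⟨ cong (_* (+ (m !) * F T * sumOver G I)) (sym (sgn-square m Π)) ⟩
        sgn m * (sgn m * Π) * (+ (m !) * F T * sumOver G I)
          ≡⟨ regroup (sgn m) (sgn m * Π) (+ (m !) * F T) (sumOver G I) ⟩
        + (m !) * F T * (sgn m * (sgn m * Π * sumOver G I))
          ≡⟨ cong (λ x → + (m !) * F T * (sgn m * x)) (trans (cong (_* sumOver G I) (sym (prodTo-negate m))) (sum-above m T len so al)) ⟩
        + (m !) * F T * (sgn m * (sgn m * (mass v L (suc h) * (prodOver v̂ T * D))))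
          ≡⟨ cong (+ (m !) * F T *_) (sgn-square m _) ⟩
        + (m !) * (prodOver b T * D) * (mass v L (suc h) * (prodOver v̂ T * D))
          ≡⟨ regroup′ (+ (m !)) (prodOver b T) (mass v L (suc h)) (prodOver v̂ T) D ⟩
        mass v L (suc h) * + (m !) * (prodOver b T * prodOver v̂ T * (D * D))
          ≡⟨ cong (λ x → mass v L (suc h) * + (m !) * (x * (D * D))) (sym (prodOver-* b v̂ T)) ⟩
        mass v L (suc h) * + (m !) * (prodOver (weight v̂ (1ℤ + L)) T * (D * D)) ∎
        where
        I = inter (0 ∷ map suc T ++ suc h ∷ [])
        D = DN (1ℤ + L) m T
        swap : ∀ a g f → a * (g * f) ≡ a * f * g
        swap = solve-∀
        regroup : ∀ s p f g → s * p * (f * g) ≡ f * (s * (p * g))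
        regroup = solve-∀
        regroup′ : ∀ m b M v d → m * (b * d) * (M * (v * d)) ≡ M * m * (b * v * (d * d))
        regroup′ = solve-∀
        interchange : ∀ a b c d → a * b * (c * d) ≡ a * c * (b * d)
        interchange = solve-∀
        prodOver-* : ∀ f g ts → prodOver (λ t → f t * g t) ts ≡ prodOver f ts * prodOver g ts
        prodOver-* f g []       = refl
        prodOver-* f g (t ∷ ts) = trans (cong (f t * g t *_) (prodOver-* f g ts)) (interchange (f t) (g t) _ _)

-- Product formulas for the mass and for the Selberg-type sum

module ClosedForm where

  open Determinant using (prodTo)
  open GelfandTsetlin using (prodTo-suc; prodTo-cong)
  open Ladder
  open import Data.Integer using (ℤ; +_; 0ℤ; 1ℤ; _+_; _*_; _-_; -_)
  open import Data.Integer.Properties using (+-identityʳ; *-identityʳ; *-assoc; *-comm; pos-*; *-cancelʳ-≡)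
  open import Data.Integer.Tactic.RingSolver using (solve-∀)
  open import Data.Nat as ℕ using (ℕ; zero; suc; _!)
  open import Data.Nat.Properties as ℕₚ using (_!≢0)
  import Data.Nat.Tactic.RingSolver as ℕ-Ring
  open import Relation.Binary.PropositionalEquality using (_≡_; sym; trans; cong; cong₂; module ≡-Reasoning)

  fct : ℕ → ℤ
  fct k = + (k !)

  fct-suc : ∀ k → fct (suc k) ≡ + suc k * fct k
  fct-suc k = pos-* (suc k) (k !)

  fct-cancel : ∀ k {x y} → x * fct k ≡ y * fct k → x ≡ y
  fct-cancel k {x} {y} = *-cancelʳ-≡ x y (fct k) {{k !≢0}}

  -- With A = a + 1 the five indices are those of a Racah weight on n + 1 points; the normalisation
  -- of its last value is the one reproduced by both hat and the contiguity of mass-contiguous.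
  record Weight (v : ℕ → ℤ) (L a s γ n η B : ℕ) : Set where
    field
      level   : L ℕ.+ n ≡ suc (a ℕ.+ s)
      η-def   : η ≡ suc (a ℕ.+ γ)
      B-def   : B ≡ suc (η ℕ.+ s)
      pearson : Pearson v (+ L) (+ suc a) (+ B) (suc n)
      norm    : v n * (fct (L ℕ.+ n ℕ.+ n) * fct n * fct s) ≡ fct (a ℕ.+ s) * fct γ * fct (a ℕ.+ n) * fct (η ℕ.+ s ℕ.+ n)

  open Weight

  -- The constant `E` of the ladder for these parameters. Being the successor of `η`, it makes the
  -- product of the E + j a quotient of factorials.
  excess : ∀ {v L a s γ n η B} → Weight v L a s γ n η B → + suc a + + B - + L - + n ≡ + suc η
  excess {L = L} {a} {s} {γ} {n} W rewrite B-def W | η-def W = begin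
    + suc a + (1ℤ + (1ℤ + (+ a + + γ)) + + s) - + L - + n    ≡⟨ group (+ suc a + (1ℤ + (1ℤ + (+ a + + γ)) + + s)) (+ L) (+ n) ⟩
    + suc a + (1ℤ + (1ℤ + (+ a + + γ)) + + s) - + (L ℕ.+ n)  ≡⟨ cong (λ t → + suc a + (1ℤ + (1ℤ + (+ a + + γ)) + + s) - + t) (level W) ⟩
    (1ℤ + + a) + (1ℤ + (1ℤ + (+ a + + γ)) + + s) - (1ℤ + (+ a + + s)) ≡⟨ cancel (+ a) (+ s) (+ γ) ⟩
    + suc (suc (a ℕ.+ γ)) ∎
    where
    open ≡-Reasoning
    group : ∀ x l n → x - l - n ≡ x - (l + n)
    group = solve-∀
    cancel : ∀ a s γ → (1ℤ + a) + (1ℤ + (1ℤ + (a + γ)) + s) - (1ℤ + (a + s)) ≡ 1ℤ + (1ℤ + (a + γ))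
    cancel = solve-∀

  contiguous : (ℕ → ℤ) → ℕ → ℕ → ℤ
  contiguous v L i = v (suc i) * node (+ L) (1ℤ + + i)

  -- Multiplication by the node (i + 1)(i + 1 + L) changes the ratio of consecutive terms by just
  -- the factors that shift `L` by two and `a`, `B` by one. The indices `s` and `γ` depend on
  -- differences in which these shifts cancel.
  weight-contiguous : ∀ {v L a s γ n η B} → Weight v L a s γ (suc n) η B →
                      Weight (contiguous v L) (suc (suc L)) (suc a) s γ n (suc η) (suc B)
  weight-contiguous {v} {L} {a} {s} {γ} {n} {η} {B} W = record
    { level   = cong suc (trans (sym (ℕₚ.+-suc L n)) (level W))
    ; η-def   = cong suc (η-def W)
    ; B-def   = cong suc (B-def W)
    ; pearson = pearson′
    ; norm    = norm′
    }
    where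
    open ≡-Reasoning
    pearson′ : Pearson (contiguous v L) (+ suc (suc L)) (+ suc (suc a)) (+ suc B) (suc n)
    pearson′ i = begin
      v (suc i) * node l (1ℤ + + i) * up (+ suc (suc L)) (+ suc (suc a)) (+ suc B) (+ suc n) (+ i)
        ≡⟨ raise (v (suc i)) l (+ suc a) (+ B) (+ suc n) (+ i) ⟩
      v (suc i) * up l (+ suc a) (+ B) (+ suc (suc n)) (+ suc i) * ((1ℤ + + i) * (1ℤ + (1ℤ + l) + + i))
        ≡⟨ cong (_* ((1ℤ + + i) * (1ℤ + (1ℤ + l) + + i))) (pearson W (suc i)) ⟩
      v (suc (suc i)) * down l (+ suc a) (+ B) (+ suc (suc n)) (+ suc (suc i)) * ((1ℤ + + i) * (1ℤ + (1ℤ + l) + + i))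
        ≡⟨ lower (v (suc (suc i))) l (+ suc a) (+ B) (+ suc n) (+ i) ⟩
      v (suc (suc i)) * node l (1ℤ + + suc i) * down (+ suc (suc L)) (+ suc (suc a)) (+ suc B) (+ suc n) (1ℤ + + i) ∎
      where
      l = + L
      raise : ∀ v l A B h i → v * ((1ℤ + i) * ((1ℤ + i) + l)) * ((1ℤ + (1ℤ + l) + i) * (1ℤ + A + i) * (h - 1ℤ - i) * (1ℤ + B + i))
              ≡ v * ((l + (1ℤ + i)) * (A + (1ℤ + i)) * (1ℤ + h - 1ℤ - (1ℤ + i)) * (B + (1ℤ + i))) * ((1ℤ + i) * (1ℤ + (1ℤ + l) + i))
      raise v l A B h i = trans (cong₂ (λ x y → v * ((1ℤ + i) * ((1ℤ + i) + l)) * (X * x * y * (1ℤ + B + i))) (e₁ A i) (e₂ h i))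
                         (trans (cong (λ x → v * ((1ℤ + i) * ((1ℤ + i) + l)) * (X * (A + (1ℤ + i)) * (1ℤ + h - 1ℤ - (1ℤ + i)) * x)) (e₁ B i))
                         (trans (move v (1ℤ + i) (1ℤ + i + l) X (A + (1ℤ + i)) (1ℤ + h - 1ℤ - (1ℤ + i)) (B + (1ℤ + i)))
                                (cong (λ x → v * (x * (A + (1ℤ + i)) * (1ℤ + h - 1ℤ - (1ℤ + i)) * (B + (1ℤ + i))) * ((1ℤ + i) * X)) (e₃ l i))))
        where
        X = 1ℤ + (1ℤ + l) + i
        e₁ : ∀ A i → 1ℤ + A + i ≡ A + (1ℤ + i)
        e₁ = solve-∀
        e₂ : ∀ h i → h - 1ℤ - i ≡ 1ℤ + h - 1ℤ - (1ℤ + i)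
        e₂ = solve-∀
        e₃ : ∀ l i → 1ℤ + i + l ≡ l + (1ℤ + i)
        e₃ = solve-∀
        move : ∀ v p q x b c d → v * (p * q) * (x * b * c * d) ≡ v * (q * b * c * d) * (p * x)
        move = solve-∀
      lower : ∀ v l A B h i → v * ((1ℤ + (1ℤ + i)) * (l - A + (1ℤ + (1ℤ + i))) * (l + (1ℤ + h - 1ℤ) + (1ℤ + (1ℤ + i))) * (B - l - (1ℤ + (1ℤ + i))))
                                * ((1ℤ + i) * (1ℤ + (1ℤ + l) + i))
              ≡ v * ((1ℤ + (1ℤ + i)) * (1ℤ + (1ℤ + i) + l))
                  * ((1ℤ + i) * (1ℤ + (1ℤ + l) - (1ℤ + A) + (1ℤ + i)) * (1ℤ + (1ℤ + l) + (h - 1ℤ) + (1ℤ + i)) * (1ℤ + B - (1ℤ + (1ℤ + l)) - (1ℤ + i)))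
      lower v l A B h i = trans (cong₂ (λ x y → v * (T * x * y * (B - l - T)) * ((1ℤ + i) * (1ℤ + (1ℤ + l) + i))) (e₁ l A i) (e₂ l h i))
                         (trans (cong₂ (λ x y → v * (T * x₁ * x₂ * x) * ((1ℤ + i) * y)) (e₃ B l i) (e₄ l i))
                                (move v T x₁ x₂ x₃ (1ℤ + i) (T + l)))
        where
        T = 1ℤ + (1ℤ + i)
        x₁ = 1ℤ + (1ℤ + l) - (1ℤ + A) + (1ℤ + i)
        x₂ = 1ℤ + (1ℤ + l) + (h - 1ℤ) + (1ℤ + i)
        x₃ = 1ℤ + B - (1ℤ + (1ℤ + l)) - (1ℤ + i)
        e₁ : ∀ l A i → l - A + (1ℤ + (1ℤ + i)) ≡ 1ℤ + (1ℤ + l) - (1ℤ + A) + (1ℤ + i)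
        e₁ = solve-∀
        e₂ : ∀ l h i → l + (1ℤ + h - 1ℤ) + (1ℤ + (1ℤ + i)) ≡ 1ℤ + (1ℤ + l) + (h - 1ℤ) + (1ℤ + i)
        e₂ = solve-∀
        e₃ : ∀ B l i → B - l - (1ℤ + (1ℤ + i)) ≡ 1ℤ + B - (1ℤ + (1ℤ + l)) - (1ℤ + i)
        e₃ = solve-∀
        e₄ : ∀ l i → 1ℤ + (1ℤ + l) + i ≡ 1ℤ + (1ℤ + i) + l
        e₄ = solve-∀
        move : ∀ v t b c d p q → v * (t * b * c * d) * (p * q) ≡ v * (t * q) * (p * b * c * d)
        move = solve-∀
    shift-sum : ∀ L n → suc (suc L) ℕ.+ n ℕ.+ n ≡ L ℕ.+ suc n ℕ.+ suc n
    shift-sum = ℕ-Ring.solve-∀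
    norm′ : contiguous v L n * (fct (suc (suc L) ℕ.+ n ℕ.+ n) * fct n * fct s)
            ≡ fct (suc a ℕ.+ s) * fct γ * fct (suc a ℕ.+ n) * fct (suc η ℕ.+ s ℕ.+ n)
    norm′ = begin
      v (suc n) * (+ suc n * (+ suc n + + L)) * (fct (suc (suc L) ℕ.+ n ℕ.+ n) * fct n * fct s)
        ≡⟨ cong₂ (λ x y → v (suc n) * (+ suc n * x) * (fct y * fct n * fct s)) (cong +_ (trans (ℕₚ.+-comm (suc n) L) (level W))) (shift-sum L n) ⟩
      v (suc n) * (+ suc n * + suc (a ℕ.+ s)) * (fct (L ℕ.+ suc n ℕ.+ suc n) * fct n * fct s)
        ≡⟨ regroup (v (suc n)) (+ suc n) (+ suc (a ℕ.+ s)) (fct (L ℕ.+ suc n ℕ.+ suc n)) (fct n) (fct s) ⟩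
      v (suc n) * (fct (L ℕ.+ suc n ℕ.+ suc n) * (+ suc n * fct n) * fct s) * + suc (a ℕ.+ s)
        ≡⟨ cong (λ x → v (suc n) * (fct (L ℕ.+ suc n ℕ.+ suc n) * x * fct s) * + suc (a ℕ.+ s)) (sym (fct-suc n)) ⟩
      v (suc n) * (fct (L ℕ.+ suc n ℕ.+ suc n) * fct (suc n) * fct s) * + suc (a ℕ.+ s)
        ≡⟨ cong (_* + suc (a ℕ.+ s)) (norm W) ⟩
      fct (a ℕ.+ s) * fct γ * fct (a ℕ.+ suc n) * fct (η ℕ.+ s ℕ.+ suc n) * + suc (a ℕ.+ s)
        ≡⟨ regroup′ (fct (a ℕ.+ s)) (fct γ) (fct (a ℕ.+ suc n)) (fct (η ℕ.+ s ℕ.+ suc n)) (+ suc (a ℕ.+ s)) ⟩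
      + suc (a ℕ.+ s) * fct (a ℕ.+ s) * fct γ * fct (a ℕ.+ suc n) * fct (η ℕ.+ s ℕ.+ suc n)
        ≡⟨ cong₂ _*_ (cong₂ (λ x y → x * fct γ * y) (sym (fct-suc (a ℕ.+ s))) (cong fct (ℕₚ.+-suc a n))) (cong fct (ℕₚ.+-suc (η ℕ.+ s) n)) ⟩
      fct (suc a ℕ.+ s) * fct γ * fct (suc a ℕ.+ n) * fct (suc η ℕ.+ s ℕ.+ n) ∎
      where
      regroup : ∀ v p q x n s → v * (p * q) * (x * n * s) ≡ v * (x * (p * n) * s) * q
      regroup = solve-∀
      regroup′ : ∀ a b c d e → a * b * c * d * e ≡ e * a * b * c * d
      regroup′ = solve-∀

  weight-hat : ∀ {v L a s γ n η B} → Weight v L a (suc s) γ (suc n) η B →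
               Weight (hat v (+ L) (+ suc a) (+ B) (suc (suc n))) (suc L) (suc a) s (suc γ) n (suc (suc η)) (suc B)
  weight-hat {v} {L} {a} {s} {γ} {n} {η} {B} W = record
    { level   = cong suc (trans (ℕₚ.suc-injective (trans (sym (ℕₚ.+-suc L n)) (level W))) (ℕₚ.+-suc a s))
    ; η-def   = cong suc (trans (cong suc (η-def W)) (cong suc (sym (ℕₚ.+-suc a γ))))
    ; B-def   = cong suc (trans (B-def W) (cong suc (ℕₚ.+-suc η s)))
    ; pearson = pearson-hat {v} {+ L} {+ suc a} {+ B} {suc n} (pearson W)
    ; norm    = norm′
    }
    where
    open ≡-Reasoning
    l = + L
    b₁ : + L - + suc a + + suc n ≡ + suc s
    b₁ = begin
      + L - + suc a + + suc n              ≡⟨ group (+ L) (+ suc a) (+ suc n) ⟩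
      + (L ℕ.+ suc n) - + suc a            ≡⟨ cong (λ t → + t - + suc a) (level W) ⟩
      1ℤ + (+ a + + suc s) - (1ℤ + + a)    ≡⟨ cancel (+ a) (+ suc s) ⟩
      + suc s ∎
      where
      group : ∀ x l n → x - l + n ≡ x + n - l
      group = solve-∀
      cancel : ∀ a s → 1ℤ + (a + s) - (1ℤ + a) ≡ s
      cancel = solve-∀
    b₂ : + B - + L - + suc n ≡ + suc γ
    b₂ = begin
      + B - + L - + suc n                  ≡⟨ isolate (+ suc a) (+ B) (+ L) (+ suc n) ⟩
      (+ suc a + + B - + L - + suc n) - + suc a  ≡⟨ cong (_- + suc a) (trans (excess W) (cong (λ t → + suc t) (η-def W))) ⟩
      1ℤ + (1ℤ + (+ a + + γ)) - (1ℤ + + a) ≡⟨ cancel (+ a) (+ γ) ⟩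
      + suc γ ∎
      where
      isolate : ∀ A B L n → B - L - n ≡ (A + B - L - n) - A
      isolate = solve-∀
      cancel : ∀ a γ → 1ℤ + (1ℤ + (a + γ)) - (1ℤ + a) ≡ 1ℤ + γ
      cancel = solve-∀
    -- The last value of `hat` is read from the right-hand side of the Pearson equation, since
    -- `norm` speaks of v (n + 1) and not of v n.
    value : hat v l (+ suc a) (+ B) (suc (suc n)) n ≡ v (suc n) * (+ suc n * + suc s * + (L ℕ.+ suc n ℕ.+ suc n) * + suc γ)
    value = trans (pearson W n) (cong (v (suc n) *_)
              (cong₂ _*_ (cong₂ _*_ (cong (+ suc n *_) b₁) (regroup (+ L) (+ n))) b₂))
      where
      regroup : ∀ l n → l + (1ℤ + (1ℤ + n) - 1ℤ) + (1ℤ + n) ≡ l + (1ℤ + n) + (1ℤ + n)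
      regroup = solve-∀
    U : L ℕ.+ suc n ℕ.+ suc n ≡ suc (suc L ℕ.+ n ℕ.+ n)
    U = shift-sum L n
      where
      shift-sum : ∀ L n → L ℕ.+ suc n ℕ.+ suc n ≡ suc (suc L ℕ.+ n ℕ.+ n)
      shift-sum = ℕ-Ring.solve-∀
    norm′ : hat v l (+ suc a) (+ B) (suc (suc n)) n * (fct (suc L ℕ.+ n ℕ.+ n) * fct n * fct s)
            ≡ fct (suc a ℕ.+ s) * fct (suc γ) * fct (suc a ℕ.+ n) * fct (suc (suc η) ℕ.+ s ℕ.+ n)
    norm′ = begin
      hat v l (+ suc a) (+ B) (suc (suc n)) n * (fct (suc L ℕ.+ n ℕ.+ n) * fct n * fct s)
        ≡⟨ cong (_* (fct (suc L ℕ.+ n ℕ.+ n) * fct n * fct s))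
                (trans value (cong (λ t → v (suc n) * (+ suc n * + suc s * + t * + suc γ)) U)) ⟩
      v (suc n) * (+ suc n * + suc s * + suc (suc L ℕ.+ n ℕ.+ n) * + suc γ) * (fct (suc L ℕ.+ n ℕ.+ n) * fct n * fct s)
        ≡⟨ regroup (v (suc n)) (+ suc n) (+ suc s) (+ suc (suc L ℕ.+ n ℕ.+ n)) (+ suc γ) (fct (suc L ℕ.+ n ℕ.+ n)) (fct n) (fct s) ⟩
      v (suc n) * (+ suc (suc L ℕ.+ n ℕ.+ n) * fct (suc L ℕ.+ n ℕ.+ n) * (+ suc n * fct n) * (+ suc s * fct s)) * + suc γ
        ≡⟨ cong (λ x → v (suc n) * x * + suc γ) (cong₂ _*_ (cong₂ _*_ (trans (sym (fct-suc (suc L ℕ.+ n ℕ.+ n))) (cong fct (sym U))) (sym (fct-suc n))) (sym (fct-suc s))) ⟩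
      v (suc n) * (fct (L ℕ.+ suc n ℕ.+ suc n) * fct (suc n) * fct (suc s)) * + suc γ
        ≡⟨ cong (_* + suc γ) (norm W) ⟩
      fct (a ℕ.+ suc s) * fct γ * fct (a ℕ.+ suc n) * fct (η ℕ.+ suc s ℕ.+ suc n) * + suc γ
        ≡⟨ regroup′ (fct (a ℕ.+ suc s)) (fct γ) (fct (a ℕ.+ suc n)) (fct (η ℕ.+ suc s ℕ.+ suc n)) (+ suc γ) ⟩
      fct (a ℕ.+ suc s) * (+ suc γ * fct γ) * fct (a ℕ.+ suc n) * fct (η ℕ.+ suc s ℕ.+ suc n)
        ≡⟨ cong₂ _*_ (cong₂ _*_ (cong₂ _*_ (cong fct (ℕₚ.+-suc a s)) (sym (fct-suc γ))) (cong fct (ℕₚ.+-suc a n))) (cong fct (shift-sum η s n)) ⟩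
      fct (suc a ℕ.+ s) * fct (suc γ) * fct (suc a ℕ.+ n) * fct (suc (suc η) ℕ.+ s ℕ.+ n) ∎
      where
      regroup : ∀ v n s u g x y z → v * (n * s * u * g) * (x * y * z) ≡ v * (u * x * (n * y) * (s * z)) * g
      regroup = solve-∀
      regroup′ : ∀ a b c d e → a * b * c * d * e ≡ a * (e * b) * c * d
      regroup′ = solve-∀
      shift-sum : ∀ η s n → η ℕ.+ suc s ℕ.+ suc n ≡ suc (suc η) ℕ.+ s ℕ.+ n
      shift-sum = ℕ-Ring.solve-∀

  -- The terminating case of Dougall's very-well-poised 5F4 sum. The contiguous relation removes one
  -- point at a time.
  mass-closed : ∀ n {v L a s γ η B} → Weight v L a s γ n η B →
    mass v (+ L) (suc n) * (fct n * fct s * fct η) ≡ fct γ * fct a * fct (η ℕ.+ s) * fct (η ℕ.+ n)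
  mass-closed zero {v} {L} {a} {s} {γ} {η} {B} W = fct-cancel (a ℕ.+ s) (begin
    ((+ L + 0ℤ) * v 0 + 0ℤ) * (1ℤ * fct s * fct η) * fct (a ℕ.+ s)
      ≡⟨ regroup (+ L) (v 0) (fct s) (fct η) (fct (a ℕ.+ s)) ⟩
    v 0 * (+ L * fct (a ℕ.+ s) * 1ℤ * fct s) * fct η
      ≡⟨ cong (λ x → v 0 * (x * 1ℤ * fct s) * fct η)
              (trans (cong (λ t → + t * fct (a ℕ.+ s)) L≡) (trans (sym (fct-suc (a ℕ.+ s))) (cong fct (sym (trans (ℕₚ.+-identityʳ (L ℕ.+ 0)) (level W)))))) ⟩
    v 0 * (fct (L ℕ.+ 0 ℕ.+ 0) * 1ℤ * fct s) * fct η
      ≡⟨ cong (_* fct η) (norm W) ⟩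
    fct (a ℕ.+ s) * fct γ * fct (a ℕ.+ 0) * fct (η ℕ.+ s ℕ.+ 0) * fct η
      ≡⟨ cong₂ (λ x y → fct (a ℕ.+ s) * fct γ * fct x * fct y * fct η) (ℕₚ.+-identityʳ a) (ℕₚ.+-identityʳ (η ℕ.+ s)) ⟩
    fct (a ℕ.+ s) * fct γ * fct a * fct (η ℕ.+ s) * fct η
      ≡⟨ regroup′ (fct (a ℕ.+ s)) (fct γ) (fct a) (fct (η ℕ.+ s)) (fct η) ⟩
    fct γ * fct a * fct (η ℕ.+ s) * fct η * fct (a ℕ.+ s)
      ≡⟨ cong (λ t → fct γ * fct a * fct (η ℕ.+ s) * fct t * fct (a ℕ.+ s)) (sym (ℕₚ.+-identityʳ η)) ⟩
    fct γ * fct a * fct (η ℕ.+ s) * fct (η ℕ.+ 0) * fct (a ℕ.+ s) ∎)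
    where
    open ≡-Reasoning
    L≡ : L ≡ suc (a ℕ.+ s)
    L≡ = trans (sym (ℕₚ.+-identityʳ L)) (level W)
    regroup : ∀ L v s e x → ((L + 0ℤ) * v + 0ℤ) * (1ℤ * s * e) * x ≡ v * (L * x * 1ℤ * s) * e
    regroup = solve-∀
    regroup′ : ∀ a b c d e → a * b * c * d * e ≡ b * c * d * e * a
    regroup′ = solve-∀
  mass-closed (suc n) {v} {L} {a} {s} {γ} {η} {B} W =
    -- The contiguous relation multiplies the mass by A = a + 1 and B = η + s + 1, to be cancelled
    -- here; its third factor n + 1 is absorbed into the factorial.
    *-cancelʳ-≡ _ _ (+ suc a * + suc (η ℕ.+ s)) (begin
    M * (fct (suc n) * fct s * fct η) * (+ suc a * + suc (η ℕ.+ s))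
      ≡⟨ cong (λ x → M * (x * fct s * fct η) * (+ suc a * + suc (η ℕ.+ s))) (fct-suc n) ⟩
    M * (+ suc n * fct n * fct s * fct η) * (+ suc a * + suc (η ℕ.+ s))
      ≡⟨ regroup M (+ suc n) (fct n) (fct s) (fct η) (+ suc a) (+ suc (η ℕ.+ s)) ⟩
    M * (+ suc n * + suc a * + suc (η ℕ.+ s)) * (fct n * fct s * fct η)
      ≡⟨ cong (_* (fct n * fct s * fct η)) (trans (cong (λ t → M * (+ suc n * + suc a * + t)) (sym (B-def W)))
              (trans (mass-contiguous v (+ L) (+ suc a) (+ B) (suc n) (pearson W)) (cong (_* M′) (excess W)))) ⟩
    + suc η * M′ * (fct n * fct s * fct η)
      ≡⟨ regroup′ (+ suc η) M′ (fct n) (fct s) (fct η) ⟩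
    M′ * (fct n * fct s * (+ suc η * fct η))
      ≡⟨ cong (λ x → M′ * (fct n * fct s * x)) (sym (fct-suc η)) ⟩
    M′ * (fct n * fct s * fct (suc η))
      ≡⟨ mass-closed n (weight-contiguous W) ⟩
    fct γ * fct (suc a) * fct (suc (η ℕ.+ s)) * fct (suc (η ℕ.+ n))
      ≡⟨ cong₂ _*_ (cong₂ _*_ (cong (fct γ *_) (fct-suc a)) (fct-suc (η ℕ.+ s))) (cong fct (sym (ℕₚ.+-suc η n))) ⟩
    fct γ * (+ suc a * fct a) * (+ suc (η ℕ.+ s) * fct (η ℕ.+ s)) * fct (η ℕ.+ suc n)
      ≡⟨ regroup″ (fct γ) (+ suc a) (fct a) (+ suc (η ℕ.+ s)) (fct (η ℕ.+ s)) (fct (η ℕ.+ suc n)) ⟩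
    fct γ * fct a * fct (η ℕ.+ s) * fct (η ℕ.+ suc n) * (+ suc a * + suc (η ℕ.+ s)) ∎)
    where
    open ≡-Reasoning
    M  = mass v (+ L) (suc (suc n))
    M′ = mass (contiguous v L) (+ suc (suc L)) (suc n)
    regroup : ∀ M n f s e a b → M * (n * f * s * e) * (a * b) ≡ M * (n * a * b) * (f * s * e)
    regroup = solve-∀
    regroup′ : ∀ e M n s x → e * M * (n * s * x) ≡ M * (n * s * (e * x))
    regroup′ = solve-∀
    regroup″ : ∀ g a x b y z → g * (a * x) * (b * y) * z ≡ g * x * y * z * (a * b)
    regroup″ = solve-∀

  -- The run of factorials that a parameter raised by one at each step of the ladder leaves behind.
  fp : ℕ → ℕ → ℤ
  fp c zero    = 1ℤ
  fp c (suc m) = fct c * fp (suc c) m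

  fp-last : ∀ c m → fp c (suc m) ≡ fp c m * fct (m ℕ.+ c)
  fp-last c zero    = *-comm (fct c) 1ℤ
  fp-last c (suc m) = begin
    fct c * fp (suc c) (suc m)                       ≡⟨ cong (fct c *_) (fp-last (suc c) m) ⟩
    fct c * (fp (suc c) m * fct (m ℕ.+ suc c))       ≡⟨ cong (λ t → fct c * (fp (suc c) m * fct t)) (ℕₚ.+-suc m c) ⟩
    fct c * (fp (suc c) m * fct (suc m ℕ.+ c))       ≡⟨ sym (*-assoc (fct c) (fp (suc c) m) (fct (suc m ℕ.+ c))) ⟩
    fp c (suc m) * fct (suc m ℕ.+ c) ∎
    where open ≡-Reasoning

  -- One step of the ladder raises `a` and `γ` by one, lowers s and n by one and raises `η` by two.
  -- Writing s = m + p and n = m + q keeps p and q fixed through the induction.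
  J-closed : ∀ m {v L a p γ q η B} → Weight v L a (m ℕ.+ p) γ (m ℕ.+ q) η B →
    J (suc m) v (+ L) (suc (m ℕ.+ q)) * (fp q (suc m) * fp p (suc m) * fp (η ℕ.+ m) (suc m))
    ≡ fp γ (suc m) * fp (η ℕ.+ (m ℕ.+ q)) (suc m) * fp a (suc m) * fp (η ℕ.+ (m ℕ.+ p)) (suc m) * fp 0 (suc m)
  J-closed zero {v} {L} {a} {p} {γ} {q} {η} {B} W = begin
    J 1 v (+ L) (suc q) * (fct q * 1ℤ * (fct p * 1ℤ) * (fct (η ℕ.+ 0) * 1ℤ))
      ≡⟨ cong₂ (λ x y → x * (fct q * 1ℤ * (fct p * 1ℤ) * (fct y * 1ℤ)))
               (trans (sym (*-identityʳ (J 1 v (+ L) (suc q)))) (J-step v (+ L) (+ suc a) (+ B) q (pearson W) 0)) (ℕₚ.+-identityʳ η) ⟩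
    mass v (+ L) (suc q) * 1ℤ * 1ℤ * (fct q * 1ℤ * (fct p * 1ℤ) * (fct η * 1ℤ))
      ≡⟨ regroup (mass v (+ L) (suc q)) (fct q) (fct p) (fct η) ⟩
    mass v (+ L) (suc q) * (fct q * fct p * fct η)
      ≡⟨ mass-closed q W ⟩
    fct γ * fct a * fct (η ℕ.+ p) * fct (η ℕ.+ q)
      ≡⟨ regroup′ (fct γ) (fct a) (fct (η ℕ.+ p)) (fct (η ℕ.+ q)) ⟩
    fct γ * 1ℤ * (fct (η ℕ.+ q) * 1ℤ) * (fct a * 1ℤ) * (fct (η ℕ.+ p) * 1ℤ) * (1ℤ * 1ℤ) ∎
    where
    open ≡-Reasoning
    regroup : ∀ M q p e → M * 1ℤ * 1ℤ * (q * 1ℤ * (p * 1ℤ) * (e * 1ℤ)) ≡ M * (q * p * e)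
    regroup = solve-∀
    regroup′ : ∀ g a x y → g * a * x * y ≡ g * 1ℤ * (y * 1ℤ) * (a * 1ℤ) * (x * 1ℤ) * (1ℤ * 1ℤ)
    regroup′ = solve-∀
  J-closed (suc m) {v} {L} {a} {p} {γ} {q} {η} {B} W = begin
    Jm * (fp q (suc (suc m)) * fp p (suc (suc m)) * fp (η ℕ.+ suc m) (suc (suc m)))
      ≡⟨ cong (Jm *_) (cong₂ _*_ (cong₂ _*_ (fp-last q (suc m)) (fp-last p (suc m)))
                                 (trans (cong (λ t → fp t (suc (suc m))) (ℕₚ.+-suc η m)) (cong (_* fp (suc (suc (η ℕ.+ m))) (suc m)) rising))) ⟩
    Jm * (fp q (suc m) * fct n * (fp p (suc m) * fct s) * (Π * fct η * F))
      ≡⟨ regroup Jm (fp q (suc m)) (fct n) (fp p (suc m)) (fct s) Π (fct η) F ⟩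
    Jm * Π * (fp q (suc m) * fp p (suc m) * F) * (fct n * fct s * fct η)
      ≡⟨ cong (λ x → x * (fp q (suc m) * fp p (suc m) * F) * (fct n * fct s * fct η))
              (J-step v (+ L) (+ suc a) (+ B) n (pearson W) (suc m)) ⟩
    mass v (+ L) (suc n) * fct (suc m) * J′ * (fp q (suc m) * fp p (suc m) * F) * (fct n * fct s * fct η)
      ≡⟨ regroup′ (mass v (+ L) (suc n)) (fct (suc m)) J′ (fp q (suc m) * fp p (suc m) * F) (fct n * fct s * fct η) ⟩
    mass v (+ L) (suc n) * (fct n * fct s * fct η) * fct (suc m) * (J′ * (fp q (suc m) * fp p (suc m) * F))
      ≡⟨ cong₂ (λ x y → x * fct (suc m) * y) (mass-closed n W) (J-closed m (weight-hat W)) ⟩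
    fct γ * fct a * fct (η ℕ.+ s) * fct (η ℕ.+ n) * fct (suc m)
      * (fp (suc γ) (suc m) * fp (suc (suc η) ℕ.+ (m ℕ.+ q)) (suc m) * fp (suc a) (suc m) * fp (suc (suc η) ℕ.+ (m ℕ.+ p)) (suc m) * fp 0 (suc m))
      ≡⟨ cong₂ (λ x y → fct γ * fct a * fct (η ℕ.+ s) * fct (η ℕ.+ n) * fct (suc m) * (fp (suc γ) (suc m) * fp x (suc m) * fp (suc a) (suc m) * fp y (suc m) * fp 0 (suc m)))
               (cong suc (sym (ℕₚ.+-suc η (m ℕ.+ q)))) (cong suc (sym (ℕₚ.+-suc η (m ℕ.+ p)))) ⟩
    fct γ * fct a * fct (η ℕ.+ s) * fct (η ℕ.+ n) * fct (suc m)
      * (fp (suc γ) (suc m) * fp (suc (η ℕ.+ n)) (suc m) * fp (suc a) (suc m) * fp (suc (η ℕ.+ s)) (suc m) * fp 0 (suc m))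
      ≡⟨ regroup″ (fct γ) (fct a) (fct (η ℕ.+ s)) (fct (η ℕ.+ n)) (fct (suc m)) (fp (suc γ) (suc m)) (fp (suc (η ℕ.+ n)) (suc m))
                  (fp (suc a) (suc m)) (fp (suc (η ℕ.+ s)) (suc m)) (fp 0 (suc m)) ⟩
    fp γ (suc (suc m)) * fp (η ℕ.+ n) (suc (suc m)) * fp a (suc (suc m)) * fp (η ℕ.+ s) (suc (suc m)) * (fp 0 (suc m) * fct (suc m))
      ≡⟨ cong (fp γ (suc (suc m)) * fp (η ℕ.+ n) (suc (suc m)) * fp a (suc (suc m)) * fp (η ℕ.+ s) (suc (suc m)) *_)
              (sym (trans (fp-last 0 (suc m)) (cong (λ t → fp 0 (suc m) * fct t) (ℕₚ.+-identityʳ (suc m))))) ⟩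
    fp γ (suc (suc m)) * fp (η ℕ.+ n) (suc (suc m)) * fp a (suc (suc m)) * fp (η ℕ.+ s) (suc (suc m)) * fp 0 (suc (suc m)) ∎
    where
    open ≡-Reasoning
    n = suc (m ℕ.+ q)
    s = suc (m ℕ.+ p)
    Jm = J (suc (suc m)) v (+ L) (suc n)
    J′ = J (suc m) (hat v (+ L) (+ suc a) (+ B) (suc n)) (+ suc L) n
    Π = prodTo (suc m) (λ j → + suc a + + B - + L - + n + + j)
    F = fp (suc (suc (η ℕ.+ m))) (suc m)
    -- The product of the E + j in `J-step` is a rising factorial starting at E = η + 1.
    rising : fct (suc (η ℕ.+ m)) ≡ Π * fct η
    rising = trans (cong fct (cong suc (ℕₚ.+-comm η m)))
             (trans (sym (prodTo-suc (suc m) η))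
                    (cong (_* fct η) (prodTo-cong (suc m) (λ j → trans (cong (λ t → + suc t) (ℕₚ.+-comm j η)) (cong (_+ + j) (sym (excess W)))))))
    regroup : ∀ J x n y s P e f → J * (x * n * (y * s) * (P * e * f)) ≡ J * P * (x * y * f) * (n * s * e)
    regroup = solve-∀
    regroup′ : ∀ M f J x y → M * f * J * x * y ≡ M * y * f * (J * x)
    regroup′ = solve-∀
    regroup″ : ∀ g a x y f G Y A X Z → g * a * x * y * f * (G * Y * A * X * Z) ≡ g * G * (y * Y) * (a * A) * (x * X) * (Z * f)
    regroup″ = solve-∀

-- The Vandermonde product of a symmetric row, and its Racah weight

module SymmetricRows where

  open Determinant
  open Summation
  open Exchange
  open Enumeration
  open Vandermonde
  open GelfandTsetlin
  open Ladder
  open ClosedForm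
  open import Data.Integer using (ℤ; +_; 0ℤ; 1ℤ; _+_; _*_; _-_; -_)
  open import Data.Integer.Properties using (+-identityʳ; *-identityˡ; *-identityʳ; *-assoc; pos-*)
  open import Data.Integer.Tactic.RingSolver using (solve-∀)
  open import Data.List using (List; []; _∷_; map; _++_)
  open import Data.List.Properties using (map-++)
  open import Data.List.Relation.Unary.All using ([]; _∷_)
  open import Data.Nat as ℕ using (ℕ; zero; suc; _!)
  import Data.Nat.Properties as ℕₚ
  import Data.Nat.Tactic.RingSolver as ℕ-Ring
  open import Function using (_∘_)
  open import Relation.Binary.PropositionalEquality using (_≡_; refl; sym; trans; cong; cong₂; module ≡-Reasoning)

  module _ {A : Set} where

    prod-cong : ∀ {f g : A → ℤ} → (∀ t → f t ≡ g t) → ∀ ts → prodOver f ts ≡ prodOver g ts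
    prod-cong h []       = refl
    prod-cong h (t ∷ ts) = cong₂ _*_ (h t) (prod-cong h ts)

    prod-++ : ∀ (f : A → ℤ) ts us → prodOver f (ts ++ us) ≡ prodOver f ts * prodOver f us
    prod-++ f []       us = sym (*-identityˡ _)
    prod-++ f (t ∷ ts) us = trans (cong (f t *_) (prod-++ f ts us)) (sym (*-assoc (f t) (prodOver f ts) (prodOver f us)))

    prod-* : ∀ (f g : A → ℤ) ts → prodOver (λ t → f t * g t) ts ≡ prodOver f ts * prodOver g ts
    prod-* f g []       = refl
    prod-* f g (t ∷ ts) = trans (cong (f t * g t *_) (prod-* f g ts)) (interchange (f t) (g t) (prodOver f ts) (prodOver g ts))
      where
      interchange : ∀ a b c d → a * b * (c * d) ≡ a * c * (b * d)
      interchange = solve-∀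

    prod-map : ∀ {B : Set} (f : A → ℤ) (g : B → A) ts → prodOver f (map g ts) ≡ prodOver (f ∘ g) ts
    prod-map f g []       = refl
    prod-map f g (t ∷ ts) = cong (f (g t) *_) (prod-map f g ts)

  cross : List ℤ → List ℤ → ℤ
  cross xs ys = prodOver (λ x → prodOver (_- x) ys) xs

  vandermonde-++ : ∀ xs ys → vandermonde (xs ++ ys) ≡ vandermonde xs * vandermonde ys * cross xs ys
  vandermonde-++ []       ys = sym (trans (*-identityʳ (1ℤ * vandermonde ys)) (*-identityˡ _))
  vandermonde-++ (x ∷ xs) ys =
    trans (cong₂ _*_ (prod-++ (_- x) xs ys) (vandermonde-++ xs ys))
          (regroup (prodOver (_- x) xs) (prodOver (_- x) ys) (vandermonde xs) (vandermonde ys) (cross xs ys))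
    where
    regroup : ∀ a b c d e → a * b * (c * d * e) ≡ a * c * d * (b * e)
    regroup = solve-∀

  cross-++ʳ : ∀ xs ys zs → cross xs (ys ++ zs) ≡ cross xs ys * cross xs zs
  cross-++ʳ xs ys zs = trans (prod-cong (λ x → prod-++ (_- x) ys zs) xs)
                             (prod-* (λ x → prodOver (_- x) ys) (λ x → prodOver (_- x) zs) xs)

  -- Pairs are wrapped around `T` from the inside outwards, so that increasing indices give an
  -- increasing list.
  nest : ∀ {A : Set} → (ℕ → A) → (ℕ → A) → List ℕ → List A → List A
  nest lo hi []      T = T
  nest lo hi (i ∷ C) T = nest lo hi C (lo i ∷ T ++ hi i ∷ [])

  map-nest : ∀ {A B : Set} (f : A → B) lo hi C T → map f (nest lo hi C T) ≡ nest (f ∘ lo) (f ∘ hi) C (map f T)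
  map-nest f lo hi []      T = refl
  map-nest f lo hi (i ∷ C) T =
    trans (map-nest f lo hi C (lo i ∷ T ++ hi i ∷ [])) (cong (λ X → nest (f ∘ lo) (f ∘ hi) C (f (lo i) ∷ X)) (map-++ f T (hi i ∷ [])))

  module _ (E₁ E₂ : List ℤ) (c : ℤ) (o : ℕ → ℤ) where

    private
      lo hi : ℕ → ℤ
      lo i = c - o i
      hi i = c + o i

    exterior interior : List ℤ → ℕ → ℤ
    exterior T i = prodOver (λ p → (lo i - p) * (hi i - p)) E₁ * prodOver (λ p → (p - lo i) * (p - hi i)) E₂
    interior T i = prodOver (λ p → (p - lo i) * (hi i - p)) T

    -- Two pairs at distances o and p from the centre contribute four differences with product (p² -
    -- o²)², whence the square of the Vandermonde product in the squared distances. The induction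
    -- absorbs each pair into the core `T`, which changes `interior` by just this factor.
    vandermonde-nest : ∀ C T →
      vandermonde (E₁ ++ nest lo hi C T ++ E₂)
      ≡ vandermonde E₁ * vandermonde E₂ * cross E₁ E₂ * (vandermonde T * cross E₁ T * cross T E₂)
        * (prodOver (λ i → (o i + o i) * (interior T i * exterior T i)) C
           * (vandermonde (map (λ i → o i * o i) C) * vandermonde (map (λ i → o i * o i) C)))
    vandermonde-nest [] T =
      trans (vandermonde-++ E₁ (T ++ E₂))
      (trans (cong₂ (λ x y → vandermonde E₁ * x * y) (vandermonde-++ T E₂) (cross-++ʳ E₁ T E₂))
             (regroup (vandermonde E₁) (vandermonde T) (vandermonde E₂) (cross T E₂) (cross E₁ T) (cross E₁ E₂)))
      where
      regroup : ∀ e t f a b d → e * (t * f * a) * (b * d) ≡ e * f * d * (t * b * a) * (1ℤ * (1ℤ * 1ℤ))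
      regroup = solve-∀
    vandermonde-nest (i ∷ C) T = begin
      vandermonde (E₁ ++ nest lo hi C T′ ++ E₂)
        ≡⟨ vandermonde-nest C T′ ⟩
      K * (vandermonde T′ * cross E₁ T′ * cross T′ E₂) * (prodOver (λ j → (o j + o j) * (interior T′ j * exterior T′ j)) C * (W * W))
        ≡⟨ cong₂ (λ x y → K * x * (y * (W * W))) (cong₂ _*_ (cong₂ _*_ V-T′ E₁-T′) T′-E₂) inner ⟩
      K * (vandermonde T * (prodOver (_- lo i) T * prodOver (λ p → hi i - p) T * (o i + o i)) * (cross E₁ T * prodOver (λ p → (lo i - p) * (hi i - p)) E₁)
           * (cross T E₂ * prodOver (λ p → (p - lo i) * (p - hi i)) E₂))
        * (Q * (D * D) * (W * W))
        ≡⟨ cong (λ x → K * (vandermonde T * (x * (o i + o i)) * (cross E₁ T * prodOver (λ p → (lo i - p) * (hi i - p)) E₁)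
                        * (cross T E₂ * prodOver (λ p → (p - lo i) * (p - hi i)) E₂)) * (Q * (D * D) * (W * W)))
                (sym (prod-* (_- lo i) (λ p → hi i - p) T)) ⟩
      K * (vandermonde T * (interior T i * (o i + o i)) * (cross E₁ T * prodOver (λ p → (lo i - p) * (hi i - p)) E₁)
           * (cross T E₂ * prodOver (λ p → (p - lo i) * (p - hi i)) E₂))
        * (Q * (D * D) * (W * W))
        ≡⟨ regroup K (vandermonde T) (interior T i) (o i + o i) (cross E₁ T) (prodOver (λ p → (lo i - p) * (hi i - p)) E₁)
                   (cross T E₂) (prodOver (λ p → (p - lo i) * (p - hi i)) E₂) Q D W ⟩
      K * (vandermonde T * cross E₁ T * cross T E₂) * ((o i + o i) * (interior T i * exterior T i) * Q * (D * W * (D * W))) ∎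
      where
      open ≡-Reasoning
      T′ = lo i ∷ T ++ hi i ∷ []
      K = vandermonde E₁ * vandermonde E₂ * cross E₁ E₂
      W = vandermonde (map (λ i → o i * o i) C)
      D = prodOver (_- o i * o i) (map (λ i → o i * o i) C)
      Q = prodOver (λ j → (o j + o j) * (interior T j * exterior T j)) C
      regroup : ∀ K t n o a b d e Q D W → K * (t * (n * o) * (a * b) * (d * e)) * (Q * (D * D) * (W * W))
                ≡ K * (t * a * d) * (o * (n * (b * e)) * Q * (D * W * (D * W)))
      regroup = solve-∀
      V-T′ : vandermonde T′ ≡ vandermonde T * (prodOver (_- lo i) T * prodOver (λ p → hi i - p) T * (o i + o i))
      V-T′ = trans (cong₂ _*_ (prod-++ (_- lo i) T (hi i ∷ [])) (vandermonde-++ T (hi i ∷ [])))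
             (trans (cong (λ x → prodOver (_- lo i) T * ((hi i - lo i) * 1ℤ) * (vandermonde T * (1ℤ * 1ℤ) * x))
                          (prod-cong (λ p → *-identityʳ (hi i - p)) T))
                    (reduce (prodOver (_- lo i) T) c (o i) (vandermonde T) (prodOver (λ p → hi i - p) T)))
        where
        reduce : ∀ l c o t h → l * ((c + o - (c - o)) * 1ℤ) * (t * (1ℤ * 1ℤ) * h) ≡ t * (l * h * (o + o))
        reduce = solve-∀
      E₁-T′ : cross E₁ T′ ≡ cross E₁ T * prodOver (λ p → (lo i - p) * (hi i - p)) E₁
      E₁-T′ = trans (prod-cong (λ p → trans (cong ((lo i - p) *_) (prod-++ (_- p) T (hi i ∷ []))) (reduce (lo i - p) (prodOver (_- p) T) (hi i - p))) E₁)
                    (prod-* (λ p → prodOver (_- p) T) (λ p → (lo i - p) * (hi i - p)) E₁)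
        where
        reduce : ∀ l t h → l * (t * (h * 1ℤ)) ≡ t * (l * h)
        reduce = solve-∀
      T′-E₂ : cross T′ E₂ ≡ cross T E₂ * prodOver (λ p → (p - lo i) * (p - hi i)) E₂
      T′-E₂ = trans (cong (prodOver (_- lo i) E₂ *_) (prod-++ (λ x → prodOver (_- x) E₂) T (hi i ∷ [])))
              (trans (reduce (prodOver (_- lo i) E₂) (cross T E₂) (prodOver (_- hi i) E₂))
                     (cong (cross T E₂ *_) (sym (prod-* (_- lo i) (_- hi i) E₂))))
        where
        reduce : ∀ l t h → l * (t * (h * 1ℤ)) ≡ t * (l * h)
        reduce = solve-∀
      interior-T′ : ∀ j → interior T′ j ≡ interior T j * ((o j * o j - o i * o i) * (o j * o j - o i * o i))
      interior-T′ j = trans (cong ((lo i - lo j) * (hi j - lo i) *_) (prod-++ (λ p → (p - lo j) * (hi j - p)) T (hi i ∷ [])))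
                            (reduce c (o i) (o j) (interior T j))
        where
        reduce : ∀ c o p t → (c - o - (c - p)) * (c + p - (c - o)) * (t * ((c + o - (c - p)) * (c + p - (c + o)) * 1ℤ))
                 ≡ t * ((p * p - o * o) * (p * p - o * o))
        reduce = solve-∀
      inner : prodOver (λ j → (o j + o j) * (interior T′ j * exterior T′ j)) C ≡ Q * (D * D)
      inner = begin
        prodOver (λ j → (o j + o j) * (interior T′ j * exterior T′ j)) C
          ≡⟨ prod-cong (λ j → trans (cong (λ x → (o j + o j) * (x * exterior T j)) (interior-T′ j))
                                    (move (o j + o j) (interior T j) (exterior T j) ((o j * o j - o i * o i) * (o j * o j - o i * o i)))) C ⟩
        prodOver (λ j → (o j + o j) * (interior T j * exterior T j) * ((o j * o j - o i * o i) * (o j * o j - o i * o i))) C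
          ≡⟨ prod-* (λ j → (o j + o j) * (interior T j * exterior T j)) (λ j → (o j * o j - o i * o i) * (o j * o j - o i * o i)) C ⟩
        Q * prodOver (λ j → (o j * o j - o i * o i) * (o j * o j - o i * o i)) C
          ≡⟨ cong (Q *_) (prod-* (λ j → o j * o j - o i * o i) (λ j → o j * o j - o i * o i) C) ⟩
        Q * (prodOver (λ j → o j * o j - o i * o i) C * prodOver (λ j → o j * o j - o i * o i) C)
          ≡⟨ cong (λ x → Q * (x * x)) (sym (prod-map (_- o i * o i) (λ j → o j * o j) C)) ⟩
        Q * (D * D) ∎
        where
        move : ∀ a n e s → a * (n * s * e) ≡ a * (n * e) * s
        move = solve-∀

  run : (ℤ → ℤ) → ℕ → ℤ
  run f zero    = 1ℤ
  run f (suc n) = f (+ suc n) * run f n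

  run-cong : ∀ {f g} → (∀ t → f t ≡ g t) → ∀ n → run f n ≡ run g n
  run-cong h zero    = refl
  run-cong h (suc n) = cong₂ _*_ (h (+ suc n)) (run-cong h n)

  prod-down : ∀ (f : ℤ → ℤ) c n → prodOver (λ p → f (+ (c ℕ.+ n) - p)) (map cast (ival c n)) ≡ run f n
  prod-down f c zero    = refl
  prod-down f c (suc n) =
    cong₂ _*_ (cong f (distance (+ c) (+ suc n)))
              (trans (prod-cong (λ p → cong (λ k → f (+ k - p)) (ℕₚ.+-suc c n)) (map cast (ival (suc c) n))) (prod-down f (suc c) n))
    where
    distance : ∀ c n → c + n - c ≡ n
    distance = solve-∀

  prod-up : ∀ (f : ℤ → ℤ) c n → prodOver (λ p → f (p - + c)) (map cast (ival (suc c) n)) ≡ run f n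
  prod-up f c zero    = refl
  prod-up f c (suc n) = begin
    prodOver F (map cast (ival (suc c) (suc n)))
      ≡⟨ cong (prodOver F) (trans (cong (map cast) (ival-snoc (suc c) n)) (map-++ cast (ival (suc c) n) (n ℕ.+ suc c ∷ []))) ⟩
    prodOver F (map cast (ival (suc c) n) ++ + (n ℕ.+ suc c) ∷ [])
      ≡⟨ prod-++ F (map cast (ival (suc c) n)) (+ (n ℕ.+ suc c) ∷ []) ⟩
    prodOver F (map cast (ival (suc c) n)) * (f (+ n + (1ℤ + + c) - + c) * 1ℤ)
      ≡⟨ cong₂ (λ x y → x * (f y * 1ℤ)) (prod-up f c n) (distance (+ n) (+ c)) ⟩
    run f n * (f (+ suc n) * 1ℤ)
      ≡⟨ swap (run f n) (f (+ suc n)) ⟩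
    run f (suc n) ∎
    where
    open ≡-Reasoning
    F : ℤ → ℤ
    F p = f (p - + c)
    distance : ∀ n c → n + (1ℤ + c) - c ≡ 1ℤ + n
    distance = solve-∀
    swap : ∀ r x → r * (x * 1ℤ) ≡ x * r
    swap = solve-∀

  run-shifted : ∀ d n → run (λ t → + d + t) n * fct d ≡ fct (d ℕ.+ n)
  run-shifted d zero    = trans (*-identityˡ _) (cong fct (sym (ℕₚ.+-identityʳ d)))
  run-shifted d (suc n) = begin
    + (d ℕ.+ suc n) * run (λ t → + d + t) n * fct d   ≡⟨ *-assoc (+ (d ℕ.+ suc n)) (run (λ t → + d + t) n) (fct d) ⟩
    + (d ℕ.+ suc n) * (run (λ t → + d + t) n * fct d) ≡⟨ cong₂ (λ x y → + x * y) (ℕₚ.+-suc d n) (run-shifted d n) ⟩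
    + suc (d ℕ.+ n) * fct (d ℕ.+ n)                   ≡⟨ sym (fct-suc (d ℕ.+ n)) ⟩
    fct (suc (d ℕ.+ n))                               ≡⟨ cong fct (sym (ℕₚ.+-suc d n)) ⟩
    fct (d ℕ.+ suc n) ∎
    where open ≡-Reasoning

  prod-from : ∀ t d n → prodOver (_- + t) (map cast (ival (suc (t ℕ.+ d)) n)) * fct d ≡ fct (d ℕ.+ n)
  prod-from t d n =
    trans (cong (_* fct d) (trans (prod-cong (λ p → distance p (+ t) (+ d)) (map cast (ival (suc (t ℕ.+ d)) n)))
                                  (prod-up (λ τ → + d + τ) (t ℕ.+ d) n)))
          (run-shifted d n)
    where
    distance : ∀ p t d → p - t ≡ d + (p - (t + d))
    distance = solve-∀

  -- An entry with g + l positions between it and the second interval contributes the quotient (r +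
  -- g + l)! / (g + l)!, and l runs over 0, ..., n - 1.
  cross-ival : ∀ c n g r → cross (map cast (ival c n)) (map cast (ival (c ℕ.+ n ℕ.+ g) r)) * fp g n ≡ fp (r ℕ.+ g) n
  cross-ival c zero    g r = refl
  cross-ival c (suc n) g r = begin
    prodOver (_- + c) Y * cross X Y * fp g (suc n)
      ≡⟨ cong (prodOver (_- + c) Y * cross X Y *_) (fp-last g n) ⟩
    prodOver (_- + c) Y * cross X Y * (fp g n * fct (n ℕ.+ g))
      ≡⟨ regroup (prodOver (_- + c) Y) (cross X Y) (fp g n) (fct (n ℕ.+ g)) ⟩
    cross X Y * fp g n * (prodOver (_- + c) Y * fct (n ℕ.+ g))
      ≡⟨ cong₂ _*_ (trans (cong (λ k → cross X (map cast (ival k r)) * fp g n) (start c n g)) (cross-ival (suc c) n g r))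
                   (trans (cong (λ k → prodOver (_- + c) (map cast (ival k r)) * fct (n ℕ.+ g)) (start′ c n g)) (prod-from c (n ℕ.+ g) r)) ⟩
    fp (r ℕ.+ g) n * fct (n ℕ.+ g ℕ.+ r)
      ≡⟨ cong (λ k → fp (r ℕ.+ g) n * fct k) (last n g r) ⟩
    fp (r ℕ.+ g) n * fct (n ℕ.+ (r ℕ.+ g))
      ≡⟨ sym (fp-last (r ℕ.+ g) n) ⟩
    fp (r ℕ.+ g) (suc n) ∎
    where
    open ≡-Reasoning
    X = map cast (ival (suc c) n)
    Y = map cast (ival (c ℕ.+ suc n ℕ.+ g) r)
    regroup : ∀ a x f k → a * x * (f * k) ≡ x * f * (a * k)
    regroup = solve-∀
    start : ∀ c n g → c ℕ.+ suc n ℕ.+ g ≡ suc c ℕ.+ n ℕ.+ g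
    start = ℕ-Ring.solve-∀
    start′ : ∀ c n g → c ℕ.+ suc n ℕ.+ g ≡ suc (c ℕ.+ (n ℕ.+ g))
    start′ = ℕ-Ring.solve-∀
    last : ∀ n g r → n ℕ.+ g ℕ.+ r ≡ n ℕ.+ (r ℕ.+ g)
    last = ℕ-Ring.solve-∀

  vandermonde-ival : ∀ c n → vandermonde (map cast (ival c n)) ≡ + superfactorial n
  vandermonde-ival c zero    = refl
  vandermonde-ival c (suc n) =
    trans (cong₂ _*_ (trans (sym (*-identityʳ (prodOver (_- + c) (map cast (ival (suc c) n))))) (trans (cong (λ k → prodOver (_- + c) (map cast (ival (suc k) n)) * 1ℤ) (sym (ℕₚ.+-identityʳ c))) (prod-from c 0 n)))
                     (vandermonde-ival (suc c) n))
          (sym (pos-* (n !) (superfactorial n)))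

  -- The weight of the pair of positions at distance o = k + 1 + i from the centre: its interaction
  -- with the k positions of the removed triangle and with the e forced ones beyond distance N.
  pairWeight : ℕ → ℕ → ℕ → ℕ → ℤ
  pairWeight k N e i = run (λ t → (+ suc (k ℕ.+ i) - t) * (+ suc (k ℕ.+ i) + t)) k
                       * run (λ t → (+ N + t - + suc (k ℕ.+ i)) * (+ N + t + + suc (k ℕ.+ i))) e

  module _ (m q k e : ℕ) where

    private
      -- For o = k + 1 + i and L = 2k + 2 the squared distance is the node i (i + L) plus a
      -- constant. Here `m` is one less than the number of pairs: the weight lives on n + 1 points,
      -- and N = k + 1 + n is the largest distance.
      n N L η B : ℕ
      n = m ℕ.+ q
      N = m ℕ.+ suc (q ℕ.+ k)
      L = suc (suc (k ℕ.+ k))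
      η = suc (k ℕ.+ e)
      B = suc (η ℕ.+ N)

      inner outer : ℤ → ℕ → ℤ
      inner o = run (λ t → (o - t) * (o + t))
      outer o = run (λ t → (+ N + t - o) * (+ N + t + o))

    -- The product is (o - j) ... (o - 1) (o + 1) ... (o + j), so a shift of o changes only the ends
    -- of its two runs. The same reason is behind `outer-shift`.
    inner-shift : ∀ o j → inner o j * ((o + (1ℤ + + j)) * o) ≡ inner (1ℤ + o) j * ((o - + j) * (1ℤ + o))
    inner-shift o zero    = base o
      where
      base : ∀ o → 1ℤ * ((o + (1ℤ + 0ℤ)) * o) ≡ 1ℤ * ((o - 0ℤ) * (1ℤ + o))
      base = solve-∀
    inner-shift o (suc j) = begin
      (o - + suc j) * (o + + suc j) * inner o j * ((o + (1ℤ + + suc j)) * o)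
        ≡⟨ before o (+ j) (inner o j) ⟩
      inner o j * ((o + (1ℤ + + j)) * o) * ((o - (1ℤ + + j)) * (o + (1ℤ + (1ℤ + + j))))
        ≡⟨ cong (_* ((o - (1ℤ + + j)) * (o + (1ℤ + (1ℤ + + j))))) (inner-shift o j) ⟩
      inner (1ℤ + o) j * ((o - + j) * (1ℤ + o)) * ((o - (1ℤ + + j)) * (o + (1ℤ + (1ℤ + + j))))
        ≡⟨ after o (+ j) (inner (1ℤ + o) j) ⟩
      (1ℤ + o - + suc j) * (1ℤ + o + + suc j) * inner (1ℤ + o) j * ((o - + suc j) * (1ℤ + o)) ∎
      where
      open ≡-Reasoning
      before : ∀ o j r → (o - (1ℤ + j)) * (o + (1ℤ + j)) * r * ((o + (1ℤ + (1ℤ + j))) * o)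
               ≡ r * ((o + (1ℤ + j)) * o) * ((o - (1ℤ + j)) * (o + (1ℤ + (1ℤ + j))))
      before = solve-∀
      after : ∀ o j r → r * ((o - j) * (1ℤ + o)) * ((o - (1ℤ + j)) * (o + (1ℤ + (1ℤ + j))))
              ≡ (1ℤ + o - (1ℤ + j)) * (1ℤ + o + (1ℤ + j)) * r * ((o - (1ℤ + j)) * (1ℤ + o))
      after = solve-∀

    outer-shift : ∀ o j → outer o j * ((+ N - o) * (+ N + + j + (1ℤ + o))) ≡ outer (1ℤ + o) j * ((+ N + (1ℤ + o)) * (+ N + + j - o))
    outer-shift o zero    = base (+ N) o
      where
      base : ∀ N o → 1ℤ * ((N - o) * (N + 0ℤ + (1ℤ + o))) ≡ 1ℤ * ((N + (1ℤ + o)) * (N + 0ℤ - o))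
      base = solve-∀
    outer-shift o (suc j) = begin
      (+ N + + suc j - o) * (+ N + + suc j + o) * outer o j * ((+ N - o) * (+ N + + suc j + (1ℤ + o)))
        ≡⟨ before (+ N) o (+ j) (outer o j) ⟩
      outer o j * ((+ N - o) * (+ N + + j + (1ℤ + o))) * ((+ N + (1ℤ + + j) - o) * (+ N + (1ℤ + + j) + (1ℤ + o)))
        ≡⟨ cong (_* ((+ N + (1ℤ + + j) - o) * (+ N + (1ℤ + + j) + (1ℤ + o)))) (outer-shift o j) ⟩
      outer (1ℤ + o) j * ((+ N + (1ℤ + o)) * (+ N + + j - o)) * ((+ N + (1ℤ + + j) - o) * (+ N + (1ℤ + + j) + (1ℤ + o)))
        ≡⟨ after (+ N) o (+ j) (outer (1ℤ + o) j) ⟩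
      (+ N + + suc j - (1ℤ + o)) * (+ N + + suc j + (1ℤ + o)) * outer (1ℤ + o) j * ((+ N + (1ℤ + o)) * (+ N + + suc j - o)) ∎
      where
      open ≡-Reasoning
      before : ∀ N o j r → (N + (1ℤ + j) - o) * (N + (1ℤ + j) + o) * r * ((N - o) * (N + (1ℤ + j) + (1ℤ + o)))
               ≡ r * ((N - o) * (N + j + (1ℤ + o))) * ((N + (1ℤ + j) - o) * (N + (1ℤ + j) + (1ℤ + o)))
      before N o j r = trans (cong (λ x → (N + (1ℤ + j) - o) * x * r * ((N - o) * (N + (1ℤ + j) + (1ℤ + o)))) (eq N o j))
                             (move (N + (1ℤ + j) - o) (N + j + (1ℤ + o)) r (N - o) (N + (1ℤ + j) + (1ℤ + o)))
        where
        eq : ∀ N o j → N + (1ℤ + j) + o ≡ N + j + (1ℤ + o)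
        eq = solve-∀
        move : ∀ a b r c d → a * b * r * (c * d) ≡ r * (c * b) * (a * d)
        move = solve-∀
      after : ∀ N o j r → r * ((N + (1ℤ + o)) * (N + j - o)) * ((N + (1ℤ + j) - o) * (N + (1ℤ + j) + (1ℤ + o)))
              ≡ (N + (1ℤ + j) - (1ℤ + o)) * (N + (1ℤ + j) + (1ℤ + o)) * r * ((N + (1ℤ + o)) * (N + (1ℤ + j) - o))
      after N o j r = trans (cong (λ x → r * ((N + (1ℤ + o)) * x) * ((N + (1ℤ + j) - o) * (N + (1ℤ + j) + (1ℤ + o)))) (eq N o j))
                            (move (N + (1ℤ + j) - (1ℤ + o)) (N + (1ℤ + j) + (1ℤ + o)) r (N + (1ℤ + o)) (N + (1ℤ + j) - o))
        where
        eq : ∀ N o j → N + j - o ≡ N + (1ℤ + j) - (1ℤ + o)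
        eq = solve-∀
        move : ∀ a b r c d → r * (c * a) * (d * b) ≡ a * b * r * (c * d)
        move = solve-∀

    -- Together with `outer-end` this evaluates the weight at the largest distance, where `norm`
    -- prescribes its value.
    inner-end : ∀ j n → inner (+ (n ℕ.+ suc j)) j * (fct n * fct (n ℕ.+ suc j)) ≡ fct (j ℕ.+ n) * fct (n ℕ.+ suc j ℕ.+ j)
    inner-end zero    n = trans (*-identityˡ _) (cong (λ t → fct n * fct t) (sym (ℕₚ.+-identityʳ (n ℕ.+ 1))))
    inner-end (suc j) n = begin
      (+ R - + suc j) * (+ R + + suc j) * inner (+ R) j * (fct n * fct R)
        ≡⟨ cong (λ x → x * (+ R + + suc j) * inner (+ R) j * (fct n * fct R)) (distance (+ n) (+ j)) ⟩
      + suc n * + (R ℕ.+ suc j) * inner (+ R) j * (fct n * fct R)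
        ≡⟨ regroup (+ suc n) (+ (R ℕ.+ suc j)) (inner (+ R) j) (fct n) (fct R) ⟩
      + (R ℕ.+ suc j) * (inner (+ R) j * (+ suc n * fct n * fct R))
        ≡⟨ cong₂ (λ x y → + x * (inner (+ R) j * (y * fct R))) (ℕₚ.+-suc R j) (sym (fct-suc n)) ⟩
      + suc (R ℕ.+ j) * (inner (+ R) j * (fct (suc n) * fct R))
        ≡⟨ cong (λ t → + suc (t ℕ.+ j) * (inner (+ t) j * (fct (suc n) * fct t))) (ℕₚ.+-suc n (suc j)) ⟩
      + suc (suc n ℕ.+ suc j ℕ.+ j) * (inner (+ (suc n ℕ.+ suc j)) j * (fct (suc n) * fct (suc n ℕ.+ suc j)))
        ≡⟨ cong (+ suc (suc n ℕ.+ suc j ℕ.+ j) *_) (inner-end j (suc n)) ⟩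
      + suc (suc n ℕ.+ suc j ℕ.+ j) * (fct (j ℕ.+ suc n) * fct (suc n ℕ.+ suc j ℕ.+ j))
        ≡⟨ swap (+ suc (suc n ℕ.+ suc j ℕ.+ j)) (fct (j ℕ.+ suc n)) (fct (suc n ℕ.+ suc j ℕ.+ j)) ⟩
      fct (j ℕ.+ suc n) * (+ suc (suc n ℕ.+ suc j ℕ.+ j) * fct (suc n ℕ.+ suc j ℕ.+ j))
        ≡⟨ cong₂ _*_ (cong fct (ℕₚ.+-suc j n)) (trans (sym (fct-suc (suc n ℕ.+ suc j ℕ.+ j))) (cong fct (last n j))) ⟩
      fct (suc j ℕ.+ n) * fct (R ℕ.+ suc j) ∎
      where
      open ≡-Reasoning
      R = n ℕ.+ suc (suc j)
      distance : ∀ n j → n + (1ℤ + (1ℤ + j)) - (1ℤ + j) ≡ 1ℤ + n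
      distance = solve-∀
      regroup : ∀ a b r f g → a * b * r * (f * g) ≡ b * (r * (a * f * g))
      regroup = solve-∀
      swap : ∀ a b c → a * (b * c) ≡ b * (a * c)
      swap = solve-∀
      last : ∀ n j → suc (suc n ℕ.+ suc j ℕ.+ j) ≡ n ℕ.+ suc (suc j) ℕ.+ suc j
      last = ℕ-Ring.solve-∀

    outer-end : ∀ j → outer (+ N) j * fct (N ℕ.+ N) ≡ fct j * fct (N ℕ.+ N ℕ.+ j)
    outer-end zero    = cong (λ t → 1ℤ * fct t) (sym (ℕₚ.+-identityʳ (N ℕ.+ N)))
    outer-end (suc j) = begin
      (+ N + + suc j - + N) * (+ N + + suc j + + N) * outer (+ N) j * fct (N ℕ.+ N)
        ≡⟨ regroup (+ N) (+ suc j) (outer (+ N) j) (fct (N ℕ.+ N)) ⟩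
      + suc j * + (N ℕ.+ N ℕ.+ suc j) * (outer (+ N) j * fct (N ℕ.+ N))
        ≡⟨ cong₂ (λ x y → + suc j * + x * y) (ℕₚ.+-suc (N ℕ.+ N) j) (outer-end j) ⟩
      + suc j * + suc (N ℕ.+ N ℕ.+ j) * (fct j * fct (N ℕ.+ N ℕ.+ j))
        ≡⟨ swap (+ suc j) (+ suc (N ℕ.+ N ℕ.+ j)) (fct j) (fct (N ℕ.+ N ℕ.+ j)) ⟩
      + suc j * fct j * (+ suc (N ℕ.+ N ℕ.+ j) * fct (N ℕ.+ N ℕ.+ j))
        ≡⟨ cong₂ _*_ (sym (fct-suc j)) (trans (sym (fct-suc (N ℕ.+ N ℕ.+ j))) (cong fct (sym (ℕₚ.+-suc (N ℕ.+ N) j)))) ⟩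
      fct (suc j) * fct (N ℕ.+ N ℕ.+ suc j) ∎
      where
      open ≡-Reasoning
      regroup : ∀ N j r f → (N + j - N) * (N + j + N) * r * f ≡ j * (N + N + j) * (r * f)
      regroup = solve-∀
      swap : ∀ a b c d → a * b * (c * d) ≡ a * c * (b * d)
      swap = solve-∀

    pairWeight-isWeight : Weight (pairWeight k N e) L k N e n η B
    pairWeight-isWeight = record
      { level   = level′ m q k
      ; η-def   = refl
      ; B-def   = refl
      ; pearson = pearson′
      ; norm    = norm′
      }
      where
      open ≡-Reasoning
      level′ : ∀ m q k → suc (suc (k ℕ.+ k)) ℕ.+ (m ℕ.+ q) ≡ suc (k ℕ.+ (m ℕ.+ suc (q ℕ.+ k)))
      level′ = ℕ-Ring.solve-∀
      pearson′ : Pearson (pairWeight k N e) (+ L) (+ suc k) (+ B) (suc n)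
      pearson′ i = begin
        inner o k * outer o e * up (+ L) (+ suc k) (+ B) (+ suc n) (+ i)
          ≡⟨ cong (inner o k * outer o e *_) up-factors ⟩
        inner o k * outer o e * ((o + (1ℤ + + k)) * o * (+ N - o) * (+ N + + e + (1ℤ + o)))
          -- The factors L + i and A + i of `up` belong to the run of the removed triangle, the two
          -- others to the run of the forced positions.
          ≡⟨ pair (inner o k) (outer o e) (o + (1ℤ + + k)) o (+ N - o) (+ N + + e + (1ℤ + o)) ⟩
        inner o k * ((o + (1ℤ + + k)) * o) * (outer o e * ((+ N - o) * (+ N + + e + (1ℤ + o))))
          ≡⟨ cong₂ _*_ (inner-shift o k) (outer-shift o e) ⟩
        inner (1ℤ + o) k * ((o - + k) * (1ℤ + o)) * (outer (1ℤ + o) e * ((+ N + (1ℤ + o)) * (+ N + + e - o)))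
          ≡⟨ sym (pair (inner (1ℤ + o) k) (outer (1ℤ + o) e) (o - + k) (1ℤ + o) (+ N + (1ℤ + o)) (+ N + + e - o)) ⟩
        inner (1ℤ + o) k * outer (1ℤ + o) e * ((o - + k) * (1ℤ + o) * (+ N + (1ℤ + o)) * (+ N + + e - o))
          ≡⟨ cong₂ (λ x y → inner x k * outer x e * y) (cong (λ t → + suc t) (sym (ℕₚ.+-suc k i))) (sym down-factors) ⟩
        pairWeight k N e (suc i) * down (+ L) (+ suc k) (+ B) (+ suc n) (1ℤ + + i) ∎
        where
        o = + suc (k ℕ.+ i)
        pair : ∀ a b c d f g → a * b * (c * d * f * g) ≡ a * (c * d) * (b * (f * g))
        pair = solve-∀
        up-factors : up (+ L) (+ suc k) (+ B) (+ suc n) (+ i) ≡ (o + (1ℤ + + k)) * o * (+ N - o) * (+ N + + e + (1ℤ + o))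
        up-factors = cong₂ _*_ (cong₂ _*_ (cong (_* o) (u₁ (+ k) (+ i))) (u₃ (+ m) (+ q) (+ k) (+ i))) (u₄ (+ k) (+ e) (+ N) (+ i))
          where
          u₁ : ∀ k i → 1ℤ + (1ℤ + (k + k)) + i ≡ 1ℤ + (k + i) + (1ℤ + k)
          u₁ = solve-∀
          u₃ : ∀ m q k i → 1ℤ + (m + q) - 1ℤ - i ≡ m + (1ℤ + (q + k)) - (1ℤ + (k + i))
          u₃ = solve-∀
          u₄ : ∀ k e N i → 1ℤ + (1ℤ + (k + e) + N) + i ≡ N + e + (1ℤ + (1ℤ + (k + i)))
          u₄ = solve-∀
        down-factors : down (+ L) (+ suc k) (+ B) (+ suc n) (1ℤ + + i) ≡ (o - + k) * (1ℤ + o) * (+ N + (1ℤ + o)) * (+ N + + e - o)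
        down-factors = cong₂ _*_ (cong₂ _*_ (cong₂ _*_ (d₁ (+ k) (+ i)) (d₂ (+ k) (+ i))) (d₃ (+ m) (+ q) (+ k) (+ i))) (d₄ (+ k) (+ e) (+ N) (+ i))
          where
          d₁ : ∀ k i → 1ℤ + i ≡ 1ℤ + (k + i) - k
          d₁ = solve-∀
          d₂ : ∀ k i → 1ℤ + (1ℤ + (k + k)) - (1ℤ + k) + (1ℤ + i) ≡ 1ℤ + (1ℤ + (k + i))
          d₂ = solve-∀
          d₃ : ∀ m q k i → 1ℤ + (1ℤ + (k + k)) + (1ℤ + (m + q) - 1ℤ) + (1ℤ + i) ≡ m + (1ℤ + (q + k)) + (1ℤ + (1ℤ + (k + i)))
          d₃ = solve-∀
          d₄ : ∀ k e N i → 1ℤ + (1ℤ + (k + e) + N) - (1ℤ + (1ℤ + (k + k))) - (1ℤ + i) ≡ N + e - (1ℤ + (k + i))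
          d₄ = solve-∀
      norm′ : pairWeight k N e n * (fct (L ℕ.+ n ℕ.+ n) * fct n * fct N) ≡ fct (k ℕ.+ N) * fct e * fct (k ℕ.+ n) * fct (η ℕ.+ N ℕ.+ n)
      norm′ = begin
        inner (+ suc (k ℕ.+ n)) k * outer (+ suc (k ℕ.+ n)) e * (fct (L ℕ.+ n ℕ.+ n) * fct n * fct N)
          ≡⟨ cong₂ (λ x y → inner (+ x) k * outer (+ x) e * (fct y * fct n * fct N)) (o-end m q k) (U-end m q k) ⟩
        inner (+ N) k * outer (+ N) e * (fct (N ℕ.+ N) * fct n * fct N)
          ≡⟨ regroup (inner (+ N) k) (outer (+ N) e) (fct (N ℕ.+ N)) (fct n) (fct N) ⟩
        inner (+ N) k * (fct n * fct N) * (outer (+ N) e * fct (N ℕ.+ N))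
          ≡⟨ cong₂ _*_ (trans (cong (λ t → inner (+ t) k * (fct n * fct t)) (N-split m q k)) (inner-end k n)) (outer-end e) ⟩
        fct (k ℕ.+ n) * fct (n ℕ.+ suc k ℕ.+ k) * (fct e * fct (N ℕ.+ N ℕ.+ e))
          ≡⟨ cong₂ (λ x y → fct (k ℕ.+ n) * fct x * (fct e * fct y)) (sum₁ m q k) (sum₂ m q k e) ⟩
        fct (k ℕ.+ n) * fct (k ℕ.+ N) * (fct e * fct (η ℕ.+ N ℕ.+ n))
          ≡⟨ regroup′ (fct (k ℕ.+ n)) (fct (k ℕ.+ N)) (fct e) (fct (η ℕ.+ N ℕ.+ n)) ⟩
        fct (k ℕ.+ N) * fct e * fct (k ℕ.+ n) * fct (η ℕ.+ N ℕ.+ n) ∎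
        where
        regroup : ∀ a b u n s → a * b * (u * n * s) ≡ a * (n * s) * (b * u)
        regroup = solve-∀
        regroup′ : ∀ a b c d → a * b * (c * d) ≡ b * c * a * d
        regroup′ = solve-∀
        o-end : ∀ m q k → suc (k ℕ.+ (m ℕ.+ q)) ≡ m ℕ.+ suc (q ℕ.+ k)
        o-end = ℕ-Ring.solve-∀
        N-split : ∀ m q k → m ℕ.+ suc (q ℕ.+ k) ≡ m ℕ.+ q ℕ.+ suc k
        N-split = ℕ-Ring.solve-∀
        U-end : ∀ m q k → suc (suc (k ℕ.+ k)) ℕ.+ (m ℕ.+ q) ℕ.+ (m ℕ.+ q) ≡ m ℕ.+ suc (q ℕ.+ k) ℕ.+ (m ℕ.+ suc (q ℕ.+ k))
        U-end = ℕ-Ring.solve-∀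
        sum₁ : ∀ m q k → m ℕ.+ q ℕ.+ suc k ℕ.+ k ≡ k ℕ.+ (m ℕ.+ suc (q ℕ.+ k))
        sum₁ = ℕ-Ring.solve-∀
        sum₂ : ∀ m q k e → m ℕ.+ suc (q ℕ.+ k) ℕ.+ (m ℕ.+ suc (q ℕ.+ k)) ℕ.+ e ≡ suc (k ℕ.+ e) ℕ.+ (m ℕ.+ suc (q ℕ.+ k)) ℕ.+ (m ℕ.+ q)
        sum₂ = ℕ-Ring.solve-∀

-- Comparing the products of factorials

open import Algebra.Bundles using (CommutativeMonoid)
open import Algebra.Structures using (IsCommutativeMonoid)
open import Data.List using ([]; _∷_)
open import Data.Nat as ℕ using (ℕ; zero; suc)
import Data.Nat.Tactic.RingSolver as ℕ-Ring
open import Relation.Binary.PropositionalEquality using (_≡_; refl; sym; trans; cong; cong₂; module ≡-Reasoning)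

-- The arithmetic of quotients of superfactorials h, for an arbitrary cancellative multiplication:
-- as a parameter it is never unfolded, which keeps the conversion checks below cheap.
module Quotients
  (Z : Set) (_*_ : Z → Z → Z) (1# : Z) (isCommutativeMonoid : IsCommutativeMonoid _≡_ _*_ 1#)
  (NonZero : Z → Set) (nonZero-* : ∀ a b → NonZero a → NonZero b → NonZero (a * b)) (1-nonZero : NonZero 1#)
  (*-cancelʳ : ∀ {x y} a → NonZero a → x * a ≡ y * a → x ≡ y)
  (h : ℕ → Z) (h≢0 : ∀ n → NonZero (h n)) (h-zero : h 0 ≡ 1#)
  (fp : ℕ → ℕ → Z) (fp-eq : ∀ c m → fp c m * h c ≡ h (m ℕ.+ c))
  (PP : ℕ → ℕ → ℕ → Z) (PP-eq : ∀ a b n → PP a b n * (h (a ℕ.+ b) * h (a ℕ.+ n)) ≡ h (a ℕ.+ b ℕ.+ n) * h a)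
  where

  open IsCommutativeMonoid isCommutativeMonoid using (assoc; comm; identityʳ; identityˡ)

  private
    monoid : CommutativeMonoid _ _
    monoid = record { isCommutativeMonoid = isCommutativeMonoid }

  open import Algebra.Solver.CommutativeMonoid monoid using (solve; _⊜_; _⊕_; id)

  private
    *-nonZero : ∀ {a b} → NonZero a → NonZero b → NonZero (a * b)
    *-nonZero {a} {b} = nonZero-* a b

  -- States x = b / a without division, so that numerators and denominators can be collected
  -- separately.
  record Ratio (x a b : Z) : Set where
    constructor ratio
    field
      ratio-eq : x * a ≡ b
      nonZero  : NonZero a

  ratio-* : ∀ {x y a b c d} → Ratio x a b → Ratio y c d → Ratio (x * y) (a * c) (b * d)
  ratio-* {x} {y} {a} {b} {c} {d} (ratio p nz) (ratio r nz′) = ratio (trans (interchange x y a c) (cong₂ _*_ p r)) (*-nonZero nz nz′)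
    where
    interchange : ∀ x y a c → ((x * y) * (a * c)) ≡ ((x * a) * (y * c))
    interchange = solve 4 (λ x y a c → ((x ⊕ y) ⊕ (a ⊕ c)) ⊜ ((x ⊕ a) ⊕ (y ⊕ c))) refl

  ratio-unique : ∀ {x y a b c d} → Ratio x a b → Ratio y c d → (b * c) ≡ (d * a) → x ≡ y
  ratio-unique {x} {y} {a} {b} {c} {d} (ratio p nz) (ratio r nz′) eq = *-cancelʳ (a * c) (*-nonZero nz nz′) (begin
    x * (a * c)  ≡⟨ sym (assoc x a c) ⟩
    (x * a) * c  ≡⟨ cong (_* c) p ⟩
    b * c        ≡⟨ eq ⟩
    d * a        ≡⟨ cong (_* a) (sym r) ⟩
    (y * c) * a  ≡⟨ trans (assoc y c a) (cong (y *_) (comm c a)) ⟩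
    y * (a * c)  ∎)
    where open ≡-Reasoning

  ratio-/ : ∀ {x y z a b c d} → (x * z) ≡ y → Ratio y a b → Ratio z c d → NonZero d → Ratio x (a * d) (b * c)
  ratio-/ {x} {y} {z} {a} {b} {c} {d} e (ratio p nz) (ratio r _) nz′ = ratio (begin
    x * (a * d)        ≡⟨ cong (λ t → x * (a * t)) (sym r) ⟩
    x * (a * (z * c))  ≡⟨ regroup x a z c ⟩
    ((x * z) * a) * c  ≡⟨ cong (λ t → (t * a) * c) e ⟩
    (y * a) * c        ≡⟨ cong (_* c) p ⟩
    b * c ∎) (*-nonZero nz nz′)
    where
    open ≡-Reasoning
    regroup : ∀ x a z c → (x * (a * (z * c))) ≡ (((x * z) * a) * c)
    regroup = solve 4 (λ x a z c → (x ⊕ (a ⊕ (z ⊕ c))) ⊜ (((x ⊕ z) ⊕ a) ⊕ c)) refl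

  h-ratio : ∀ n → Ratio (h n) 1# (h n)
  h-ratio n = ratio (identityʳ (h n)) 1-nonZero

  fp-ratio : ∀ {c} m {b d} → b ≡ c → d ≡ m ℕ.+ c → Ratio (fp c m) (h b) (h d)
  fp-ratio {c} m refl refl = ratio (fp-eq c m) (h≢0 c)

  fp₀-ratio : ∀ m {d} → d ≡ m ℕ.+ 0 → Ratio (fp 0 m) 1# (h d)
  fp₀-ratio m refl = ratio (trans (cong (fp 0 m *_) (sym h-zero)) (fp-eq 0 m)) 1-nonZero

  PP₀-ratio : ∀ b n {bn} → bn ≡ b ℕ.+ n → Ratio (PP 0 b n) (h b * h n) (h bn)
  PP₀-ratio b n refl = ratio (trans (PP-eq 0 b n) (trans (cong (h (b ℕ.+ n) *_) h-zero) (identityʳ (h (b ℕ.+ n)))))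
                             (*-nonZero (h≢0 b) (h≢0 n))

  h₀-ratio : Ratio (h 0) 1# 1#
  h₀-ratio = ratio (trans (identityʳ (h 0)) h-zero) 1-nonZero

  PP-ratio : ∀ a b n {a′ ab an abn} → a′ ≡ a → ab ≡ a ℕ.+ b → an ≡ a ℕ.+ n → abn ≡ a ℕ.+ b ℕ.+ n →
             Ratio (PP a b n) (h ab * h an) (h abn * h a′)
  PP-ratio a b n refl refl refl refl = ratio (PP-eq a b n) (*-nonZero (h≢0 (a ℕ.+ b)) (h≢0 (a ℕ.+ n)))

  -- The case of forced positions below the pairs, x ≥ z. Every factor is a quotient of
  -- superfactorials, and after cross-multiplication the claim is an identity between monomials in
  -- twenty of them.
  wide : ∀ m q k e {x X₁ X₂ J} →
    (X₁ * fp (m ℕ.+ q) e) ≡ fp (k ℕ.+ (m ℕ.+ q)) e →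
    (X₂ * fp (suc (m ℕ.+ (q ℕ.+ k))) k) ≡ fp (0 ℕ.+ suc (m ℕ.+ (q ℕ.+ k))) k →
    (J * ((fp q m * fp (suc (q ℕ.+ k)) m) * fp (k ℕ.+ (e ℕ.+ 0) ℕ.+ m) m))
      ≡ ((((fp (e ℕ.+ 0) m * fp (k ℕ.+ (e ℕ.+ 0) ℕ.+ (m ℕ.+ q)) m) * fp k m) * fp (k ℕ.+ (e ℕ.+ 0) ℕ.+ (m ℕ.+ suc (q ℕ.+ k))) m) * fp 0 m) →
    (h (e ℕ.+ (m ℕ.+ m ℕ.+ k ℕ.+ 0)) * x) ≡ (((h e * h 0) * ((h k * X₁) * X₂)) * J) →
    ((((x * PP 0 m (suc (q ℕ.+ k))) * PP 0 k q) * PP k q m) * PP k (suc (q ℕ.+ k)) m)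
      ≡ (((PP k m (suc (q ℕ.+ k)) * PP (m ℕ.+ e) k q) * PP (m ℕ.+ k ℕ.+ e) q m) * PP (m ℕ.+ k ℕ.+ e) (suc (q ℕ.+ k)) m)
  wide m q k e {x} {X₁} {X₂} {J} below-eq above-eq pairs-eq count-eq = ratio-unique
    (ratio-* (ratio-* (ratio-* (ratio-* count (PP₀-ratio m (suc (q ℕ.+ k)) {suc (m ℕ.+ q ℕ.+ k)} (ℕ-Ring.solve (m ∷ q ∷ k ∷ e ∷ [])))) (PP₀-ratio k q {q ℕ.+ k} (ℕ-Ring.solve (m ∷ q ∷ k ∷ e ∷ [])))) (PP-ratio k q m {k} {q ℕ.+ k} {m ℕ.+ k} {m ℕ.+ q ℕ.+ k} refl (ℕ-Ring.solve (m ∷ q ∷ k ∷ e ∷ [])) (ℕ-Ring.solve (m ∷ q ∷ k ∷ e ∷ [])) (ℕ-Ring.solve (m ∷ q ∷ k ∷ e ∷ [])))) (PP-ratio k (suc (q ℕ.+ k)) m {k} {suc (q ℕ.+ k ℕ.+ k)} {m ℕ.+ k} {suc (m ℕ.+ q ℕ.+ k ℕ.+ k)} refl (ℕ-Ring.solve (m ∷ q ∷ k ∷ e ∷ [])) (ℕ-Ring.solve (m ∷ q ∷ k ∷ e ∷ [])) (ℕ-Ring.solve (m ∷ q ∷ k ∷ e ∷ []))))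
    (ratio-* (ratio-* (ratio-* (PP-ratio k m (suc (q ℕ.+ k)) {k} {m ℕ.+ k} {suc (q ℕ.+ k ℕ.+ k)} {suc (m ℕ.+ q ℕ.+ k ℕ.+ k)} refl (ℕ-Ring.solve (m ∷ q ∷ k ∷ e ∷ [])) (ℕ-Ring.solve (m ∷ q ∷ k ∷ e ∷ [])) (ℕ-Ring.solve (m ∷ q ∷ k ∷ e ∷ []))) (PP-ratio (m ℕ.+ e) k q {m ℕ.+ e} {m ℕ.+ k ℕ.+ e} {m ℕ.+ q ℕ.+ e} {m ℕ.+ q ℕ.+ k ℕ.+ e} refl (ℕ-Ring.solve (m ∷ q ∷ k ∷ e ∷ [])) (ℕ-Ring.solve (m ∷ q ∷ k ∷ e ∷ [])) (ℕ-Ring.solve (m ∷ q ∷ k ∷ e ∷ [])))) (PP-ratio (m ℕ.+ k ℕ.+ e) q m {m ℕ.+ k ℕ.+ e} {m ℕ.+ q ℕ.+ k ℕ.+ e} {m ℕ.+ m ℕ.+ k ℕ.+ e} {m ℕ.+ m ℕ.+ q ℕ.+ k ℕ.+ e} refl (ℕ-Ring.solve (m ∷ q ∷ k ∷ e ∷ [])) (ℕ-Ring.solve (m ∷ q ∷ k ∷ e ∷ [])) (ℕ-Ring.solve (m ∷ q ∷ k ∷ e ∷ [])))) (PP-ratio (m ℕ.+ k ℕ.+ e) (suc (q ℕ.+ k)) m {m ℕ.+ k ℕ.+ e} {suc (m ℕ.+ q ℕ.+ k ℕ.+ k ℕ.+ e)} {m ℕ.+ m ℕ.+ k ℕ.+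 e} {suc (m ℕ.+ m ℕ.+ q ℕ.+ k ℕ.+ k ℕ.+ e)} refl (ℕ-Ring.solve (m ∷ q ∷ k ∷ e ∷ [])) (ℕ-Ring.solve (m ∷ q ∷ k ∷ e ∷ [])) (ℕ-Ring.solve (m ∷ q ∷ k ∷ e ∷ []))))
    (monomials (h e) (h k) (h (m ℕ.+ q ℕ.+ k ℕ.+ e)) (h (m ℕ.+ q)) (h (suc (m ℕ.+ q ℕ.+ k ℕ.+ k))) (h (suc (m ℕ.+ q ℕ.+ k))) (h (m ℕ.+ e)) (h (m ℕ.+ m ℕ.+ q ℕ.+ k ℕ.+ e)) (h (m ℕ.+ k)) (h (suc (m ℕ.+ m ℕ.+ q ℕ.+ k ℕ.+ k ℕ.+ e))) (h m) (h q) (h (suc (q ℕ.+ k))) (h (m ℕ.+ k ℕ.+ e)) (h (q ℕ.+ k)) (h (m ℕ.+ q ℕ.+ k)) (h (suc (q ℕ.+ k ℕ.+ k))) (h (m ℕ.+ q ℕ.+ e)) (h (m ℕ.+ m ℕ.+ k ℕ.+ e)) (h (suc (m ℕ.+ q ℕ.+ k ℕ.+ k ℕ.+ e))))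
    where
    below : Ratio X₁ (h (m ℕ.+ q ℕ.+ k) * h (m ℕ.+ q ℕ.+ e)) (h (m ℕ.+ q ℕ.+ k ℕ.+ e) * h (m ℕ.+ q))
    below = ratio-/ below-eq (fp-ratio e (ℕ-Ring.solve (m ∷ q ∷ k ∷ e ∷ [])) (ℕ-Ring.solve (m ∷ q ∷ k ∷ e ∷ []))) (fp-ratio e (ℕ-Ring.solve (m ∷ q ∷ k ∷ e ∷ [])) (ℕ-Ring.solve (m ∷ q ∷ k ∷ e ∷ []))) (h≢0 (m ℕ.+ q ℕ.+ e))
    above : Ratio X₂ (h (suc (m ℕ.+ q ℕ.+ k)) * h (suc (m ℕ.+ q ℕ.+ k ℕ.+ k))) (h (suc (m ℕ.+ q ℕ.+ k ℕ.+ k)) * h (suc (m ℕ.+ q ℕ.+ k)))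
    above = ratio-/ above-eq (fp-ratio k (ℕ-Ring.solve (m ∷ q ∷ k ∷ e ∷ [])) (ℕ-Ring.solve (m ∷ q ∷ k ∷ e ∷ []))) (fp-ratio k (ℕ-Ring.solve (m ∷ q ∷ k ∷ e ∷ [])) (ℕ-Ring.solve (m ∷ q ∷ k ∷ e ∷ []))) (h≢0 (suc (m ℕ.+ q ℕ.+ k ℕ.+ k)))
    pairs : Ratio J (((((h e * h (m ℕ.+ q ℕ.+ k ℕ.+ e)) * h k) * h (suc (m ℕ.+ q ℕ.+ k ℕ.+ k ℕ.+ e))) * 1#) * ((h (m ℕ.+ q) * h (suc (m ℕ.+ q ℕ.+ k))) * h (m ℕ.+ m ℕ.+ k ℕ.+ e))) (((((h (m ℕ.+ e) * h (m ℕ.+ m ℕ.+ q ℕ.+ k ℕ.+ e)) * h (m ℕ.+ k)) * h (suc (m ℕ.+ m ℕ.+ q ℕ.+ k ℕ.+ k ℕ.+ e))) * h m) * ((h q * h (suc (q ℕ.+ k))) * h (m ℕ.+ k ℕ.+ e)))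
    pairs = ratio-/ pairs-eq (ratio-* (ratio-* (ratio-* (ratio-* (fp-ratio m (ℕ-Ring.solve (m ∷ q ∷ k ∷ e ∷ [])) (ℕ-Ring.solve (m ∷ q ∷ k ∷ e ∷ []))) (fp-ratio m (ℕ-Ring.solve (m ∷ q ∷ k ∷ e ∷ [])) (ℕ-Ring.solve (m ∷ q ∷ k ∷ e ∷ [])))) (fp-ratio m (ℕ-Ring.solve (m ∷ q ∷ k ∷ e ∷ [])) (ℕ-Ring.solve (m ∷ q ∷ k ∷ e ∷ [])))) (fp-ratio m (ℕ-Ring.solve (m ∷ q ∷ k ∷ e ∷ [])) (ℕ-Ring.solve (m ∷ q ∷ k ∷ e ∷ [])))) (fp₀-ratio m (ℕ-Ring.solve (m ∷ q ∷ k ∷ e ∷ [])))) (ratio-* (ratio-* (fp-ratio m (ℕ-Ring.solve (m ∷ q ∷ k ∷ e ∷ [])) (ℕ-Ring.solve (m ∷ q ∷ k ∷ e ∷ []))) (fp-ratio m (ℕ-Ring.solve (m ∷ q ∷ k ∷ e ∷ [])) (ℕ-Ring.solve (m ∷ q ∷ k ∷ e ∷ [])))) (fp-ratio m (ℕ-Ring.solve (m ∷ q ∷ k ∷ e ∷ [])) (ℕ-Ring.solve (m ∷ q ∷ k ∷ e ∷ [])))) (*-nonZero (*-nonZero (h≢0 (m ℕ.+ q)) (h≢0 (suc (m ℕ.+ q ℕ.+ k)))) (h≢0 (m ℕ.+ m ℕ.+ k ℕ.+ e)))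
    size : m ℕ.+ m ℕ.+ k ℕ.+ e ≡ e ℕ.+ (m ℕ.+ m ℕ.+ k ℕ.+ 0)
    size = ℕ-Ring.solve (m ∷ q ∷ k ∷ e ∷ [])
    count : Ratio x ((((1# * 1#) * ((1# * (h (m ℕ.+ q ℕ.+ k) * h (m ℕ.+ q ℕ.+ e))) * (h (suc (m ℕ.+ q ℕ.+ k)) * h (suc (m ℕ.+ q ℕ.+ k ℕ.+ k))))) * (((((h e * h (m ℕ.+ q ℕ.+ k ℕ.+ e)) * h k) * h (suc (m ℕ.+ q ℕ.+ k ℕ.+ k ℕ.+ e))) * 1#) * ((h (m ℕ.+ q) * h (suc (m ℕ.+ q ℕ.+ k))) * h (m ℕ.+ m ℕ.+ k ℕ.+ e)))) * h (m ℕ.+ m ℕ.+ k ℕ.+ e)) ((((h e * 1#) * ((h k * (h (m ℕ.+ q ℕ.+ k ℕ.+ e) * h (m ℕ.+ q))) * (h (suc (m ℕ.+ q ℕ.+ k ℕ.+ k)) * h (suc (m ℕ.+ q ℕ.+ k))))) * (((((h (m ℕ.+ e) * h (m ℕ.+ m ℕ.+ q ℕ.+ k ℕ.+ e)) * h (m ℕ.+ k)) * h (suc (m ℕ.+ m ℕ.+ q ℕ.+ k ℕ.+ k ℕ.+ e))) * h m) * ((h q * h (suc (q ℕ.+ k))) * h (m ℕ.+ k ℕ.+ e)))) * 1#)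
    count = ratio-/ (trans (comm x (h (m ℕ.+ m ℕ.+ k ℕ.+ e))) (trans (cong (λ s → h s * x) size) count-eq)) (ratio-* (ratio-* (ratio-* (h-ratio e) h₀-ratio) (ratio-* (ratio-* (h-ratio k) below) above)) pairs) (h-ratio (m ℕ.+ m ℕ.+ k ℕ.+ e)) (h≢0 (m ℕ.+ m ℕ.+ k ℕ.+ e))
    monomials : ∀ h₀ h₁ h₂ h₃ h₄ h₅ h₆ h₇ h₈ h₉ h₁₀ h₁₁ h₁₂ h₁₃ h₁₄ h₁₅ h₁₆ h₁₇ h₁₈ h₁₉ →
      (((((((((h₀ * 1#) * ((h₁ * (h₂ * h₃)) * (h₄ * h₅))) * (((((h₆ * h₇) * h₈) * h₉) * h₁₀) * ((h₁₁ * h₁₂) * h₁₃))) * 1#) * h₅) * h₁₄) * (h₁₅ * h₁)) * (h₄ * h₁)) * ((((h₈ * h₁₆) * (h₁₃ * h₁₇)) * (h₂ * h₁₈)) * (h₁₉ * h₁₈)))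
      ≡ (((((h₄ * h₁) * (h₂ * h₆)) * (h₇ * h₁₃)) * (h₉ * h₁₃)) * ((((((((1# * 1#) * ((1# * (h₁₅ * h₁₇)) * (h₅ * h₄))) * (((((h₀ * h₂) * h₁) * h₁₉) * 1#) * ((h₃ * h₅) * h₁₈))) * h₁₈) * (h₁₀ * h₁₂)) * (h₁ * h₁₁)) * (h₁₄ * h₈)) * (h₁₆ * h₈)))
    monomials = solve 20 (λ h₀ h₁ h₂ h₃ h₄ h₅ h₆ h₇ h₈ h₉ h₁₀ h₁₁ h₁₂ h₁₃ h₁₄ h₁₅ h₁₆ h₁₇ h₁₈ h₁₉ →
      (((((((((h₀ ⊕ id) ⊕ ((h₁ ⊕ (h₂ ⊕ h₃)) ⊕ (h₄ ⊕ h₅))) ⊕ (((((h₆ ⊕ h₇) ⊕ h₈) ⊕ h₉) ⊕ h₁₀) ⊕ ((h₁₁ ⊕ h₁₂) ⊕ h₁₃))) ⊕ id) ⊕ h₅) ⊕ h₁₄) ⊕ (h₁₅ ⊕ h₁)) ⊕ (h₄ ⊕ h₁)) ⊕ ((((h₈ ⊕ h₁₆) ⊕ (h₁₃ ⊕ h₁₇)) ⊕ (h₂ ⊕ h₁₈)) ⊕ (h₁₉ ⊕ h₁₈)))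
      ⊜ (((((h₄ ⊕ h₁) ⊕ (h₂ ⊕ h₆)) ⊕ (h₇ ⊕ h₁₃)) ⊕ (h₉ ⊕ h₁₃)) ⊕ ((((((((id ⊕ id) ⊕ ((id ⊕ (h₁₅ ⊕ h₁₇)) ⊕ (h₅ ⊕ h₄))) ⊕ (((((h₀ ⊕ h₂) ⊕ h₁) ⊕ h₁₉) ⊕ id) ⊕ ((h₃ ⊕ h₅) ⊕ h₁₈))) ⊕ h₁₈) ⊕ (h₁₀ ⊕ h₁₂)) ⊕ (h₁ ⊕ h₁₁)) ⊕ (h₁₄ ⊕ h₈)) ⊕ (h₁₆ ⊕ h₈)))) refl

  -- The case of forced positions above the pairs, x ≤ z. The triangle occupies positions on one
  -- side of the centre only, so its distances to these forced positions differ from those in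
  -- `wide`, and the monomials with them.
  narrow : ∀ m q k e {x X₁ X₂ J} →
    (X₁ * fp (m ℕ.+ q) 0) ≡ fp (k ℕ.+ (m ℕ.+ q)) 0 →
    (X₂ * fp (suc (m ℕ.+ (q ℕ.+ k))) k) ≡ fp (e ℕ.+ suc (m ℕ.+ (q ℕ.+ k))) k →
    (J * ((fp q m * fp (suc (q ℕ.+ k)) m) * fp (k ℕ.+ (0 ℕ.+ e) ℕ.+ m) m))
      ≡ ((((fp (0 ℕ.+ e) m * fp (k ℕ.+ (0 ℕ.+ e) ℕ.+ (m ℕ.+ q)) m) * fp k m) * fp (k ℕ.+ (0 ℕ.+ e) ℕ.+ (m ℕ.+ suc (q ℕ.+ k))) m) * fp 0 m) →
    (h (0 ℕ.+ (m ℕ.+ m ℕ.+ k ℕ.+ e)) * x) ≡ (((h 0 * h e) * ((h k * X₁) * X₂)) * J) →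
    ((((x * PP 0 (m ℕ.+ e) (suc (q ℕ.+ k))) * PP 0 k q) * PP k q (m ℕ.+ e)) * PP k (suc (q ℕ.+ k)) (m ℕ.+ e))
      ≡ (((PP k (m ℕ.+ e) (suc (q ℕ.+ k)) * PP m k q) * PP (m ℕ.+ k) q (m ℕ.+ e)) * PP (m ℕ.+ k) (suc (q ℕ.+ k)) (m ℕ.+ e))
  narrow m q k e {x} {X₁} {X₂} {J} below-eq above-eq pairs-eq count-eq = ratio-unique
    (ratio-* (ratio-* (ratio-* (ratio-* count (PP₀-ratio (m ℕ.+ e) (suc (q ℕ.+ k)) {suc (m ℕ.+ q ℕ.+ k ℕ.+ e)} (ℕ-Ring.solve (m ∷ q ∷ k ∷ e ∷ [])))) (PP₀-ratio k q {q ℕ.+ k} (ℕ-Ring.solve (m ∷ q ∷ k ∷ e ∷ [])))) (PP-ratio k q (m ℕ.+ e) {k} {q ℕ.+ k} {m ℕ.+ k ℕ.+ e} {m ℕ.+ q ℕ.+ k ℕ.+ e} refl (ℕ-Ring.solve (m ∷ q ∷ k ∷ e ∷ [])) (ℕ-Ring.solve (m ∷ q ∷ k ∷ e ∷ [])) (ℕ-Ring.solve (m ∷ q ∷ k ∷ e ∷ [])))) (PP-ratio k (suc (q ℕ.+ k)) (m ℕ.+ e) {k} {suc (q ℕ.+ k ℕ.+ k)} {m ℕ.+ k ℕ.+ e} {suc (m ℕ.+ q ℕ.+ k ℕ.+ k ℕ.+ e)} refl (ℕ-Ring.solve (m ∷ q ∷ k ∷ e ∷ [])) (ℕ-Ring.solve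 (m ∷ q ∷ k ∷ e ∷ [])) (ℕ-Ring.solve (m ∷ q ∷ k ∷ e ∷ []))))
    (ratio-* (ratio-* (ratio-* (PP-ratio k (m ℕ.+ e) (suc (q ℕ.+ k)) {k} {m ℕ.+ k ℕ.+ e} {suc (q ℕ.+ k ℕ.+ k)} {suc (m ℕ.+ q ℕ.+ k ℕ.+ k ℕ.+ e)} refl (ℕ-Ring.solve (m ∷ q ∷ k ∷ e ∷ [])) (ℕ-Ring.solve (m ∷ q ∷ k ∷ e ∷ [])) (ℕ-Ring.solve (m ∷ q ∷ k ∷ e ∷ []))) (PP-ratio m k q {m} {m ℕ.+ k} {m ℕ.+ q} {m ℕ.+ q ℕ.+ k} refl (ℕ-Ring.solve (m ∷ q ∷ k ∷ e ∷ [])) (ℕ-Ring.solve (m ∷ q ∷ k ∷ e ∷ [])) (ℕ-Ring.solve (m ∷ q ∷ k ∷ e ∷ [])))) (PP-ratio (m ℕ.+ k) q (m ℕ.+ e) {m ℕ.+ k} {m ℕ.+ q ℕ.+ k} {m ℕ.+ m ℕ.+ k ℕ.+ e} {m ℕ.+ m ℕ.+ q ℕ.+ k ℕ.+ e} refl (ℕ-Ring.solve (m ∷ q ∷ k ∷ e ∷ [])) (ℕ-Ring.solve (m ∷ q ∷ k ∷ e ∷ [])) (ℕ-Ring.solve (m ∷ q ∷ k ∷ e ∷ [])))) (PP-ratio (m ℕ.+ k) (suc (q ℕ.+ k)) (m ℕ.+ e) {m ℕ.+ k} {suc (m ℕ.+ q ℕ.+ k ℕ.+ k)} {m ℕ.+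 m ℕ.+ k ℕ.+ e} {suc (m ℕ.+ m ℕ.+ q ℕ.+ k ℕ.+ k ℕ.+ e)} refl (ℕ-Ring.solve (m ∷ q ∷ k ∷ e ∷ [])) (ℕ-Ring.solve (m ∷ q ∷ k ∷ e ∷ [])) (ℕ-Ring.solve (m ∷ q ∷ k ∷ e ∷ []))))
    (monomials (h e) (h k) (h (m ℕ.+ q ℕ.+ k)) (h (m ℕ.+ q)) (h (suc (m ℕ.+ q ℕ.+ k ℕ.+ k ℕ.+ e))) (h (suc (m ℕ.+ q ℕ.+ k))) (h (m ℕ.+ e)) (h (m ℕ.+ m ℕ.+ q ℕ.+ k ℕ.+ e)) (h (m ℕ.+ k)) (h (suc (m ℕ.+ m ℕ.+ q ℕ.+ k ℕ.+ k ℕ.+ e))) (h m) (h q) (h (suc (q ℕ.+ k))) (h (m ℕ.+ k ℕ.+ e)) (h (suc (m ℕ.+ q ℕ.+ k ℕ.+ e))) (h (q ℕ.+ k)) (h (m ℕ.+ q ℕ.+ k ℕ.+ e)) (h (suc (q ℕ.+ k ℕ.+ k))) (h (m ℕ.+ m ℕ.+ k ℕ.+ e)) (h (suc (m ℕ.+ q ℕ.+ k ℕ.+ k))))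
    where
    below : Ratio X₁ (h (m ℕ.+ q ℕ.+ k) * h (m ℕ.+ q)) (h (m ℕ.+ q ℕ.+ k) * h (m ℕ.+ q))
    below = ratio-/ below-eq (fp-ratio 0 (ℕ-Ring.solve (m ∷ q ∷ k ∷ e ∷ [])) (ℕ-Ring.solve (m ∷ q ∷ k ∷ e ∷ []))) (fp-ratio 0 (ℕ-Ring.solve (m ∷ q ∷ k ∷ e ∷ [])) (ℕ-Ring.solve (m ∷ q ∷ k ∷ e ∷ []))) (h≢0 (m ℕ.+ q))
    above : Ratio X₂ (h (suc (m ℕ.+ q ℕ.+ k ℕ.+ e)) * h (suc (m ℕ.+ q ℕ.+ k ℕ.+ k))) (h (suc (m ℕ.+ q ℕ.+ k ℕ.+ k ℕ.+ e)) * h (suc (m ℕ.+ q ℕ.+ k)))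
    above = ratio-/ above-eq (fp-ratio k (ℕ-Ring.solve (m ∷ q ∷ k ∷ e ∷ [])) (ℕ-Ring.solve (m ∷ q ∷ k ∷ e ∷ []))) (fp-ratio k (ℕ-Ring.solve (m ∷ q ∷ k ∷ e ∷ [])) (ℕ-Ring.solve (m ∷ q ∷ k ∷ e ∷ []))) (h≢0 (suc (m ℕ.+ q ℕ.+ k ℕ.+ k)))
    pairs : Ratio J (((((h e * h (m ℕ.+ q ℕ.+ k ℕ.+ e)) * h k) * h (suc (m ℕ.+ q ℕ.+ k ℕ.+ k ℕ.+ e))) * 1#) * ((h (m ℕ.+ q) * h (suc (m ℕ.+ q ℕ.+ k))) * h (m ℕ.+ m ℕ.+ k ℕ.+ e))) (((((h (m ℕ.+ e) * h (m ℕ.+ m ℕ.+ q ℕ.+ k ℕ.+ e)) * h (m ℕ.+ k)) * h (suc (m ℕ.+ m ℕ.+ q ℕ.+ k ℕ.+ k ℕ.+ e))) * h m) * ((h q * h (suc (q ℕ.+ k))) * h (m ℕ.+ k ℕ.+ e)))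
    pairs = ratio-/ pairs-eq (ratio-* (ratio-* (ratio-* (ratio-* (fp-ratio m (ℕ-Ring.solve (m ∷ q ∷ k ∷ e ∷ [])) (ℕ-Ring.solve (m ∷ q ∷ k ∷ e ∷ []))) (fp-ratio m (ℕ-Ring.solve (m ∷ q ∷ k ∷ e ∷ [])) (ℕ-Ring.solve (m ∷ q ∷ k ∷ e ∷ [])))) (fp-ratio m (ℕ-Ring.solve (m ∷ q ∷ k ∷ e ∷ [])) (ℕ-Ring.solve (m ∷ q ∷ k ∷ e ∷ [])))) (fp-ratio m (ℕ-Ring.solve (m ∷ q ∷ k ∷ e ∷ [])) (ℕ-Ring.solve (m ∷ q ∷ k ∷ e ∷ [])))) (fp₀-ratio m (ℕ-Ring.solve (m ∷ q ∷ k ∷ e ∷ [])))) (ratio-* (ratio-* (fp-ratio m (ℕ-Ring.solve (m ∷ q ∷ k ∷ e ∷ [])) (ℕ-Ring.solve (m ∷ q ∷ k ∷ e ∷ []))) (fp-ratio m (ℕ-Ring.solve (m ∷ q ∷ k ∷ e ∷ [])) (ℕ-Ring.solve (m ∷ q ∷ k ∷ e ∷ [])))) (fp-ratio m (ℕ-Ring.solve (m ∷ q ∷ k ∷ e ∷ [])) (ℕ-Ring.solve (m ∷ q ∷ k ∷ e ∷ [])))) (*-nonZero (*-nonZero (h≢0 (m ℕ.+ q)) (h≢0 (suc (m ℕ.+ q ℕ.+ k)))) (h≢0 (m ℕ.+ m ℕ.+ k ℕ.+ e)))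
    size : m ℕ.+ m ℕ.+ k ℕ.+ e ≡ 0 ℕ.+ (m ℕ.+ m ℕ.+ k ℕ.+ e)
    size = ℕ-Ring.solve (m ∷ q ∷ k ∷ e ∷ [])
    count : Ratio x ((((1# * 1#) * ((1# * (h (m ℕ.+ q ℕ.+ k) * h (m ℕ.+ q))) * (h (suc (m ℕ.+ q ℕ.+ k ℕ.+ e)) * h (suc (m ℕ.+ q ℕ.+ k ℕ.+ k))))) * (((((h e * h (m ℕ.+ q ℕ.+ k ℕ.+ e)) * h k) * h (suc (m ℕ.+ q ℕ.+ k ℕ.+ k ℕ.+ e))) * 1#) * ((h (m ℕ.+ q) * h (suc (m ℕ.+ q ℕ.+ k))) * h (m ℕ.+ m ℕ.+ k ℕ.+ e)))) * h (m ℕ.+ m ℕ.+ k ℕ.+ e)) ((((1# * h e) * ((h k * (h (m ℕ.+ q ℕ.+ k) * h (m ℕ.+ q))) * (h (suc (m ℕ.+ q ℕ.+ k ℕ.+ k ℕ.+ e)) * h (suc (m ℕ.+ q ℕ.+ k))))) * (((((h (m ℕ.+ e) * h (m ℕ.+ m ℕ.+ q ℕ.+ k ℕ.+ e)) * h (m ℕ.+ k)) * h (suc (m ℕ.+ m ℕ.+ q ℕ.+ k ℕ.+ k ℕ.+ e))) * h m) * ((h q * h (suc (q ℕ.+ k))) * h (m ℕ.+ k ℕ.+ e)))) * 1#)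
    count = ratio-/ (trans (comm x (h (m ℕ.+ m ℕ.+ k ℕ.+ e))) (trans (cong (λ s → h s * x) size) count-eq)) (ratio-* (ratio-* (ratio-* h₀-ratio (h-ratio e)) (ratio-* (ratio-* (h-ratio k) below) above)) pairs) (h-ratio (m ℕ.+ m ℕ.+ k ℕ.+ e)) (h≢0 (m ℕ.+ m ℕ.+ k ℕ.+ e))
    monomials : ∀ h₀ h₁ h₂ h₃ h₄ h₅ h₆ h₇ h₈ h₉ h₁₀ h₁₁ h₁₂ h₁₃ h₁₄ h₁₅ h₁₆ h₁₇ h₁₈ h₁₉ →
      (((((((((1# * h₀) * ((h₁ * (h₂ * h₃)) * (h₄ * h₅))) * (((((h₆ * h₇) * h₈) * h₉) * h₁₀) * ((h₁₁ * h₁₂) * h₁₃))) * 1#) * h₁₄) * h₁₅) * (h₁₆ * h₁)) * (h₄ * h₁)) * ((((h₁₃ * h₁₇) * (h₈ * h₃)) * (h₂ * h₁₈)) * (h₁₉ * h₁₈)))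
      ≡ (((((h₄ * h₁) * (h₂ * h₁₀)) * (h₇ * h₈)) * (h₉ * h₈)) * ((((((((1# * 1#) * ((1# * (h₂ * h₃)) * (h₁₄ * h₁₉))) * (((((h₀ * h₁₆) * h₁) * h₄) * 1#) * ((h₃ * h₅) * h₁₈))) * h₁₈) * (h₆ * h₁₂)) * (h₁ * h₁₁)) * (h₁₅ * h₁₃)) * (h₁₇ * h₁₃)))
    monomials = solve 20 (λ h₀ h₁ h₂ h₃ h₄ h₅ h₆ h₇ h₈ h₉ h₁₀ h₁₁ h₁₂ h₁₃ h₁₄ h₁₅ h₁₆ h₁₇ h₁₈ h₁₉ →
      (((((((((id ⊕ h₀) ⊕ ((h₁ ⊕ (h₂ ⊕ h₃)) ⊕ (h₄ ⊕ h₅))) ⊕ (((((h₆ ⊕ h₇) ⊕ h₈) ⊕ h₉) ⊕ h₁₀) ⊕ ((h₁₁ ⊕ h₁₂) ⊕ h₁₃))) ⊕ id) ⊕ h₁₄) ⊕ h₁₅) ⊕ (h₁₆ ⊕ h₁)) ⊕ (h₄ ⊕ h₁)) ⊕ ((((h₁₃ ⊕ h₁₇) ⊕ (h₈ ⊕ h₃)) ⊕ (h₂ ⊕ h₁₈)) ⊕ (h₁₉ ⊕ h₁₈)))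
      ⊜ (((((h₄ ⊕ h₁) ⊕ (h₂ ⊕ h₁₀)) ⊕ (h₇ ⊕ h₈)) ⊕ (h₉ ⊕ h₈)) ⊕ ((((((((id ⊕ id) ⊕ ((id ⊕ (h₂ ⊕ h₃)) ⊕ (h₁₄ ⊕ h₁₉))) ⊕ (((((h₀ ⊕ h₁₆) ⊕ h₁) ⊕ h₄) ⊕ id) ⊕ ((h₃ ⊕ h₅) ⊕ h₁₈))) ⊕ h₁₈) ⊕ (h₆ ⊕ h₁₂)) ⊕ (h₁ ⊕ h₁₁)) ⊕ (h₁₅ ⊕ h₁₃)) ⊕ (h₁₇ ⊕ h₁₃)))) refl

-- The number of patterns over all symmetric top rows

module CountFormula where

  open import Defs using (poch)
  open Determinant
  open Summation
  open Exchange
  open Enumeration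
  open Vandermonde
  open GelfandTsetlin
  open Ladder
  open ClosedForm
  open SymmetricRows
  open import Data.Integer using (ℤ; +_; 1ℤ; _+_; _*_; _-_; -_; NonZero)
  open import Data.Integer.Properties using (+-identityʳ; *-identityˡ; *-identityʳ; pos-*; *-cancelʳ-≡; i*j≢0; *-1-isCommutativeMonoid; m-n≡m⊖n; ⊖-≥)
  open import Data.Integer.Tactic.RingSolver using (solve-∀)
  open import Data.List using (List; []; _∷_; map; length; _++_)
  open import Data.List.Properties using (map-∘; map-++; length-map; length-++)
  open import Data.List.Membership.Propositional using (_∈_)
  open import Data.List.Relation.Unary.All as All using (All; []; _∷_)
  open import Data.Nat as ℕ using (ℕ; zero; suc; _!; _∸_; _≤_; _<_)
  open import Data.Nat.Properties as ℕₚ using (_!≢0)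
  import Data.Nat.Tactic.RingSolver as ℕ-Ring
  open import Data.Product using (_×_; _,_; proj₁; proj₂)
  open import Data.Sum using (_⊎_; inj₁; inj₂; [_,_]′)
  open import Relation.Binary.PropositionalEquality using (_≡_; refl; sym; trans; cong; cong₂; module ≡-Reasoning)

  h : ℕ → ℤ
  h n = + superfactorial n

  h≢0 : ∀ n → NonZero (h n)
  h≢0 zero    = record { nonZero = _ }
  h≢0 (suc n) = ℕₚ.m*n≢0 (n !) (superfactorial n) {{n !≢0}} {{h≢0 n}}

  fp-superfactorial : ∀ c m → fp c m * h c ≡ h (m ℕ.+ c)
  fp-superfactorial c zero    = *-identityˡ (h c)
  fp-superfactorial c (suc m) = begin
    fp c (suc m) * h c              ≡⟨ cong (_* h c) (fp-last c m) ⟩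
    fp c m * fct (m ℕ.+ c) * h c    ≡⟨ rotate (fp c m) (fct (m ℕ.+ c)) (h c) ⟩
    fct (m ℕ.+ c) * (fp c m * h c)  ≡⟨ cong (fct (m ℕ.+ c) *_) (fp-superfactorial c m) ⟩
    fct (m ℕ.+ c) * h (m ℕ.+ c)     ≡⟨ sym (pos-* ((m ℕ.+ c) !) (superfactorial (m ℕ.+ c))) ⟩
    h (suc m ℕ.+ c) ∎
    where
    open ≡-Reasoning
    rotate : ∀ a b c → a * b * c ≡ b * (a * c)
    rotate = solve-∀

  -- The product of the rising factorials of length b starting at a + 1, ..., a + n. Each factor of
  -- the claimed formula is a quotient of two such products.
  PP : ℕ → ℕ → ℕ → ℕ
  PP a b zero    = 1
  PP a b (suc n) = PP a b n ℕ.* poch (a ℕ.+ suc n) b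

  poch-factorial : ∀ c b → + poch (suc c) b * fct c ≡ fct (c ℕ.+ b)
  poch-factorial c zero    = trans (*-identityˡ (fct c)) (cong fct (sym (ℕₚ.+-identityʳ c)))
  poch-factorial c (suc b) = begin
    + (poch (suc c) b ℕ.* suc (c ℕ.+ b)) * fct c   ≡⟨ cong (_* fct c) (pos-* (poch (suc c) b) (suc (c ℕ.+ b))) ⟩
    + poch (suc c) b * + suc (c ℕ.+ b) * fct c     ≡⟨ rotate (+ poch (suc c) b) (+ suc (c ℕ.+ b)) (fct c) ⟩
    + suc (c ℕ.+ b) * (+ poch (suc c) b * fct c)   ≡⟨ cong (+ suc (c ℕ.+ b) *_) (poch-factorial c b) ⟩
    + suc (c ℕ.+ b) * fct (c ℕ.+ b)                ≡⟨ sym (fct-suc (c ℕ.+ b)) ⟩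
    fct (suc (c ℕ.+ b))                            ≡⟨ cong fct (sym (ℕₚ.+-suc c b)) ⟩
    fct (c ℕ.+ suc b) ∎
    where
    open ≡-Reasoning
    rotate : ∀ a b c → a * b * c ≡ b * (a * c)
    rotate = solve-∀

  PP-superfactorial : ∀ a b n → + PP a b n * (h (a ℕ.+ b) * h (a ℕ.+ n)) ≡ h (a ℕ.+ b ℕ.+ n) * h a
  PP-superfactorial a b = go
    where
    open ≡-Reasoning
    go : ∀ n → + PP a b n * (h (a ℕ.+ b) * h (a ℕ.+ n)) ≡ h (a ℕ.+ b ℕ.+ n) * h a
    go zero    = trans (*-identityˡ (h (a ℕ.+ b) * h (a ℕ.+ 0)))
                       (cong₂ (λ x y → h x * h y) (sym (ℕₚ.+-identityʳ (a ℕ.+ b))) (ℕₚ.+-identityʳ a))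
    go (suc n) = begin
      + (PP a b n ℕ.* poch (a ℕ.+ suc n) b) * (h (a ℕ.+ b) * h (a ℕ.+ suc n))
        ≡⟨ cong₂ (λ x y → x * (h (a ℕ.+ b) * y)) (pos-* (PP a b n) (poch (a ℕ.+ suc n) b))
                 (trans (cong h (ℕₚ.+-suc a n)) (pos-* ((a ℕ.+ n) !) (superfactorial (a ℕ.+ n)))) ⟩
      + PP a b n * + poch (a ℕ.+ suc n) b * (h (a ℕ.+ b) * (fct (a ℕ.+ n) * h (a ℕ.+ n)))
        ≡⟨ regroup (+ PP a b n) (+ poch (a ℕ.+ suc n) b) (h (a ℕ.+ b)) (fct (a ℕ.+ n)) (h (a ℕ.+ n)) ⟩
      + PP a b n * (h (a ℕ.+ b) * h (a ℕ.+ n)) * (+ poch (a ℕ.+ suc n) b * fct (a ℕ.+ n))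
        ≡⟨ cong₂ _*_ (go n) (trans (cong (λ t → + poch t b * fct (a ℕ.+ n)) (ℕₚ.+-suc a n))
                            (trans (poch-factorial (a ℕ.+ n) b) (cong fct (swap-last a n b)))) ⟩
      h (a ℕ.+ b ℕ.+ n) * h a * fct (a ℕ.+ b ℕ.+ n)
        ≡⟨ rotate (h (a ℕ.+ b ℕ.+ n)) (h a) (fct (a ℕ.+ b ℕ.+ n)) ⟩
      fct (a ℕ.+ b ℕ.+ n) * h (a ℕ.+ b ℕ.+ n) * h a
        ≡⟨ cong (_* h a) (trans (sym (pos-* ((a ℕ.+ b ℕ.+ n) !) (superfactorial (a ℕ.+ b ℕ.+ n)))) (cong h (sym (ℕₚ.+-suc (a ℕ.+ b) n)))) ⟩
      h (a ℕ.+ b ℕ.+ suc n) * h a ∎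
      where
      regroup : ∀ p c x f y → p * c * (x * (f * y)) ≡ p * (x * y) * (c * f)
      regroup = solve-∀
      rotate : ∀ x a f → x * a * f ≡ f * x * a
      rotate = solve-∀
      swap-last : ∀ a n b → a ℕ.+ n ℕ.+ b ≡ a ℕ.+ b ℕ.+ n
      swap-last = ℕ-Ring.solve-∀

  nest-cong : ∀ {A : Set} {lo hi lo′ hi′ : ℕ → A} {C} → All (λ i → lo i ≡ lo′ i × hi i ≡ hi′ i) C →
              ∀ T → nest lo hi C T ≡ nest lo′ hi′ C T
  nest-cong []                   T = refl
  nest-cong {lo = lo} {hi} {lo′} {hi′} {i ∷ C} ((l , r) ∷ al) T =
    trans (nest-cong al (lo i ∷ T ++ hi i ∷ [])) (cong₂ (λ x y → nest lo′ hi′ C (x ∷ T ++ y ∷ [])) l r)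

  length-nest : ∀ {A : Set} (lo hi : ℕ → A) C T → length (nest lo hi C T) ≡ length C ℕ.+ length C ℕ.+ length T
  length-nest lo hi []      T = refl
  length-nest lo hi (i ∷ C) T =
    trans (length-nest lo hi C (lo i ∷ T ++ hi i ∷ []))
          (trans (cong (λ t → length C ℕ.+ length C ℕ.+ suc t) (length-++ T)) (count (length C) (length T)))
    where
    count : ∀ c t → c ℕ.+ c ℕ.+ suc (t ℕ.+ 1) ≡ suc c ℕ.+ suc c ℕ.+ t
    count = ℕ-Ring.solve-∀

  vandermonde-differences : ∀ {A : Set} (f g : A → ℤ) → (∀ i j → f i - f j ≡ g i - g j) → ∀ C →
                            vandermonde (map f C) ≡ vandermonde (map g C)
  vandermonde-differences f g e []      = refl
  vandermonde-differences f g e (i ∷ C) =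
    cong₂ _*_ (trans (prod-map (_- f i) f C) (trans (prod-cong (λ j → e j i) C) (sym (prod-map (_- g i) g C))))
              (vandermonde-differences f g e C)

  length-ival : ∀ a n → length (ival a n) ≡ n
  length-ival a zero    = refl
  length-ival a (suc n) = cong suc (length-ival (suc a) n)

  module Rows (m q k e₁ e₂ : ℕ) where

    -- The m pairs are chosen among the m + q distances k + 1, ..., `N` from the centre `p₀`.
    N c₀ p₀ : ℕ
    N = m ℕ.+ (q ℕ.+ k)
    c₀ = e₁ ℕ.+ (m ℕ.+ q)
    p₀ = c₀ ℕ.+ k

    lo hi : ℕ → ℕ
    lo i = c₀ ∸ suc i
    hi i = p₀ ℕ.+ suc (k ℕ.+ i)

    -- The top row: forced positions at both ends, the removed triangle [c₀ , p₀), and the pairs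
    -- of positions symmetric about the centre p₀.
    top : List ℕ → List ℕ
    top C = ival 0 e₁ ++ nest lo hi C (ival c₀ k) ++ ival (p₀ ℕ.+ suc N) e₂

    size : ℕ
    size = e₁ ℕ.+ (m ℕ.+ m ℕ.+ k ℕ.+ e₂)

    length-top : ∀ C → length C ≡ m → length (top C) ≡ size
    length-top C refl =
      trans (length-++ (ival 0 e₁)) (cong₂ ℕ._+_ (length-ival 0 e₁)
        (trans (length-++ (nest lo hi C (ival c₀ k)))
               (cong₂ ℕ._+_ (trans (length-nest lo hi C (ival c₀ k)) (cong (length C ℕ.+ length C ℕ.+_) (length-ival c₀ k)))
                            (length-ival (p₀ ℕ.+ suc N) e₂))))

    private
      L : ℕ
      L = suc (suc (k ℕ.+ k))

      o : ℕ → ℤ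
      o i = + suc (k ℕ.+ i)

      E₁ T E₂ : List ℤ
      E₁ = map cast (ival 0 e₁)
      T  = map cast (ival c₀ k)
      E₂ = map cast (ival (p₀ ℕ.+ suc N) e₂)

    map-top : ∀ C → All (λ i → 0 ≤ i × i < m ℕ.+ q) C →
              map cast (top C) ≡ E₁ ++ nest (λ i → + p₀ - o i) (λ i → + p₀ + o i) C T ++ E₂
    map-top C al =
      trans (map-++ cast (ival 0 e₁) _) (cong (E₁ ++_)
        (trans (map-++ cast (nest lo hi C (ival c₀ k)) _) (cong (_++ E₂)
          (trans (map-nest cast lo hi C (ival c₀ k)) (nest-cong (All.map (λ q → low (proj₂ q) , refl) al) T)))))
      where
      distance : ∀ c k i → c - (1ℤ + i) ≡ c + k - (1ℤ + (k + i))
      distance = solve-∀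
      low : ∀ {i} → i < m ℕ.+ q → + (c₀ ∸ suc i) ≡ + p₀ - o i
      low {i} lt = trans (sym (trans (m-n≡m⊖n c₀ (suc i)) (⊖-≥ (ℕₚ.≤-trans lt (ℕₚ.m≤n+m (m ℕ.+ q) e₁))))) (distance (+ c₀) (+ k) (+ i))

    outerRun : ℤ → ℕ → ℤ
    outerRun o = run (λ t → (+ N + t - o) * (+ N + t + o))

    interior-run : ∀ i → interior E₁ E₂ (+ p₀) o T i ≡ run (λ t → (o i - t) * (o i + t)) k
    interior-run i = trans (prod-cong (λ p → distance (+ p₀) (o i) p) T) (prod-down (λ t → (o i - t) * (o i + t)) c₀ k)
      where
      distance : ∀ c o p → (p - (c - o)) * (c + o - p) ≡ (o - (c - p)) * (o + (c - p))
      distance = solve-∀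

    exterior-run : ∀ i → exterior E₁ E₂ (+ p₀) o T i ≡ outerRun (o i) e₁ * outerRun (o i) e₂
    exterior-run i = cong₂ _*_
      (trans (prod-cong (λ p → distance₁ (+ e₁) (+ m) (+ q) (+ k) (o i) p) E₁) (prod-down (λ t → (+ N + t - o i) * (+ N + t + o i)) 0 e₁))
      (trans (cong (λ s → prodOver (λ p → (p - (+ p₀ - o i)) * (p - (+ p₀ + o i))) (map cast (ival s e₂))) (ℕₚ.+-suc p₀ N))
      (trans (prod-cong (λ p → distance₂ (+ p₀) (+ N) (o i) p) (map cast (ival (suc (p₀ ℕ.+ N)) e₂)))
             (prod-up (λ t → (+ N + t - o i) * (+ N + t + o i)) (p₀ ℕ.+ N) e₂)))
      where
      distance₁ : ∀ e m q k o p → (e + (m + q) + k - o - p) * (e + (m + q) + k + o - p) ≡ (m + (q + k) + (e - p) - o) * (m + (q + k) + (e - p) + o)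
      distance₁ = solve-∀
      distance₂ : ∀ c N o p → (p - (c - o)) * (p - (c + o)) ≡ (N + (p - (c + N)) - o) * (N + (p - (c + N)) + o)
      distance₂ = solve-∀

    module _ (one-sided : e₁ ≡ 0 ⊎ e₂ ≡ 0) where

      cross-ends : cross E₁ E₂ ≡ 1ℤ
      cross-ends = [ (λ e → cong (λ j → cross (map cast (ival 0 j)) E₂) e)
                   , (λ e → trans (cong (λ j → cross E₁ (map cast (ival (p₀ ℕ.+ suc N) j))) e) (ones E₁)) ]′ one-sided
        where
        ones : ∀ xs → cross xs [] ≡ 1ℤ
        ones []       = refl
        ones (x ∷ xs) = trans (*-identityˡ _) (ones xs)

      -- Forced positions at either end act alike on a pair symmetric about the centre, so its
      -- weight depends on e₁ + e₂ only.
      merge-runs : ∀ x → outerRun x e₁ * outerRun x e₂ ≡ outerRun x (e₁ ℕ.+ e₂)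
      merge-runs x = [ (λ e → trans (cong (λ j → outerRun x j * outerRun x e₂) e)
                              (trans (*-identityˡ _) (cong (λ j → outerRun x (j ℕ.+ e₂)) (sym e))))
                     , (λ e → trans (cong (λ j → outerRun x e₁ * outerRun x j) e)
                              (trans (*-identityʳ _) (cong (outerRun x) (trans (sym (ℕₚ.+-identityʳ e₁)) (cong (e₁ ℕ.+_) (sym e)))))) ]′ one-sided

      -- The part of the Vandermonde product common to all choices of the pairs.
      K : ℤ
      K = h e₁ * h e₂ * (h k * cross E₁ T * cross T E₂)

      vandermonde-top : ∀ {C} → C ∈ subs m 0 (m ℕ.+ q) →
        vandermonde (map cast (top C)) ≡ K * (prodOver (weight (pairWeight k N (e₁ ℕ.+ e₂)) (+ L)) C * (DN (+ L) m C * DN (+ L) m C))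
      vandermonde-top {C} C∈ = begin
        vandermonde (map cast (top C))
          ≡⟨ cong vandermonde (map-top C (proj₂ (proj₂ sound))) ⟩
        vandermonde (E₁ ++ nest (λ i → + p₀ - o i) (λ i → + p₀ + o i) C T ++ E₂)
          ≡⟨ vandermonde-nest E₁ E₂ (+ p₀) o C T ⟩
        vandermonde E₁ * vandermonde E₂ * cross E₁ E₂ * (vandermonde T * cross E₁ T * cross T E₂)
          * (prodOver (λ i → (o i + o i) * (interior E₁ E₂ (+ p₀) o T i * exterior E₁ E₂ (+ p₀) o T i)) C * (W * W))
          ≡⟨ cong₂ _*_ (cong₂ _*_ (trans (cong₂ _*_ (cong₂ _*_ (vandermonde-ival 0 e₁) (vandermonde-ival (p₀ ℕ.+ suc N) e₂)) cross-ends)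
                                        (*-identityʳ (h e₁ * h e₂)))
                                  (cong (λ x → x * cross E₁ T * cross T E₂) (vandermonde-ival c₀ k)))
                       (cong₂ (λ x y → x * (y * y)) (prod-cong weights C) W≡) ⟩
        K * (prodOver (weight (pairWeight k N (e₁ ℕ.+ e₂)) (+ L)) C * (DN (+ L) m C * DN (+ L) m C)) ∎
        where
        open ≡-Reasoning
        sound = subs-sound m 0 (m ℕ.+ q) C∈
        W = vandermonde (map (λ i → o i * o i) C)
        double : ∀ k i → 1ℤ + (k + i) + (1ℤ + (k + i)) ≡ 1ℤ + (1ℤ + (k + k)) + (i + i)
        double = solve-∀
        weights : ∀ i → (o i + o i) * (interior E₁ E₂ (+ p₀) o T i * exterior E₁ E₂ (+ p₀) o T i) ≡ weight (pairWeight k N (e₁ ℕ.+ e₂)) (+ L) i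
        weights i = cong₂ _*_ (double (+ k) (+ i)) (cong₂ _*_ (interior-run i) (trans (exterior-run i) (merge-runs (o i))))
        squares : ∀ k i j → (1ℤ + (k + i)) * (1ℤ + (k + i)) - (1ℤ + (k + j)) * (1ℤ + (k + j))
                  ≡ i * (i + (1ℤ + (1ℤ + (k + k)))) - j * (j + (1ℤ + (1ℤ + (k + k))))
        squares = solve-∀
        -- The squared distances exceed the nodes i (i + L) by the constant (k + 1)², so the
        -- Vandermonde products agree; by `det-newton` the second is the determinant of the Newton
        -- basis.
        W≡ : W ≡ DN (+ L) m C
        W≡ = begin
          W                                                     ≡⟨ vandermonde-differences (λ i → o i * o i) (λ i → node (+ L) (+ i)) (λ i j → squares (+ k) (+ i) (+ j)) C ⟩
          vandermonde (map (λ i → node (+ L) (+ i)) C)          ≡⟨ sym (det-newton nodes (map (λ i → node (+ L) (+ i)) C)) ⟩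
          det (length (map (λ i → node (+ L) (+ i)) C)) (map (newton nodes) (map (λ i → node (+ L) (+ i)) C))
            ≡⟨ cong₂ det (trans (length-map _ C) (proj₁ sound)) (sym (map-∘ {g = newton nodes} {f = λ i → node (+ L) (+ i)} C)) ⟩
          DN (+ L) m C ∎
          where
          nodes : ℕ → ℤ
          nodes l = node (+ L) (+ l)

      total : (∀ {C} → C ∈ subs m 0 (m ℕ.+ q) → Sorted (top C)) →
        h size * sumOver (λ C → + length (patterns size (top C))) (subs m 0 (m ℕ.+ q))
        ≡ K * J m (pairWeight k N (e₁ ℕ.+ e₂)) (+ L) (m ℕ.+ q)
      total sorted = begin
        h size * sumOver (λ C → + length (patterns size (top C))) (subs m 0 (m ℕ.+ q))
          ≡⟨ sym (sum-* (h size) (λ C → + length (patterns size (top C))) (subs m 0 (m ℕ.+ q))) ⟩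
        sumOver (λ C → h size * + length (patterns size (top C))) (subs m 0 (m ℕ.+ q))
          ≡⟨ sum-cong-All (All.tabulate (λ {C} C∈ → trans (pattern-count size (top C) (length-top C (proj₁ (subs-sound m 0 (m ℕ.+ q) C∈))) (sorted C∈))
                                                         (vandermonde-top C∈))) ⟩
        sumOver (λ C → K * (prodOver (weight (pairWeight k N (e₁ ℕ.+ e₂)) (+ L)) C * (DN (+ L) m C * DN (+ L) m C))) (subs m 0 (m ℕ.+ q))
          ≡⟨ sum-* K _ (subs m 0 (m ℕ.+ q)) ⟩
        K * J m (pairWeight k N (e₁ ℕ.+ e₂)) (+ L) (m ℕ.+ q) ∎
        where open ≡-Reasoning

  -- `J-closed` for the parameters of `pairWeight-isWeight`, restated with `m` as the number of
  -- pairs. Without pairs all products are empty.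
  J-product : ∀ m q k e →
    J m (pairWeight k (m ℕ.+ (q ℕ.+ k)) e) (+ suc (suc (k ℕ.+ k))) (m ℕ.+ q) * (fp q m * fp (suc (q ℕ.+ k)) m * fp (k ℕ.+ e ℕ.+ m) m)
    ≡ fp e m * fp (k ℕ.+ e ℕ.+ (m ℕ.+ q)) m * fp k m * fp (k ℕ.+ e ℕ.+ (m ℕ.+ suc (q ℕ.+ k))) m * fp 0 m
  J-product zero    q k e = refl
  J-product (suc m) q k e = begin
    J (suc m) (pairWeight k (suc m ℕ.+ (q ℕ.+ k)) e) l (suc m ℕ.+ q) * (fp q (suc m) * fp (suc (q ℕ.+ k)) (suc m) * fp (k ℕ.+ e ℕ.+ suc m) (suc m))
      ≡⟨ cong₂ (λ x y → J (suc m) (pairWeight k x e) l (suc m ℕ.+ q) * (fp q (suc m) * fp (suc (q ℕ.+ k)) (suc m) * fp y (suc m)))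
               (sym (ℕₚ.+-suc m (q ℕ.+ k))) (ℕₚ.+-suc (k ℕ.+ e) m) ⟩
    J (suc m) (pairWeight k (m ℕ.+ suc (q ℕ.+ k)) e) l (suc m ℕ.+ q) * (fp q (suc m) * fp (suc (q ℕ.+ k)) (suc m) * fp (suc (k ℕ.+ e) ℕ.+ m) (suc m))
      ≡⟨ J-closed m (pairWeight-isWeight m q k e) ⟩
    fp e (suc m) * fp (suc (k ℕ.+ e) ℕ.+ (m ℕ.+ q)) (suc m) * fp k (suc m) * fp (suc (k ℕ.+ e) ℕ.+ (m ℕ.+ suc (q ℕ.+ k))) (suc m) * fp 0 (suc m)
      ≡⟨ cong₂ (λ x y → fp e (suc m) * fp x (suc m) * fp k (suc m) * fp y (suc m) * fp 0 (suc m))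
               (sym (ℕₚ.+-suc (k ℕ.+ e) (m ℕ.+ q))) (sym (ℕₚ.+-suc (k ℕ.+ e) (m ℕ.+ suc (q ℕ.+ k)))) ⟩
    fp e (suc m) * fp (k ℕ.+ e ℕ.+ (suc m ℕ.+ q)) (suc m) * fp k (suc m) * fp (k ℕ.+ e ℕ.+ (suc m ℕ.+ suc (q ℕ.+ k))) (suc m) * fp 0 (suc m) ∎
    where
    open ≡-Reasoning
    l = + suc (suc (k ℕ.+ k))

  *-nonZero : ∀ a b → NonZero a → NonZero b → NonZero (a * b)
  *-nonZero a b p r = i*j≢0 a b {{p}} {{r}}

  *-cancel : ∀ {x y} a → NonZero a → x * a ≡ y * a → x ≡ y
  *-cancel {x} {y} a nz = *-cancelʳ-≡ x y a {{nz}}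

  PPℤ : ℕ → ℕ → ℕ → ℤ
  PPℤ a b n = + PP a b n

  open Quotients ℤ _*_ 1ℤ *-1-isCommutativeMonoid NonZero *-nonZero _ *-cancel h h≢0 refl
    fp fp-superfactorial PPℤ PP-superfactorial using (wide; narrow)

  patternTotal : (m q k e₁ e₂ : ℕ) → ℤ
  patternTotal m q k e₁ e₂ = sumOver (λ C → + length (patterns size (top C))) (subs m 0 (m ℕ.+ q))
    where open Rows m q k e₁ e₂

  SortedTops : (m q k e₁ e₂ : ℕ) → Set
  SortedTops m q k e₁ e₂ = ∀ {C} → C ∈ subs m 0 (m ℕ.+ q) → Sorted (Rows.top m q k e₁ e₂ C)

  total-wide : ∀ m q k e → SortedTops m q k e 0 →
    patternTotal m q k e 0 * PPℤ 0 m (suc (q ℕ.+ k)) * PPℤ 0 k q * PPℤ k q m * PPℤ k (suc (q ℕ.+ k)) m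
    ≡ PPℤ k m (suc (q ℕ.+ k)) * PPℤ (m ℕ.+ e) k q * PPℤ (m ℕ.+ k ℕ.+ e) q m * PPℤ (m ℕ.+ k ℕ.+ e) (suc (q ℕ.+ k)) m
  total-wide m q k e sorted =
    wide m q k e (cross-ival 0 e (m ℕ.+ q) k) (cross-ival c₀ k (suc N) 0) (J-product m q k (e ℕ.+ 0)) (total (inj₂ refl) sorted)
    where open Rows m q k e 0

  total-narrow : ∀ m q k e → SortedTops m q k 0 e →
    patternTotal m q k 0 e * PPℤ 0 (m ℕ.+ e) (suc (q ℕ.+ k)) * PPℤ 0 k q * PPℤ k q (m ℕ.+ e) * PPℤ k (suc (q ℕ.+ k)) (m ℕ.+ e)
    ≡ PPℤ k (m ℕ.+ e) (suc (q ℕ.+ k)) * PPℤ m k q * PPℤ (m ℕ.+ k) q (m ℕ.+ e) * PPℤ (m ℕ.+ k) (suc (q ℕ.+ k)) (m ℕ.+ e)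
  total-narrow m q k e sorted =
    narrow m q k e (cross-ival 0 0 (m ℕ.+ q) k) (cross-ival c₀ k (suc N) e) (J-product m q k (0 ℕ.+ e)) (total (inj₁ refl) sorted)
    where open Rows m q k 0 e

-- From naturals to the rational products of the statement

module Ratios where

  open import Defs using (_//_; prodQ; poch; P)
  open import Data.Integer as ℤ using (+_)
  open import Data.Integer.Properties using (pos-*)
  open import Data.Nat as ℕ using (ℕ; zero; suc; NonZero)
  import Data.Nat.Properties as ℕₚ
  import Data.Nat.Tactic.RingSolver as ℕ-Ring
  open import Data.Rational using (_*_; fromℚᵘ)
  open import Data.Rational.Properties using (*-zeroˡ; *-zeroʳ; *-assoc; *-comm; toℚᵘ-injective; toℚᵘ-homo-*; toℚᵘ-fromℚᵘ; fromℚᵘ-cong)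
  open import Data.Rational.Unnormalised as ℚᵘ using (mkℚᵘ; *≡*)
  import Data.Rational.Unnormalised.Properties as ℚᵘₚ
  open import Relation.Binary.PropositionalEquality using (_≡_; refl; sym; trans; cong; cong₂; subst; module ≡-Reasoning)
  open CountFormula using (PP)

  //-cross : ∀ a b c d → .{{NonZero b}} → .{{NonZero d}} → a ℕ.* d ≡ c ℕ.* b → a // b ≡ c // d
  //-cross a (suc b) c (suc d) e = fromℚᵘ-cong {mkℚᵘ (+ a) b} {mkℚᵘ (+ c) d} (*≡* (trans (sym (pos-* a (suc d))) (trans (cong (λ n → + n) e) (pos-* c (suc b)))))

  fromℚᵘ-homo-* : ∀ p q → fromℚᵘ p * fromℚᵘ q ≡ fromℚᵘ (p ℚᵘ.* q)
  fromℚᵘ-homo-* p q = toℚᵘ-injective (ℚᵘₚ.≃-trans (toℚᵘ-homo-* (fromℚᵘ p) (fromℚᵘ q))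
    (ℚᵘₚ.≃-trans (ℚᵘₚ.*-cong (toℚᵘ-fromℚᵘ p) (toℚᵘ-fromℚᵘ q)) (ℚᵘₚ.≃-sym (toℚᵘ-fromℚᵘ (p ℚᵘ.* q)))))

  -- Valid for zero denominators as well, where both sides are 0.
  //-* : ∀ a b c d → (a // b) * (c // d) ≡ (a ℕ.* c) // (b ℕ.* d)
  //-* a zero    c d       = *-zeroˡ (c // d)
  //-* a (suc b) c zero    = trans (*-zeroʳ (a // suc b)) (cong (λ n → (a ℕ.* c) // n) (sym (ℕₚ.*-zeroʳ (suc b))))
  //-* a (suc b) c (suc d) = trans (fromℚᵘ-homo-* (mkℚᵘ (+ a) b) (mkℚᵘ (+ c) d))
    (fromℚᵘ-cong {mkℚᵘ (+ a) b ℚᵘ.* mkℚᵘ (+ c) d} {mkℚᵘ (+ (a ℕ.* c)) (d ℕ.+ b ℕ.* suc d)}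
                 (*≡* (cong (λ n → n ℤ.* + (suc b ℕ.* suc d)) (sym (pos-* a c)))))

  prodQ-cong : ∀ n {f g} → (∀ i → f (suc i) ≡ g (suc i)) → prodQ n f ≡ prodQ n g
  prodQ-cong zero    h = refl
  prodQ-cong (suc n) h = cong₂ _*_ (prodQ-cong n h) (h n)

  prodQ-* : ∀ n f g → prodQ n (λ i → f i * g i) ≡ prodQ n f * prodQ n g
  prodQ-* zero    f g = refl
  prodQ-* (suc n) f g = begin
    prodQ n (λ i → f i * g i) * (F * G)  ≡⟨ cong (_* (F * G)) (prodQ-* n f g) ⟩
    A * B * (F * G)                      ≡⟨ *-assoc A B (F * G) ⟩
    A * (B * (F * G))                    ≡⟨ cong (A *_) (trans (sym (*-assoc B F G)) (trans (cong (_* G) (*-comm B F)) (*-assoc F B G))) ⟩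
    A * (F * (B * G))                    ≡⟨ sym (*-assoc A F (B * G)) ⟩
    A * F * (B * G) ∎
    where
    open ≡-Reasoning
    A = prodQ n f
    B = prodQ n g
    F = f (suc n)
    G = g (suc n)

  prodQ-PP : ∀ a a′ b n → prodQ n (λ i → poch (a ℕ.+ i) b // poch (a′ ℕ.+ i) b) ≡ PP a b n // PP a′ b n
  prodQ-PP a a′ b zero    = refl
  prodQ-PP a a′ b (suc n) = trans (cong (_* (poch (a ℕ.+ suc n) b // poch (a′ ℕ.+ suc n) b)) (prodQ-PP a a′ b n))
                                  (//-* (PP a b n) (PP a′ b n) (poch (a ℕ.+ suc n) b) (poch (a′ ℕ.+ suc n) b))

  poch-nonZero : ∀ a b → NonZero (poch (suc a) b)
  poch-nonZero a zero    = _
  poch-nonZero a (suc b) = ℕₚ.m*n≢0 (poch (suc a) b) (suc a ℕ.+ b) {{poch-nonZero a b}}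

  PP-nonZero : ∀ a b n → NonZero (PP a b n)
  PP-nonZero a b zero    = _
  PP-nonZero a b (suc n) = ℕₚ.m*n≢0 (PP a b n) (poch (a ℕ.+ suc n) b) {{PP-nonZero a b n}}
                             {{subst (λ t → NonZero (poch t b)) (sym (ℕₚ.+-suc a n)) (poch-nonZero (a ℕ.+ n) b)}}

  -- The product over the third index telescopes to (i + j + k - 1) / (i + j - 1), and the product
  -- over the second one turns these into Pochhammer symbols.
  P-ratio : ∀ x y k → P x y k ≡ PP k y x // PP 0 y x
  P-ratio x y k = trans (prodQ-cong x (λ i → trans (prodQ-cong y (λ j → inner i j)) (column i y))) (prodQ-PP k 0 y x)
    where
    inner : ∀ i j → prodQ k (λ l → (suc i ℕ.+ suc j ℕ.+ l ℕ.∸ 1) // (suc i ℕ.+ suc j ℕ.+ l ℕ.∸ 2)) ≡ (k ℕ.+ suc i ℕ.+ j) // (suc i ℕ.+ j)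
    inner i j = trans (prodQ-cong k (λ l → cong₂ _//_ (numerator i j l) (denominator i j l))) (trans (telescoped k) (cong (_// (suc i ℕ.+ j)) (ring k i j)))
      where
      t : ℕ
      t = suc i ℕ.+ j
      ring : ∀ k i j → suc i ℕ.+ j ℕ.+ k ≡ k ℕ.+ suc i ℕ.+ j
      ring = ℕ-Ring.solve-∀
      numerator : ∀ i j l → suc i ℕ.+ suc j ℕ.+ suc l ℕ.∸ 1 ≡ suc i ℕ.+ j ℕ.+ suc l
      numerator i j l = cong (λ n → n ℕ.+ suc l) (ℕₚ.+-suc i j)
      denominator : ∀ i j l → suc i ℕ.+ suc j ℕ.+ suc l ℕ.∸ 2 ≡ suc i ℕ.+ j ℕ.+ l
      denominator i j l = cong (ℕ._∸ 2) (ring′ i j l)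
        where
        ring′ : ∀ i j l → suc i ℕ.+ suc j ℕ.+ suc l ≡ suc (suc (suc i ℕ.+ j ℕ.+ l))
        ring′ = ℕ-Ring.solve-∀
      telescoped : ∀ k → prodQ k (λ l → (t ℕ.+ l) // (t ℕ.+ (l ℕ.∸ 1))) ≡ (t ℕ.+ k) // t
      telescoped zero    = trans (//-cross 1 1 t t (ℕₚ.*-comm 1 t)) (cong (_// t) (sym (ℕₚ.+-identityʳ t)))
      telescoped (suc k) = trans (cong (_* ((t ℕ.+ suc k) // (t ℕ.+ k))) (telescoped k))
        (trans (//-* (t ℕ.+ k) t (t ℕ.+ suc k) (t ℕ.+ k))
               (//-cross ((t ℕ.+ k) ℕ.* (t ℕ.+ suc k)) (t ℕ.* (t ℕ.+ k)) (t ℕ.+ suc k) t (swap (t ℕ.+ k) (t ℕ.+ suc k) t)))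
        where
        swap : ∀ a b t → a ℕ.* b ℕ.* t ≡ b ℕ.* (t ℕ.* a)
        swap = ℕ-Ring.solve-∀
    column : ∀ i y → prodQ y (λ j → (k ℕ.+ suc i ℕ.+ (j ℕ.∸ 1)) // (suc i ℕ.+ (j ℕ.∸ 1))) ≡ poch (k ℕ.+ suc i) y // poch (suc i) y
    column i zero    = refl
    column i (suc y) = trans (cong (_* ((k ℕ.+ suc i ℕ.+ y) // (suc i ℕ.+ y))) (column i y)) (//-* (poch (k ℕ.+ suc i) y) (poch (suc i) y) (k ℕ.+ suc i ℕ.+ y) (suc i ℕ.+ y))

  -- All products are gathered into one fraction, of which the hypothesis is the cross-multiplied
  -- form over the naturals.
  ratio-formula : ∀ M x z q k → let X = suc (q ℕ.+ k) in
    M ℕ.* PP 0 z X ℕ.* PP 0 k q ℕ.* PP k q z ℕ.* PP k X z ≡ PP k z X ℕ.* PP x k q ℕ.* PP (x ℕ.+ k) q z ℕ.* PP (x ℕ.+ k) X z →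
    M // 1 ≡ P X z k * prodQ q (λ i → poch (x ℕ.+ i) k // poch i k)
               * prodQ z (λ i → (poch (x ℕ.+ k ℕ.+ i) q // poch (k ℕ.+ i) q) * (poch (x ℕ.+ k ℕ.+ i) X // poch (k ℕ.+ i) X))
  ratio-formula M x z q k e = begin
    M // 1
      ≡⟨ //-cross M 1 (n₁ ℕ.* n₂ ℕ.* (n₃ ℕ.* n₄)) (d₁ ℕ.* d₂ ℕ.* (d₃ ℕ.* d₄)) {{_}} {{den}} (trans (spread M d₁ d₂ d₃ d₄) (trans e (collect n₁ n₂ n₃ n₄))) ⟩
    (n₁ ℕ.* n₂ ℕ.* (n₃ ℕ.* n₄)) // (d₁ ℕ.* d₂ ℕ.* (d₃ ℕ.* d₄))
      ≡⟨ sym (//-* (n₁ ℕ.* n₂) (d₁ ℕ.* d₂) (n₃ ℕ.* n₄) (d₃ ℕ.* d₄)) ⟩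
    ((n₁ ℕ.* n₂) // (d₁ ℕ.* d₂)) * ((n₃ ℕ.* n₄) // (d₃ ℕ.* d₄))
      ≡⟨ sym (cong₂ _*_ (//-* n₁ d₁ n₂ d₂) (//-* n₃ d₃ n₄ d₄)) ⟩
    (n₁ // d₁) * (n₂ // d₂) * ((n₃ // d₃) * (n₄ // d₄))
      ≡⟨ sym (cong₂ _*_ (cong₂ _*_ (P-ratio X z k) (prodQ-PP x 0 k q)) (trans (prodQ-* z _ _) (cong₂ _*_ (prodQ-PP (x ℕ.+ k) k q z) (prodQ-PP (x ℕ.+ k) k X z)))) ⟩
    P X z k * prodQ q (λ i → poch (x ℕ.+ i) k // poch i k)
      * prodQ z (λ i → (poch (x ℕ.+ k ℕ.+ i) q // poch (k ℕ.+ i) q) * (poch (x ℕ.+ k ℕ.+ i) X // poch (k ℕ.+ i) X)) ∎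
    where
    open ≡-Reasoning
    X n₁ n₂ n₃ n₄ d₁ d₂ d₃ d₄ : ℕ
    X  = suc (q ℕ.+ k)
    n₁ = PP k z X
    n₂ = PP x k q
    n₃ = PP (x ℕ.+ k) q z
    n₄ = PP (x ℕ.+ k) X z
    d₁ = PP 0 z X
    d₂ = PP 0 k q
    d₃ = PP k q z
    d₄ = PP k X z
    den : NonZero (d₁ ℕ.* d₂ ℕ.* (d₃ ℕ.* d₄))
    den = ℕₚ.m*n≢0 (d₁ ℕ.* d₂) (d₃ ℕ.* d₄) {{ℕₚ.m*n≢0 d₁ d₂ {{PP-nonZero 0 z X}} {{PP-nonZero 0 k q}}}}
                                           {{ℕₚ.m*n≢0 d₃ d₄ {{PP-nonZero k q z}} {{PP-nonZero k X z}}}}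
    spread : ∀ M a b c d → M ℕ.* (a ℕ.* b ℕ.* (c ℕ.* d)) ≡ M ℕ.* a ℕ.* b ℕ.* c ℕ.* d
    spread = ℕ-Ring.solve-∀
    collect : ∀ a b c d → a ℕ.* b ℕ.* c ℕ.* d ≡ a ℕ.* b ℕ.* (c ℕ.* d) ℕ.* 1
    collect = ℕ-Ring.solve-∀

-- Counting by bijections, and sorted lists

module ListCounting where

  open import Data.List using (List; []; _∷_; _++_; map; length; filter)
  open import Data.List.Membership.Propositional using (_∈_; _∉_)
  open import Data.List.Membership.Propositional.Properties using (∈-∃++; ∈-++⁺ˡ; ∈-++⁺ʳ; ∈-++⁻; ∈-filter⁻)
  open import Data.List.Properties using (length-++)
  open import Data.List.Relation.Unary.All as All using (All; []; _∷_)
  open import Data.List.Relation.Unary.Any using (here; there)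
  open import Data.List.Relation.Unary.AllPairs using ([]; _∷_)
  open import Data.List.Relation.Unary.Linked using ([]; [-]; _∷_)
  open import Data.List.Relation.Unary.Unique.Propositional using (Unique)
  open import Data.Empty using (⊥-elim)
  open import Data.Nat using (ℕ; zero; suc; _∸_; _≤_; _<_; z≤n; s≤s)
  open import Data.Nat.Properties
  open import Data.Product using (_×_; _,_; proj₁; proj₂)
  open import Data.Sum using (inj₁; inj₂)
  open import Relation.Binary.PropositionalEquality using (_≡_; _≢_; refl; sym; trans; cong; subst)

  open import Relation.Nullary using (Dec; yes; no)

  open Summation
  open Enumeration

  -- A map with a left inverse on `xs` is injective there; when the image of the head is deleted
  -- from `ys`, the images of the tail remain.
  retract-length : ∀ {A B : Set} (f : A → B) (g : B → A) {xs ys} → Unique xs →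
                   (∀ {x} → x ∈ xs → f x ∈ ys × g (f x) ≡ x) → length xs ≤ length ys
  retract-length f g {[]}     _        h = z≤n
  retract-length f g {x ∷ xs} (x∉ ∷ u) h with ∈-∃++ (proj₁ (h (here refl)))
  ... | as , bs , refl =
    subst (suc (length xs) ≤_) (sym (trans (length-++ as) (trans (+-suc (length as) (length bs)) (cong suc (sym (length-++ as))))))
          (s≤s (retract-length f g u (λ x∈ → avoid x∈ , proj₂ (h (there x∈)))))
    where
    avoid : ∀ {x′} → x′ ∈ xs → f x′ ∈ as ++ bs
    avoid {x′} x∈ with ∈-++⁻ as (proj₁ (h (there x∈)))
    ... | inj₁ p             = ∈-++⁺ˡ p
    ... | inj₂ (there p)     = ∈-++⁺ʳ as p
    ... | inj₂ (here eq)     = ⊥-elim (All.lookup x∉ x∈ (trans (sym (proj₂ (h (here refl)))) (trans (cong g (sym eq)) (proj₂ (h (there x∈))))))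

  bijection-length : ∀ {A B : Set} (f : A → B) (g : B → A) {xs ys} → Unique xs → Unique ys →
                     (∀ {x} → x ∈ xs → f x ∈ ys × g (f x) ≡ x) → (∀ {y} → y ∈ ys → g y ∈ xs × f (g y) ≡ y) →
                     length xs ≡ length ys
  bijection-length f g ux uy h h′ = ≤-antisym (retract-length f g ux h) (retract-length g f uy h′)

  consAll-unique : ∀ {A : Set} {ts} {g : A → List (List A)} → Unique ts → (∀ t → Unique (g t)) → Unique (consAll ts g)
  consAll-unique {ts = []}     _        _ = []
  consAll-unique {A} {t ∷ ts} {g} (t∉ ∷ u) ug = append (heads (g t) (ug t)) (consAll-unique u ug) disjoint
    where
    append : ∀ {B : Set} {xs ys : List B} → Unique xs → Unique ys → (∀ {x} → x ∈ xs → x ∉ ys) → Unique (xs ++ ys)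
    append []        uy d = uy
    append {xs = x ∷ xs} {ys} (x∉ ∷ ux) uy d =
      All.tabulate (λ {w} w∈ eq → distinct w∈ eq) ∷ append ux uy (λ x∈ → d (there x∈))
      where
      distinct : ∀ {w} → w ∈ xs ++ ys → x ≢ w
      distinct w∈ refl with ∈-++⁻ xs w∈
      ... | inj₁ p = All.lookup x∉ p refl
      ... | inj₂ p = d (here refl) p
    heads : ∀ rs → Unique rs → Unique (map (t ∷_) rs)
    heads []       _        = []
    heads (r ∷ rs) (r∉ ∷ v) = All.tabulate (λ w∈ eq → distinct rs r∉ w∈ eq) ∷ heads rs v
      where
      distinct : ∀ rs {w} → All (r ≢_) rs → w ∈ map (t ∷_) rs → t ∷ r ≢ w
      distinct (r′ ∷ rs) (ne ∷ _)  (here refl) refl = ne refl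
      distinct (r′ ∷ rs) (_ ∷ nes) (there w∈)  eq   = distinct rs nes w∈ eq
    disjoint : ∀ {w} → w ∈ map (t ∷_) (g t) → w ∉ consAll ts g
    disjoint p q with ∈-consAll⁻ ts q
    ... | t′ , r′ , t∈ , _ , refl = ⊥-elim (All.lookup t∉ t∈ (sym (head-eq (g t) p)))
      where
      head-eq : ∀ rs → (t′ ∷ r′) ∈ map (t ∷_) rs → t′ ≡ t
      head-eq (r ∷ rs) (here refl) = refl
      head-eq (r ∷ rs) (there p)   = head-eq rs p

  ival-unique : ∀ a n → Unique (ival a n)
  ival-unique a zero    = []
  ival-unique a (suc n) = All.tabulate (λ i∈ → <⇒≢ (proj₁ (∈-ival⁻ (suc a) n i∈))) ∷ ival-unique (suc a) n

  subs-unique : ∀ m l h → Unique (subs m l h)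
  subs-unique zero    l h = [] ∷ []
  subs-unique (suc m) l h = consAll-unique (ival-unique l (h ∸ l)) (λ c → subs-unique m (suc c) h)

  inter-unique : ∀ s → Unique (inter s)
  inter-unique []           = []
  inter-unique (s ∷ [])     = [] ∷ []
  inter-unique (s ∷ s′ ∷ r) = consAll-unique (ival-unique s (s′ ∸ s)) (λ _ → inter-unique (s′ ∷ r))

  sorted-tail : ∀ {x xs} → Sorted (x ∷ xs) → Sorted xs
  sorted-tail [-]      = []
  sorted-tail (_ ∷ so) = so

  sorted-head : ∀ {x xs} → Sorted (x ∷ xs) → All (x <_) xs
  sorted-head [-]       = []
  sorted-head (lt ∷ so) = lt ∷ All.map (<-trans lt) (sorted-head so)

  sorted-cons : ∀ {x xs} → All (x <_) xs → Sorted xs → Sorted (x ∷ xs)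
  sorted-cons []       []       = [-]
  sorted-cons (lt ∷ _) so@([-])     = lt ∷ so
  sorted-cons (lt ∷ _) so@(_ ∷ _) = lt ∷ so

  -- A row is determined by its set of positions. All equalities between rows in the tiling
  -- bijection are obtained in this way, from membership alone.
  sorted-≡ : ∀ {xs ys} → Sorted xs → Sorted ys → (∀ {p} → p ∈ xs → p ∈ ys) → (∀ {p} → p ∈ ys → p ∈ xs) → xs ≡ ys
  sorted-≡ {[]}     {[]}     _  _  _ _ = refl
  sorted-≡ {[]}     {y ∷ ys} _  _  _ g with () ← g (here refl)
  sorted-≡ {x ∷ xs} {[]}     _  _  f _ with () ← f (here refl)
  sorted-≡ {x ∷ xs} {y ∷ ys} sx sy f g with x≡y
    where
    x≡y : x ≡ y
    x≡y with f (here refl) | g (here refl)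
    ... | here eq  | _        = eq
    ... | there _  | here eq  = sym eq
    ... | there x∈ | there y∈ = ⊥-elim (<-asym (All.lookup (sorted-head sy) x∈) (All.lookup (sorted-head sx) y∈))
  ... | refl = cong (x ∷_) (sorted-≡ (sorted-tail sx) (sorted-tail sy) (λ p∈ → strip sx p∈ (f (there p∈))) (λ p∈ → strip sy p∈ (g (there p∈))))
    where
    strip : ∀ {zs ws p} → Sorted (x ∷ zs) → p ∈ zs → p ∈ x ∷ ws → p ∈ ws
    strip sz p∈ (there q)   = q
    strip sz p∈ (here refl) = ⊥-elim (<-irrefl refl (All.lookup (sorted-head sz) p∈))

  sorted-++ : ∀ {xs ys} → Sorted xs → Sorted ys → (∀ {p q} → p ∈ xs → q ∈ ys → p < q) → Sorted (xs ++ ys)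
  sorted-++ {[]}     _  sy _ = sy
  sorted-++ {x ∷ xs} {ys} sx sy h =
    sorted-cons (All.tabulate (λ p∈ → below p∈)) (sorted-++ (sorted-tail sx) sy (λ p∈ → h (there p∈)))
    where
    below : ∀ {p} → p ∈ xs ++ ys → x < p
    below p∈ with ∈-++⁻ xs p∈
    ... | inj₁ q = All.lookup (sorted-head sx) q
    ... | inj₂ q = h (here refl) q

  ival-sorted : ∀ a n → Sorted (ival a n)
  ival-sorted a zero    = []
  ival-sorted a (suc n) = sorted-cons (All.tabulate (λ p∈ → proj₁ (∈-ival⁻ (suc a) n p∈))) (ival-sorted (suc a) n)

  subs-complete : ∀ {m l h C} → length C ≡ m → Sorted C → All (λ c → l ≤ c × c < h) C → C ∈ subs m l h
  subs-complete {C = []}    refl _  _                  = here refl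
  subs-complete {l = l} {h} {c ∷ C} refl so ((lc , ch) ∷ al) =
    ∈-consAll⁺ (∈-range⁺ l h lc ch) (subs-complete refl (sorted-tail so) (All.zipWith (λ q → proj₁ q , proj₂ (proj₂ q)) (sorted-head so , al)))

  filter-sorted : ∀ {P : ℕ → Set} (P? : ∀ i → Dec (P i)) {ps} → Sorted ps → Sorted (filter P? ps)
  filter-sorted P? {[]}     _  = []
  filter-sorted P? {p ∷ ps} so with P? p
  ... | yes _ = sorted-cons (All.tabulate (λ q → All.lookup (sorted-head so) (proj₁ (∈-filter⁻ P? q)))) (filter-sorted P? (sorted-tail so))
  ... | no _  = filter-sorted P? (sorted-tail so)

-- Matchings of one strip and interlacing rows

module Strip where

  open Summation
  open Enumeration
  open ListCounting
  open import Data.Empty using (⊥-elim)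
  open import Data.Fin using (Fin; zero; suc; _≟_)
  open import Data.List using (List; []; _∷_; filter)
  open import Data.List.Membership.Propositional using (_∈_; _∉_)
  open import Data.List.Membership.Propositional.Properties using (∈-filter⁻)
  open import Data.List.Properties using (filter-accept; filter-reject)
  open import Data.List.Relation.Unary.All as All using (All; []; _∷_)
  open import Data.List.Relation.Unary.Any using (here; there)
  open import Data.Nat using (ℕ; zero; suc; _+_; _≤_; _<_; z≤n; s≤s)
  open import Data.Nat.Properties hiding (_≟_)
  open import Data.Product using (_×_; _,_; proj₁; proj₂; ∃)
  open import Data.Sum using (_⊎_; inj₁; inj₂)
  open import Relation.Binary.Definitions using (tri<; tri≈; tri>)
  open import Relation.Binary.PropositionalEquality using (_≡_; _≢_; refl; sym; trans; subst; subst₂)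

  pattern 0F = zero
  pattern 1F = suc zero
  pattern 2F = suc (suc zero)

  -- A strip is the path down₀, up₀, down₁, up₁, …, downₙ of unit triangles. The row t lists the
  -- ups and s the downs that are matched outside the strip (colour 1); the others are matched with
  -- the next down (colour 0) or with the previous one (colour 2). The suffix D or U says whether
  -- the next element to be met is in s or in t.
  χD χU κD κU : List ℕ → List ℕ → ℕ → Fin 3
  χD []      t p = 2F
  χD (x ∷ s) t p with <-cmp p x
  ... | tri< _ _ _ = 2F
  ... | tri≈ _ _ _ = χU s t p
  ... | tri> _ _ _ = χU s t p
  χU s []      p = 0F
  χU s (x ∷ t) p with <-cmp p x
  ... | tri< _ _ _ = 0F
  ... | tri≈ _ _ _ = 1F
  ... | tri> _ _ _ = χD s t p
  κD []      t p = 2F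
  κD (x ∷ s) t p with <-cmp p x
  ... | tri< _ _ _ = 2F
  ... | tri≈ _ _ _ = 1F
  ... | tri> _ _ _ = κU s t p
  κU s []      p = 0F
  κU s (x ∷ t) p with <-cmp p x
  ... | tri< _ _ _ = 0F
  ... | tri≈ _ _ _ = 0F
  ... | tri> _ _ _ = κD s t p

  clash : ∀ {f i j : Fin 3} → f ≡ i → f ≡ j → i ≢ j → ∀ {A : Set} → A
  clash e e′ ne = ⊥-elim (ne (trans (sym e) e′))

  -- Local consistency of the matching: colour 0 joins up p with down p + 1, colour 2 joins up p
  -- with down p. The two end downs have only one up beside them, hence `first` and `last`.
  record Coloured (χ κ : ℕ → Fin 3) (n : ℕ) : Set where
    field
      next⇒  : ∀ {p} → p < n → χ p ≡ 0F → κ (suc p) ≡ 0F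
      next⇐  : ∀ {p} → p < n → κ (suc p) ≡ 0F → χ p ≡ 0F
      same⇒  : ∀ {p} → p < n → χ p ≡ 2F → κ p ≡ 2F
      same⇐  : ∀ {p} → p < n → κ p ≡ 2F → χ p ≡ 2F
      first  : κ 0 ≢ 0F
      last   : κ n ≢ 2F

  ones : (ℕ → Fin 3) → List ℕ → List ℕ
  ones f = filter (λ p → f p ≟ 1F)

  χD-below : ∀ {p} x s t → p < x → χD (x ∷ s) t p ≡ 2F
  χD-below {p} x s t lt with <-cmp p x
  ... | tri< _ _ _ = refl
  ... | tri≈ ¬lt _ _ = ⊥-elim (¬lt lt)
  ... | tri> ¬lt _ _ = ⊥-elim (¬lt lt)

  χD-above : ∀ {p} x s t → x ≤ p → χD (x ∷ s) t p ≡ χU s t p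
  χD-above {p} x s t le with <-cmp p x
  ... | tri< lt _ _ = ⊥-elim (<⇒≱ lt le)
  ... | tri≈ _ _ _ = refl
  ... | tri> _ _ _ = refl

  χU-below : ∀ {p} s x t → p < x → χU s (x ∷ t) p ≡ 0F
  χU-below {p} s x t lt with <-cmp p x
  ... | tri< _ _ _ = refl
  ... | tri≈ ¬lt _ _ = ⊥-elim (¬lt lt)
  ... | tri> ¬lt _ _ = ⊥-elim (¬lt lt)

  χU-at : ∀ s x t → χU s (x ∷ t) x ≡ 1F
  χU-at s x t with <-cmp x x
  ... | tri< _ ne _ = ⊥-elim (ne refl)
  ... | tri≈ _ _ _ = refl
  ... | tri> _ ne _ = ⊥-elim (ne refl)

  χU-above : ∀ {p} s x t → x < p → χU s (x ∷ t) p ≡ χD s t p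
  χU-above {p} s x t lt with <-cmp p x
  ... | tri< _ _ ¬gt = ⊥-elim (¬gt lt)
  ... | tri≈ _ _ ¬gt = ⊥-elim (¬gt lt)
  ... | tri> _ _ _ = refl

  κD-below : ∀ {p} x s t → p < x → κD (x ∷ s) t p ≡ 2F
  κD-below {p} x s t lt with <-cmp p x
  ... | tri< _ _ _ = refl
  ... | tri≈ ¬lt _ _ = ⊥-elim (¬lt lt)
  ... | tri> ¬lt _ _ = ⊥-elim (¬lt lt)

  κD-at : ∀ x s t → κD (x ∷ s) t x ≡ 1F
  κD-at x s t with <-cmp x x
  ... | tri< _ ne _ = ⊥-elim (ne refl)
  ... | tri≈ _ _ _ = refl
  ... | tri> _ ne _ = ⊥-elim (ne refl)

  κD-above : ∀ {p} x s t → x < p → κD (x ∷ s) t p ≡ κU s t p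
  κD-above {p} x s t lt with <-cmp p x
  ... | tri< _ _ ¬gt = ⊥-elim (¬gt lt)
  ... | tri≈ _ _ ¬gt = ⊥-elim (¬gt lt)
  ... | tri> _ _ _ = refl

  κU-below : ∀ {p} s x t → p ≤ x → κU s (x ∷ t) p ≡ 0F
  κU-below {p} s x t le with <-cmp p x
  ... | tri< _ _ _ = refl
  ... | tri≈ _ _ _ = refl
  ... | tri> _ _ gt = ⊥-elim (<⇒≱ gt le)

  κU-above : ∀ {p} s x t → x < p → κU s (x ∷ t) p ≡ κD s t p
  κU-above {p} s x t lt with <-cmp p x
  ... | tri< _ _ ¬gt = ⊥-elim (¬gt lt)
  ... | tri≈ _ _ ¬gt = ⊥-elim (¬gt lt)
  ... | tri> _ _ _ = refl

  module _ {χ κ : ℕ → Fin 3} {n : ℕ} (col : Coloured χ κ n) where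

    open Coloured col

    GoalD : (s t : List ℕ) → ℕ → Set
    GoalD s t p = t ∈ inter s × (∀ {j} → p ≤ j → (j < n → χ j ≡ χD s t j) × (j ≤ n → κ j ≡ κD s t j))

    GoalU : ℕ → (s t : List ℕ) → ℕ → Set
    GoalU x s t p = t ∈ inter (x ∷ s) × (∀ {j} → p ≤ j → (j < n → χ j ≡ χU s t j) × (p < j → j ≤ n → κ j ≡ κU s t j))

    ones-∈ : ∀ f {p a m} → p ∈ ones f (ival a m) → a ≤ p
    ones-∈ f {a = a} {m} p∈ = proj₁ (∈-ival⁻ a m (proj₁ (∈-filter⁻ (λ p → f p ≟ 1F) p∈)))

    ones-yes : ∀ f p ps → f p ≡ 1F → ones f (p ∷ ps) ≡ p ∷ ones f ps
    ones-yes f p ps e = filter-accept (λ p → f p ≟ 1F) e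

    ones-no : ∀ f p ps → f p ≢ 1F → ones f (p ∷ ps) ≡ ones f ps
    ones-no f p ps e = filter-reject (λ p → f p ≟ 1F) e

    -- Read along the strip, the inner pairs have colour 2 until a down is matched outside, then
    -- colour 0 until an up is matched outside, then colour 2 again. This alternation is the
    -- interlacing of the two rows, and it determines all colours.
    scanD : ∀ d p → d + p ≡ n → κ p ≢ 0F → GoalD (ones κ (ival p (suc d))) (ones χ (ival p d)) p
    -- In this state the down p is taken already, from outside or by the up before it, so the up p
    -- cannot have colour 2 and only later downs are described. The number `x` is the last down
    -- matched outside.
    scanU : ∀ d p x → d + p ≡ n → (p < n → χ p ≢ 2F) → x ≤ p → GoalU x (ones κ (ival (suc p) d)) (ones χ (ival p d)) p

    scanD d p eq ne = go d (κ p) refl eq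
      where
      go : ∀ d i → κ p ≡ i → d + p ≡ n → GoalD (ones κ (ival p (suc d))) (ones χ (ival p d)) p
      go d 0F κp eq = ⊥-elim (ne κp)
      go d 1F κp eq with scanU d p p eq (λ lt χp → clash κp (same⇒ lt χp) (λ ())) ≤-refl
      ... | t∈ , agree = subst (λ s → GoalD s (ones χ (ival p d)) p) (sym (ones-yes κ p (ival (suc p) d) κp)) (t∈ , agree′)
        where
        S = ones κ (ival (suc p) d)
        T = ones χ (ival p d)
        agree′ : ∀ {j} → p ≤ j → (j < n → χ j ≡ χD (p ∷ S) T j) × (j ≤ n → κ j ≡ κD (p ∷ S) T j)
        agree′ {j} le = (λ lt → trans (proj₁ (agree le) lt) (sym (χD-above p S T le))) , down (m≤n⇒m<n∨m≡n le)
          where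
          down : p < j ⊎ p ≡ j → j ≤ n → κ j ≡ κD (p ∷ S) T j
          down (inj₁ lt)   jn = trans (proj₂ (agree le) lt jn) (sym (κD-above p S T lt))
          down (inj₂ refl) jn = trans κp (sym (κD-at p S T))
      go zero    2F κp refl = ⊥-elim (last κp)
      go (suc d) 2F κp eq =
        subst₂ (λ s t → GoalD s t p) (sym (ones-no κ p _ (λ e → clash κp e (λ ())))) (sym (ones-no χ p _ (λ e → clash χp e (λ ()))))
               (proj₁ rec , agree′ S T refl (proj₁ rec) (proj₂ rec))
        where
        p<n : p < n
        p<n = subst (p <_) eq (s≤s (m≤n+m p d))
        χp : χ p ≡ 2F
        χp = same⇐ p<n κp
        S = ones κ (ival (suc p) (suc d))
        T = ones χ (ival (suc p) d)
        rec : GoalD S T (suc p)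
        rec = scanD d (suc p) (trans (+-suc d p) eq) (λ e → clash χp (next⇐ p<n e) (λ ()))
        agree′ : ∀ s t → s ≡ S → t ∈ inter s → (∀ {j} → suc p ≤ j → (j < n → χ j ≡ χD s t j) × (j ≤ n → κ j ≡ κD s t j)) →
                 ∀ {j} → p ≤ j → (j < n → χ j ≡ χD s t j) × (j ≤ n → κ j ≡ κD s t j)
        agree′ (y ∷ s) t e t∈ agree {j} le with m≤n⇒m<n∨m≡n le
        ... | inj₁ lt   = agree lt
        ... | inj₂ refl = (λ _ → trans χp (sym (χD-below y s t y>))) , (λ _ → trans κp (sym (κD-below y s t y>)))
          where
          y> : p < y
          y> = ones-∈ κ {m = suc d} (subst (y ∈_) e (here refl))

    scanU zero    p x refl _  _  = here refl , λ le → (λ lt → ⊥-elim (<⇒≱ lt le)) , (λ lt jn → ⊥-elim (<⇒≱ lt jn))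
    scanU (suc d) p x eq ne x≤p = go (χ p) refl
      where
      p<n : p < n
      p<n = subst (p <_) eq (s≤s (m≤n+m p d))
      go : ∀ i → χ p ≡ i → GoalU x (ones κ (ival (suc p) (suc d))) (ones χ (ival p (suc d))) p
      go 0F χp = subst₂ (λ s t → GoalU x s t p) (sym (ones-no κ (suc p) _ (λ e → clash κp e (λ ())))) (sym (ones-no χ p _ (λ e → clash χp e (λ ()))))
                        (proj₁ rec , agree′ T refl (proj₂ rec))
        where
        κp : κ (suc p) ≡ 0F
        κp = next⇒ p<n χp
        S = ones κ (ival (suc (suc p)) d)
        T = ones χ (ival (suc p) d)
        rec : GoalU x S T (suc p)
        rec = scanU d (suc p) x (trans (+-suc d p) eq) (λ lt e → clash κp (same⇒ lt e) (λ ())) (m≤n⇒m≤1+n x≤p)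
        up-first : ∀ t → t ≡ T → χU S t p ≡ 0F
        up-first []      e = refl
        up-first (y ∷ t) e = χU-below S y t (ones-∈ χ {m = d} (subst (y ∈_) e (here refl)))
        down-first : ∀ t → t ≡ T → κU S t (suc p) ≡ 0F
        down-first []      e = refl
        down-first (y ∷ t) e = κU-below S y t (ones-∈ χ {m = d} (subst (y ∈_) e (here refl)))
        agree′ : ∀ t → t ≡ T → (∀ {j} → suc p ≤ j → (j < n → χ j ≡ χU S t j) × (suc p < j → j ≤ n → κ j ≡ κU S t j)) →
                 ∀ {j} → p ≤ j → (j < n → χ j ≡ χU S t j) × (p < j → j ≤ n → κ j ≡ κU S t j)
        agree′ t e agree {j} le with m≤n⇒m<n∨m≡n le
        ... | inj₂ refl = (λ _ → trans χp (sym (up-first t e))) , (λ lt _ → ⊥-elim (<-irrefl refl lt))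
        ... | inj₁ lt with m≤n⇒m<n∨m≡n lt
        ...   | inj₁ lt′  = proj₁ (agree lt) , (λ _ → proj₂ (agree lt) lt′)
        ...   | inj₂ refl = proj₁ (agree lt) , (λ _ _ → trans κp (sym (down-first t e)))
      go 1F χp = subst (λ t → GoalU x (ones κ (ival (suc p) (suc d))) t p) (sym (ones-yes χ p _ χp)) (finish _ refl (proj₁ rec) (proj₂ rec))
        where
        T = ones χ (ival (suc p) d)
        rec : GoalD (ones κ (ival (suc p) (suc d))) T (suc p)
        rec = scanD d (suc p) (trans (+-suc d p) eq) (λ e → clash χp (next⇐ p<n e) (λ ()))
        finish : ∀ s → s ≡ ones κ (ival (suc p) (suc d)) → T ∈ inter s →
                 (∀ {j} → suc p ≤ j → (j < n → χ j ≡ χD s T j) × (j ≤ n → κ j ≡ κD s T j)) → GoalU x s (p ∷ T) p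
        finish (y ∷ s) e t∈ agree =
          ∈-consAll⁺ (∈-range⁺ x y x≤p (ones-∈ κ {m = suc d} (subst (y ∈_) e (here refl)))) t∈ , agree′
          where
          agree′ : ∀ {j} → p ≤ j → (j < n → χ j ≡ χU (y ∷ s) (p ∷ T) j) × (p < j → j ≤ n → κ j ≡ κU (y ∷ s) (p ∷ T) j)
          agree′ {j} le with m≤n⇒m<n∨m≡n le
          ... | inj₂ refl = (λ _ → trans χp (sym (χU-at (y ∷ s) p T))) , (λ lt _ → ⊥-elim (<-irrefl refl lt))
          ... | inj₁ lt   = (λ jn → trans (proj₁ (agree lt) jn) (sym (χU-above (y ∷ s) p T lt)))
                          , (λ _ jn → trans (proj₂ (agree lt) jn) (sym (κU-above (y ∷ s) p T lt)))
      go 2F χp = ⊥-elim (ne p<n χp)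

    strip-rows : GoalD (ones κ (ival 0 (suc n))) (ones χ (ival 0 n)) 0
    strip-rows = scanD n 0 (+-identityʳ n) first

  -- For the converse of `strip-rows`: the colours defined by interlacing rows are consistent, and
  -- colour 1 marks exactly the rows. The field `bound` shows that a down of colour 2 is not the
  -- last of its strip.
  record AtD (s t : List ℕ) (p : ℕ) : Set where
    field
      χ⇒  : χD s t p ≡ 1F → p ∈ t
      χ⇐  : p ∈ t → χD s t p ≡ 1F
      κ⇒  : κD s t p ≡ 1F → p ∈ s
      κ⇐  : p ∈ s → κD s t p ≡ 1F
      next⇒ : χD s t p ≡ 0F → κD s t (suc p) ≡ 0F
      next⇐ : κD s t (suc p) ≡ 0F → χD s t p ≡ 0F
      same⇒ : χD s t p ≡ 2F → κD s t p ≡ 2F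
      same⇐ : κD s t p ≡ 2F → χD s t p ≡ 2F
      bound : κD s t p ≡ 2F → ∃ λ y → y ∈ s × p < y

  record AtU (x : ℕ) (s t : List ℕ) (p : ℕ) : Set where
    field
      χ⇒  : χU s t p ≡ 1F → p ∈ t
      χ⇐  : p ∈ t → χU s t p ≡ 1F
      κ⇒  : κU s t p ≡ 1F → p ∈ s
      κ⇐  : p ∈ s → κU s t p ≡ 1F
      next⇒ : χU s t p ≡ 0F → κU s t (suc p) ≡ 0F
      next⇐ : κU s t (suc p) ≡ 0F → χU s t p ≡ 0F
      -- The strict inequality is handed to `atD`, where at p = x the colour of the down is 1
      -- instead.
      same⇒ : χU s t p ≡ 2F → x < p × κU s t p ≡ 2F
      same⇐ : κU s t p ≡ 2F → χU s t p ≡ 2F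
      bound : κU s t p ≡ 2F → ∃ λ y → y ∈ s × p < y

  κD-not0 : ∀ {p} x s t → p ≤ x → κD (x ∷ s) t p ≢ 0F
  κD-not0 x s t le e with m≤n⇒m<n∨m≡n le
  ... | inj₁ lt with () ← trans (sym (κD-below x s t lt)) e
  ... | inj₂ refl with () ← trans (sym (κD-at x s t)) e

  private
    absurd : ∀ {f i j : Fin 3} {A : Set} → f ≡ i → i ≢ j → f ≡ j → A
    absurd e ne e′ = ⊥-elim (ne (trans (sym e) e′))

  atD : ∀ {s t} → Sorted s → t ∈ inter s → ∀ p → AtD s t p
  atU : ∀ {x s t} → Sorted (x ∷ s) → t ∈ inter (x ∷ s) → ∀ {p} → x ≤ p → AtU x s t p

  atD {x ∷ s} {t} so t∈ p with <-≤-connex p x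
  ... | inj₁ lt = record
    { χ⇒ = absurd χ≡ (λ ()) ; χ⇐ = λ p∈ → ⊥-elim (<⇒≱ lt (All.lookup (proj₂ (proj₂ (inter-sound x s t∈))) p∈))
    ; κ⇒ = absurd κ≡ (λ ()) ; κ⇐ = λ p∈ → ⊥-elim (not-in p∈)
    ; next⇒ = absurd χ≡ (λ ()) ; next⇐ = λ e → ⊥-elim (κD-not0 x s t lt e)
    ; same⇒ = λ _ → κ≡ ; same⇐ = λ _ → χ≡ ; bound = λ _ → x , here refl , lt }
    where
    χ≡ = χD-below {p} x s t lt
    κ≡ = κD-below {p} x s t lt
    not-in : p ∉ x ∷ s
    not-in (here refl) = <-irrefl refl lt
    not-in (there p∈)  = <-asym lt (All.lookup (sorted-head so) p∈)
  ... | inj₂ le = record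
    { χ⇒ = λ e → U.χ⇒ (trans (sym χ≡) e) ; χ⇐ = λ p∈ → trans χ≡ (U.χ⇐ p∈)
    ; κ⇒ = κ-in (m≤n⇒m<n∨m≡n le) ; κ⇐ = in-κ
    ; next⇒ = λ e → trans κ≡ (U.next⇒ (trans (sym χ≡) e)) ; next⇐ = λ e → trans χ≡ (U.next⇐ (trans (sym κ≡) e))
    ; same⇒ = λ e → let q = U.same⇒ (trans (sym χ≡) e) in trans (κD-above x s t (proj₁ q)) (proj₂ q)
    ; same⇐ = λ e → trans χ≡ (U.same⇐ (trans (sym (κD-above x s t (past e))) e))
    ; bound = λ e → let (y , y∈ , lt) = U.bound (trans (sym (κD-above x s t (past e))) e) in y , there y∈ , lt }
    where
    module U = AtU (atU so t∈ le)
    χ≡ = χD-above {p} x s t le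
    κ≡ = κD-above {suc p} x s t (s≤s le)
    κ-in : x < p ⊎ x ≡ p → κD (x ∷ s) t p ≡ 1F → p ∈ x ∷ s
    κ-in (inj₁ lt)   e = there (U.κ⇒ (trans (sym (κD-above x s t lt)) e))
    κ-in (inj₂ refl) e = here refl
    in-κ : p ∈ x ∷ s → κD (x ∷ s) t p ≡ 1F
    in-κ (here refl) = κD-at x s t
    in-κ (there p∈)  = trans (κD-above x s t (All.lookup (sorted-head so) p∈)) (U.κ⇐ p∈)
    past : κD (x ∷ s) t p ≡ 2F → x < p
    past e with m≤n⇒m<n∨m≡n le
    ... | inj₁ lt = lt
    ... | inj₂ refl with () ← trans (sym (κD-at x s t)) e

  atU {x} {[]} so (here refl) le = record
    { χ⇒ = λ () ; χ⇐ = λ () ; κ⇒ = λ () ; κ⇐ = λ () ; next⇒ = λ _ → refl ; next⇐ = λ _ → refl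
    ; same⇒ = λ () ; same⇐ = λ () ; bound = λ () }
  atU {x} {y ∷ s} so t∈ {p} le with ∈-consAll⁻ (range x y) t∈
  ... | t₀ , t , t₀∈ , t∈′ , refl with ∈-range⁻ x y t₀∈
  ...   | x≤t₀ , t₀<y with <-cmp p t₀
  ...     | tri< lt _ _ = record
    { χ⇒ = absurd χ≡ (λ ()) ; χ⇐ = λ p∈ → ⊥-elim (not-t p∈)
    ; κ⇒ = absurd κ≡ (λ ()) ; κ⇐ = λ p∈ → ⊥-elim (not-s p∈)
    ; next⇒ = λ _ → κU-below (y ∷ s) t₀ t lt ; next⇐ = λ _ → χ≡
    ; same⇒ = absurd χ≡ (λ ()) ; same⇐ = absurd κ≡ (λ ()) ; bound = absurd κ≡ (λ ()) }
    where
    χ≡ : χU (y ∷ s) (t₀ ∷ t) p ≡ 0F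
    χ≡ = χU-below (y ∷ s) t₀ t lt
    κ≡ : κU (y ∷ s) (t₀ ∷ t) p ≡ 0F
    κ≡ = κU-below (y ∷ s) t₀ t (<⇒≤ lt)
    not-t : p ∉ t₀ ∷ t
    not-t (here refl) = <-irrefl refl lt
    not-t (there p∈)  = <⇒≱ (<-trans lt t₀<y) (All.lookup (proj₂ (proj₂ (inter-sound y s t∈′))) p∈)
    not-s : p ∉ y ∷ s
    not-s (here refl) = <-asym lt t₀<y
    not-s (there p∈)  = <-asym (<-trans lt t₀<y) (All.lookup (sorted-head (sorted-tail so)) p∈)
  ...     | tri≈ _ refl _ = record
    { χ⇒ = λ _ → here refl ; χ⇐ = λ _ → χ≡
    ; κ⇒ = absurd κ≡ (λ ()) ; κ⇐ = λ p∈ → ⊥-elim (not-s p∈)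
    ; next⇒ = absurd χ≡ (λ ()) ; next⇐ = λ e → ⊥-elim (κD-not0 y s t t₀<y (trans (sym (κU-above (y ∷ s) p t ≤-refl)) e))
    ; same⇒ = absurd χ≡ (λ ()) ; same⇐ = absurd κ≡ (λ ()) ; bound = absurd κ≡ (λ ()) }
    where
    χ≡ : χU (y ∷ s) (p ∷ t) p ≡ 1F
    χ≡ = χU-at (y ∷ s) p t
    κ≡ : κU (y ∷ s) (p ∷ t) p ≡ 0F
    κ≡ = κU-below (y ∷ s) p t ≤-refl
    not-s : p ∉ y ∷ s
    not-s (here refl) = <-irrefl refl t₀<y
    not-s (there p∈)  = <-asym t₀<y (All.lookup (sorted-head (sorted-tail so)) p∈)
  ...     | tri> _ _ gt = record
    { χ⇒ = λ e → there (D.χ⇒ (trans (sym χ≡) e)) ; χ⇐ = λ p∈ → trans χ≡ (D.χ⇐ (later p∈))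
    ; κ⇒ = λ e → D.κ⇒ (trans (sym κ≡) e) ; κ⇐ = λ p∈ → trans κ≡ (D.κ⇐ p∈)
    ; next⇒ = λ e → trans κ₁≡ (D.next⇒ (trans (sym χ≡) e)) ; next⇐ = λ e → trans χ≡ (D.next⇐ (trans (sym κ₁≡) e))
    ; same⇒ = λ e → ≤-<-trans x≤t₀ gt , trans κ≡ (D.same⇒ (trans (sym χ≡) e)) ; same⇐ = λ e → trans χ≡ (D.same⇐ (trans (sym κ≡) e))
    ; bound = λ e → D.bound (trans (sym κ≡) e) }
    where
    module D = AtD (atD (sorted-tail so) t∈′ p)
    χ≡ : χU (y ∷ s) (t₀ ∷ t) p ≡ χD (y ∷ s) t p
    χ≡ = χU-above (y ∷ s) t₀ t gt
    κ≡ : κU (y ∷ s) (t₀ ∷ t) p ≡ κD (y ∷ s) t p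
    κ≡ = κU-above (y ∷ s) t₀ t gt
    κ₁≡ : κU (y ∷ s) (t₀ ∷ t) (suc p) ≡ κD (y ∷ s) t (suc p)
    κ₁≡ = κU-above (y ∷ s) t₀ t (m≤n⇒m≤1+n gt)
    later : p ∈ t₀ ∷ t → p ∈ t
    later (here refl) = ⊥-elim (<-irrefl refl gt)
    later (there p∈)  = p∈

  inter-first : ∀ {s t} → t ∈ inter s → κD s t 0 ≢ 0F
  inter-first {x ∷ s} {t} _ = κD-not0 x s t z≤n

-- Linear inequalities between naturals

module LinearArithmetic where

  open import Data.List as List using (List; length)
  open import Data.Nat using (ℕ; zero; suc; _+_; _*_; _≤_)
  open import Data.Nat.Properties
  open import Data.Nat.Tactic.RingSolver using (solve-∀)
  open import Data.Product using (_×_; _,_; proj₁; proj₂)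
  open import Relation.Binary.PropositionalEquality using (_≡_; refl; sym; trans; cong; cong₂)

  infixr 5 _▸_
  pattern _▸_ x xs = x List.∷ xs
  pattern ∅ = List.[]

  -- A solver for equations between sums: much cheaper to check than the ring solver, whose normal
  -- forms are computed in the context of the goal.
  infixl 6 _:+_
  data Sum : Set where
    con  : ℕ → Sum
    var  : ℕ → Sum
    _:+_ : Sum → Sum → Sum

  value : ℕ → List ℕ → ℕ
  value i       ∅       = 0
  value zero    (a ▸ ρ) = a
  value (suc i) (a ▸ ρ) = value i ρ

  ⟦_⟧ : Sum → List ℕ → ℕ
  ⟦ con n ⟧  ρ = n
  ⟦ var i ⟧  ρ = value i ρ
  ⟦ e :+ f ⟧ ρ = ⟦ e ⟧ ρ + ⟦ f ⟧ ρ

  unit : ℕ → List ℕ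
  unit zero    = 1 ▸ ∅
  unit (suc i) = 0 ▸ unit i

  infixl 6 _⊞_
  _⊞_ : List ℕ → List ℕ → List ℕ
  ∅       ⊞ l       = l
  (m ▸ k) ⊞ ∅       = m ▸ k
  (m ▸ k) ⊞ (n ▸ l) = m + n ▸ k ⊞ l

  -- The first coefficient is the constant term, which is why these lists are evaluated at `1 ▸ ρ`.
  coefficients : Sum → List ℕ
  coefficients (con n)  = n ▸ ∅
  coefficients (var i)  = 0 ▸ unit i
  coefficients (e :+ f) = coefficients e ⊞ coefficients f

  dot : List ℕ → List ℕ → ℕ
  dot ∅       ρ       = 0
  dot (n ▸ k) ∅       = 0
  dot (n ▸ k) (a ▸ ρ) = n * a + dot k ρ

  dot-⊞ : ∀ k l ρ → dot (k ⊞ l) ρ ≡ dot k ρ + dot l ρ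
  dot-⊞ ∅       l       ρ       = refl
  dot-⊞ (m ▸ k) ∅       ρ       = sym (+-identityʳ (dot (m ▸ k) ρ))
  dot-⊞ (m ▸ k) (n ▸ l) ∅       = refl
  dot-⊞ (m ▸ k) (n ▸ l) (a ▸ ρ) = trans (cong ((m + n) * a +_) (dot-⊞ k l ρ)) (interchange m n a (dot k ρ) (dot l ρ))
    where
    interchange : ∀ m n a u v → (m + n) * a + (u + v) ≡ m * a + u + (n * a + v)
    interchange = solve-∀

  dot-unit : ∀ i ρ → dot (unit i) ρ ≡ value i ρ
  dot-unit zero    ∅       = refl
  dot-unit zero    (a ▸ ρ) = trans (+-identityʳ (1 * a)) (*-identityˡ a)
  dot-unit (suc i) ∅       = refl
  dot-unit (suc i) (a ▸ ρ) = dot-unit i ρ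

  dot-coefficients : ∀ e ρ → dot (coefficients e) (1 ▸ ρ) ≡ ⟦ e ⟧ ρ
  dot-coefficients (con n)  ρ = trans (+-identityʳ (n * 1)) (*-identityʳ n)
  dot-coefficients (var i)  ρ = dot-unit i ρ
  dot-coefficients (e :+ f) ρ = trans (dot-⊞ (coefficients e) (coefficients f) (1 ▸ ρ)) (cong₂ _+_ (dot-coefficients e ρ) (dot-coefficients f ρ))

  Equation : ℕ → Set
  Equation zero    = Sum × Sum
  Equation (suc n) = Sum → Equation n

  infix 4 _:=_
  _:=_ : Sum → Sum → Sum × Sum
  e := f = e , f

  sides : ∀ n → ℕ → Equation n → Sum × Sum
  sides zero    i eq = eq
  sides (suc n) i eq = sides n (suc i) (eq (var i))

  -- Abstract, because with-abstraction would otherwise normalise the arithmetic proofs in its goal.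
  abstract

    solve-sides : ∀ ρ (s : Sum × Sum) → coefficients (proj₁ s) ≡ coefficients (proj₂ s) → ⟦ proj₁ s ⟧ ρ ≡ ⟦ proj₂ s ⟧ ρ
    solve-sides ρ (e , f) h = trans (sym (dot-coefficients e ρ)) (trans (cong (λ k → dot k (1 ▸ ρ)) h) (dot-coefficients f ρ))

    solve : ∀ ρ (eq : Equation (length ρ)) → (let s = sides (length ρ) 0 eq) →
            coefficients (proj₁ s) ≡ coefficients (proj₂ s) → ⟦ proj₁ s ⟧ ρ ≡ ⟦ proj₂ s ⟧ ρ
    solve ρ eq = solve-sides ρ (sides (length ρ) 0 eq)

  abstract

    -- A combination A ≤ B of the hypotheses that proves a ≤ b with slack r.
    linear : ∀ {A B a b} r → A ≤ B → B + a + r ≡ A + b → a ≤ b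
    linear {A} {B} {a} {b} r le e =
      +-cancelˡ-≤ A a b (≤-trans (+-monoˡ-≤ a le) (≤-trans (m≤m+n (B + a) r) (≤-reflexive e)))

  infixr 5 _⊹_
  _⊹_ : ∀ {a b c d} → a ≤ b → c ≤ d → a + c ≤ b + d
  _⊹_ = +-mono-≤

open import Data.Empty using (⊥; ⊥-elim)
open import Data.Fin using (Fin; zero; suc) renaming (_≟_ to _≟ᶠ_)
open import Data.List using (List; []; _∷_; _++_; map; length; filter)
open import Data.List.Membership.Propositional using (_∈_; _∉_)
open import Data.List.Membership.Propositional.Properties using (∈-filter⁻; ∈-filter⁺; ∈-++⁺ˡ; ∈-++⁺ʳ; ∈-++⁻)
open import Data.List.Properties using (filter-accept; filter-reject; length-++)
open import Data.List.Relation.Unary.All as All using (All; []; _∷_)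
open import Data.List.Relation.Unary.Any using (here; there)
open import Data.List.Relation.Unary.Linked using ([]; [-]; _∷_)
open import Data.Nat using (ℕ; zero; suc; pred; _+_; _∸_; _≤_; _<_; z≤n; s≤s; s≤s⁻¹; _≤?_; _<?_; _≟_)
open import Data.Nat.Properties hiding (_≟_; _≤?_; _<?_)
open import Data.List.Membership.DecPropositional _≟_ using (_∈?_)
open import Data.Product using (_×_; _,_; proj₁; proj₂; ∃)
open import Data.Sum using (_⊎_; inj₁; inj₂)
open import Relation.Binary.Definitions using (tri<; tri≈; tri>)
open import Relation.Binary.PropositionalEquality using (_≡_; _≢_; refl; sym; trans; cong; cong₂; subst; subst₂)
open import Relation.Nullary using (¬_; Dec; yes; no)
open import Relation.Nullary.Decidable using (_×-dec_)

-- The region in coordinates; `p₀` is the position of the segment s on the line a = c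

module Geometry (x y z k c d p₀ : ℕ) (x+z : c + c ≡ x + z) (y+z : suc (d + d) ≡ y + z) (c+d : p₀ + z ≡ c + d) (k≤c : k ≤ c) where

  open LinearArithmetic
  open Summation
  open Enumeration
  open ListCounting
  open Strip

  -- The up-triangle (a , b) belongs to the region.
  record Up (a b : ℕ) : Set where
    constructor up
    field
      lo : z ≤ a + b
      a< : a < x + z
      b< : b < y + z
      hi : a + b < x + y + z
      t₁ : ¬ (a < c × b < d × c + d ≤ a + b + k)
      t₂ : ¬ (c ≤ a × d < b × a + b ≤ c + d + k)

  -- The unit segment from (l , b) to (l , b + 1), with l + b = z + p, is inside the left half of
  -- the region: it is a side of the up-triangle (l , b) and of the down-triangle (l − 1 , b).
  record Seg (l p : ℕ) : Set where
    constructor seg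
    field
      lo : l ≤ z + p
      in< : p < y + l
      hi : p < x + y
      t₁ : ¬ (z + p < l + d × c + d ≤ z + p + k)

  abstract
    seg? : ∀ l p → Dec (Seg l p)
    seg? l p with l ≤? z + p | p <? y + l | p <? x + y | ((z + p <? l + d) ×-dec (c + d ≤? z + p + k))
    ... | yes e₁ | yes e₂ | yes e₃ | no e₄  = yes (seg e₁ e₂ e₃ e₄)
    ... | no ¬e  | _      | _      | _      = no (λ s → ¬e (Seg.lo s))
    ... | yes _  | no ¬e  | _      | _      = no (λ s → ¬e (Seg.in< s))
    ... | yes _  | yes _  | no ¬e  | _      = no (λ s → ¬e (Seg.hi s))
    ... | yes _  | yes _  | yes _  | yes e  = no (λ s → Seg.t₁ s e)

  abstract

    up→seg : ∀ {a b p} → a + b ≡ z + p → a < c → Up a b → Seg a p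
    up→seg {a} {b} {p} e a<c (up lo a< b< hi t₁ t₂) = seg
      (linear b (≤-reflexive e) (solve (a ▸ b ▸ p ▸ z ▸ ∅) (λ a b p z → z :+ p :+ a :+ b := a :+ b :+ (z :+ p)) refl))
      (linear 0 (≤-reflexive (sym e) ⊹ b<) (solve (a ▸ b ▸ p ▸ y ▸ z ▸ ∅) (λ a b p y z → a :+ b :+ (y :+ z) :+ (con 1 :+ p) :+ con 0 := z :+ p :+ (con 1 :+ b) :+ (y :+ a)) refl))
      (linear 0 (≤-reflexive (sym e) ⊹ hi) (solve (a ▸ b ▸ p ▸ x ▸ y ▸ z ▸ ∅) (λ a b p x y z → a :+ b :+ (x :+ y :+ z) :+ (con 1 :+ p) :+ con 0 := z :+ p :+ (con 1 :+ (a :+ b)) :+ (x :+ y)) refl))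
      (λ (u , v) → t₁ (a<c , (linear 0 (≤-reflexive e ⊹ u) (solve (a ▸ b ▸ d ▸ p ▸ z ▸ ∅) (λ a b d p z → z :+ p :+ (a :+ d) :+ (con 1 :+ b) :+ con 0 := a :+ b :+ (con 1 :+ (z :+ p)) :+ d) refl)) , (linear 0 (≤-reflexive (sym e) ⊹ v) (solve (a ▸ b ▸ c ▸ d ▸ k ▸ p ▸ z ▸ ∅) (λ a b c d k p z → a :+ b :+ (z :+ p :+ k) :+ (c :+ d) :+ con 0 := z :+ p :+ (c :+ d) :+ (a :+ b :+ k)) refl))))

    seg→up : ∀ {a b p} → a + b ≡ z + p → a < c → Seg a p → Up a b
    seg→up {a} {b} {p} e a<c (seg lo in< hi t₁) = up
      (linear p (≤-reflexive (sym e)) (solve (a ▸ b ▸ p ▸ z ▸ ∅) (λ a b p z → a :+ b :+ z :+ p := z :+ p :+ (a :+ b)) refl))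
      (linear c (a<c ⊹ ≤-reflexive x+z) (solve (a ▸ c ▸ x ▸ z ▸ ∅) (λ a c x z → c :+ (x :+ z) :+ (con 1 :+ a) :+ c := con 1 :+ a :+ (c :+ c) :+ (x :+ z)) refl))
      (linear 0 (≤-reflexive e ⊹ in<) (solve (a ▸ b ▸ p ▸ y ▸ z ▸ ∅) (λ a b p y z → z :+ p :+ (y :+ a) :+ (con 1 :+ b) :+ con 0 := a :+ b :+ (con 1 :+ p) :+ (y :+ z)) refl))
      (linear 0 (≤-reflexive e ⊹ hi) (solve (a ▸ b ▸ p ▸ x ▸ y ▸ z ▸ ∅) (λ a b p x y z → z :+ p :+ (x :+ y) :+ (con 1 :+ (a :+ b)) :+ con 0 := a :+ b :+ (con 1 :+ p) :+ (x :+ y :+ z)) refl))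
      (λ (_ , u , v) → t₁ ((linear 0 (≤-reflexive (sym e) ⊹ u) (solve (a ▸ b ▸ d ▸ p ▸ z ▸ ∅) (λ a b d p z → a :+ b :+ d :+ (con 1 :+ (z :+ p)) :+ con 0 := z :+ p :+ (con 1 :+ b) :+ (a :+ d)) refl)) , (linear 0 (≤-reflexive e ⊹ v) (solve (a ▸ b ▸ c ▸ d ▸ k ▸ p ▸ z ▸ ∅) (λ a b c d k p z → z :+ p :+ (a :+ b :+ k) :+ (c :+ d) :+ con 0 := a :+ b :+ (c :+ d) :+ (z :+ p :+ k)) refl))))
      -- The second removed triangle lies to the right of the line a = c.
      (λ (u , _ , _) → (n≮0 (linear {a = 1} {b = 0} 0 (u ⊹ a<c) (solve (a ▸ c ▸ ∅) (λ a c → a :+ c :+ con 1 :+ con 0 := c :+ (con 1 :+ a) :+ con 0) refl))))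

    -- A right up-triangle (a , b) is the image under the rotation of the down-triangle of the segment (l , p).
    up→segʳ : ∀ {a b l p} → a + l ≡ c + c → b + (z + p) ≡ l + (d + d) → c ≤ a → Up a b → Seg l p × 0 < l × l ≤ c
    up→segʳ {a} {b} {l} {p} e f c≤a (up lo a< b< hi t₁ t₂) = seg
      (linear 0 (≤-reflexive (sym f) ⊹ b< ⊹ ≤-reflexive (sym y+z)) (solve (b ▸ d ▸ l ▸ p ▸ y ▸ z ▸ ∅) (λ b d l p y z → b :+ (z :+ p) :+ (y :+ z :+ (con 1 :+ (d :+ d))) :+ l :+ con 0 := l :+ (d :+ d) :+ (con 1 :+ b :+ (y :+ z)) :+ (z :+ p)) refl))
      (linear b (≤-reflexive f ⊹ ≤-reflexive y+z) (solve (b ▸ d ▸ l ▸ p ▸ y ▸ z ▸ ∅) (λ b d l p y z → l :+ (d :+ d) :+ (y :+ z) :+ (con 1 :+ p) :+ b := b :+ (z :+ p) :+ (con 1 :+ (d :+ d)) :+ (y :+ l)) refl))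
      (linear 0 (≤-reflexive e ⊹ ≤-reflexive f ⊹ lo ⊹ ≤-reflexive y+z ⊹ ≤-reflexive x+z) (solve (a ▸ b ▸ c ▸ d ▸ l ▸ p ▸ x ▸ y ▸ z ▸ ∅) (λ a b c d l p x y z → c :+ c :+ (l :+ (d :+ d) :+ (a :+ b :+ (y :+ z :+ (x :+ z)))) :+ (con 1 :+ p) :+ con 0 := a :+ l :+ (b :+ (z :+ p) :+ (z :+ (con 1 :+ (d :+ d) :+ (c :+ c)))) :+ (x :+ y)) refl))
      (λ (u , v) → t₂ (c≤a , (linear 0 (≤-reflexive (sym f) ⊹ u) (solve (b ▸ d ▸ l ▸ p ▸ z ▸ ∅) (λ b d l p z → b :+ (z :+ p) :+ (l :+ d) :+ (con 1 :+ d) :+ con 0 := l :+ (d :+ d) :+ (con 1 :+ (z :+ p)) :+ b) refl))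
                          , (linear 0 (≤-reflexive e ⊹ ≤-reflexive f ⊹ v) (solve (a ▸ b ▸ c ▸ d ▸ k ▸ l ▸ p ▸ z ▸ ∅) (λ a b c d k l p z → c :+ c :+ (l :+ (d :+ d) :+ (z :+ p :+ k)) :+ (a :+ b) :+ con 0 := a :+ l :+ (b :+ (z :+ p) :+ (c :+ d)) :+ (c :+ d :+ k)) refl))))
      , (linear 0 (≤-reflexive (sym e) ⊹ a< ⊹ ≤-reflexive (sym x+z)) (solve (a ▸ c ▸ l ▸ x ▸ z ▸ ∅) (λ a c l x z → a :+ l :+ (x :+ z :+ (c :+ c)) :+ con 1 :+ con 0 := c :+ c :+ (con 1 :+ a :+ (x :+ z)) :+ l) refl))
      , (linear 0 (≤-reflexive e ⊹ c≤a) (solve (a ▸ c ▸ l ▸ ∅) (λ a c l → c :+ c :+ a :+ l :+ con 0 := a :+ l :+ c :+ c) refl))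

    seg→upʳ : ∀ {a b l p} → a + l ≡ c + c → b + (z + p) ≡ l + (d + d) → 0 < l → l ≤ c → Seg l p → Up a b
    seg→upʳ {a} {b} {l} {p} e f 0<l l≤c (seg lo in< hi t₁) = up
      (linear 0 (≤-reflexive (sym e) ⊹ ≤-reflexive (sym f) ⊹ hi ⊹ ≤-reflexive (sym y+z) ⊹ ≤-reflexive (sym x+z)) (solve (a ▸ b ▸ c ▸ d ▸ l ▸ p ▸ x ▸ y ▸ z ▸ ∅) (λ a b c d l p x y z → a :+ l :+ (b :+ (z :+ p) :+ (x :+ y :+ (con 1 :+ (d :+ d) :+ (c :+ c)))) :+ z :+ con 0 := c :+ c :+ (l :+ (d :+ d) :+ (con 1 :+ p :+ (y :+ z :+ (x :+ z)))) :+ (a :+ b)) refl))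
      (linear 0 (≤-reflexive e ⊹ 0<l ⊹ ≤-reflexive x+z) (solve (a ▸ c ▸ l ▸ x ▸ z ▸ ∅) (λ a c l x z → c :+ c :+ (l :+ (x :+ z)) :+ (con 1 :+ a) :+ con 0 := a :+ l :+ (con 1 :+ (c :+ c)) :+ (x :+ z)) refl))
      (linear 0 (≤-reflexive f ⊹ lo ⊹ ≤-reflexive y+z) (solve (b ▸ d ▸ l ▸ p ▸ y ▸ z ▸ ∅) (λ b d l p y z → l :+ (d :+ d) :+ (z :+ p :+ (y :+ z)) :+ (con 1 :+ b) :+ con 0 := b :+ (z :+ p) :+ (l :+ (con 1 :+ (d :+ d))) :+ (y :+ z)) refl))
      (linear p (≤-reflexive e ⊹ ≤-reflexive f ⊹ ≤-reflexive x+z ⊹ ≤-reflexive y+z) (solve (a ▸ b ▸ c ▸ d ▸ l ▸ p ▸ x ▸ y ▸ z ▸ ∅) (λ a b c d l p x y z → c :+ c :+ (l :+ (d :+ d) :+ (x :+ z :+ (y :+ z))) :+ (con 1 :+ (a :+ b)) :+ p := a :+ l :+ (b :+ (z :+ p) :+ (c :+ c :+ (con 1 :+ (d :+ d)))) :+ (x :+ y :+ z)) refl))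
      (λ (u , _ , _) → (n≮0 (linear {a = 1} {b = 0} 0 (u ⊹ ≤-reflexive (sym e) ⊹ l≤c) (solve (a ▸ c ▸ l ▸ ∅) (λ a c l → c :+ (a :+ l :+ c) :+ con 1 :+ con 0 := con 1 :+ a :+ (c :+ c :+ l) :+ con 0) refl))))
      (λ (_ , u , v) → t₁ ((linear 0 (≤-reflexive f ⊹ u) (solve (b ▸ d ▸ l ▸ p ▸ z ▸ ∅) (λ b d l p z → l :+ (d :+ d) :+ b :+ (con 1 :+ (z :+ p)) :+ con 0 := b :+ (z :+ p) :+ (con 1 :+ d) :+ (l :+ d)) refl))
                          , (linear 0 (≤-reflexive (sym e) ⊹ ≤-reflexive (sym f) ⊹ v) (solve (a ▸ b ▸ c ▸ d ▸ k ▸ l ▸ p ▸ z ▸ ∅) (λ a b c d k l p z → a :+ l :+ (b :+ (z :+ p) :+ (c :+ d :+ k)) :+ (c :+ d) :+ con 0 := c :+ c :+ (l :+ (d :+ d) :+ (a :+ b)) :+ (z :+ p :+ k)) refl))))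

    leftUp : ∀ {a p} → a < c → Seg a p → ∃ λ b → a + b ≡ z + p × Up a b
    leftUp {a} {p} a<c s = z + p ∸ a , e , seg→up e a<c s
      where
      e : a + (z + p ∸ a) ≡ z + p
      e = m+[n∸m]≡n (Seg.lo s)

    rightUp : ∀ {l p} → 0 < l → l ≤ c → Seg l p → ∃ λ a → ∃ λ b → a + l ≡ c + c × b + (z + p) ≡ l + (d + d) × Up a b
    rightUp {l} {p} 0<l l≤c s = c + c ∸ l , l + (d + d) ∸ (z + p) , e , f , seg→upʳ e f 0<l l≤c s
      where
      in< : p < y + l
      in< = Seg.in< s
      l≤2c : l ≤ c + c
      l≤2c = (linear c (l≤c) (solve (c ▸ l ▸ ∅) (λ c l → c :+ l :+ c := l :+ (c :+ c)) refl))
      e : c + c ∸ l + l ≡ c + c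
      e = m∸n+n≡m l≤2c
      below : z + p ≤ l + (d + d)
      below = (linear 0 (in< ⊹ ≤-reflexive (sym y+z)) (solve (d ▸ l ▸ p ▸ y ▸ z ▸ ∅) (λ d l p y z → y :+ l :+ (con 1 :+ (d :+ d)) :+ (z :+ p) :+ con 0 := con 1 :+ p :+ (y :+ z) :+ (l :+ (d :+ d))) refl))
      f : l + (d + d) ∸ (z + p) + (z + p) ≡ l + (d + d)
      f = m∸n+n≡m below

    -- As k ≤ c, the removed triangle meets the line a = 0 in at most a vertex.
    seg-first : ∀ {p} → p < y → Seg 0 p
    seg-first {p} lt = seg z≤n (linear 0 (lt) (solve (p ▸ y ▸ ∅) (λ p y → y :+ (con 1 :+ p) :+ con 0 := con 1 :+ p :+ (y :+ con 0)) refl)) (linear x (lt) (solve (p ▸ x ▸ y ▸ ∅) (λ p x y → y :+ (con 1 :+ p) :+ x := con 1 :+ p :+ (x :+ y)) refl))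
      (λ (u , v) → (n≮0 (linear {a = 1} {b = 0} 0 (u ⊹ v ⊹ k≤c) (solve (c ▸ d ▸ k ▸ p ▸ z ▸ ∅) (λ c d k p z → con 0 :+ d :+ (z :+ p :+ k :+ c) :+ con 1 :+ con 0 := con 1 :+ (z :+ p) :+ (c :+ d :+ k) :+ con 0) refl))))

    -- From one line to the next, each run of missing positions gains one: the removed triangle and
    -- a cut-off corner widen towards the middle line.
    hole-step : ∀ {l p} → p < y + l → ¬ Seg l p → ¬ Seg (suc l) p × ¬ Seg (suc l) (suc p)
    hole-step {l} {p} lt ¬s =
      (λ (seg lo in< hi t₁) → ¬s (seg (linear 1 (lo) (solve (l ▸ p ▸ z ▸ ∅) (λ l p z → z :+ p :+ l :+ con 1 := con 1 :+ l :+ (z :+ p)) refl)) lt hi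
                                     (λ (u , v) → t₁ ((linear 1 (u) (solve (d ▸ l ▸ p ▸ z ▸ ∅) (λ d l p z → l :+ d :+ (con 1 :+ (z :+ p)) :+ con 1 := con 1 :+ (z :+ p) :+ (con 1 :+ l :+ d)) refl)) , v)))) ,
      (λ (seg lo in< hi t₁) → ¬s (seg (linear 0 (lo) (solve (l ▸ p ▸ z ▸ ∅) (λ l p z → z :+ (con 1 :+ p) :+ l :+ con 0 := con 1 :+ l :+ (z :+ p)) refl)) lt (linear 1 (hi) (solve (p ▸ x ▸ y ▸ ∅) (λ p x y → x :+ y :+ (con 1 :+ p) :+ con 1 := con 1 :+ (con 1 :+ p) :+ (x :+ y)) refl))
                                     (λ (u , v) → t₁ ((linear 0 (u) (solve (d ▸ l ▸ p ▸ z ▸ ∅) (λ d l p z → l :+ d :+ (con 1 :+ (z :+ (con 1 :+ p))) :+ con 0 := con 1 :+ (z :+ p) :+ (con 1 :+ l :+ d)) refl)) , (linear 1 (v) (solve (c ▸ d ▸ k ▸ p ▸ z ▸ ∅) (λ c d k p z → z :+ p :+ k :+ (c :+ d) :+ con 1 := c :+ d :+ (z :+ (con 1 :+ p) :+ k)) refl))))))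

    reflect-bound : ∀ {p} → Seg c p → p ≤ p₀ + p₀
    reflect-bound {p} (seg _ _ hi _) = (linear 0 (hi ⊹ ≤-reflexive (sym x+z) ⊹ ≤-reflexive (sym y+z) ⊹ ≤-reflexive (sym c+d) ⊹ ≤-reflexive (sym c+d)) (solve (c ▸ d ▸ p ▸ p₀ ▸ x ▸ y ▸ z ▸ ∅) (λ c d p p₀ x y z → x :+ y :+ (c :+ c :+ (con 1 :+ (d :+ d) :+ (p₀ :+ z :+ (p₀ :+ z)))) :+ p :+ con 0 := con 1 :+ p :+ (x :+ z :+ (y :+ z :+ (c :+ d :+ (c :+ d)))) :+ (p₀ :+ p₀)) refl))

  -- The point (a′ , b′) is the image under the rotation of the down-triangle in the given direction
  -- from (a , b). Stating it by sums of coordinates avoids subtraction.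
  data Partner : Fin 3 → (a b a′ b′ : ℕ) → Set where
    partner₀ : ∀ {a b a′ b′} → suc (a + a′) ≡ c + c → b + b′ ≡ d + d → Partner 0F a b a′ b′
    partner₁ : ∀ {a b a′ b′} → a + a′ ≡ c + c → b + b′ ≡ d + d → Partner 1F a b a′ b′
    partner₂ : ∀ {a b a′ b′} → suc (a + a′) ≡ c + c → b + b′ ≡ suc (d + d) → Partner 2F a b a′ b′

  -- A centrally symmetric tiling, as a choice of direction for every up-triangle u: the rotated
  -- image of the partner of u is an up-triangle matched in the same direction.
  Symmetric : (ℕ → ℕ → Fin 3) → Set
  Symmetric τ = ∀ {a b} → Up a b → ∃ λ a′ → ∃ λ b′ → Partner (τ a b) a b a′ b′ × Up a′ b′ × τ a′ b′ ≡ τ a b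

  abstract

    -- Left up-triangles are addressed by their own vertical side, right ones by that of their image.
    locate : ∀ {a b} → Up a b → (∃ λ p → a < c × a + b ≡ z + p × Seg a p) ⊎
             (∃ λ l → ∃ λ p → l < c × a + suc l ≡ c + c × b + (z + p) ≡ suc l + (d + d) × Seg (suc l) p)
    locate {a} {b} u = go (<-≤-connex a c)
      where
      open Up u
      Left Right : Set
      Left  = ∃ λ p → a < c × a + b ≡ z + p × Seg a p
      Right = ∃ λ l → ∃ λ p → l < c × a + suc l ≡ c + c × b + (z + p) ≡ suc l + (d + d) × Seg (suc l) p
      go : a < c ⊎ c ≤ a → Left ⊎ Right
      go (inj₁ a<c) = inj₁ (a + b ∸ z , a<c , e , up→seg e a<c u)
        where
        e : a + b ≡ z + (a + b ∸ z)
        e = sym (m+[n∸m]≡n lo)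
      go (inj₂ c≤a) = inj₂ (right (c + c ∸ a) (m+[n∸m]≡n a≤2c))
        where
        a≤2c : a ≤ c + c
        a≤2c = (linear 1 (a< ⊹ ≤-reflexive (sym x+z)) (solve (a ▸ c ▸ x ▸ z ▸ ∅) (λ a c x z → x :+ z :+ (c :+ c) :+ a :+ con 1 := con 1 :+ a :+ (x :+ z) :+ (c :+ c)) refl))
        right : ∀ l → a + l ≡ c + c → Right
        right zero f = ⊥-elim (n≮0 (linear {a = 1} {b = 0} 0 (≤-reflexive (sym f) ⊹ a< ⊹ ≤-reflexive (sym x+z)) (solve (a ▸ c ▸ x ▸ z ▸ ∅) (λ a c x z → a :+ con 0 :+ (x :+ z :+ (c :+ c)) :+ con 1 :+ con 0 := c :+ c :+ (con 1 :+ a :+ (x :+ z)) :+ con 0) refl)))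
        right (suc l) f = l , suc l + (d + d) ∸ (b + z) , l<c , f , g , proj₁ (up→segʳ f g c≤a u)
          where
          l<c : l < c
          l<c = (linear 0 (≤-reflexive f ⊹ c≤a) (solve (a ▸ c ▸ l ▸ ∅) (λ a c l → c :+ c :+ a :+ (con 1 :+ l) :+ con 0 := a :+ (con 1 :+ l) :+ c :+ c) refl))
          low : b + z ≤ suc l + (d + d)
          low = (linear 0 (≤-reflexive (sym f) ⊹ hi ⊹ ≤-reflexive (sym x+z) ⊹ ≤-reflexive (sym y+z)) (solve (a ▸ b ▸ c ▸ d ▸ l ▸ x ▸ y ▸ z ▸ ∅) (λ a b c d l x y z → a :+ (con 1 :+ l) :+ (x :+ y :+ z :+ (c :+ c :+ (con 1 :+ (d :+ d)))) :+ (b :+ z) :+ con 0 := c :+ c :+ (con 1 :+ (a :+ b) :+ (x :+ z :+ (y :+ z))) :+ (con 1 :+ l :+ (d :+ d))) refl))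
          g : b + (z + (suc l + (d + d) ∸ (b + z))) ≡ suc l + (d + d)
          g = trans (sym (+-assoc b z (suc l + (d + d) ∸ (b + z)))) (m+[n∸m]≡n low)

  module Colours (τ : ℕ → ℕ → Fin 3) where

    -- The rotation preserves directions, so the colour of a down-triangle of the left half is the
    -- direction of its image, an up-triangle of the right half, and `κ̂` reads `τ` there. Missing
    -- positions count as matched across their line.
    χ̂ κ̂ : ℕ → ℕ → Fin 3
    χ̂ a p with seg? a p
    ... | yes _ = τ a (z + p ∸ a)
    ... | no  _ = 1F
    κ̂ l p with seg? l p
    ... | yes _ = τ (c + c ∸ l) (l + (d + d) ∸ (z + p))
    ... | no  _ = 1F

    χ̂-hole : ∀ {a p} → ¬ Seg a p → χ̂ a p ≡ 1F
    χ̂-hole {a} {p} ¬s with seg? a p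
    ... | yes s = ⊥-elim (¬s s)
    ... | no  _ = refl

    κ̂-hole : ∀ {l p} → ¬ Seg l p → κ̂ l p ≡ 1F
    κ̂-hole {l} {p} ¬s with seg? l p
    ... | yes s = ⊥-elim (¬s s)
    ... | no  _ = refl

    χ̂-seg : ∀ {a b p} → a + b ≡ z + p → Seg a p → χ̂ a p ≡ τ a b
    χ̂-seg {a} {b} {p} e s with seg? a p
    ... | yes _ = cong (τ a) (trans (cong (_∸ a) (sym e)) (m+n∸m≡n a b))
    ... | no ¬s = ⊥-elim (¬s s)

    κ̂-seg : ∀ {a b l p} → a + l ≡ c + c → b + (z + p) ≡ l + (d + d) → Seg l p → κ̂ l p ≡ τ a b
    κ̂-seg {a} {b} {l} {p} e f s with seg? l p
    ... | yes _ = cong₂ τ (trans (cong (_∸ l) (sym e)) (m+n∸n≡m a l)) (trans (cong (_∸ (z + p)) (sym f)) (m+n∸n≡m b (z + p)))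
    ... | no ¬s = ⊥-elim (¬s s)

    χ̂-Seg : ∀ {a p} → χ̂ a p ≢ 1F → Seg a p
    χ̂-Seg {a} {p} ne with seg? a p
    ... | yes s = s
    ... | no  _ = ⊥-elim (ne refl)

    κ̂-Seg : ∀ {l p} → κ̂ l p ≢ 1F → Seg l p
    κ̂-Seg {l} {p} ne with seg? l p
    ... | yes s = s
    ... | no  _ = ⊥-elim (ne refl)

    row : ℕ → List ℕ
    -- No lozenge crosses the side a = 0 of the hexagon.
    row zero    = []
    row (suc l) = ones (κ̂ (suc l)) (ival 0 (suc (y + l)))

    row-sorted : ∀ l → Sorted (row l)
    row-sorted zero    = []
    row-sorted (suc l) = filter-sorted (λ p → κ̂ (suc l) p ≟ᶠ 1F) (ival-sorted 0 (suc (y + l)))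

    ∈-row⁺ : ∀ {l p} → p ≤ y + l → κ̂ (suc l) p ≡ 1F → p ∈ row (suc l)
    ∈-row⁺ {l} {p} le e = ∈-filter⁺ (λ p → κ̂ (suc l) p ≟ᶠ 1F) (∈-ival⁺ 0 (suc (y + l)) z≤n (subst (p <_) (sym (+-identityʳ (suc (y + l)))) (s≤s le))) e

    ∈-row⁻ : ∀ {l p} → p ∈ row (suc l) → p ≤ y + l × κ̂ (suc l) p ≡ 1F
    ∈-row⁻ {l} {p} p∈ with ∈-filter⁻ (λ p → κ̂ (suc l) p ≟ᶠ 1F) p∈
    ... | q , e = s≤s⁻¹ (subst (p <_) (+-identityʳ (suc (y + l))) (proj₂ (∈-ival⁻ 0 (suc (y + l)) q))) , e

  module Decode (τ : ℕ → ℕ → Fin 3) (sy : Symmetric τ) where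

    open Colours τ

    leftCell : ∀ {a p} → a < c → Seg a p → ∃ λ b → a + b ≡ z + p × Up a b × χ̂ a p ≡ τ a b
    leftCell a<c s with leftUp a<c s
    ... | b , e , u = b , e , u , χ̂-seg e s

    rightCell : ∀ {l p} → 0 < l → l ≤ c → Seg l p →
                ∃ λ a → ∃ λ b → a + l ≡ c + c × b + (z + p) ≡ l + (d + d) × Up a b × κ̂ l p ≡ τ a b
    rightCell 0<l l≤c s with rightUp 0<l l≤c s
    ... | a , b , e , f , u = a , b , e , f , u , κ̂-seg e f s

    -- The symmetry supplies the image of the matched down-triangle, with the same direction; that
    -- direction is by definition the colour `κ̂` of the down-triangle. The other directions, and
    -- the way back from downs to ups, follow the same pattern.
    left-0 : ∀ {a p} → a < c → χ̂ a p ≡ 0F → κ̂ (suc a) (suc p) ≡ 0F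
    left-0 {a} {p} a<c χ≡ with leftCell a<c (χ̂-Seg (λ e → clash e χ≡ (λ ())))
    ... | b , e , u , v with sy u | trans (sym v) χ≡
    ...   | a′ , b′ , pr , u′ , τ≡ | τ≡0 rewrite τ≡0 with pr
    ...     | partner₀ f g = trans (κ̂-seg l₁ l₂ (proj₁ (up→segʳ l₁ l₂ l₃ u′))) τ≡
      where
      l₁ : a′ + suc a ≡ c + c
      l₁ = (≤-antisym (linear 0 (≤-reflexive f) (solve (a ▸ a′ ▸ c ▸ ∅) (λ a a′ c → c :+ c :+ (a′ :+ (con 1 :+ a)) :+ con 0 := con 1 :+ (a :+ a′) :+ (c :+ c)) refl)) (linear 0 (≤-reflexive (sym f)) (solve (a ▸ a′ ▸ c ▸ ∅) (λ a a′ c → con 1 :+ (a :+ a′) :+ (c :+ c) :+ con 0 := c :+ c :+ (a′ :+ (con 1 :+ a))) refl)))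
      l₂ : b′ + (z + suc p) ≡ suc a + (d + d)
      l₂ = (≤-antisym (linear 0 (≤-reflexive g ⊹ ≤-reflexive (sym e)) (solve (a ▸ b ▸ b′ ▸ d ▸ p ▸ z ▸ ∅) (λ a b b′ d p z → d :+ d :+ (a :+ b) :+ (b′ :+ (z :+ (con 1 :+ p))) :+ con 0 := b :+ b′ :+ (z :+ p) :+ (con 1 :+ a :+ (d :+ d))) refl)) (linear 0 (≤-reflexive (sym g) ⊹ ≤-reflexive e) (solve (a ▸ b ▸ b′ ▸ d ▸ p ▸ z ▸ ∅) (λ a b b′ d p z → b :+ b′ :+ (z :+ p) :+ (con 1 :+ a :+ (d :+ d)) :+ con 0 := d :+ d :+ (a :+ b) :+ (b′ :+ (z :+ (con 1 :+ p)))) refl)))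
      l₃ : c ≤ a′
      l₃ = (linear 0 (≤-reflexive (sym f) ⊹ a<c) (solve (a ▸ a′ ▸ c ▸ ∅) (λ a a′ c → con 1 :+ (a :+ a′) :+ c :+ c :+ con 0 := c :+ c :+ (con 1 :+ a) :+ a′) refl))

    left-2 : ∀ {a p} → a < c → χ̂ a p ≡ 2F → κ̂ (suc a) p ≡ 2F
    left-2 {a} {p} a<c χ≡ with leftCell a<c (χ̂-Seg (λ e → clash e χ≡ (λ ())))
    ... | b , e , u , v with sy u | trans (sym v) χ≡
    ...   | a′ , b′ , pr , u′ , τ≡ | τ≡2 rewrite τ≡2 with pr
    ...     | partner₂ f g = trans (κ̂-seg l₁ l₂ (proj₁ (up→segʳ l₁ l₂ l₃ u′))) τ≡
      where
      l₁ : a′ + suc a ≡ c + c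
      l₁ = (≤-antisym (linear 0 (≤-reflexive f) (solve (a ▸ a′ ▸ c ▸ ∅) (λ a a′ c → c :+ c :+ (a′ :+ (con 1 :+ a)) :+ con 0 := con 1 :+ (a :+ a′) :+ (c :+ c)) refl)) (linear 0 (≤-reflexive (sym f)) (solve (a ▸ a′ ▸ c ▸ ∅) (λ a a′ c → con 1 :+ (a :+ a′) :+ (c :+ c) :+ con 0 := c :+ c :+ (a′ :+ (con 1 :+ a))) refl)))
      l₂ : b′ + (z + p) ≡ suc a + (d + d)
      l₂ = (≤-antisym (linear 0 (≤-reflexive g ⊹ ≤-reflexive (sym e)) (solve (a ▸ b ▸ b′ ▸ d ▸ p ▸ z ▸ ∅) (λ a b b′ d p z → con 1 :+ (d :+ d) :+ (a :+ b) :+ (b′ :+ (z :+ p)) :+ con 0 := b :+ b′ :+ (z :+ p) :+ (con 1 :+ a :+ (d :+ d))) refl)) (linear 0 (≤-reflexive (sym g) ⊹ ≤-reflexive e) (solve (a ▸ b ▸ b′ ▸ d ▸ p ▸ z ▸ ∅) (λ a b b′ d p z → b :+ b′ :+ (z :+ p) :+ (con 1 :+ a :+ (d :+ d)) :+ con 0 := con 1 :+ (d :+ d) :+ (a :+ b) :+ (b′ :+ (z :+ p))) refl)))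
      l₃ : c ≤ a′
      l₃ = (linear 0 (≤-reflexive (sym f) ⊹ a<c) (solve (a ▸ a′ ▸ c ▸ ∅) (λ a a′ c → con 1 :+ (a :+ a′) :+ c :+ c :+ con 0 := c :+ c :+ (con 1 :+ a) :+ a′) refl))

    right-0 : ∀ {a p} → a < c → κ̂ (suc a) p ≡ 0F → ∃ λ p′ → p ≡ suc p′ × χ̂ a p′ ≡ 0F
    right-0 {a} {p} a<c κ≡ with rightCell (s≤s z≤n) a<c (κ̂-Seg (λ e → clash e κ≡ (λ ())))
    ... | a′ , b′ , e₁ , e₂ , u , v with sy u | trans (sym v) κ≡
    ...   | a″ , b , pr , u′ , τ≡ | τ≡0 rewrite τ≡0 with pr
    ...     | partner₀ f g with +-cancelˡ-≡ a′ a″ a l₁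
      where
      l₁ : a′ + a″ ≡ a′ + a
      l₁ = (≤-antisym (linear 0 (≤-reflexive f ⊹ ≤-reflexive (sym e₁)) (solve (a ▸ a′ ▸ a″ ▸ c ▸ ∅) (λ a a′ a″ c → c :+ c :+ (a′ :+ (con 1 :+ a)) :+ (a′ :+ a″) :+ con 0 := con 1 :+ (a′ :+ a″) :+ (c :+ c) :+ (a′ :+ a)) refl)) (linear 0 (≤-reflexive (sym f) ⊹ ≤-reflexive e₁) (solve (a ▸ a′ ▸ a″ ▸ c ▸ ∅) (λ a a′ a″ c → con 1 :+ (a′ :+ a″) :+ (c :+ c) :+ (a′ :+ a) :+ con 0 := c :+ c :+ (a′ :+ (con 1 :+ a)) :+ (a′ :+ a″)) refl)))
    ...       | refl with p
    -- For p = 0 the up-triangle would lie below the side a + b = z.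
    ...         | zero = ⊥-elim (n≮0 (linear {a = 1} {b = 0} 0 (lo ⊹ ≤-reflexive (sym e₂) ⊹ ≤-reflexive g) (solve (a ▸ b ▸ b′ ▸ d ▸ z ▸ ∅) (λ a b b′ d z → a :+ b :+ (b′ :+ (z :+ con 0) :+ (d :+ d)) :+ con 1 :+ con 0 := z :+ (con 1 :+ a :+ (d :+ d) :+ (b′ :+ b)) :+ con 0) refl)))
      where lo = Up.lo u′
    ...         | suc p′ = p′ , refl , trans (χ̂-seg l₂ (up→seg l₂ a<c u′)) τ≡
      where
      l₂ : a + b ≡ z + p′
      l₂ = (≤-antisym (linear 0 (≤-reflexive g ⊹ ≤-reflexive (sym e₂)) (solve (a ▸ b ▸ b′ ▸ d ▸ p′ ▸ z ▸ ∅) (λ a b b′ d p′ z → d :+ d :+ (b′ :+ (z :+ (con 1 :+ p′))) :+ (a :+ b) :+ con 0 := b′ :+ b :+ (con 1 :+ a :+ (d :+ d)) :+ (z :+ p′)) refl)) (linear 0 (≤-reflexive (sym g) ⊹ ≤-reflexive e₂) (solve (a ▸ b ▸ b′ ▸ d ▸ p′ ▸ z ▸ ∅) (λ a b b′ d p′ z → b′ :+ b :+ (con 1 :+ a :+ (d :+ d)) :+ (z :+ p′) :+ con 0 := d :+ d :+ (b′ :+ (z :+ (con 1 :+ p′))) :+ (a :+ b)) refl)))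

    right-2 : ∀ {a p} → a < c → κ̂ (suc a) p ≡ 2F → χ̂ a p ≡ 2F
    right-2 {a} {p} a<c κ≡ with rightCell (s≤s z≤n) a<c (κ̂-Seg (λ e → clash e κ≡ (λ ())))
    ... | a′ , b′ , e₁ , e₂ , u , v with sy u | trans (sym v) κ≡
    ...   | a″ , b , pr , u′ , τ≡ | τ≡2 rewrite τ≡2 with pr
    ...     | partner₂ f g with +-cancelˡ-≡ a′ a″ a l₁
      where
      l₁ : a′ + a″ ≡ a′ + a
      l₁ = (≤-antisym (linear 0 (≤-reflexive f ⊹ ≤-reflexive (sym e₁)) (solve (a ▸ a′ ▸ a″ ▸ c ▸ ∅) (λ a a′ a″ c → c :+ c :+ (a′ :+ (con 1 :+ a)) :+ (a′ :+ a″) :+ con 0 := con 1 :+ (a′ :+ a″) :+ (c :+ c) :+ (a′ :+ a)) refl)) (linear 0 (≤-reflexive (sym f) ⊹ ≤-reflexive e₁) (solve (a ▸ a′ ▸ a″ ▸ c ▸ ∅) (λ a a′ a″ c → con 1 :+ (a′ :+ a″) :+ (c :+ c) :+ (a′ :+ a) :+ con 0 := c :+ c :+ (a′ :+ (con 1 :+ a)) :+ (a′ :+ a″)) refl)))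
    ...       | refl = trans (χ̂-seg l₂ (up→seg l₂ a<c u′)) τ≡
      where
      l₂ : a + b ≡ z + p
      l₂ = (≤-antisym (linear 0 (≤-reflexive g ⊹ ≤-reflexive (sym e₂)) (solve (a ▸ b ▸ b′ ▸ d ▸ p ▸ z ▸ ∅) (λ a b b′ d p z → con 1 :+ (d :+ d) :+ (b′ :+ (z :+ p)) :+ (a :+ b) :+ con 0 := b′ :+ b :+ (con 1 :+ a :+ (d :+ d)) :+ (z :+ p)) refl)) (linear 0 (≤-reflexive (sym g) ⊹ ≤-reflexive e₂) (solve (a ▸ b ▸ b′ ▸ d ▸ p ▸ z ▸ ∅) (λ a b b′ d p z → b′ :+ b :+ (con 1 :+ a :+ (d :+ d)) :+ (z :+ p) :+ con 0 := con 1 :+ (d :+ d) :+ (b′ :+ (z :+ p)) :+ (a :+ b)) refl)))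

    -- Direction 1 crosses the line a, so the strip to its left sees the same position matched
    -- outside. On the line a = 0 the rotated partner would leave the hexagon.
    left-1 : ∀ {a p} → a < c → Seg a p → χ̂ a p ≡ 1F → 0 < a × κ̂ a p ≡ 1F
    left-1 {a} {p} a<c s χ≡ with leftCell a<c s
    ... | b , e , u , v with sy u | trans (sym v) χ≡
    ...   | a′ , b′ , pr , u′ , τ≡ | τ≡1 rewrite τ≡1 with pr
    ...     | partner₁ f g = (linear 0 (≤-reflexive (sym f) ⊹ a< ⊹ ≤-reflexive (sym x+z)) (solve (a ▸ a′ ▸ c ▸ x ▸ z ▸ ∅) (λ a a′ c x z → a :+ a′ :+ (x :+ z :+ (c :+ c)) :+ con 1 :+ con 0 := c :+ c :+ (con 1 :+ a′ :+ (x :+ z)) :+ a) refl)) , trans (κ̂-seg l₁ l₂ s) τ≡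
      where
      a< = Up.a< u′
      l₁ : a′ + a ≡ c + c
      l₁ = (≤-antisym (linear 0 (≤-reflexive f) (solve (a ▸ a′ ▸ c ▸ ∅) (λ a a′ c → c :+ c :+ (a′ :+ a) :+ con 0 := a :+ a′ :+ (c :+ c)) refl)) (linear 0 (≤-reflexive (sym f)) (solve (a ▸ a′ ▸ c ▸ ∅) (λ a a′ c → a :+ a′ :+ (c :+ c) :+ con 0 := c :+ c :+ (a′ :+ a)) refl)))
      l₂ : b′ + (z + p) ≡ a + (d + d)
      l₂ = (≤-antisym (linear 0 (≤-reflexive g ⊹ ≤-reflexive (sym e)) (solve (a ▸ b ▸ b′ ▸ d ▸ p ▸ z ▸ ∅) (λ a b b′ d p z → d :+ d :+ (a :+ b) :+ (b′ :+ (z :+ p)) :+ con 0 := b :+ b′ :+ (z :+ p) :+ (a :+ (d :+ d))) refl)) (linear 0 (≤-reflexive (sym g) ⊹ ≤-reflexive e) (solve (a ▸ b ▸ b′ ▸ d ▸ p ▸ z ▸ ∅) (λ a b b′ d p z → b :+ b′ :+ (z :+ p) :+ (a :+ (d :+ d)) :+ con 0 := d :+ d :+ (a :+ b) :+ (b′ :+ (z :+ p))) refl)))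

    right-1 : ∀ {a p} → 0 < a → a < c → Seg a p → κ̂ a p ≡ 1F → χ̂ a p ≡ 1F
    right-1 {a} {p} 0<a a<c s κ≡ with rightCell 0<a (<⇒≤ a<c) s
    ... | a′ , b′ , e₁ , e₂ , u , v with sy u | trans (sym v) κ≡
    ...   | a″ , b , pr , u′ , τ≡ | τ≡1 rewrite τ≡1 with pr
    ...     | partner₁ f g with +-cancelˡ-≡ a′ a″ a (trans f (sym e₁))
    ...       | refl = trans (χ̂-seg l₂ s) τ≡
      where
      l₂ : a + b ≡ z + p
      l₂ = (≤-antisym (linear 0 (≤-reflexive g ⊹ ≤-reflexive (sym e₂)) (solve (a ▸ b ▸ b′ ▸ d ▸ p ▸ z ▸ ∅) (λ a b b′ d p z → d :+ d :+ (b′ :+ (z :+ p)) :+ (a :+ b) :+ con 0 := b′ :+ b :+ (a :+ (d :+ d)) :+ (z :+ p)) refl)) (linear 0 (≤-reflexive (sym g) ⊹ ≤-reflexive e₂) (solve (a ▸ b ▸ b′ ▸ d ▸ p ▸ z ▸ ∅) (λ a b b′ d p z → b′ :+ b :+ (a :+ (d :+ d)) :+ (z :+ p) :+ con 0 := d :+ d :+ (b′ :+ (z :+ p)) :+ (a :+ b)) refl)))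

    -- The image of a lozenge across the middle line crosses that line again, at the position
    -- reflected in p₀.
    top-1 : ∀ {p p′} → 0 < c → p + p′ ≡ p₀ + p₀ → Seg c p → κ̂ c p ≡ 1F → Seg c p′ × κ̂ c p′ ≡ 1F
    top-1 {p} {p′} 0<c pp s κ≡ with rightCell 0<c ≤-refl s
    ... | a′ , b′ , e₁ , e₂ , u , v with sy u | trans (sym v) κ≡
    ...   | a″ , b , pr , u′ , τ≡ | τ≡1 rewrite τ≡1 with pr
    ...     | partner₁ f g = s′ , trans (κ̂-seg l₁ l₂ s′) τ≡
      where
      l₁ : a″ + c ≡ c + c
      l₁ = (≤-antisym (linear 0 (≤-reflexive f ⊹ ≤-reflexive (sym e₁)) (solve (a′ ▸ a″ ▸ c ▸ ∅) (λ a′ a″ c → c :+ c :+ (a′ :+ c) :+ (a″ :+ c) :+ con 0 := a′ :+ a″ :+ (c :+ c) :+ (c :+ c)) refl)) (linear 0 (≤-reflexive (sym f) ⊹ ≤-reflexive e₁) (solve (a′ ▸ a″ ▸ c ▸ ∅) (λ a′ a″ c → a′ :+ a″ :+ (c :+ c) :+ (c :+ c) :+ con 0 := c :+ c :+ (a′ :+ c) :+ (a″ :+ c)) refl)))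
      l₂ : b + (z + p′) ≡ c + (d + d)
      l₂ = (≤-antisym (linear 0 (≤-reflexive g ⊹ ≤-reflexive (sym e₂) ⊹ ≤-reflexive pp ⊹ ≤-reflexive c+d ⊹ ≤-reflexive c+d) (solve (b ▸ b′ ▸ c ▸ d ▸ p ▸ p′ ▸ p₀ ▸ z ▸ ∅) (λ b b′ c d p p′ p₀ z → d :+ d :+ (b′ :+ (z :+ p) :+ (p₀ :+ p₀ :+ (c :+ d :+ (c :+ d)))) :+ (b :+ (z :+ p′)) :+ con 0 := b′ :+ b :+ (c :+ (d :+ d) :+ (p :+ p′ :+ (p₀ :+ z :+ (p₀ :+ z)))) :+ (c :+ (d :+ d))) refl)) (linear 0 (≤-reflexive (sym g) ⊹ ≤-reflexive e₂ ⊹ ≤-reflexive (sym pp) ⊹ ≤-reflexive (sym c+d) ⊹ ≤-reflexive (sym c+d)) (solve (b ▸ b′ ▸ c ▸ d ▸ p ▸ p′ ▸ p₀ ▸ z ▸ ∅) (λ b b′ c d p p′ p₀ z → b′ :+ b :+ (c :+ (d :+ d) :+ (p :+ p′ :+ (p₀ :+ z :+ (p₀ :+ z)))) :+ (c :+ (d :+ d)) :+ con 0 := d :+ d :+ (b′ :+ (z :+ p) :+ (p₀ :+ p₀ :+ (c :+ d :+ (c :+ d)))) :+ (b :+ (z :+ p′))) refl)))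
      l₃ : c ≤ a″
      l₃ = (linear 0 (≤-reflexive (sym f) ⊹ ≤-reflexive e₁) (solve (a′ ▸ a″ ▸ c ▸ ∅) (λ a′ a″ c → a′ :+ a″ :+ (c :+ c) :+ c :+ con 0 := c :+ c :+ (a′ :+ c) :+ a″) refl))
      s′ : Seg c p′
      s′ = proj₁ (up→segʳ l₁ l₂ l₃ u′)

-- From a symmetric tiling to interlacing rows

module DecodedRows (x y z k c d p₀ : ℕ) (x+z : c + c ≡ x + z) (y+z : suc (d + d) ≡ y + z) (c+d : p₀ + z ≡ c + d) (k≤c : k ≤ c) where

  open LinearArithmetic
  open Summation
  open Enumeration
  open ListCounting
  open Strip
  open Geometry x y z k c d p₀ x+z y+z c+d k≤c

  module _ (τ : ℕ → ℕ → Fin 3) (sy : Symmetric τ) where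

    open Colours τ
    open Decode τ sy

    -- At the two ends of the strip, a down of the excluded colour would be matched with an
    -- up-triangle outside the region.
    coloured : ∀ {a} → a < c → Coloured (χ̂ a) (κ̂ (suc a)) (y + a)
    coloured {a} a<c = record
      { next⇒ = λ _ → left-0 a<c
      ; next⇐ = λ _ e → let (p′ , eq , χ≡) = right-0 a<c e in trans (cong (χ̂ a) (suc-injective eq)) χ≡
      ; same⇒ = λ _ → left-2 a<c
      ; same⇐ = λ _ → right-2 a<c
      ; first = λ e → let (p′ , eq , _) = right-0 a<c e in 0≢1+n eq
      ; last  = λ e → <-irrefl refl (Seg.in< (χ̂-Seg {a} (λ e′ → clash (right-2 a<c e) e′ (λ ()))))
      }

    ones-cong : ∀ {f g} ps → (∀ {p} → p ∈ ps → (f p ≡ 1F → g p ≡ 1F) × (g p ≡ 1F → f p ≡ 1F)) → ones f ps ≡ ones g ps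
    ones-cong             []       h = refl
    ones-cong {f} {g} (p ∷ ps) h with f p ≟ᶠ 1F
    ... | yes e = trans (cong (p ∷_) (ones-cong ps (λ q → h (there q)))) (sym (filter-accept (λ p → g p ≟ᶠ 1F) (proj₁ (h (here refl)) e)))
    ... | no ¬e = trans (ones-cong ps (λ q → h (there q))) (sym (filter-reject (λ p → g p ≟ᶠ 1F) (λ e → ¬e (proj₂ (h (here refl)) e))))

    ones-none : ∀ {f} ps → (∀ {p} → p ∈ ps → f p ≢ 1F) → ones f ps ≡ []
    ones-none             []       h = refl
    ones-none {f} (p ∷ ps) h = trans (filter-reject (λ p → f p ≟ᶠ 1F) (h (here refl))) (ones-none ps (λ q → h (there q)))

    -- A lozenge across the line a is seen from both sides: as an up matched outside in the strip to
    -- the right and as a down matched outside in the strip to the left. Missing positions have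
    -- colour 1 on both sides.
    ups-row : ∀ {a} → a < c → ones (χ̂ a) (ival 0 (y + a)) ≡ row a
    ups-row {zero} a<c = ones-none (ival 0 (y + 0)) no-first
      where
      no-first : ∀ {p} → p ∈ ival 0 (y + 0) → χ̂ 0 p ≢ 1F
      no-first {p} p∈ e = <-irrefl refl (proj₁ (left-1 a<c (seg-first (subst (p <_) (trans (+-identityʳ (y + 0)) (+-identityʳ y)) (proj₂ (∈-ival⁻ 0 (y + 0) p∈)))) e))
    ups-row {suc a} a<c = trans (ones-cong (ival 0 (y + suc a)) (λ {p} _ → agree p (seg? (suc a) p))) (cong (λ n → ones (κ̂ (suc a)) (ival 0 n)) (+-suc y a))
      where
      agree : ∀ p → Dec (Seg (suc a) p) → (χ̂ (suc a) p ≡ 1F → κ̂ (suc a) p ≡ 1F) × (κ̂ (suc a) p ≡ 1F → χ̂ (suc a) p ≡ 1F)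
      agree p (yes s) = (λ e → proj₂ (left-1 a<c s e)) , right-1 (s≤s z≤n) a<c s
      agree p (no ¬s) = (λ _ → κ̂-hole ¬s) , (λ _ → χ̂-hole ¬s)

    chain : ∀ {a} → a < c → row a ∈ inter (row (suc a)) ×
            (∀ {p} → (p < y + a → χ̂ a p ≡ χD (row (suc a)) (row a) p) × (p ≤ y + a → κ̂ (suc a) p ≡ κD (row (suc a)) (row a) p))
    chain {a} a<c =
      subst (_∈ inter (row (suc a))) (ups-row a<c) (proj₁ strip) ,
      λ {p} → (λ lt → trans (proj₁ (proj₂ strip z≤n) lt) (cong (λ t → χD (row (suc a)) t p) (ups-row a<c)))
            , (λ le → trans (proj₂ (proj₂ strip z≤n) le) (cong (λ t → κD (row (suc a)) t p) (ups-row a<c)))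
      where
      strip : GoalD (coloured a<c) (row (suc a)) (ones (χ̂ a) (ival 0 (y + a))) 0
      strip = strip-rows (coloured a<c)

    row-length : ∀ {a} → a ≤ c → length (row a) ≡ a
    row-length {zero}  _  = refl
    row-length {suc a} le = inter-length (row (suc a)) (proj₁ (chain le)) (row-length (<⇒≤ le))
      where
      inter-length : ∀ s {t n} → t ∈ inter s → length t ≡ n → length s ≡ suc n
      inter-length (s ∷ ss) t∈ refl = cong suc (sym (proj₁ (inter-sound s ss t∈)))

-- From interlacing rows to a symmetric tiling

module EncodedRows (x y z k c d p₀ : ℕ) (x+z : c + c ≡ x + z) (y+z : suc (d + d) ≡ y + z) (c+d : p₀ + z ≡ c + d) (k≤c : k ≤ c) where

  open LinearArithmetic
  open Summation
  open Enumeration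
  open ListCounting
  open Strip
  open Geometry x y z k c d p₀ x+z y+z c+d k≤c

  inter-sorted : ∀ s {t} → t ∈ inter s → Sorted t
  inter-sorted (s ∷ ss) t∈ = proj₁ (proj₂ (inter-sound s ss t∈))

  inter-bound : ∀ s {t B} → t ∈ inter s → (∀ {p} → p ∈ s → p < suc B) → ∀ {p} → p ∈ t → p < B
  inter-bound (s ∷ []) (here refl) _ ()
  inter-bound (s ∷ s′ ∷ ss) t∈ bd p∈ with ∈-consAll⁻ (range s s′) t∈
  inter-bound (s ∷ s′ ∷ ss) t∈ bd (here refl) | t₀ , t , t₀∈ , _ , refl =
    <-≤-trans (proj₂ (∈-range⁻ s s′ t₀∈)) (s≤s⁻¹ (bd (there (here refl))))
  inter-bound (s ∷ s′ ∷ ss) t∈ bd (there p∈)  | t₀ , t , _ , t∈′ , refl = inter-bound (s′ ∷ ss) t∈′ (λ q → bd (there q)) p∈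

  -- In the half-open range between the entries p and p + 1 only p fits.
  inter-consecutive : ∀ s {t} → Sorted s → t ∈ inter s → ∀ {p} → p ∈ s → suc p ∈ s → p ∈ t
  inter-consecutive (s ∷ []) so t∈ (here refl) (here ())
  inter-consecutive (s ∷ s′ ∷ ss) so t∈ p∈ q∈ with ∈-consAll⁻ (range s s′) t∈
  inter-consecutive (s ∷ s′ ∷ ss) so t∈ (here refl) (there (here refl)) | t₀ , t , t₀∈ , _ , refl with ∈-range⁻ s s′ t₀∈
  ... | le , lt = here (≤-antisym le (s≤s⁻¹ lt))
  inter-consecutive (s ∷ s′ ∷ ss) so t∈ (here refl) (there (there q∈))  | t₀ , t , t₀∈ , _ , refl =
    ⊥-elim (<⇒≱ (All.lookup (sorted-head (sorted-tail so)) q∈) (proj₁ (≤-pair so)))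
    where
    ≤-pair : Sorted (s ∷ s′ ∷ ss) → suc s ≤ s′ × s < s′
    ≤-pair (lt ∷ _) = lt , lt
  inter-consecutive (s ∷ s′ ∷ ss) so t∈ (there p∈) (here refl)          | _ , _ , _ , _ , refl =
    ⊥-elim (<-asym (All.lookup (sorted-head so) p∈) ≤-refl)
  inter-consecutive (s ∷ s′ ∷ ss) so t∈ (there p∈) (there q∈)           | _ , _ , _ , t∈′ , refl =
    there (inter-consecutive (s′ ∷ ss) (sorted-tail so) t∈′ p∈ q∈)

  -- The conditions under which rows come from a symmetric tiling. Only the last row refers to the
  -- region; interlacing carries its missing positions to the others.
  record Rows (r : ℕ → List ℕ) : Set where
    field
      chain  : ∀ {a} → a < c → r a ∈ inter (r (suc a))
      bottom : r 0 ≡ []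
      sorted : Sorted (r c)
      bound  : ∀ {p} → p ∈ r c → p < y + c
      holes  : ∀ {p} → p < y + c → ¬ Seg c p → p ∈ r c
      mirror : ∀ {p p′} → p + p′ ≡ p₀ + p₀ → p ∈ r c → Seg c p → p′ ∈ r c × Seg c p′

  module Colouring (r : ℕ → List ℕ) where

    -- Left up-triangles take the colours of the ups of their strip, right ones the colours of the
    -- downs of which they are the images.
    τ : ℕ → ℕ → Fin 3
    τ a b with a <? c
    ... | yes _ = χD (r (suc a)) (r a) (a + b ∸ z)
    ... | no  _ = κD (r (c + c ∸ a)) (r (pred (c + c ∸ a))) (c + c ∸ a + (d + d) ∸ (b + z))

    τ-left : ∀ {a b p} → a < c → a + b ≡ z + p → τ a b ≡ χD (r (suc a)) (r a) p
    τ-left {a} {b} {p} a<c e with a <? c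
    ... | yes _ = cong (χD (r (suc a)) (r a)) (trans (cong (_∸ z) e) (m+n∸m≡n z p))
    ... | no ≮  = ⊥-elim (≮ a<c)

    τ-right : ∀ {a b l p} → a + suc l ≡ c + c → b + (z + p) ≡ suc l + (d + d) → l < c → τ a b ≡ κD (r (suc l)) (r l) p
    τ-right {a} {b} {l} {p} e f l<c with a <? c
    ... | yes a<c = ⊥-elim (n≮0 (linear {a = 1} {b = 0} 0 (a<c ⊹ ≤-reflexive (sym e) ⊹ l<c) (solve (a ▸ c ▸ l ▸ ∅) (λ a c l → c :+ (a :+ (con 1 :+ l) :+ c) :+ con 1 :+ con 0 := con 1 :+ a :+ (c :+ c :+ (con 1 :+ l)) :+ con 0) refl)))
    ... | no  _   = trans (cong (λ s → κD (r s) (r (pred s)) (s + (d + d) ∸ (b + z))) (trans (cong (_∸ a) (sym e)) (m+n∸m≡n a (suc l))))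
                          (cong (κD (r (suc l)) (r l)) (trans (cong (_∸ (b + z)) (trans (sym f) (sym (+-assoc b z p)))) (m+n∸m≡n (b + z) p)))

  module Encode (r : ℕ → List ℕ) (rows : Rows r) where

    open Rows rows
    open Colouring r

    -- Rows interlacing a full run of positions contain all but one of it, so the forced positions
    -- of the last row fill the missing triangles.
    record Full (l : ℕ) : Set where
      constructor full
      field
        fsorted : Sorted (r l)
        fbound  : ∀ {p} → p ∈ r l → p < y + l
        fholes  : ∀ {p} → p < y + l → ¬ Seg l p → p ∈ r l

    descend : ∀ {l} → l < c → Full (suc l) → Full l
    descend {l} l<c (full so bd ho) = full
      (inter-sorted (r (suc l)) (chain l<c))
      (inter-bound (r (suc l)) (chain l<c) (λ {p} q → subst (p <_) (+-suc y l) (bd q)))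
      (λ {p} lt ¬s → inter-consecutive (r (suc l)) so (chain l<c)
        (ho {p} (linear 1 (lt) (solve (l ▸ p ▸ y ▸ ∅) (λ l p y → y :+ l :+ (con 1 :+ p) :+ con 1 := con 1 :+ p :+ (y :+ (con 1 :+ l))) refl)) (proj₁ (hole-step lt ¬s)))
        (ho {suc p} (linear 0 (lt) (solve (l ▸ p ▸ y ▸ ∅) (λ l p y → y :+ l :+ (con 1 :+ (con 1 :+ p)) :+ con 0 := con 1 :+ p :+ (y :+ (con 1 :+ l))) refl)) (proj₂ (hole-step lt ¬s))))

    allFull : ∀ e {l} → e + l ≡ c → Full l
    allFull zero    refl = full sorted bound holes
    allFull (suc e) {l} eq = descend (subst (l <_) eq (s≤s (m≤n+m l e))) (allFull e (trans (+-suc e l) eq))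

    full-at : ∀ {l} → l ≤ c → Full l
    full-at {l} le = allFull (c ∸ l) (m∸n+n≡m le)

    seg-of : ∀ {l p} → l ≤ c → p < y + l → p ∉ r l → Seg l p
    seg-of {l} {p} le lt p∉ with seg? l p
    ... | yes s = s
    ... | no ¬s = ⊥-elim (p∉ (Full.fholes (full-at le) lt ¬s))

    at : ∀ {a} → a < c → ∀ p → AtD (r (suc a)) (r a) p
    at a<c p = atD (Full.fsorted (full-at a<c)) (chain a<c) p

    Goal : ℕ → ℕ → Fin 3 → Set
    Goal a b i = ∃ λ a′ → ∃ λ b′ → Partner i a b a′ b′ × Up a′ b′ × τ a′ b′ ≡ i

    fromLeft : ∀ {a b p} → a < c → a + b ≡ z + p → Seg a p → ∀ i → χD (r (suc a)) (r a) p ≡ i → Goal a b i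
    fromLeft {a} {b} {p} a<c e s 0F χ≡ = go (rightUp (s≤s z≤n) a<c s′)
      where
      in< = Seg.in< s
      κ≡ : κD (r (suc a)) (r a) (suc p) ≡ 0F
      κ≡ = AtD.next⇒ (at a<c p) χ≡
      s′ : Seg (suc a) (suc p)
      s′ = seg-of a<c (linear 0 (in<) (solve (a ▸ p ▸ y ▸ ∅) (λ a p y → y :+ a :+ (con 1 :+ (con 1 :+ p)) :+ con 0 := con 1 :+ p :+ (y :+ (con 1 :+ a))) refl)) (λ q → clash κ≡ (AtD.κ⇐ (at a<c (suc p)) q) (λ ()))
      go : (∃ λ a′ → ∃ λ b′ → a′ + suc a ≡ c + c × b′ + (z + suc p) ≡ suc a + (d + d) × Up a′ b′) → Goal a b 0F
      go (a′ , b′ , f , g , u) = a′ , b′ , partner₀ f′ g′ , u , trans (τ-right f g a<c) κ≡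
        where
        f′ : suc (a + a′) ≡ c + c
        f′ = (≤-antisym (linear 0 (≤-reflexive f) (solve (a ▸ a′ ▸ c ▸ ∅) (λ a a′ c → c :+ c :+ (con 1 :+ (a :+ a′)) :+ con 0 := a′ :+ (con 1 :+ a) :+ (c :+ c)) refl)) (linear 0 (≤-reflexive (sym f)) (solve (a ▸ a′ ▸ c ▸ ∅) (λ a a′ c → a′ :+ (con 1 :+ a) :+ (c :+ c) :+ con 0 := c :+ c :+ (con 1 :+ (a :+ a′))) refl)))
        g′ : b + b′ ≡ d + d
        g′ = (≤-antisym (linear 0 (≤-reflexive g ⊹ ≤-reflexive e) (solve (a ▸ b ▸ b′ ▸ d ▸ p ▸ z ▸ ∅) (λ a b b′ d p z → con 1 :+ a :+ (d :+ d) :+ (z :+ p) :+ (b :+ b′) :+ con 0 := b′ :+ (z :+ (con 1 :+ p)) :+ (a :+ b) :+ (d :+ d)) refl)) (linear 0 (≤-reflexive (sym g) ⊹ ≤-reflexive (sym e)) (solve (a ▸ b ▸ b′ ▸ d ▸ p ▸ z ▸ ∅) (λ a b b′ d p z → b′ :+ (z :+ (con 1 :+ p)) :+ (a :+ b) :+ (d :+ d) :+ con 0 := con 1 :+ a :+ (d :+ d) :+ (z :+ p) :+ (b :+ b′)) refl)))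
    fromLeft {a} {b} {p} a<c e s 2F χ≡ = go (rightUp (s≤s z≤n) a<c s′)
      where
      in< = Seg.in< s
      κ≡ : κD (r (suc a)) (r a) p ≡ 2F
      κ≡ = AtD.same⇒ (at a<c p) χ≡
      s′ : Seg (suc a) p
      s′ = seg-of a<c (linear 1 (in<) (solve (a ▸ p ▸ y ▸ ∅) (λ a p y → y :+ a :+ (con 1 :+ p) :+ con 1 := con 1 :+ p :+ (y :+ (con 1 :+ a))) refl)) (λ q → clash κ≡ (AtD.κ⇐ (at a<c p) q) (λ ()))
      go : (∃ λ a′ → ∃ λ b′ → a′ + suc a ≡ c + c × b′ + (z + p) ≡ suc a + (d + d) × Up a′ b′) → Goal a b 2F
      go (a′ , b′ , f , g , u) = a′ , b′ , partner₂ f′ g′ , u , trans (τ-right f g a<c) κ≡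
        where
        f′ : suc (a + a′) ≡ c + c
        f′ = (≤-antisym (linear 0 (≤-reflexive f) (solve (a ▸ a′ ▸ c ▸ ∅) (λ a a′ c → c :+ c :+ (con 1 :+ (a :+ a′)) :+ con 0 := a′ :+ (con 1 :+ a) :+ (c :+ c)) refl)) (linear 0 (≤-reflexive (sym f)) (solve (a ▸ a′ ▸ c ▸ ∅) (λ a a′ c → a′ :+ (con 1 :+ a) :+ (c :+ c) :+ con 0 := c :+ c :+ (con 1 :+ (a :+ a′))) refl)))
        g′ : b + b′ ≡ suc (d + d)
        g′ = (≤-antisym (linear 0 (≤-reflexive g ⊹ ≤-reflexive e) (solve (a ▸ b ▸ b′ ▸ d ▸ p ▸ z ▸ ∅) (λ a b b′ d p z → con 1 :+ a :+ (d :+ d) :+ (z :+ p) :+ (b :+ b′) :+ con 0 := b′ :+ (z :+ p) :+ (a :+ b) :+ (con 1 :+ (d :+ d))) refl)) (linear 0 (≤-reflexive (sym g) ⊹ ≤-reflexive (sym e)) (solve (a ▸ b ▸ b′ ▸ d ▸ p ▸ z ▸ ∅) (λ a b b′ d p z → b′ :+ (z :+ p) :+ (a :+ b) :+ (con 1 :+ (d :+ d)) :+ con 0 := con 1 :+ a :+ (d :+ d) :+ (z :+ p) :+ (b :+ b′)) refl)))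
    fromLeft {zero} {b} {p} a<c e s 1F χ≡ with () ← subst (p ∈_) bottom (AtD.χ⇒ (at a<c p) χ≡)
    fromLeft {suc a} {b} {p} a<c e s 1F χ≡ = go (rightUp (s≤s z≤n) (<⇒≤ a<c) s)
      where
      κ≡ : κD (r (suc a)) (r a) p ≡ 1F
      κ≡ = AtD.κ⇐ (at (<⇒≤ a<c) p) (AtD.χ⇒ (at a<c p) χ≡)
      go : (∃ λ a′ → ∃ λ b′ → a′ + suc a ≡ c + c × b′ + (z + p) ≡ suc a + (d + d) × Up a′ b′) → Goal (suc a) b 1F
      go (a′ , b′ , f , g , u) = a′ , b′ , partner₁ f′ g′ , u , trans (τ-right f g (<⇒≤ a<c)) κ≡
        where
        f′ : suc a + a′ ≡ c + c
        f′ = (≤-antisym (linear 0 (≤-reflexive f) (solve (a ▸ a′ ▸ c ▸ ∅) (λ a a′ c → c :+ c :+ (con 1 :+ a :+ a′) :+ con 0 := a′ :+ (con 1 :+ a) :+ (c :+ c)) refl)) (linear 0 (≤-reflexive (sym f)) (solve (a ▸ a′ ▸ c ▸ ∅) (λ a a′ c → a′ :+ (con 1 :+ a) :+ (c :+ c) :+ con 0 := c :+ c :+ (con 1 :+ a :+ a′)) refl)))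
        g′ : b + b′ ≡ d + d
        g′ = (≤-antisym (linear 0 (≤-reflexive g ⊹ ≤-reflexive e) (solve (a ▸ b ▸ b′ ▸ d ▸ p ▸ z ▸ ∅) (λ a b b′ d p z → con 1 :+ a :+ (d :+ d) :+ (z :+ p) :+ (b :+ b′) :+ con 0 := b′ :+ (z :+ p) :+ (con 1 :+ a :+ b) :+ (d :+ d)) refl)) (linear 0 (≤-reflexive (sym g) ⊹ ≤-reflexive (sym e)) (solve (a ▸ b ▸ b′ ▸ d ▸ p ▸ z ▸ ∅) (λ a b b′ d p z → b′ :+ (z :+ p) :+ (con 1 :+ a :+ b) :+ (d :+ d) :+ con 0 := con 1 :+ a :+ (d :+ d) :+ (z :+ p) :+ (b :+ b′)) refl)))

    fromRight : ∀ {a b l p} → a + suc l ≡ c + c → b + (z + p) ≡ suc l + (d + d) → l < c → Seg (suc l) p →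
                ∀ i → κD (r (suc l)) (r l) p ≡ i → Goal a b i
    fromRight {l = l} {zero} f g l<c s 0F κ≡ = ⊥-elim (inter-first {r (suc l)} {r l} (chain l<c) κ≡)
    fromRight {a} {b} {l} {suc p} f g l<c s 0F κ≡ = go (leftUp l<c s′)
      where
      in< = Seg.in< s
      χ≡ : χD (r (suc l)) (r l) p ≡ 0F
      χ≡ = AtD.next⇐ (at l<c p) κ≡
      s′ : Seg l p
      s′ = seg-of (<⇒≤ l<c) (linear 0 (in<) (solve (l ▸ p ▸ y ▸ ∅) (λ l p y → y :+ (con 1 :+ l) :+ (con 1 :+ p) :+ con 0 := con 1 :+ (con 1 :+ p) :+ (y :+ l)) refl)) (λ q → clash χ≡ (AtD.χ⇐ (at l<c p) q) (λ ()))
      go : (∃ λ b′ → l + b′ ≡ z + p × Up l b′) → Goal a b 0F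
      go (b′ , e , u) = l , b′ , partner₀ f′ g′ , u , trans (τ-left l<c e) χ≡
        where
        f′ : suc (a + l) ≡ c + c
        f′ = (≤-antisym (linear 0 (≤-reflexive f) (solve (a ▸ c ▸ l ▸ ∅) (λ a c l → c :+ c :+ (con 1 :+ (a :+ l)) :+ con 0 := a :+ (con 1 :+ l) :+ (c :+ c)) refl)) (linear 0 (≤-reflexive (sym f)) (solve (a ▸ c ▸ l ▸ ∅) (λ a c l → a :+ (con 1 :+ l) :+ (c :+ c) :+ con 0 := c :+ c :+ (con 1 :+ (a :+ l))) refl)))
        g′ : b + b′ ≡ d + d
        g′ = (≤-antisym (linear 0 (≤-reflexive g ⊹ ≤-reflexive e) (solve (b ▸ b′ ▸ d ▸ l ▸ p ▸ z ▸ ∅) (λ b b′ d l p z → con 1 :+ l :+ (d :+ d) :+ (z :+ p) :+ (b :+ b′) :+ con 0 := b :+ (z :+ (con 1 :+ p)) :+ (l :+ b′) :+ (d :+ d)) refl)) (linear 0 (≤-reflexive (sym g) ⊹ ≤-reflexive (sym e)) (solve (b ▸ b′ ▸ d ▸ l ▸ p ▸ z ▸ ∅) (λ b b′ d l p z → b :+ (z :+ (con 1 :+ p)) :+ (l :+ b′) :+ (d :+ d) :+ con 0 := con 1 :+ l :+ (d :+ d) :+ (z :+ p) :+ (b :+ b′)) refl)))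
    fromRight {a} {b} {l} {p} f g l<c s 2F κ≡ = go (leftUp l<c s′)
      where
      χ≡ : χD (r (suc l)) (r l) p ≡ 2F
      χ≡ = AtD.same⇐ (at l<c p) κ≡
      -- A down of colour 2 has a row entry above it, so it is not the last of its strip and the up
      -- with the same index exists.
      next-in : (∃ λ q → q ∈ r (suc l) × p < q) → p < y + l
      next-in (q , q∈ , lt) = (linear 0 (lt ⊹ bd) (solve (l ▸ p ▸ q ▸ y ▸ ∅) (λ l p q y → q :+ (y :+ (con 1 :+ l)) :+ (con 1 :+ p) :+ con 0 := con 1 :+ p :+ (con 1 :+ q) :+ (y :+ l)) refl))
        where
        bd : q < y + suc l
        bd = Full.fbound (full-at l<c) q∈
      s′ : Seg l p
      s′ = seg-of (<⇒≤ l<c) (next-in (AtD.bound (at l<c p) κ≡)) (λ q → clash χ≡ (AtD.χ⇐ (at l<c p) q) (λ ()))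
      go : (∃ λ b′ → l + b′ ≡ z + p × Up l b′) → Goal a b 2F
      go (b′ , e , u) = l , b′ , partner₂ f′ g′ , u , trans (τ-left l<c e) χ≡
        where
        f′ : suc (a + l) ≡ c + c
        f′ = (≤-antisym (linear 0 (≤-reflexive f) (solve (a ▸ c ▸ l ▸ ∅) (λ a c l → c :+ c :+ (con 1 :+ (a :+ l)) :+ con 0 := a :+ (con 1 :+ l) :+ (c :+ c)) refl)) (linear 0 (≤-reflexive (sym f)) (solve (a ▸ c ▸ l ▸ ∅) (λ a c l → a :+ (con 1 :+ l) :+ (c :+ c) :+ con 0 := c :+ c :+ (con 1 :+ (a :+ l))) refl)))
        g′ : b + b′ ≡ suc (d + d)
        g′ = (≤-antisym (linear 0 (≤-reflexive g ⊹ ≤-reflexive e) (solve (b ▸ b′ ▸ d ▸ l ▸ p ▸ z ▸ ∅) (λ b b′ d l p z → con 1 :+ l :+ (d :+ d) :+ (z :+ p) :+ (b :+ b′) :+ con 0 := b :+ (z :+ p) :+ (l :+ b′) :+ (con 1 :+ (d :+ d))) refl)) (linear 0 (≤-reflexive (sym g) ⊹ ≤-reflexive (sym e)) (solve (b ▸ b′ ▸ d ▸ l ▸ p ▸ z ▸ ∅) (λ b b′ d l p z → b :+ (z :+ p) :+ (l :+ b′) :+ (con 1 :+ (d :+ d)) :+ con 0 := con 1 :+ l :+ (d :+ d) :+ (z :+ p) :+ (b :+ b′)) refl)))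
    fromRight {a} {b} {l} {p} f g l<c s 1F κ≡ = go (m≤n⇒m<n∨m≡n l<c)
      where
      p∈ : p ∈ r (suc l)
      p∈ = AtD.κ⇒ (at l<c p) κ≡
      go : suc l < c ⊎ suc l ≡ c → Goal a b 1F
      go (inj₁ lt) = finish (leftUp lt s)
        where
        finish : (∃ λ b′ → suc l + b′ ≡ z + p × Up (suc l) b′) → Goal a b 1F
        finish (b′ , e , u) = suc l , b′ , partner₁ f g′ , u , trans (τ-left lt e) (AtD.χ⇐ (at lt p) p∈)
          where
          g′ : b + b′ ≡ d + d
          g′ = (≤-antisym (linear 0 (≤-reflexive g ⊹ ≤-reflexive e) (solve (b ▸ b′ ▸ d ▸ l ▸ p ▸ z ▸ ∅) (λ b b′ d l p z → con 1 :+ l :+ (d :+ d) :+ (z :+ p) :+ (b :+ b′) :+ con 0 := b :+ (z :+ p) :+ (con 1 :+ l :+ b′) :+ (d :+ d)) refl)) (linear 0 (≤-reflexive (sym g) ⊹ ≤-reflexive (sym e)) (solve (b ▸ b′ ▸ d ▸ l ▸ p ▸ z ▸ ∅) (λ b b′ d l p z → b :+ (z :+ p) :+ (con 1 :+ l :+ b′) :+ (d :+ d) :+ con 0 := con 1 :+ l :+ (d :+ d) :+ (z :+ p) :+ (b :+ b′)) refl)))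
      -- On the middle line there is no further strip of the left half: the rotated partner is again
      -- a right up-triangle, and the mirror symmetry of the last row supplies it.
      go (inj₂ e) = finish (p₀ + p₀ ∸ p) (m+[n∸m]≡n (reflect-bound s₀))
        where
        s₀ : Seg c p
        s₀ = subst (λ l → Seg l p) e s
        finish : ∀ p′ → p + p′ ≡ p₀ + p₀ → Goal a b 1F
        finish p′ pp = close (mirror pp (subst (λ s → p ∈ r s) e p∈) s₀)
          where
          place : p′ ∈ r c → (∃ λ a′ → ∃ λ b′ → a′ + c ≡ c + c × b′ + (z + p′) ≡ c + (d + d) × Up a′ b′) → Goal a b 1F
          place q∈ (a′ , b′ , f₁ , g₁ , u) = a′ , b′ , partner₁ f′ g′ , u ,
            trans (τ-right (trans (cong (a′ +_) e) f₁) (trans g₁ (cong (_+ (d + d)) (sym e))) l<c)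
                  (AtD.κ⇐ (at l<c p′) (subst (λ s → p′ ∈ r s) (sym e) q∈))
            where
            f′ : a + a′ ≡ c + c
            f′ = (≤-antisym (linear 0 (≤-reflexive f ⊹ ≤-reflexive (sym e) ⊹ ≤-reflexive f₁) (solve (a ▸ a′ ▸ c ▸ l ▸ ∅) (λ a a′ c l → c :+ c :+ (con 1 :+ l :+ (c :+ c)) :+ (a :+ a′) :+ con 0 := a :+ (con 1 :+ l) :+ (c :+ (a′ :+ c)) :+ (c :+ c)) refl)) (linear 0 (≤-reflexive (sym f) ⊹ ≤-reflexive e ⊹ ≤-reflexive (sym f₁)) (solve (a ▸ a′ ▸ c ▸ l ▸ ∅) (λ a a′ c l → a :+ (con 1 :+ l) :+ (c :+ (a′ :+ c)) :+ (c :+ c) :+ con 0 := c :+ c :+ (con 1 :+ l :+ (c :+ c)) :+ (a :+ a′)) refl)))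
            g′ : b + b′ ≡ d + d
            g′ = (≤-antisym (linear 0 (≤-reflexive g ⊹ ≤-reflexive e ⊹ ≤-reflexive g₁ ⊹ ≤-reflexive (sym pp) ⊹ ≤-reflexive (sym c+d) ⊹ ≤-reflexive (sym c+d)) (solve (b ▸ b′ ▸ c ▸ d ▸ l ▸ p ▸ p′ ▸ p₀ ▸ z ▸ ∅) (λ b b′ c d l p p′ p₀ z → con 1 :+ l :+ (d :+ d) :+ (c :+ (c :+ (d :+ d) :+ (p :+ p′ :+ (p₀ :+ z :+ (p₀ :+ z))))) :+ (b :+ b′) :+ con 0 := b :+ (z :+ p) :+ (con 1 :+ l :+ (b′ :+ (z :+ p′) :+ (p₀ :+ p₀ :+ (c :+ d :+ (c :+ d))))) :+ (d :+ d)) refl)) (linear 0 (≤-reflexive (sym g) ⊹ ≤-reflexive (sym e) ⊹ ≤-reflexive (sym g₁) ⊹ ≤-reflexive pp ⊹ ≤-reflexive c+d ⊹ ≤-reflexive c+d) (solve (b ▸ b′ ▸ c ▸ d ▸ l ▸ p ▸ p′ ▸ p₀ ▸ z ▸ ∅) (λ b b′ c d l p p′ p₀ z → b :+ (z :+ p) :+ (con 1 :+ l :+ (b′ :+ (z :+ p′) :+ (p₀ :+ p₀ :+ (c :+ d :+ (c :+ d))))) :+ (d :+ d) :+ con 0 := con 1 :+ l :+ (d :+ d) :+ (c :+ (c :+ (d :+ d) :+ (p :+ p′ :+ (p₀ :+ z :+ (p₀ :+ z))))) :+ (b :+ b′)) refl)))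
          close : p′ ∈ r c × Seg c p′ → Goal a b 1F
          close (q∈ , s′) = place q∈ (rightUp (subst (0 <_) e (s≤s z≤n)) ≤-refl s′)

    symmetric : Symmetric τ
    symmetric {a} {b} u = go (locate u)
      where
      go : (∃ λ p → a < c × a + b ≡ z + p × Seg a p) ⊎
           (∃ λ l → ∃ λ p → l < c × a + suc l ≡ c + c × b + (z + p) ≡ suc l + (d + d) × Seg (suc l) p) → Goal a b (τ a b)
      go (inj₁ (p , a<c , e , s))         = fromLeft a<c e s (τ a b) (sym (τ-left a<c e))
      go (inj₂ (l , p , l<c , f , g , s)) = fromRight f g l<c s (τ a b) (sym (τ-right f g l<c))

-- The row on the middle line; m + e₁, m + e₂, q are the halves of x - k, z - k, y - k - 1

module TopRow (m q k e₁ e₂ x y z c d N c₀ p₀ : ℕ)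
  (x≡ : x ≡ m + e₁ + (m + e₁) + k) (y≡ : y ≡ suc (q + q + k)) (z≡ : z ≡ m + e₂ + (m + e₂) + k)
  (c≡ : c ≡ m + e₁ + (m + e₂) + k) (d≡ : d ≡ q + (m + e₂) + k)
  (N≡ : N ≡ m + (q + k)) (c₀≡ : c₀ ≡ e₁ + (m + q)) (p₀≡ : p₀ ≡ c₀ + k)
  (one-sided : e₁ ≡ 0 ⊎ e₂ ≡ 0) where

  open LinearArithmetic
  open Summation
  open Enumeration
  open ListCounting
  open Strip
  open SymmetricRows using (nest)
  open CountFormula using (length-nest; length-ival)

  x+z : c + c ≡ x + z
  x+z = (≤-antisym (linear 0 (≤-reflexive (sym x≡) ⊹ ≤-reflexive (sym z≡) ⊹ ≤-reflexive c≡ ⊹ ≤-reflexive c≡) (solve (c ▸ e₁ ▸ e₂ ▸ k ▸ m ▸ x ▸ z ▸ ∅) (λ c e₁ e₂ k m x z → x :+ (z :+ (m :+ e₁ :+ (m :+ e₂) :+ k :+ (m :+ e₁ :+ (m :+ e₂) :+ k))) :+ (c :+ c) :+ con 0 := m :+ e₁ :+ (m :+ e₁) :+ k :+ (m :+ e₂ :+ (m :+ e₂) :+ k :+ (c :+ c)) :+ (x :+ z)) refl)) (linear 0 (≤-reflexive x≡ ⊹ ≤-reflexive z≡ ⊹ ≤-reflexive (sym c≡) ⊹ ≤-reflexive (sym c≡)) (solve (c ▸ e₁ ▸ e₂ ▸ k ▸ m ▸ x ▸ z ▸ ∅) (λ c e₁ e₂ k m x z → m :+ e₁ :+ (m :+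 e₁) :+ k :+ (m :+ e₂ :+ (m :+ e₂) :+ k :+ (c :+ c)) :+ (x :+ z) :+ con 0 := x :+ (z :+ (m :+ e₁ :+ (m :+ e₂) :+ k :+ (m :+ e₁ :+ (m :+ e₂) :+ k))) :+ (c :+ c)) refl)))

  y+z : suc (d + d) ≡ y + z
  y+z = (≤-antisym (linear 0 (≤-reflexive (sym y≡) ⊹ ≤-reflexive (sym z≡) ⊹ ≤-reflexive d≡ ⊹ ≤-reflexive d≡) (solve (d ▸ e₂ ▸ k ▸ m ▸ q ▸ y ▸ z ▸ ∅) (λ d e₂ k m q y z → y :+ (z :+ (q :+ (m :+ e₂) :+ k :+ (q :+ (m :+ e₂) :+ k))) :+ (con 1 :+ (d :+ d)) :+ con 0 := con 1 :+ (q :+ q :+ k) :+ (m :+ e₂ :+ (m :+ e₂) :+ k :+ (d :+ d)) :+ (y :+ z)) refl)) (linear 0 (≤-reflexive y≡ ⊹ ≤-reflexive z≡ ⊹ ≤-reflexive (sym d≡) ⊹ ≤-reflexive (sym d≡)) (solve (d ▸ e₂ ▸ k ▸ m ▸ q ▸ y ▸ z ▸ ∅) (λ d e₂ k m q y z → con 1 :+ (q :+ q :+ k) :+ (m :+ e₂ :+ (m :+ e₂) :+ k :+ (d :+ d)) :+ (y :+ z) :+ con 0 := y :+ (z :+ (q :+ (m :+ e₂) :+ k :+ (q :+ (m :+ e₂) :+ k))) :+ (con 1 :+ (d :+ d))) refl)))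

  c+d : p₀ + z ≡ c + d
  c+d = (≤-antisym (linear 0 (≤-reflexive z≡ ⊹ ≤-reflexive (sym c≡) ⊹ ≤-reflexive (sym d≡) ⊹ ≤-reflexive c₀≡ ⊹ ≤-reflexive p₀≡) (solve (c ▸ c₀ ▸ d ▸ e₁ ▸ e₂ ▸ k ▸ m ▸ p₀ ▸ q ▸ z ▸ ∅) (λ c c₀ d e₁ e₂ k m p₀ q z → m :+ e₂ :+ (m :+ e₂) :+ k :+ (c :+ (d :+ (e₁ :+ (m :+ q) :+ (c₀ :+ k)))) :+ (p₀ :+ z) :+ con 0 := z :+ (m :+ e₁ :+ (m :+ e₂) :+ k :+ (q :+ (m :+ e₂) :+ k :+ (c₀ :+ p₀))) :+ (c :+ d)) refl)) (linear 0 (≤-reflexive (sym z≡) ⊹ ≤-reflexive c≡ ⊹ ≤-reflexive d≡ ⊹ ≤-reflexive (sym c₀≡) ⊹ ≤-reflexive (sym p₀≡)) (solve (c ▸ c₀ ▸ d ▸ e₁ ▸ e₂ ▸ k ▸ m ▸ p₀ ▸ q ▸ z ▸ ∅) (λ c c₀ d e₁ e₂ k m p₀ q z → z :+ (m :+ e₁ :+ (m :+ e₂) :+ k :+ (q :+ (m :+ e₂) :+ k :+ (c₀ :+ p₀))) :+ (c :+ d) :+ con 0 := m :+ e₂ :+ (m :+ e₂) :+ k :+ (c :+ (d :+ (e₁ :+ (m :+ q) :+ (c₀ :+ k)))) :+ (p₀ :+ z)) refl)))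

  k≤c : k ≤ c
  k≤c = (linear (e₁ + e₂ + m + m) (≤-reflexive (sym c≡)) (solve (c ▸ e₁ ▸ e₂ ▸ k ▸ m ▸ ∅) (λ c e₁ e₂ k m → c :+ k :+ (e₁ :+ e₂ :+ m :+ m) := m :+ e₁ :+ (m :+ e₂) :+ k :+ c) refl))

  open Geometry x y z k c d p₀ x+z y+z c+d k≤c
  open EncodedRows x y z k c d p₀ x+z y+z c+d k≤c

  lo hi : ℕ → ℕ
  lo i = c₀ ∸ suc i
  hi i = p₀ + suc (k + i)

  topRow : ℕ → List ℕ → List ℕ
  topRow κ C = ival 0 e₁ ++ nest lo hi C (ival c₀ κ) ++ ival (p₀ + suc N) e₂

  -- Both sides count the positions on the middle line.
  end : p₀ + suc N + e₂ ≡ y + c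
  end = (≤-antisym (linear 0 (≤-reflexive (sym y≡) ⊹ ≤-reflexive (sym c≡) ⊹ ≤-reflexive N≡ ⊹ ≤-reflexive c₀≡ ⊹ ≤-reflexive p₀≡) (solve (N ▸ c ▸ c₀ ▸ e₁ ▸ e₂ ▸ k ▸ m ▸ p₀ ▸ q ▸ y ▸ ∅) (λ N c c₀ e₁ e₂ k m p₀ q y → y :+ (c :+ (m :+ (q :+ k) :+ (e₁ :+ (m :+ q) :+ (c₀ :+ k)))) :+ (p₀ :+ (con 1 :+ N) :+ e₂) :+ con 0 := con 1 :+ (q :+ q :+ k) :+ (m :+ e₁ :+ (m :+ e₂) :+ k :+ (N :+ (c₀ :+ p₀))) :+ (y :+ c)) refl)) (linear 0 (≤-reflexive y≡ ⊹ ≤-reflexive c≡ ⊹ ≤-reflexive (sym N≡) ⊹ ≤-reflexive (sym c₀≡) ⊹ ≤-reflexive (sym p₀≡)) (solve (N ▸ c ▸ c₀ ▸ e₁ ▸ e₂ ▸ k ▸ m ▸ p₀ ▸ q ▸ y ▸ ∅) (λ N c c₀ e₁ e₂ k m p₀ q y → con 1 :+ (q :+ q :+ k) :+ (m :+ e₁ :+ (m :+ e₂) :+ k :+ (N :+ (c₀ :+ p₀))) :+ (y :+ c) :+ con 0 := y :+ (c :+ (m :+ (q :+ k) :+ (e₁ :+ (m :+ q) :+ (c₀ :+ k)))) :+ (p₀ :+ (con 1 :+ N) :+ e₂)) refl)))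

  -- At each end either a side of the hexagon or the end of the line is the sharper bound, according
  -- to which of e₁ and e₂ is zero.
  segTop⇒ : ∀ {p} → Seg c p → e₁ ≤ p × p < p₀ + suc N × (p < p₀ → c₀ ≤ p → ∀ {A : Set} → A)
  segTop⇒ {p} (seg lo′ in< hi′ t₁) = left one-sided , right one-sided ,
    (λ u v → ⊥-elim (t₁ ((linear 0 (u ⊹ ≤-reflexive c+d) (solve (c ▸ d ▸ p ▸ p₀ ▸ z ▸ ∅) (λ c d p p₀ z → p₀ :+ (c :+ d) :+ (con 1 :+ (z :+ p)) :+ con 0 := con 1 :+ p :+ (p₀ :+ z) :+ (c :+ d)) refl)) , (linear 0 (v ⊹ ≤-reflexive p₀≡ ⊹ ≤-reflexive (sym c+d)) (solve (c ▸ c₀ ▸ d ▸ k ▸ p ▸ p₀ ▸ z ▸ ∅) (λ c c₀ d k p p₀ z → p :+ (c₀ :+ k :+ (p₀ :+ z)) :+ (c :+ d) :+ con 0 := c₀ :+ (p₀ :+ (c :+ d)) :+ (z :+ p :+ k)) refl)))))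
    where
    left : e₁ ≡ 0 ⊎ e₂ ≡ 0 → e₁ ≤ p
    left (inj₁ e) = (linear p (≤-reflexive e) (solve (e₁ ▸ p ▸ ∅) (λ e₁ p → con 0 :+ e₁ :+ p := e₁ :+ p) refl))
    left (inj₂ e) = (linear 0 (≤-reflexive e ⊹ lo′ ⊹ ≤-reflexive z≡ ⊹ ≤-reflexive (sym c≡)) (solve (c ▸ e₁ ▸ e₂ ▸ k ▸ m ▸ p ▸ z ▸ ∅) (λ c e₁ e₂ k m p z → con 0 :+ (z :+ p :+ (m :+ e₂ :+ (m :+ e₂) :+ k :+ c)) :+ e₁ :+ con 0 := e₂ :+ (c :+ (z :+ (m :+ e₁ :+ (m :+ e₂) :+ k))) :+ p) refl))
    right : e₁ ≡ 0 ⊎ e₂ ≡ 0 → p < p₀ + suc N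
    right (inj₁ e) = (linear 0 (≤-reflexive e ⊹ hi′ ⊹ ≤-reflexive x≡ ⊹ ≤-reflexive y≡ ⊹ ≤-reflexive (sym N≡) ⊹ ≤-reflexive (sym c₀≡) ⊹ ≤-reflexive (sym p₀≡)) (solve (N ▸ c₀ ▸ e₁ ▸ k ▸ m ▸ p ▸ p₀ ▸ q ▸ x ▸ y ▸ ∅) (λ N c₀ e₁ k m p p₀ q x y → con 0 :+ (x :+ y :+ (m :+ e₁ :+ (m :+ e₁) :+ k :+ (con 1 :+ (q :+ q :+ k) :+ (N :+ (c₀ :+ p₀))))) :+ (con 1 :+ p) :+ con 0 := e₁ :+ (con 1 :+ p :+ (x :+ (y :+ (m :+ (q :+ k) :+ (e₁ :+ (m :+ q) :+ (c₀ :+ k)))))) :+ (p₀ :+ (con 1 :+ N))) refl))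
    right (inj₂ e) = (linear 0 (≤-reflexive e ⊹ in< ⊹ ≤-reflexive (sym end)) (solve (N ▸ c ▸ e₂ ▸ p ▸ p₀ ▸ y ▸ ∅) (λ N c e₂ p p₀ y → con 0 :+ (y :+ c :+ (p₀ :+ (con 1 :+ N) :+ e₂)) :+ (con 1 :+ p) :+ con 0 := e₂ :+ (con 1 :+ p :+ (y :+ c)) :+ (p₀ :+ (con 1 :+ N))) refl))

  segTop⇐ : ∀ {p} → e₁ ≤ p → p < p₀ + suc N → (p < p₀ → c₀ ≤ p → ⊥) → Seg c p
  segTop⇐ {p} le lt out = seg (left one-sided) (linear e₂ (lt ⊹ ≤-reflexive end) (solve (N ▸ c ▸ e₂ ▸ p ▸ p₀ ▸ y ▸ ∅) (λ N c e₂ p p₀ y → p₀ :+ (con 1 :+ N) :+ (y :+ c) :+ (con 1 :+ p) :+ e₂ := con 1 :+ p :+ (p₀ :+ (con 1 :+ N) :+ e₂) :+ (y :+ c)) refl)) (right one-sided)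
    (λ (u , v) → out (linear 0 (u ⊹ ≤-reflexive (sym c+d)) (solve (c ▸ d ▸ p ▸ p₀ ▸ z ▸ ∅) (λ c d p p₀ z → c :+ d :+ (p₀ :+ z) :+ (con 1 :+ p) :+ con 0 := con 1 :+ (z :+ p) :+ (c :+ d) :+ p₀) refl)) (linear 0 (v ⊹ ≤-reflexive (sym p₀≡) ⊹ ≤-reflexive c+d) (solve (c ▸ c₀ ▸ d ▸ k ▸ p ▸ p₀ ▸ z ▸ ∅) (λ c c₀ d k p p₀ z → z :+ p :+ k :+ (p₀ :+ (c :+ d)) :+ c₀ :+ con 0 := c :+ d :+ (c₀ :+ k :+ (p₀ :+ z)) :+ p) refl)))
    where
    left : e₁ ≡ 0 ⊎ e₂ ≡ 0 → c ≤ z + p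
    left (inj₁ e) = (linear (e₂ + p) (≤-reflexive e ⊹ ≤-reflexive (sym z≡) ⊹ ≤-reflexive c≡) (solve (c ▸ e₁ ▸ e₂ ▸ k ▸ m ▸ p ▸ z ▸ ∅) (λ c e₁ e₂ k m p z → con 0 :+ (z :+ (m :+ e₁ :+ (m :+ e₂) :+ k)) :+ c :+ (e₂ :+ p) := e₁ :+ (m :+ e₂ :+ (m :+ e₂) :+ k :+ c) :+ (z :+ p)) refl))
    left (inj₂ e) = (linear e₂ (le ⊹ ≤-reflexive (sym z≡) ⊹ ≤-reflexive c≡) (solve (c ▸ e₁ ▸ e₂ ▸ k ▸ m ▸ p ▸ z ▸ ∅) (λ c e₁ e₂ k m p z → p :+ (z :+ (m :+ e₁ :+ (m :+ e₂) :+ k)) :+ c :+ e₂ := e₁ :+ (m :+ e₂ :+ (m :+ e₂) :+ k :+ c) :+ (z :+ p)) refl))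
    right : e₁ ≡ 0 ⊎ e₂ ≡ 0 → p < x + y
    right (inj₁ e) = (linear e₁ (lt ⊹ ≤-reflexive (sym x≡) ⊹ ≤-reflexive (sym y≡) ⊹ ≤-reflexive N≡ ⊹ ≤-reflexive c₀≡ ⊹ ≤-reflexive p₀≡) (solve (N ▸ c₀ ▸ e₁ ▸ k ▸ m ▸ p ▸ p₀ ▸ q ▸ x ▸ y ▸ ∅) (λ N c₀ e₁ k m p p₀ q x y → p₀ :+ (con 1 :+ N) :+ (x :+ (y :+ (m :+ (q :+ k) :+ (e₁ :+ (m :+ q) :+ (c₀ :+ k))))) :+ (con 1 :+ p) :+ e₁ := con 1 :+ p :+ (m :+ e₁ :+ (m :+ e₁) :+ k :+ (con 1 :+ (q :+ q :+ k) :+ (N :+ (c₀ :+ p₀)))) :+ (x :+ y)) refl))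
    right (inj₂ e) = (linear e₁ (lt ⊹ ≤-reflexive (sym x≡) ⊹ ≤-reflexive (sym y≡) ⊹ ≤-reflexive N≡ ⊹ ≤-reflexive c₀≡ ⊹ ≤-reflexive p₀≡) (solve (N ▸ c₀ ▸ e₁ ▸ k ▸ m ▸ p ▸ p₀ ▸ q ▸ x ▸ y ▸ ∅) (λ N c₀ e₁ k m p p₀ q x y → p₀ :+ (con 1 :+ N) :+ (x :+ (y :+ (m :+ (q :+ k) :+ (e₁ :+ (m :+ q) :+ (c₀ :+ k))))) :+ (con 1 :+ p) :+ e₁ := con 1 :+ p :+ (m :+ e₁ :+ (m :+ e₁) :+ k :+ (con 1 :+ (q :+ q :+ k) :+ (N :+ (c₀ :+ p₀)))) :+ (x :+ y)) refl))

  lo-def : ∀ {i} → i < m + q → lo i + suc i ≡ c₀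
  lo-def {i} lt = m∸n+n≡m i<c₀
    where
    i<c₀ : suc i ≤ c₀
    i<c₀ = (linear e₁ (lt ⊹ ≤-reflexive (sym c₀≡)) (solve (c₀ ▸ e₁ ▸ i ▸ m ▸ q ▸ ∅) (λ c₀ e₁ i m q → m :+ q :+ c₀ :+ (con 1 :+ i) :+ e₁ := con 1 :+ i :+ (e₁ :+ (m :+ q)) :+ c₀) refl))

  Pairs : List ℕ → Set
  Pairs C = Sorted C × All (λ i → i < m + q) C

  ∈-nest⁻ : ∀ C T {p} → p ∈ nest lo hi C T → p ∈ T ⊎ ∃ λ i → i ∈ C × (p ≡ lo i ⊎ p ≡ hi i)
  ∈-nest⁻ []      T p∈ = inj₁ p∈
  ∈-nest⁻ (i ∷ C) T p∈ with ∈-nest⁻ C (lo i ∷ T ++ hi i ∷ []) p∈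
  ... | inj₂ (j , j∈ , eq)  = inj₂ (j , there j∈ , eq)
  ... | inj₁ (here eq)      = inj₂ (i , here refl , inj₁ eq)
  ... | inj₁ (there q) with ∈-++⁻ T q
  ...   | inj₁ t∈        = inj₁ t∈
  ...   | inj₂ (here eq) = inj₂ (i , here refl , inj₂ eq)

  ∈-nest-core : ∀ C T {p} → p ∈ T → p ∈ nest lo hi C T
  ∈-nest-core []      T p∈ = p∈
  ∈-nest-core (i ∷ C) T p∈ = ∈-nest-core C (lo i ∷ T ++ hi i ∷ []) (there (∈-++⁺ˡ p∈))

  ∈-nest-lo : ∀ C T {i} → i ∈ C → lo i ∈ nest lo hi C T
  ∈-nest-lo (i ∷ C) T (here refl) = ∈-nest-core C (lo i ∷ T ++ hi i ∷ []) (here refl)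
  ∈-nest-lo (i ∷ C) T (there i∈)  = ∈-nest-lo C (lo i ∷ T ++ hi i ∷ []) i∈

  ∈-nest-hi : ∀ C T {i} → i ∈ C → hi i ∈ nest lo hi C T
  ∈-nest-hi (i ∷ C) T (here refl) = ∈-nest-core C (lo i ∷ T ++ hi i ∷ []) (there (∈-++⁺ʳ T (here refl)))
  ∈-nest-hi (i ∷ C) T (there i∈)  = ∈-nest-hi C (lo i ∷ T ++ hi i ∷ []) i∈

  lo<hi : ∀ {i j} → lo i < hi j
  lo<hi {i} {j} = lemma (lo i) (m∸n≤m c₀ (suc i))
    where
    lemma : ∀ u → u ≤ c₀ → u < p₀ + suc (k + j)
    lemma u below = (linear (j + k + k) (below ⊹ ≤-reflexive (sym p₀≡)) (solve (c₀ ▸ j ▸ k ▸ p₀ ▸ u ▸ ∅) (λ c₀ j k p₀ u → c₀ :+ p₀ :+ (con 1 :+ u) :+ (j :+ k :+ k) := u :+ (c₀ :+ k) :+ (p₀ :+ (con 1 :+ (k :+ j)))) refl))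

  nest-sorted : ∀ C T → Pairs C → Sorted T → (∀ {t i} → t ∈ T → i ∈ C → lo i < t × t < hi i) → Sorted (nest lo hi C T)
  nest-sorted []      T _         sT _  = sT
  nest-sorted (i ∷ C) T (so , i< ∷ al) sT bd = nest-sorted C (lo i ∷ T ++ hi i ∷ []) (sorted-tail so , al) sT′ bd′
    where
    sT′ : Sorted (lo i ∷ T ++ hi i ∷ [])
    sT′ = sorted-cons (All.tabulate first) (sorted-++ sT [-] (λ { t∈ (here refl) → proj₂ (bd t∈ (here refl)) }))
      where
      first : ∀ {t} → t ∈ T ++ hi i ∷ [] → lo i < t
      first t∈ with ∈-++⁻ T t∈
      ... | inj₁ q           = proj₁ (bd q (here refl))
      ... | inj₂ (here refl) = lo<hi {i} {i}
    lo-mono : ∀ {j} → j ∈ C → lo j < lo i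
    lo-mono {j} j∈ = lemma (lo i) (lo j) (lo-def i<) (lo-def (All.lookup al j∈)) (All.lookup (sorted-head so) j∈)
      where
      lemma : ∀ u v → u + suc i ≡ c₀ → v + suc j ≡ c₀ → i < j → v < u
      lemma u v e f lt = (linear 0 (≤-reflexive (sym e) ⊹ ≤-reflexive f ⊹ lt) (solve (c₀ ▸ i ▸ j ▸ u ▸ v ▸ ∅) (λ c₀ i j u v → u :+ (con 1 :+ i) :+ (c₀ :+ j) :+ (con 1 :+ v) :+ con 0 := c₀ :+ (v :+ (con 1 :+ j) :+ (con 1 :+ i)) :+ u) refl))
    hi-mono : ∀ {j} → j ∈ C → hi i < hi j
    hi-mono {j} j∈ = lemma (All.lookup (sorted-head so) j∈)
      where
      lemma : i < j → p₀ + suc (k + i) < p₀ + suc (k + j)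
      lemma lt = (linear 0 (lt) (solve (i ▸ j ▸ k ▸ p₀ ▸ ∅) (λ i j k p₀ → j :+ (con 1 :+ (p₀ :+ (con 1 :+ (k :+ i)))) :+ con 0 := con 1 :+ i :+ (p₀ :+ (con 1 :+ (k :+ j)))) refl))
    bd′ : ∀ {t j} → t ∈ lo i ∷ T ++ hi i ∷ [] → j ∈ C → lo j < t × t < hi j
    bd′ {j = j} (here refl) j∈ = lo-mono j∈ , lo<hi {i} {j}
    bd′ {j = j} (there t∈) j∈ with ∈-++⁻ T t∈
    ... | inj₁ q           = bd q (there j∈)
    ... | inj₂ (here refl) = lo<hi {j} {i} , hi-mono j∈

  -- Membership in the top row; κ is k, or k + 1 to include the centre p₀.
  data In (κ : ℕ) (C : List ℕ) (p : ℕ) : Set where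
    below  : p < e₁ → In κ C p
    low    : ∀ {i} → i ∈ C → p ≡ lo i → In κ C p
    high   : ∀ {i} → i ∈ C → p ≡ hi i → In κ C p
    middle : c₀ ≤ p → p < κ + c₀ → In κ C p
    above  : p₀ + suc N ≤ p → p < e₂ + (p₀ + suc N) → In κ C p

  ∈-top⁻ : ∀ κ C {p} → p ∈ topRow κ C → In κ C p
  ∈-top⁻ κ C {p} p∈ with ∈-++⁻ (ival 0 e₁) p∈
  ... | inj₁ q = below (subst (p <_) (+-identityʳ e₁) (proj₂ (∈-ival⁻ 0 e₁ q)))
  ... | inj₂ q with ∈-++⁻ (nest lo hi C (ival c₀ κ)) q
  ...   | inj₂ u = let b = ∈-ival⁻ (p₀ + suc N) e₂ u in above (proj₁ b) (proj₂ b)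
  ...   | inj₁ u with ∈-nest⁻ C (ival c₀ κ) u
  ...     | inj₁ t∈                  = let b = ∈-ival⁻ c₀ κ t∈ in middle (proj₁ b) (proj₂ b)
  ...     | inj₂ (i , i∈ , inj₁ eq)  = low i∈ eq
  ...     | inj₂ (i , i∈ , inj₂ eq)  = high i∈ eq

  ∈-top⁺ : ∀ κ C {p} → In κ C p → p ∈ topRow κ C
  ∈-top⁺ κ C {p} (below lt)     = ∈-++⁺ˡ (∈-ival⁺ 0 e₁ z≤n (subst (p <_) (sym (+-identityʳ e₁)) lt))
  ∈-top⁺ κ C (low i∈ refl)      = ∈-++⁺ʳ (ival 0 e₁) (∈-++⁺ˡ (∈-nest-lo C (ival c₀ κ) i∈))
  ∈-top⁺ κ C (high i∈ refl)     = ∈-++⁺ʳ (ival 0 e₁) (∈-++⁺ˡ (∈-nest-hi C (ival c₀ κ) i∈))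
  ∈-top⁺ κ C (middle le lt)     = ∈-++⁺ʳ (ival 0 e₁) (∈-++⁺ˡ (∈-nest-core C (ival c₀ κ) (∈-ival⁺ c₀ κ le lt)))
  ∈-top⁺ κ C (above le lt)      = ∈-++⁺ʳ (ival 0 e₁) (∈-++⁺ʳ (nest lo hi C (ival c₀ κ)) (∈-ival⁺ (p₀ + suc N) e₂ le lt))

  lo-bounds : ∀ {i} → i < m + q → e₁ ≤ lo i × lo i < c₀
  lo-bounds {i} lt = lemma (lo i) (lo-def lt)
    where
    lemma : ∀ u → u + suc i ≡ c₀ → e₁ ≤ u × u < c₀
    lemma u e = (linear 0 (≤-reflexive (sym e) ⊹ lt ⊹ ≤-reflexive (sym c₀≡)) (solve (c₀ ▸ e₁ ▸ i ▸ m ▸ q ▸ u ▸ ∅) (λ c₀ e₁ i m q u → u :+ (con 1 :+ i) :+ (m :+ q :+ c₀) :+ e₁ :+ con 0 := c₀ :+ (con 1 :+ i :+ (e₁ :+ (m :+ q))) :+ u) refl)) , (linear i (≤-reflexive e) (solve (c₀ ▸ i ▸ u ▸ ∅) (λ c₀ i u → c₀ :+ (con 1 :+ u) :+ i := u :+ (con 1 :+ i) :+ c₀) refl))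

  hi-bound : ∀ {i} → i < m + q → hi i < p₀ + suc N
  hi-bound {i} lt = bound
    where
    bound : p₀ + suc (k + i) < p₀ + suc N
    bound = (linear 0 (lt ⊹ ≤-reflexive (sym N≡)) (solve (N ▸ i ▸ k ▸ m ▸ p₀ ▸ q ▸ ∅) (λ N i k m p₀ q → m :+ q :+ N :+ (con 1 :+ (p₀ :+ (con 1 :+ (k :+ i)))) :+ con 0 := con 1 :+ i :+ (m :+ (q :+ k)) :+ (p₀ :+ (con 1 :+ N))) refl))

  c₀≤p₀ : c₀ ≤ p₀
  c₀≤p₀ = (linear k (≤-reflexive (sym p₀≡)) (solve (c₀ ▸ k ▸ p₀ ▸ ∅) (λ c₀ k p₀ → p₀ :+ c₀ :+ k := c₀ :+ k :+ p₀) refl))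

  seg-lo : ∀ {i} → i < m + q → Seg c (lo i)
  seg-lo {i} lt = segTop⇐ (proj₁ b) (<-trans (<-≤-trans (proj₂ b) c₀≤p₀) (m<m+n p₀ (s≤s z≤n))) (λ _ le → <⇒≱ (proj₂ b) le)
    where b = lo-bounds lt

  seg-hi : ∀ {i} → i < m + q → Seg c (hi i)
  seg-hi {i} lt = segTop⇐ above-e₁ (hi-bound lt) (λ u _ → <⇒≱ u (m≤m+n p₀ (suc (k + i))))
    where
    above-e₁ : e₁ ≤ p₀ + suc (k + i)
    above-e₁ = (linear (1 + i + k + k + m + q) (≤-reflexive (sym c₀≡) ⊹ ≤-reflexive (sym p₀≡)) (solve (c₀ ▸ e₁ ▸ i ▸ k ▸ m ▸ p₀ ▸ q ▸ ∅) (λ c₀ e₁ i k m p₀ q → c₀ :+ p₀ :+ e₁ :+ (con 1 :+ i :+ k :+ k :+ m :+ q) := e₁ :+ (m :+ q) :+ (c₀ :+ k) :+ (p₀ :+ (con 1 :+ (k :+ i)))) refl))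

  mirror-lo-hi : ∀ {i} → i < m + q → lo i + hi i ≡ p₀ + p₀
  mirror-lo-hi {i} lt = lemma (lo i) (lo-def lt)
    where
    lemma : ∀ u → u + suc i ≡ c₀ → u + (p₀ + suc (k + i)) ≡ p₀ + p₀
    lemma u e = (≤-antisym (linear 0 (≤-reflexive e ⊹ ≤-reflexive (sym p₀≡)) (solve (c₀ ▸ i ▸ k ▸ p₀ ▸ u ▸ ∅) (λ c₀ i k p₀ u → c₀ :+ p₀ :+ (u :+ (p₀ :+ (con 1 :+ (k :+ i)))) :+ con 0 := u :+ (con 1 :+ i) :+ (c₀ :+ k) :+ (p₀ :+ p₀)) refl)) (linear 0 (≤-reflexive (sym e) ⊹ ≤-reflexive p₀≡) (solve (c₀ ▸ i ▸ k ▸ p₀ ▸ u ▸ ∅) (λ c₀ i k p₀ u → u :+ (con 1 :+ i) :+ (c₀ :+ k) :+ (p₀ :+ p₀) :+ con 0 := c₀ :+ p₀ :+ (u :+ (p₀ :+ (con 1 :+ (k :+ i))))) refl)))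

  topRow-sorted : ∀ κ C → κ ≤ suc k → Pairs C → Sorted (topRow κ C)
  topRow-sorted κ C κ≤ pc@(so , al) =
    sorted-++ (ival-sorted 0 e₁)
      (sorted-++ (nest-sorted C (ival c₀ κ) pc (ival-sorted c₀ κ) between) (ival-sorted (p₀ + suc N) e₂)
        (λ u v → <-≤-trans (proj₂ (inside u)) (proj₁ (∈-ival⁻ (p₀ + suc N) e₂ v))))
      (λ u v → <-≤-trans (subst (_ <_) (+-identityʳ e₁) (proj₂ (∈-ival⁻ 0 e₁ u))) (after v))
    where
    core : ∀ {p} → p ∈ ival c₀ κ → c₀ ≤ p × p ≤ p₀
    core {p} p∈ with ∈-ival⁻ c₀ κ p∈
    ... | le , lt = le , (linear 0 (lt ⊹ κ≤ ⊹ ≤-reflexive (sym p₀≡)) (solve (c₀ ▸ k ▸ p ▸ p₀ ▸ κ ▸ ∅) (λ c₀ k p p₀ κ → κ :+ c₀ :+ (con 1 :+ k :+ p₀) :+ p :+ con 0 := con 1 :+ p :+ (κ :+ (c₀ :+ k)) :+ p₀) refl))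
    between : ∀ {t i} → t ∈ ival c₀ κ → i ∈ C → lo i < t × t < hi i
    between {t} {i} t∈ i∈ = <-≤-trans (proj₂ (lo-bounds (All.lookup al i∈))) (proj₁ (core t∈))
                          , ≤-<-trans (proj₂ (core t∈)) (m<m+n p₀ (s≤s z≤n))
    inside : ∀ {p} → p ∈ nest lo hi C (ival c₀ κ) → e₁ ≤ p × p < p₀ + suc N
    inside {p} p∈ with ∈-nest⁻ C (ival c₀ κ) p∈
    ... | inj₁ t∈ = ≤-trans e₁≤c₀ (proj₁ (core t∈)) , ≤-<-trans (proj₂ (core t∈)) (m<m+n p₀ (s≤s z≤n))
      where
      e₁≤c₀ : e₁ ≤ c₀
      e₁≤c₀ = (linear (m + q) (≤-reflexive (sym c₀≡)) (solve (c₀ ▸ e₁ ▸ m ▸ q ▸ ∅) (λ c₀ e₁ m q → c₀ :+ e₁ :+ (m :+ q) := e₁ :+ (m :+ q) :+ c₀) refl))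
    ... | inj₂ (i , i∈ , inj₁ refl) = proj₁ (segTop⇒ (seg-lo (All.lookup al i∈))) , proj₁ (proj₂ (segTop⇒ (seg-lo (All.lookup al i∈))))
    ... | inj₂ (i , i∈ , inj₂ refl) = proj₁ (segTop⇒ (seg-hi (All.lookup al i∈))) , proj₁ (proj₂ (segTop⇒ (seg-hi (All.lookup al i∈))))
    after : ∀ {p} → p ∈ nest lo hi C (ival c₀ κ) ++ ival (p₀ + suc N) e₂ → e₁ ≤ p
    after {p} p∈ with ∈-++⁻ (nest lo hi C (ival c₀ κ)) p∈
    ... | inj₁ u = proj₁ (inside u)
    ... | inj₂ u with ∈-ival⁻ (p₀ + suc N) e₂ u
    ...   | le , _ = (linear (1 + N + k + m + q) (le ⊹ ≤-reflexive (sym c₀≡) ⊹ ≤-reflexive (sym p₀≡)) (solve (N ▸ c₀ ▸ e₁ ▸ k ▸ m ▸ p ▸ p₀ ▸ q ▸ ∅) (λ N c₀ e₁ k m p p₀ q → p :+ (c₀ :+ p₀) :+ e₁ :+ (con 1 :+ N :+ k :+ m :+ q) := p₀ :+ (con 1 :+ N) :+ (e₁ :+ (m :+ q) :+ (c₀ :+ k)) :+ p) refl))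

  hole-cases : ∀ κ C {p} → k ≤ κ → p < y + c → ¬ Seg c p → In κ C p
  hole-cases κ C {p} k≤κ lt ¬s = go (<-≤-connex p e₁) (<-≤-connex p (p₀ + suc N)) (<-≤-connex p p₀) (<-≤-connex p c₀)
    where
    last : p < e₂ + (p₀ + suc N)
    last = (linear 0 (lt ⊹ ≤-reflexive (sym end)) (solve (N ▸ c ▸ e₂ ▸ p ▸ p₀ ▸ y ▸ ∅) (λ N c e₂ p p₀ y → y :+ c :+ (p₀ :+ (con 1 :+ N) :+ e₂) :+ (con 1 :+ p) :+ con 0 := con 1 :+ p :+ (y :+ c) :+ (e₂ :+ (p₀ :+ (con 1 :+ N)))) refl))
    inside : p < p₀ → p < κ + c₀
    inside u = (linear 0 (u ⊹ k≤κ ⊹ ≤-reflexive p₀≡) (solve (c₀ ▸ k ▸ p ▸ p₀ ▸ κ ▸ ∅) (λ c₀ k p p₀ κ → p₀ :+ (κ :+ (c₀ :+ k)) :+ (con 1 :+ p) :+ con 0 := con 1 :+ p :+ (k :+ p₀) :+ (κ :+ c₀)) refl))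
    go : p < e₁ ⊎ e₁ ≤ p → p < p₀ + suc N ⊎ p₀ + suc N ≤ p → p < p₀ ⊎ p₀ ≤ p → p < c₀ ⊎ c₀ ≤ p → In κ C p
    go (inj₁ l)  _         _        _        = below l
    go (inj₂ _)  (inj₂ ge) _        _        = above ge last
    go (inj₂ _)  (inj₁ _)  (inj₁ u) (inj₂ v) = middle v (inside u)
    go (inj₂ ge) (inj₁ l)  (inj₂ u) _        = ⊥-elim (¬s (segTop⇐ ge l (λ u′ _ → <⇒≱ u′ u)))
    go (inj₂ ge) (inj₁ l)  (inj₁ _) (inj₁ v) = ⊥-elim (¬s (segTop⇐ ge l (λ _ v′ → <⇒≱ v v′)))

  in-bound : ∀ C {p} → Pairs C → In k C p → p < y + c
  in-bound C {p} (_ , al) (below lt)    = (linear (e₂ + k + m + m + y) (lt ⊹ ≤-reflexive (sym c≡)) (solve (c ▸ e₁ ▸ e₂ ▸ k ▸ m ▸ p ▸ y ▸ ∅) (λ c e₁ e₂ k m p y → e₁ :+ c :+ (con 1 :+ p) :+ (e₂ :+ k :+ m :+ m :+ y) := con 1 :+ p :+ (m :+ e₁ :+ (m :+ e₂) :+ k) :+ (y :+ c)) refl))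
  in-bound C (_ , al) (low i∈ refl)     = Seg.in< (seg-lo (All.lookup al i∈))
  in-bound C (_ , al) (high i∈ refl)    = Seg.in< (seg-hi (All.lookup al i∈))
  in-bound C {p} (_ , al) (middle le lt) = (linear (1 + N + e₂) (lt ⊹ ≤-reflexive (sym p₀≡) ⊹ ≤-reflexive end) (solve (N ▸ c ▸ c₀ ▸ e₂ ▸ k ▸ p ▸ p₀ ▸ y ▸ ∅) (λ N c c₀ e₂ k p p₀ y → k :+ c₀ :+ (p₀ :+ (y :+ c)) :+ (con 1 :+ p) :+ (con 1 :+ N :+ e₂) := con 1 :+ p :+ (c₀ :+ k :+ (p₀ :+ (con 1 :+ N) :+ e₂)) :+ (y :+ c)) refl))
  in-bound C {p} (_ , al) (above le lt)  = (linear 0 (lt ⊹ ≤-reflexive end) (solve (N ▸ c ▸ e₂ ▸ p ▸ p₀ ▸ y ▸ ∅) (λ N c e₂ p p₀ y → e₂ :+ (p₀ :+ (con 1 :+ N)) :+ (y :+ c) :+ (con 1 :+ p) :+ con 0 := con 1 :+ p :+ (p₀ :+ (con 1 :+ N) :+ e₂) :+ (y :+ c)) refl))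

  -- The reflection exchanges the two members of each pair. All other entries of the row lie outside
  -- the region, where nothing is demanded.
  in-mirror : ∀ C {p p′} → Pairs C → p + p′ ≡ p₀ + p₀ → In k C p → Seg c p → In k C p′ × Seg c p′
  in-mirror C (_ , al) pp (below lt) s = ⊥-elim (<⇒≱ lt (proj₁ (segTop⇒ s)))
  in-mirror C {p} {p′} (_ , al) pp (low {i} i∈ refl) s = subst (λ t → In k C t × Seg c t) eq (high i∈ refl , seg-hi (All.lookup al i∈))
    where
    eq : hi i ≡ p′
    eq = +-cancelˡ-≡ (lo i) (hi i) p′ (trans (mirror-lo-hi (All.lookup al i∈)) (sym pp))
  in-mirror C {p} {p′} (_ , al) pp (high {i} i∈ refl) s = subst (λ t → In k C t × Seg c t) eq (low i∈ refl , seg-lo (All.lookup al i∈))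
    where
    eq : lo i ≡ p′
    eq = +-cancelˡ-≡ (hi i) (lo i) p′ (trans (+-comm (hi i) (lo i)) (trans (mirror-lo-hi (All.lookup al i∈)) (sym pp)))
  in-mirror C {p} (_ , al) pp (middle le lt) s = proj₂ (proj₂ (segTop⇒ s)) (subst (p <_) (trans (+-comm k c₀) (sym p₀≡)) lt) le
  in-mirror C (_ , al) pp (above le lt) s = ⊥-elim (<⇒≱ (proj₁ (proj₂ (segTop⇒ s))) le)

  -- What decoding a tiling yields for the last row. These properties characterise the rows
  -- `topRow k C` with an m-subset C.
  record Balanced (S : List ℕ) : Set where
    field
      sorted : Sorted S
      size   : length S ≡ c
      bound  : ∀ {p} → p ∈ S → p < y + c
      holes  : ∀ {p} → p < y + c → ¬ Seg c p → p ∈ S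
      mirror : ∀ {p p′} → p + p′ ≡ p₀ + p₀ → p ∈ S → Seg c p → p′ ∈ S × Seg c p′

  pairsIn : List ℕ → List ℕ
  pairsIn S = filter (λ i → hi i ∈? S) (ival 0 (m + q))

  ∈-pairsIn⁻ : ∀ S {i} → i ∈ pairsIn S → i < m + q × hi i ∈ S
  ∈-pairsIn⁻ S {i} i∈ with ∈-filter⁻ (λ i → hi i ∈? S) i∈
  ... | i∈′ , h∈ = subst (i <_) (+-identityʳ (m + q)) (proj₂ (∈-ival⁻ 0 (m + q) i∈′)) , h∈

  ∈-pairsIn⁺ : ∀ S {i} → i < m + q → hi i ∈ S → i ∈ pairsIn S
  ∈-pairsIn⁺ S {i} lt h∈ = ∈-filter⁺ (λ i → hi i ∈? S) (∈-ival⁺ 0 (m + q) z≤n (subst (i <_) (sym (+-identityʳ (m + q))) lt)) h∈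

  pairsIn-pairs : ∀ S → Pairs (pairsIn S)
  pairsIn-pairs S = filter-sorted (λ i → hi i ∈? S) (ival-sorted 0 (m + q)) , All.tabulate (λ i∈ → proj₁ (∈-pairsIn⁻ S i∈))

  odd≢even : ∀ n m → suc (n + n) ≢ m + m
  odd≢even n       zero    ()
  odd≢even zero    (suc m) e = 0≢1+n (trans (suc-injective e) (+-suc m m))
  odd≢even (suc n) (suc m) e = odd≢even n m (suc-injective (trans (sym (+-suc (suc n) n)) (trans (suc-injective e) (+-suc m m))))

  length-topRow : ∀ κ C → length (topRow κ C) ≡ e₁ + (length C + length C + κ + e₂)
  length-topRow κ C =
    trans (length-++ (ival 0 e₁)) (cong₂ _+_ (length-ival 0 e₁)
      (trans (length-++ (nest lo hi C (ival c₀ κ)))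
             (cong₂ _+_ (trans (length-nest lo hi C (ival c₀ κ)) (cong (length C + length C +_) (length-ival c₀ κ)))
                        (length-ival (p₀ + suc N) e₂))))

  module DecodeTop (S : List ℕ) (bal : Balanced S) where

    open Balanced bal

    C : List ℕ
    C = pairsIn S

    C< : ∀ {i} → i ∈ C → i < m + q
    C< i∈ = proj₁ (∈-pairsIn⁻ S i∈)

    -- An entry in the region has its mirror image there too, so both avoid the triangle; unless the
    -- entry is the centre, they form a pair at a distance greater than k. Entries outside the
    -- region are settled by `hole-cases`.
    into : ∀ κ → k ≤ κ → (p₀ ∈ S → In κ C p₀) → ∀ {p} → p ∈ S → In κ C p
    into κ k≤κ centre {p} p∈ = split (seg? c p)
      where
      right : Seg c p → p₀ < p → In κ C p
      right s gt = step (p₀ + p₀ ∸ p) (m+[n∸m]≡n (reflect-bound s))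
        where
        step : ∀ p′ → p + p′ ≡ p₀ + p₀ → In κ C p
        step p′ pp = high (∈-pairsIn⁺ S i< (subst (_∈ S) p≡ p∈)) p≡
          where
          s′ : Seg c p′
          s′ = proj₂ (mirror pp p∈ s)
          p′<p₀ : p′ < p₀
          p′<p₀ = (linear 0 (≤-reflexive pp ⊹ gt) (solve (p ▸ p′ ▸ p₀ ▸ ∅) (λ p p′ p₀ → p₀ :+ p₀ :+ p :+ (con 1 :+ p′) :+ con 0 := p :+ p′ :+ (con 1 :+ p₀) :+ p₀) refl))
          p′<c₀ : p′ < c₀
          p′<c₀ = ≰⇒> (λ le → proj₂ (proj₂ (segTop⇒ s′)) p′<p₀ le)
          i : ℕ
          i = p ∸ (p₀ + suc k)
          far : p₀ + suc k ≤ p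
          far = (linear 0 (≤-reflexive (sym pp) ⊹ p′<c₀ ⊹ ≤-reflexive (sym p₀≡)) (solve (c₀ ▸ k ▸ p ▸ p′ ▸ p₀ ▸ ∅) (λ c₀ k p p′ p₀ → p :+ p′ :+ (c₀ :+ p₀) :+ (p₀ :+ (con 1 :+ k)) :+ con 0 := p₀ :+ p₀ :+ (con 1 :+ p′ :+ (c₀ :+ k)) :+ p) refl))
          p≡ : p ≡ hi i
          p≡ = trans (sym (m+[n∸m]≡n far)) (trans (+-assoc p₀ (suc k) i) refl)
          p<end : p < p₀ + suc N
          p<end = proj₁ (proj₂ (segTop⇒ s))
          i< : i < m + q
          i< = index i p≡
            where
            index : ∀ i → p ≡ p₀ + suc (k + i) → i < m + q
            index i e = (linear 0 (≤-reflexive (sym e) ⊹ p<end ⊹ ≤-reflexive N≡) (solve (N ▸ i ▸ k ▸ m ▸ p ▸ p₀ ▸ q ▸ ∅) (λ N i k m p p₀ q → p :+ (p₀ :+ (con 1 :+ N) :+ (m :+ (q :+ k))) :+ (con 1 :+ i) :+ con 0 := p₀ :+ (con 1 :+ (k :+ i)) :+ (con 1 :+ p :+ N) :+ (m :+ q)) refl))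
      left : Seg c p → p < p₀ → In κ C p
      left s lt = step (c₀ ∸ suc p) (m+[n∸m]≡n p<c₀)
        where
        p<c₀ : p < c₀
        p<c₀ = ≰⇒> (λ le → proj₂ (proj₂ (segTop⇒ s)) lt le)
        e₁≤p : e₁ ≤ p
        e₁≤p = proj₁ (segTop⇒ s)
        step : ∀ i → suc p + i ≡ c₀ → In κ C p
        step i e = low (∈-pairsIn⁺ S i< (proj₁ (mirror pp p∈ s))) p≡
          where
          i< : i < m + q
          i< = (linear 0 (≤-reflexive e ⊹ e₁≤p ⊹ ≤-reflexive c₀≡) (solve (c₀ ▸ e₁ ▸ i ▸ m ▸ p ▸ q ▸ ∅) (λ c₀ e₁ i m p q → c₀ :+ (p :+ (e₁ :+ (m :+ q))) :+ (con 1 :+ i) :+ con 0 := con 1 :+ p :+ i :+ (e₁ :+ c₀) :+ (m :+ q)) refl))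
          p≡ : p ≡ lo i
          p≡ = sym (trans (cong (_∸ suc i) (trans (sym e) (sym (+-suc p i)))) (m+n∸n≡m p (suc i)))
          pp : p + hi i ≡ p₀ + p₀
          pp = trans (cong (_+ hi i) p≡) (mirror-lo-hi i<)
      split : Dec (Seg c p) → In κ C p
      split (no ¬s) = hole-cases κ C k≤κ (bound p∈) ¬s
      split (yes s) with <-cmp p p₀
      ... | tri< lt _ _   = left s lt
      ... | tri≈ _ refl _ = centre p∈
      ... | tri> _ _ gt   = right s gt

    outof : ∀ κ → (∀ {p} → c₀ ≤ p → p < κ + c₀ → p ∈ S) → ∀ {p} → In κ C p → p ∈ S
    outof κ mid {p} (below lt)    = holes (<-≤-trans lt e₁≤) (λ s → <⇒≱ lt (proj₁ (segTop⇒ s)))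
      where
      e₁≤ : e₁ ≤ y + c
      e₁≤ = (linear (e₂ + k + m + m + y) (≤-reflexive (sym c≡)) (solve (c ▸ e₁ ▸ e₂ ▸ k ▸ m ▸ y ▸ ∅) (λ c e₁ e₂ k m y → c :+ e₁ :+ (e₂ :+ k :+ m :+ m :+ y) := m :+ e₁ :+ (m :+ e₂) :+ k :+ (y :+ c)) refl))
    outof κ mid (low {i} i∈ refl)  = proj₁ (mirror (trans (+-comm (hi i) (lo i)) (mirror-lo-hi (C< i∈))) (proj₂ (∈-pairsIn⁻ S i∈)) (seg-hi (C< i∈)))
    outof κ mid (high i∈ refl)     = proj₂ (∈-pairsIn⁻ S i∈)
    outof κ mid (middle le lt)     = mid le lt
    outof κ mid {p} (above le lt)  = holes last (λ s → <⇒≱ (proj₁ (proj₂ (segTop⇒ s))) le)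
      where
      last : p < y + c
      last = (linear 0 (lt ⊹ ≤-reflexive end) (solve (N ▸ c ▸ e₂ ▸ p ▸ p₀ ▸ y ▸ ∅) (λ N c e₂ p p₀ y → e₂ :+ (p₀ :+ (con 1 :+ N)) :+ (y :+ c) :+ (con 1 :+ p) :+ con 0 := con 1 :+ p :+ (p₀ :+ (con 1 :+ N) :+ e₂) :+ (y :+ c)) refl))

    core : ∀ {p} → c₀ ≤ p → p < k + c₀ → p ∈ S
    core {p} le lt = holes last (λ s → proj₂ (proj₂ (segTop⇒ s)) inside le)
      where
      inside : p < p₀
      inside = (linear 0 (lt ⊹ ≤-reflexive (sym p₀≡)) (solve (c₀ ▸ k ▸ p ▸ p₀ ▸ ∅) (λ c₀ k p p₀ → k :+ c₀ :+ p₀ :+ (con 1 :+ p) :+ con 0 := con 1 :+ p :+ (c₀ :+ k) :+ p₀) refl))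
      last : p < y + c
      last = (linear (1 + N + e₂) (lt ⊹ ≤-reflexive (sym p₀≡) ⊹ ≤-reflexive end) (solve (N ▸ c ▸ c₀ ▸ e₂ ▸ k ▸ p ▸ p₀ ▸ y ▸ ∅) (λ N c c₀ e₂ k p p₀ y → k :+ c₀ :+ (p₀ :+ (y :+ c)) :+ (con 1 :+ p) :+ (con 1 :+ N :+ e₂) := con 1 :+ p :+ (c₀ :+ k :+ (p₀ :+ (con 1 :+ N) :+ e₂)) :+ (y :+ c)) refl))

    -- The row has as many entries as needed only if the centre is not one of them.
    no-centre : p₀ ∉ S
    no-centre p₀∈ = odd≢even n m count
      where
      n : ℕ
      n = length C
      S≡ : S ≡ topRow (suc k) C
      S≡ = sorted-≡ sorted (topRow-sorted (suc k) C ≤-refl (pairsIn-pairs S))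
             (λ p∈ → ∈-top⁺ (suc k) C (into (suc k) (n≤1+n k) (λ _ → middle c₀≤p₀ centre<) p∈))
             (λ p∈ → outof (suc k) mid (∈-top⁻ (suc k) C p∈))
        where
        centre< : p₀ < suc k + c₀
        centre< = (linear 0 (≤-reflexive p₀≡) (solve (c₀ ▸ k ▸ p₀ ▸ ∅) (λ c₀ k p₀ → c₀ :+ k :+ (con 1 :+ p₀) :+ con 0 := p₀ :+ (con 1 :+ k :+ c₀)) refl))
        mid : ∀ {p} → c₀ ≤ p → p < suc k + c₀ → p ∈ S
        mid {p} le lt with m≤n⇒m<n∨m≡n (s≤s⁻¹ lt)
        ... | inj₁ lt′  = core le lt′
        ... | inj₂ refl = subst (_∈ S) (trans p₀≡ (+-comm c₀ k)) p₀∈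
      count : suc (n + n) ≡ m + m
      count = arith n (trans (sym (length-topRow (suc k) C)) (trans (cong length (sym S≡)) size))
        where
        arith : ∀ n → e₁ + (n + n + suc k + e₂) ≡ c → suc (n + n) ≡ m + m
        arith n e = (≤-antisym (linear 0 (≤-reflexive e ⊹ ≤-reflexive c≡) (solve (c ▸ e₁ ▸ e₂ ▸ k ▸ m ▸ n ▸ ∅) (λ c e₁ e₂ k m n → c :+ (m :+ e₁ :+ (m :+ e₂) :+ k) :+ (con 1 :+ (n :+ n)) :+ con 0 := e₁ :+ (n :+ n :+ (con 1 :+ k) :+ e₂) :+ c :+ (m :+ m)) refl)) (linear 0 (≤-reflexive (sym e) ⊹ ≤-reflexive (sym c≡)) (solve (c ▸ e₁ ▸ e₂ ▸ k ▸ m ▸ n ▸ ∅) (λ c e₁ e₂ k m n → e₁ :+ (n :+ n :+ (con 1 :+ k) :+ e₂) :+ c :+ (m :+ m) :+ con 0 := c :+ (m :+ e₁ :+ (m :+ e₂) :+ k) :+ (con 1 :+ (n :+ n))) refl)))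

    S≡top : S ≡ topRow k C
    S≡top = sorted-≡ sorted (topRow-sorted k C (n≤1+n k) (pairsIn-pairs S))
              (λ p∈ → ∈-top⁺ k C (into k ≤-refl (λ c∈ → ⊥-elim (no-centre c∈)) p∈))
              (λ p∈ → outof k core (∈-top⁻ k C p∈))

    C∈subs : C ∈ subs m 0 (m + q)
    C∈subs = subs-complete (halves (length C) m (arith (length C) (trans (sym (length-topRow k C)) (trans (cong length (sym S≡top)) size))))
               (proj₁ (pairsIn-pairs S)) (All.map (λ lt → z≤n , lt) (proj₂ (pairsIn-pairs S)))
      where
      arith : ∀ n → e₁ + (n + n + k + e₂) ≡ c → n + n ≡ m + m
      arith n e = (≤-antisym (linear 0 (≤-reflexive e ⊹ ≤-reflexive c≡) (solve (c ▸ e₁ ▸ e₂ ▸ k ▸ m ▸ n ▸ ∅) (λ c e₁ e₂ k m n → c :+ (m :+ e₁ :+ (m :+ e₂) :+ k) :+ (n :+ n) :+ con 0 := e₁ :+ (n :+ n :+ k :+ e₂) :+ c :+ (m :+ m)) refl)) (linear 0 (≤-reflexive (sym e) ⊹ ≤-reflexive (sym c≡)) (solve (c ▸ e₁ ▸ e₂ ▸ k ▸ m ▸ n ▸ ∅) (λ c e₁ e₂ k m n → e₁ :+ (n :+ n :+ k :+ e₂) :+ c :+ (m :+ m) :+ con 0 := c :+ (m :+ e₁ :+ (m :+ e₂) :+ k) :+ (n :+ n)) refl)))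
      halves : ∀ n m → n + n ≡ m + m → n ≡ m
      halves zero    zero    _ = refl
      halves zero    (suc m) ()
      halves (suc n) zero    ()
      halves (suc n) (suc m) e = cong suc (halves n m (suc-injective (trans (sym (+-suc n n)) (trans (suc-injective e) (+-suc m m)))))

  pairs-of-subs : ∀ {C} → C ∈ subs m 0 (m + q) → Pairs C
  pairs-of-subs C∈ with subs-sound m 0 (m + q) C∈
  ... | _ , so , al = so , All.map proj₂ al

  pairsIn-topRow : ∀ {C} → C ∈ subs m 0 (m + q) → pairsIn (topRow k C) ≡ C
  pairsIn-topRow {C} C∈ = sorted-≡ (proj₁ (pairsIn-pairs (topRow k C))) (proj₁ pc) back
                            (λ i∈ → ∈-pairsIn⁺ (topRow k C) (All.lookup (proj₂ pc) i∈) (∈-top⁺ k C (high i∈ refl)))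
    where
    pc = pairs-of-subs C∈
    back : ∀ {i} → i ∈ pairsIn (topRow k C) → i ∈ C
    back {i} i∈ = cases (∈-top⁻ k C (proj₂ (∈-pairsIn⁻ (topRow k C) i∈)))
      where
      i< : i < m + q
      i< = proj₁ (∈-pairsIn⁻ (topRow k C) i∈)
      cases : In k C (hi i) → i ∈ C
      cases (below lt)           = ⊥-elim (<⇒≱ lt (proj₁ (segTop⇒ (seg-hi i<))))
      cases (low {j} j∈ eq)      = ⊥-elim (<-irrefl (sym eq) (lo<hi {j} {i}))
      cases (high {j} j∈ eq)     = subst (_∈ C) (sym (+-cancelˡ-≡ k i j (suc-injective (+-cancelˡ-≡ p₀ (suc (k + i)) (suc (k + j)) eq)))) j∈
      cases (middle le lt)       = ⊥-elim (<⇒≱ (subst (hi i <_) (trans (+-comm k c₀) (sym p₀≡)) lt) (m≤m+n p₀ (suc (k + i))))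
      cases (above le lt)        = ⊥-elim (<⇒≱ (hi-bound i<) le)

  balanced-topRow : ∀ {C} → C ∈ subs m 0 (m + q) → Balanced (topRow k C)
  balanced-topRow {C} C∈ = record
    { sorted = topRow-sorted k C (n≤1+n k) pc
    ; size   = trans (length-topRow k C) (trans (cong (λ n → e₁ + (n + n + k + e₂)) (proj₁ (subs-sound m 0 (m + q) C∈))) arith)
    ; bound  = λ p∈ → in-bound C pc (∈-top⁻ k C p∈)
    ; holes  = λ lt ¬s → ∈-top⁺ k C (hole-cases k C ≤-refl lt ¬s)
    ; mirror = λ pp p∈ s → let q = in-mirror C pc pp (∈-top⁻ k C p∈) s in ∈-top⁺ k C (proj₁ q) , proj₂ q
    }
    where
    pc = pairs-of-subs C∈
    arith : e₁ + (m + m + k + e₂) ≡ c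
    arith = (≤-antisym (linear 0 (≤-reflexive (sym c≡)) (solve (c ▸ e₁ ▸ e₂ ▸ k ▸ m ▸ ∅) (λ c e₁ e₂ k m → c :+ (e₁ :+ (m :+ m :+ k :+ e₂)) :+ con 0 := m :+ e₁ :+ (m :+ e₂) :+ k :+ c) refl)) (linear 0 (≤-reflexive c≡) (solve (c ▸ e₁ ▸ e₂ ▸ k ▸ m ▸ ∅) (λ c e₁ e₂ k m → m :+ e₁ :+ (m :+ e₂) :+ k :+ c :+ con 0 := c :+ (e₁ :+ (m :+ m :+ k :+ e₂))) refl)))

import Data.Bool
open import Data.Bool using (Bool; true; false; _∧_; not)
open import Data.Bool.ListAction using (all)
open import Data.Bool.Properties using (T-≡)
open import Data.Integer as ℤ using (ℤ; +_; -[1+_])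
import Data.Integer.Properties as ℤₚ
import Data.Integer.Tactic.RingSolver as ℤ-Ring
open import Data.List using (applyUpTo; concatMap; upTo; zip)
open import Data.List.Membership.Propositional.Properties using (∈-map⁺; ∈-map⁻; ∈-upTo⁺; ∈-concat⁺′; ∈-concat⁻′)
open import Data.List.Properties using (length-map; map-∘)
open import Data.List.Relation.Unary.AllPairs as AllPairs using ([]; _∷_)
open import Data.List.Relation.Unary.Unique.Propositional using (Unique)
import Data.List.Relation.Unary.Unique.Propositional.Properties as Uniqueₚ
open import Data.Maybe using (just)
open import Data.Nat using (_/_; _≤ᵇ_; _≡ᵇ_)
import Defs as D
open import Defs using (Pt; neighbour; rotTri; upVerts; downVerts; upTris; downTris; memP; countP; partnerOf; eqMaybeP; pairsOf; isTiling; isSymmetric; choices; McsBowtie)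
open import Function using (_∘_; Equivalence)

-- From the Boolean tests to inequalities, and the rotation of the region

module Reflection (x y z k c d : ℕ) (x+z : c + c ≡ x + z) (y+z : suc (d + d) ≡ y + z)
  (cx≡ : D.cx x y z ≡ + c) (cy≡ : D.cy x y z ≡ + d) (p₀ : ℕ) (c+d : p₀ + z ≡ c + d) (k≤c : k ≤ c) where

  open LinearArithmetic
  open Summation
  open Enumeration
  open ListCounting
  open Strip using (clash)
  open Geometry x y z k c d p₀ x+z y+z c+d k≤c

  ∧⁻ : ∀ {a b} → a ∧ b ≡ true → a ≡ true × b ≡ true
  ∧⁻ {true} {true} refl = refl , refl

  ∧⁺ : ∀ {a b} → a ≡ true → b ≡ true → a ∧ b ≡ true
  ∧⁺ refl refl = refl

  not⁻ : ∀ {a} → not a ≡ true → a ≢ true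
  not⁻ {false} _ ()

  not⁺ : ∀ {a} → a ≢ true → not a ≡ true
  not⁺ {false} _ = refl
  not⁺ {true} ne = ⊥-elim (ne refl)

  all⁻ : ∀ {A : Set} {f : A → Bool} xs → all f xs ≡ true → ∀ {u} → u ∈ xs → f u ≡ true
  all⁻ (v ∷ xs) e (here refl) = proj₁ (∧⁻ e)
  all⁻ (v ∷ xs) e (there u∈)  = all⁻ xs (proj₂ (∧⁻ e)) u∈

  all⁺ : ∀ {A : Set} {f : A → Bool} xs → (∀ {u} → u ∈ xs → f u ≡ true) → all f xs ≡ true
  all⁺ []       h = refl
  all⁺ (v ∷ xs) h = ∧⁺ (h (here refl)) (all⁺ xs (λ u∈ → h (there u∈)))

  ≤ᵇ⁻ : ∀ {m n} → (m ≤ᵇ n) ≡ true → m ≤ n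
  ≤ᵇ⁻ {m} {n} e = ≤ᵇ⇒≤ m n (Equivalence.from T-≡ e)

  ≤ᵇ⁺ : ∀ {m n} → m ≤ n → (m ≤ᵇ n) ≡ true
  ≤ᵇ⁺ le = Equivalence.to T-≡ (≤⇒≤ᵇ le)

  Hex T₁ T₂ : ℕ → ℕ → Set
  Hex a b = a ≤ x + z × b ≤ y + z × z ≤ a + b × a + b ≤ x + y + z
  T₁ a b = a ≤ c × b ≤ d × c + d ≤ a + b + k
  T₂ a b = c ≤ a × d + 1 ≤ b × a + b ≤ c + d + 1 + k

  hex⁻ : ∀ {a b} → D.inHex x y z (+ a , + b) ≡ true → Hex a b
  hex⁻ e = let (e₁ , e) = ∧⁻ e ; (e₂ , e) = ∧⁻ e ; (e₃ , e₄) = ∧⁻ e in ≤ᵇ⁻ e₁ , ≤ᵇ⁻ e₂ , ≤ᵇ⁻ e₃ , ≤ᵇ⁻ e₄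

  hex⁺ : ∀ {a b} → Hex a b → D.inHex x y z (+ a , + b) ≡ true
  hex⁺ (h₁ , h₂ , h₃ , h₄) = ∧⁺ (≤ᵇ⁺ h₁) (∧⁺ (≤ᵇ⁺ h₂) (∧⁺ (≤ᵇ⁺ h₃) (≤ᵇ⁺ h₄)))

  ℤ≤ᵇ⁻ : ∀ {i j} → (i ℤ.≤ᵇ j) ≡ true → i ℤ.≤ j
  ℤ≤ᵇ⁻ e = ℤₚ.≤ᵇ⇒≤ (Equivalence.from T-≡ e)

  ℤ≤ᵇ⁺ : ∀ {i j} → i ℤ.≤ j → (i ℤ.≤ᵇ j) ≡ true
  ℤ≤ᵇ⁺ le = Equivalence.to T-≡ (ℤₚ.≤⇒≤ᵇ le)

  -- The slanted side of the first triangle is tested by a subtraction of integers; `k` is moved to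
  -- the other side to remain within the naturals.
  minus⁻ : ∀ {m n} → + m ℤ.- + k ℤ.≤ + n → m ≤ n + k
  minus⁻ {m} {n} le = ℤₚ.drop‿+≤+ (subst (ℤ._≤ + (n + k)) (cancel (+ m) (+ k)) (ℤₚ.+-monoˡ-≤ (+ k) le))
    where
    cancel : ∀ m k → m ℤ.- k ℤ.+ k ≡ m
    cancel = ℤ-Ring.solve-∀

  minus⁺ : ∀ {m n} → m ≤ n + k → + m ℤ.- + k ℤ.≤ + n
  minus⁺ {m} {n} le = subst (+ m ℤ.- + k ℤ.≤_) (cancel (+ n) (+ k)) (ℤₚ.+-monoˡ-≤ (ℤ.- + k) (ℤ.+≤+ le))
    where
    cancel : ∀ n k → n ℤ.+ k ℤ.+ ℤ.- k ≡ n
    cancel = ℤ-Ring.solve-∀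

  inT1-≡ : ∀ a b → D.inT1 x y z k (+ a , + b) ≡ (a ≤ᵇ c) ∧ (b ≤ᵇ d) ∧ (+ (c + d) ℤ.- + k ℤ.≤ᵇ + (a + b))
  inT1-≡ a b = cong₂ (λ C D → (+ a ℤ.≤ᵇ C) ∧ (+ b ℤ.≤ᵇ D) ∧ (C ℤ.+ D ℤ.- + k ℤ.≤ᵇ + a ℤ.+ + b)) cx≡ cy≡

  inT2-≡ : ∀ a b → D.inT2 x y z k (+ a , + b) ≡ (c ≤ᵇ a) ∧ (d + 1 ≤ᵇ b) ∧ (a + b ≤ᵇ c + d + 1 + k)
  inT2-≡ a b = cong₂ (λ C D → (C ℤ.≤ᵇ + a) ∧ (D ℤ.+ ℤ.1ℤ ℤ.≤ᵇ + b) ∧ (+ a ℤ.+ + b ℤ.≤ᵇ C ℤ.+ D ℤ.+ ℤ.1ℤ ℤ.+ + k)) cx≡ cy≡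

  t₁⁻ : ∀ {a b} → D.inT1 x y z k (+ a , + b) ≡ true → T₁ a b
  t₁⁻ {a} {b} e = let (e₁ , e) = ∧⁻ (trans (sym (inT1-≡ a b)) e) ; (e₂ , e₃) = ∧⁻ e in ≤ᵇ⁻ e₁ , ≤ᵇ⁻ e₂ , minus⁻ (ℤ≤ᵇ⁻ e₃)

  t₁⁺ : ∀ {a b} → T₁ a b → D.inT1 x y z k (+ a , + b) ≡ true
  t₁⁺ {a} {b} (h₁ , h₂ , h₃) = trans (inT1-≡ a b) (∧⁺ (≤ᵇ⁺ h₁) (∧⁺ (≤ᵇ⁺ h₂) (ℤ≤ᵇ⁺ (minus⁺ h₃))))

  t₂⁻ : ∀ {a b} → D.inT2 x y z k (+ a , + b) ≡ true → T₂ a b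
  t₂⁻ {a} {b} e = let (e₁ , e) = ∧⁻ (trans (sym (inT2-≡ a b)) e) ; (e₂ , e₃) = ∧⁻ e in ≤ᵇ⁻ e₁ , ≤ᵇ⁻ e₂ , ≤ᵇ⁻ e₃

  t₂⁺ : ∀ {a b} → T₂ a b → D.inT2 x y z k (+ a , + b) ≡ true
  t₂⁺ {a} {b} (h₁ , h₂ , h₃) = trans (inT2-≡ a b) (∧⁺ (≤ᵇ⁺ h₁) (∧⁺ (≤ᵇ⁺ h₂) (≤ᵇ⁺ h₃)))

  -- The down-triangle (a , b) belongs to the region.
  record Dn (a b : ℕ) : Set where
    constructor dn
    field
      lo : z ≤ suc (a + b)
      a< : a < x + z
      b< : b < y + z
      hi : suc (a + b) < x + y + z
      t₁ : ¬ (a < c × b < d × c + d ≤ suc (a + b) + k)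
      t₂ : ¬ (c ≤ a × d < b × suc (a + b) ≤ c + d + k)

  Three : (ℕ → ℕ → Set) → (a₁ b₁ a₂ b₂ a₃ b₃ : ℕ) → Set
  Three S a₁ b₁ a₂ b₂ a₃ b₃ = S a₁ b₁ × S a₂ b₂ × S a₃ b₃

  vs : (a₁ b₁ a₂ b₂ a₃ b₃ : ℕ) → List Pt
  vs a₁ b₁ a₂ b₂ a₃ b₃ = (+ a₁ , + b₁) ∷ (+ a₂ , + b₂) ∷ (+ a₃ , + b₃) ∷ []

  region⁻ : ∀ {a₁ b₁ a₂ b₂ a₃ b₃} → D.triInRegion x y z k (vs a₁ b₁ a₂ b₂ a₃ b₃) ≡ true →
            Three Hex a₁ b₁ a₂ b₂ a₃ b₃ × ¬ Three T₁ a₁ b₁ a₂ b₂ a₃ b₃ × ¬ Three T₂ a₁ b₁ a₂ b₂ a₃ b₃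
  region⁻ e =
    let (h , e) = ∧⁻ e ; (n₁ , n₂) = ∧⁻ e ; (h₁ , h) = ∧⁻ h ; (h₂ , h) = ∧⁻ h ; (h₃ , _) = ∧⁻ h in
    (hex⁻ h₁ , hex⁻ h₂ , hex⁻ h₃) ,
    (λ (u , v , w) → not⁻ n₁ (∧⁺ (t₁⁺ u) (∧⁺ (t₁⁺ v) (∧⁺ (t₁⁺ w) refl)))) ,
    (λ (u , v , w) → not⁻ n₂ (∧⁺ (t₂⁺ u) (∧⁺ (t₂⁺ v) (∧⁺ (t₂⁺ w) refl))))

  region⁺ : ∀ {a₁ b₁ a₂ b₂ a₃ b₃} →
            Three Hex a₁ b₁ a₂ b₂ a₃ b₃ → ¬ Three T₁ a₁ b₁ a₂ b₂ a₃ b₃ → ¬ Three T₂ a₁ b₁ a₂ b₂ a₃ b₃ →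
            D.triInRegion x y z k (vs a₁ b₁ a₂ b₂ a₃ b₃) ≡ true
  region⁺ (h₁ , h₂ , h₃) n₁ n₂ =
    ∧⁺ (∧⁺ (hex⁺ h₁) (∧⁺ (hex⁺ h₂) (∧⁺ (hex⁺ h₃) refl)))
       (∧⁺ (not⁺ (λ e → let (u , e) = ∧⁻ e ; (v , e) = ∧⁻ e ; (w , _) = ∧⁻ e in n₁ (t₁⁻ u , t₁⁻ v , t₁⁻ w)))
           (not⁺ (λ e → let (u , e) = ∧⁻ e ; (v , e) = ∧⁻ e ; (w , _) = ∧⁻ e in n₂ (t₂⁻ u , t₂⁻ v , t₂⁻ w))))

  -- For each side of a convex set only the extreme vertex of the unit triangle matters, which
  -- reduces the tests of all vertices to the inequalities of `Up`.
  up⁻ : ∀ {a b} → D.triInRegion x y z k (upVerts (+ a , + b)) ≡ true → Up a b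
  up⁻ {a} {b} e with region⁻ {a} {b} {a + 1} {b} {a} {b + 1} e
  ... | ((_ , _ , lo , _) , (a≤ , _ , _ , hi) , (_ , b≤ , _ , _)) , n₁ , n₂ = up lo
    (linear 0 (a≤) (solve (a ▸ x ▸ z ▸ ∅) (λ a x z → x :+ z :+ (con 1 :+ a) :+ con 0 := a :+ con 1 :+ (x :+ z)) refl))
    (linear 0 (b≤) (solve (b ▸ y ▸ z ▸ ∅) (λ b y z → y :+ z :+ (con 1 :+ b) :+ con 0 := b :+ con 1 :+ (y :+ z)) refl))
    (linear 0 (hi) (solve (a ▸ b ▸ x ▸ y ▸ z ▸ ∅) (λ a b x y z → x :+ y :+ z :+ (con 1 :+ (a :+ b)) :+ con 0 := a :+ con 1 :+ b :+ (x :+ y :+ z)) refl))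
    (λ (u , v , w) → n₁ ((<⇒≤ u , <⇒≤ v , w)
      , ((linear 0 (u) (solve (a ▸ c ▸ ∅) (λ a c → c :+ (a :+ con 1) :+ con 0 := con 1 :+ a :+ c) refl)) , <⇒≤ v , (linear 1 (w) (solve (a ▸ b ▸ c ▸ d ▸ k ▸ ∅) (λ a b c d k → a :+ b :+ k :+ (c :+ d) :+ con 1 := c :+ d :+ (a :+ con 1 :+ b :+ k)) refl)))
      , (<⇒≤ u , (linear 0 (v) (solve (b ▸ d ▸ ∅) (λ b d → d :+ (b :+ con 1) :+ con 0 := con 1 :+ b :+ d) refl)) , (linear 1 (w) (solve (a ▸ b ▸ c ▸ d ▸ k ▸ ∅) (λ a b c d k → a :+ b :+ k :+ (c :+ d) :+ con 1 := c :+ d :+ (a :+ (b :+ con 1) :+ k)) refl)))))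
    (λ (u , v , w) → n₂ ((u , (linear 0 (v) (solve (b ▸ d ▸ ∅) (λ b d → b :+ (d :+ con 1) :+ con 0 := con 1 :+ d :+ b) refl)) , (linear 1 (w) (solve (a ▸ b ▸ c ▸ d ▸ k ▸ ∅) (λ a b c d k → c :+ d :+ k :+ (a :+ b) :+ con 1 := a :+ b :+ (c :+ d :+ con 1 :+ k)) refl)))
      , ((linear 1 (u) (solve (a ▸ c ▸ ∅) (λ a c → a :+ c :+ con 1 := c :+ (a :+ con 1)) refl)) , (linear 0 (v) (solve (b ▸ d ▸ ∅) (λ b d → b :+ (d :+ con 1) :+ con 0 := con 1 :+ d :+ b) refl)) , (linear 0 (w) (solve (a ▸ b ▸ c ▸ d ▸ k ▸ ∅) (λ a b c d k → c :+ d :+ k :+ (a :+ con 1 :+ b) :+ con 0 := a :+ b :+ (c :+ d :+ con 1 :+ k)) refl)))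
      , (u , (linear 1 (v) (solve (b ▸ d ▸ ∅) (λ b d → b :+ (d :+ con 1) :+ con 1 := con 1 :+ d :+ (b :+ con 1)) refl)) , (linear 0 (w) (solve (a ▸ b ▸ c ▸ d ▸ k ▸ ∅) (λ a b c d k → c :+ d :+ k :+ (a :+ (b :+ con 1)) :+ con 0 := a :+ b :+ (c :+ d :+ con 1 :+ k)) refl)))))

  up⁺ : ∀ {a b} → Up a b → D.triInRegion x y z k (upVerts (+ a , + b)) ≡ true
  up⁺ {a} {b} (up lo a< b< hi t₁ t₂) = region⁺ {a} {b} {a + 1} {b} {a} {b + 1}
    ((<⇒≤ a< , <⇒≤ b< , lo , <⇒≤ hi)
    , ((linear 0 (a<) (solve (a ▸ x ▸ z ▸ ∅) (λ a x z → x :+ z :+ (a :+ con 1) :+ con 0 := con 1 :+ a :+ (x :+ z)) refl)) , <⇒≤ b< , (linear 1 (lo) (solve (a ▸ b ▸ z ▸ ∅) (λ a b z → a :+ b :+ z :+ con 1 := z :+ (a :+ con 1 :+ b)) refl)) , (linear 0 (hi) (solve (a ▸ b ▸ x ▸ y ▸ z ▸ ∅) (λ a b x y z → x :+ y :+ z :+ (a :+ con 1 :+ b) :+ con 0 := con 1 :+ (a :+ b) :+ (x :+ y :+ z)) refl)))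
    , (<⇒≤ a< , (linear 0 (b<) (solve (b ▸ y ▸ z ▸ ∅) (λ b y z → y :+ z :+ (b :+ con 1) :+ con 0 := con 1 :+ b :+ (y :+ z)) refl)) , (linear 1 (lo) (solve (a ▸ b ▸ z ▸ ∅) (λ a b z → a :+ b :+ z :+ con 1 := z :+ (a :+ (b :+ con 1))) refl)) , (linear 0 (hi) (solve (a ▸ b ▸ x ▸ y ▸ z ▸ ∅) (λ a b x y z → x :+ y :+ z :+ (a :+ (b :+ con 1)) :+ con 0 := con 1 :+ (a :+ b) :+ (x :+ y :+ z)) refl))))
    (λ ((_ , _ , w) , (u , _ , _) , (_ , v , _)) → t₁ ((linear 0 (u) (solve (a ▸ c ▸ ∅) (λ a c → c :+ (con 1 :+ a) :+ con 0 := a :+ con 1 :+ c) refl)) , (linear 0 (v) (solve (b ▸ d ▸ ∅) (λ b d → d :+ (con 1 :+ b) :+ con 0 := b :+ con 1 :+ d) refl)) , w))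
    (λ ((u , v , _) , (_ , _ , w) , _) → t₂ (u , (linear 0 (v) (solve (b ▸ d ▸ ∅) (λ b d → b :+ (con 1 :+ d) :+ con 0 := d :+ con 1 :+ b) refl)) , (linear 0 (w) (solve (a ▸ b ▸ c ▸ d ▸ k ▸ ∅) (λ a b c d k → c :+ d :+ con 1 :+ k :+ (a :+ b) :+ con 0 := a :+ con 1 :+ b :+ (c :+ d :+ k)) refl))))

  dn⁻ : ∀ {a b} → D.triInRegion x y z k (downVerts (+ a , + b)) ≡ true → Dn a b
  dn⁻ {a} {b} e with region⁻ {a + 1} {b} {a} {b + 1} {a + 1} {b + 1} e
  ... | ((a≤ , _ , lo , _) , (_ , b≤ , _ , _) , (_ , _ , _ , hi)) , n₁ , n₂ = dn
    (linear 0 (lo) (solve (a ▸ b ▸ z ▸ ∅) (λ a b z → a :+ con 1 :+ b :+ z :+ con 0 := z :+ (con 1 :+ (a :+ b))) refl))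
    (linear 0 (a≤) (solve (a ▸ x ▸ z ▸ ∅) (λ a x z → x :+ z :+ (con 1 :+ a) :+ con 0 := a :+ con 1 :+ (x :+ z)) refl))
    (linear 0 (b≤) (solve (b ▸ y ▸ z ▸ ∅) (λ b y z → y :+ z :+ (con 1 :+ b) :+ con 0 := b :+ con 1 :+ (y :+ z)) refl))
    (linear 0 (hi) (solve (a ▸ b ▸ x ▸ y ▸ z ▸ ∅) (λ a b x y z → x :+ y :+ z :+ (con 1 :+ (con 1 :+ (a :+ b))) :+ con 0 := a :+ con 1 :+ (b :+ con 1) :+ (x :+ y :+ z)) refl))
    (λ (u , v , w) → n₁ (((linear 0 (u) (solve (a ▸ c ▸ ∅) (λ a c → c :+ (a :+ con 1) :+ con 0 := con 1 :+ a :+ c) refl)) , <⇒≤ v , (linear 0 (w) (solve (a ▸ b ▸ c ▸ d ▸ k ▸ ∅) (λ a b c d k → con 1 :+ (a :+ b) :+ k :+ (c :+ d) :+ con 0 := c :+ d :+ (a :+ con 1 :+ b :+ k)) refl)))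
      , (<⇒≤ u , (linear 0 (v) (solve (b ▸ d ▸ ∅) (λ b d → d :+ (b :+ con 1) :+ con 0 := con 1 :+ b :+ d) refl)) , (linear 0 (w) (solve (a ▸ b ▸ c ▸ d ▸ k ▸ ∅) (λ a b c d k → con 1 :+ (a :+ b) :+ k :+ (c :+ d) :+ con 0 := c :+ d :+ (a :+ (b :+ con 1) :+ k)) refl)))
      , ((linear 0 (u) (solve (a ▸ c ▸ ∅) (λ a c → c :+ (a :+ con 1) :+ con 0 := con 1 :+ a :+ c) refl)) , (linear 0 (v) (solve (b ▸ d ▸ ∅) (λ b d → d :+ (b :+ con 1) :+ con 0 := con 1 :+ b :+ d) refl)) , (linear 1 (w) (solve (a ▸ b ▸ c ▸ d ▸ k ▸ ∅) (λ a b c d k → con 1 :+ (a :+ b) :+ k :+ (c :+ d) :+ con 1 := c :+ d :+ (a :+ con 1 :+ (b :+ con 1) :+ k)) refl)))))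
    (λ (u , v , w) → n₂ (((linear 1 (u) (solve (a ▸ c ▸ ∅) (λ a c → a :+ c :+ con 1 := c :+ (a :+ con 1)) refl)) , (linear 0 (v) (solve (b ▸ d ▸ ∅) (λ b d → b :+ (d :+ con 1) :+ con 0 := con 1 :+ d :+ b) refl)) , (linear 1 (w) (solve (a ▸ b ▸ c ▸ d ▸ k ▸ ∅) (λ a b c d k → c :+ d :+ k :+ (a :+ con 1 :+ b) :+ con 1 := con 1 :+ (a :+ b) :+ (c :+ d :+ con 1 :+ k)) refl)))
      , (u , (linear 1 (v) (solve (b ▸ d ▸ ∅) (λ b d → b :+ (d :+ con 1) :+ con 1 := con 1 :+ d :+ (b :+ con 1)) refl)) , (linear 1 (w) (solve (a ▸ b ▸ c ▸ d ▸ k ▸ ∅) (λ a b c d k → c :+ d :+ k :+ (a :+ (b :+ con 1)) :+ con 1 := con 1 :+ (a :+ b) :+ (c :+ d :+ con 1 :+ k)) refl)))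
      , ((linear 1 (u) (solve (a ▸ c ▸ ∅) (λ a c → a :+ c :+ con 1 := c :+ (a :+ con 1)) refl)) , (linear 1 (v) (solve (b ▸ d ▸ ∅) (λ b d → b :+ (d :+ con 1) :+ con 1 := con 1 :+ d :+ (b :+ con 1)) refl)) , (linear 0 (w) (solve (a ▸ b ▸ c ▸ d ▸ k ▸ ∅) (λ a b c d k → c :+ d :+ k :+ (a :+ con 1 :+ (b :+ con 1)) :+ con 0 := con 1 :+ (a :+ b) :+ (c :+ d :+ con 1 :+ k)) refl)))))

  dn⁺ : ∀ {a b} → Dn a b → D.triInRegion x y z k (downVerts (+ a , + b)) ≡ true
  dn⁺ {a} {b} (dn lo a< b< hi t₁ t₂) = region⁺ {a + 1} {b} {a} {b + 1} {a + 1} {b + 1}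
    (((linear 0 (a<) (solve (a ▸ x ▸ z ▸ ∅) (λ a x z → x :+ z :+ (a :+ con 1) :+ con 0 := con 1 :+ a :+ (x :+ z)) refl)) , <⇒≤ b< , (linear 0 (lo) (solve (a ▸ b ▸ z ▸ ∅) (λ a b z → con 1 :+ (a :+ b) :+ z :+ con 0 := z :+ (a :+ con 1 :+ b)) refl)) , (linear 1 (hi) (solve (a ▸ b ▸ x ▸ y ▸ z ▸ ∅) (λ a b x y z → x :+ y :+ z :+ (a :+ con 1 :+ b) :+ con 1 := con 1 :+ (con 1 :+ (a :+ b)) :+ (x :+ y :+ z)) refl)))
    , (<⇒≤ a< , (linear 0 (b<) (solve (b ▸ y ▸ z ▸ ∅) (λ b y z → y :+ z :+ (b :+ con 1) :+ con 0 := con 1 :+ b :+ (y :+ z)) refl)) , (linear 0 (lo) (solve (a ▸ b ▸ z ▸ ∅) (λ a b z → con 1 :+ (a :+ b) :+ z :+ con 0 := z :+ (a :+ (b :+ con 1))) refl)) , (linear 1 (hi) (solve (a ▸ b ▸ x ▸ y ▸ z ▸ ∅) (λ a b x y z → x :+ y :+ z :+ (a :+ (b :+ con 1)) :+ con 1 := con 1 :+ (con 1 :+ (a :+ b)) :+ (x :+ y :+ z)) refl)))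
    , ((linear 0 (a<) (solve (a ▸ x ▸ z ▸ ∅) (λ a x z → x :+ z :+ (a :+ con 1) :+ con 0 := con 1 :+ a :+ (x :+ z)) refl)) , (linear 0 (b<) (solve (b ▸ y ▸ z ▸ ∅) (λ b y z → y :+ z :+ (b :+ con 1) :+ con 0 := con 1 :+ b :+ (y :+ z)) refl)) , (linear 1 (lo) (solve (a ▸ b ▸ z ▸ ∅) (λ a b z → con 1 :+ (a :+ b) :+ z :+ con 1 := z :+ (a :+ con 1 :+ (b :+ con 1))) refl)) , (linear 0 (hi) (solve (a ▸ b ▸ x ▸ y ▸ z ▸ ∅) (λ a b x y z → x :+ y :+ z :+ (a :+ con 1 :+ (b :+ con 1)) :+ con 0 := con 1 :+ (con 1 :+ (a :+ b)) :+ (x :+ y :+ z)) refl))))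
    (λ ((u , _ , w) , (_ , v , _) , _) → t₁ ((linear 0 (u) (solve (a ▸ c ▸ ∅) (λ a c → c :+ (con 1 :+ a) :+ con 0 := a :+ con 1 :+ c) refl)) , (linear 0 (v) (solve (b ▸ d ▸ ∅) (λ b d → d :+ (con 1 :+ b) :+ con 0 := b :+ con 1 :+ d) refl)) , (linear 0 (w) (solve (a ▸ b ▸ c ▸ d ▸ k ▸ ∅) (λ a b c d k → a :+ con 1 :+ b :+ k :+ (c :+ d) :+ con 0 := c :+ d :+ (con 1 :+ (a :+ b) :+ k)) refl))))
    (λ ((_ , v , _) , (u , _ , _) , (_ , _ , w)) → t₂ (u , (linear 0 (v) (solve (b ▸ d ▸ ∅) (λ b d → b :+ (con 1 :+ d) :+ con 0 := d :+ con 1 :+ b) refl)) , (linear 0 (w) (solve (a ▸ b ▸ c ▸ d ▸ k ▸ ∅) (λ a b c d k → c :+ d :+ con 1 :+ k :+ (con 1 :+ (a :+ b)) :+ con 0 := a :+ con 1 :+ (b :+ con 1) :+ (c :+ d :+ k)) refl))))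

  -- The rotation preserves the hexagon and exchanges the two removed triangles, so the condition on
  -- each is proved from that on the other.
  up→dn : ∀ {a b a′ b′} → suc (a + a′) ≡ c + c → b + b′ ≡ d + d → Up a b → Dn a′ b′
  up→dn {a} {b} {a′} {b′} e f (up lo a< b< hi t₁ t₂) = dn
    (linear 0 (≤-reflexive (sym e) ⊹ ≤-reflexive (sym f) ⊹ hi ⊹ ≤-reflexive (sym x+z) ⊹ ≤-reflexive (sym y+z)) (solve (a ▸ a′ ▸ b ▸ b′ ▸ c ▸ d ▸ x ▸ y ▸ z ▸ ∅) (λ a a′ b b′ c d x y z → con 1 :+ (a :+ a′) :+ (b :+ b′ :+ (x :+ y :+ z :+ (c :+ c :+ (con 1 :+ (d :+ d))))) :+ z :+ con 0 := c :+ c :+ (d :+ d :+ (con 1 :+ (a :+ b) :+ (x :+ z :+ (y :+ z)))) :+ (con 1 :+ (a′ :+ b′))) refl))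
    (linear a (≤-reflexive e ⊹ ≤-reflexive x+z) (solve (a ▸ a′ ▸ c ▸ x ▸ z ▸ ∅) (λ a a′ c x z → c :+ c :+ (x :+ z) :+ (con 1 :+ a′) :+ a := con 1 :+ (a :+ a′) :+ (c :+ c) :+ (x :+ z)) refl))
    (linear b (≤-reflexive f ⊹ ≤-reflexive y+z) (solve (b ▸ b′ ▸ d ▸ y ▸ z ▸ ∅) (λ b b′ d y z → d :+ d :+ (y :+ z) :+ (con 1 :+ b′) :+ b := b :+ b′ :+ (con 1 :+ (d :+ d)) :+ (y :+ z)) refl))
    (linear 0 (≤-reflexive e ⊹ ≤-reflexive f ⊹ lo ⊹ ≤-reflexive x+z ⊹ ≤-reflexive y+z) (solve (a ▸ a′ ▸ b ▸ b′ ▸ c ▸ d ▸ x ▸ y ▸ z ▸ ∅) (λ a a′ b b′ c d x y z → c :+ c :+ (d :+ d :+ (a :+ b :+ (x :+ z :+ (y :+ z)))) :+ (con 1 :+ (con 1 :+ (a′ :+ b′))) :+ con 0 := con 1 :+ (a :+ a′) :+ (b :+ b′ :+ (z :+ (c :+ c :+ (con 1 :+ (d :+ d))))) :+ (x :+ y :+ z)) refl))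
    (λ (u , v , w) → t₂ ((linear 0 (u ⊹ ≤-reflexive (sym e)) (solve (a ▸ a′ ▸ c ▸ ∅) (λ a a′ c → c :+ (con 1 :+ (a :+ a′)) :+ c :+ con 0 := con 1 :+ a′ :+ (c :+ c) :+ a) refl)) , (linear 0 (v ⊹ ≤-reflexive (sym f)) (solve (b ▸ b′ ▸ d ▸ ∅) (λ b b′ d → d :+ (b :+ b′) :+ (con 1 :+ d) :+ con 0 := con 1 :+ b′ :+ (d :+ d) :+ b) refl))
       , (linear 0 (w ⊹ ≤-reflexive e ⊹ ≤-reflexive f) (solve (a ▸ a′ ▸ b ▸ b′ ▸ c ▸ d ▸ k ▸ ∅) (λ a a′ b b′ c d k → con 1 :+ (a′ :+ b′) :+ k :+ (c :+ c :+ (d :+ d)) :+ (a :+ b) :+ con 0 := c :+ d :+ (con 1 :+ (a :+ a′) :+ (b :+ b′)) :+ (c :+ d :+ k)) refl))))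
    (λ (u , v , w) → t₁ ((linear 0 (u ⊹ ≤-reflexive e) (solve (a ▸ a′ ▸ c ▸ ∅) (λ a a′ c → a′ :+ (c :+ c) :+ (con 1 :+ a) :+ con 0 := c :+ (con 1 :+ (a :+ a′)) :+ c) refl)) , (linear 0 (v ⊹ ≤-reflexive f) (solve (b ▸ b′ ▸ d ▸ ∅) (λ b b′ d → b′ :+ (d :+ d) :+ (con 1 :+ b) :+ con 0 := con 1 :+ d :+ (b :+ b′) :+ d) refl))
       , (linear 0 (w ⊹ ≤-reflexive (sym e) ⊹ ≤-reflexive (sym f)) (solve (a ▸ a′ ▸ b ▸ b′ ▸ c ▸ d ▸ k ▸ ∅) (λ a a′ b b′ c d k → c :+ d :+ k :+ (con 1 :+ (a :+ a′) :+ (b :+ b′)) :+ (c :+ d) :+ con 0 := con 1 :+ (a′ :+ b′) :+ (c :+ c :+ (d :+ d)) :+ (a :+ b :+ k)) refl))))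

  dn→up : ∀ {a b a′ b′} → suc (a + a′) ≡ c + c → b + b′ ≡ d + d → Dn a b → Up a′ b′
  dn→up {a} {b} {a′} {b′} e f (dn lo a< b< hi t₁ t₂) = up
    (linear 0 (≤-reflexive (sym e) ⊹ ≤-reflexive (sym f) ⊹ hi ⊹ ≤-reflexive (sym x+z) ⊹ ≤-reflexive (sym y+z)) (solve (a ▸ a′ ▸ b ▸ b′ ▸ c ▸ d ▸ x ▸ y ▸ z ▸ ∅) (λ a a′ b b′ c d x y z → con 1 :+ (a :+ a′) :+ (b :+ b′ :+ (x :+ y :+ z :+ (c :+ c :+ (con 1 :+ (d :+ d))))) :+ z :+ con 0 := c :+ c :+ (d :+ d :+ (con 1 :+ (con 1 :+ (a :+ b)) :+ (x :+ z :+ (y :+ z)))) :+ (a′ :+ b′)) refl))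
    (linear a (≤-reflexive e ⊹ ≤-reflexive x+z) (solve (a ▸ a′ ▸ c ▸ x ▸ z ▸ ∅) (λ a a′ c x z → c :+ c :+ (x :+ z) :+ (con 1 :+ a′) :+ a := con 1 :+ (a :+ a′) :+ (c :+ c) :+ (x :+ z)) refl))
    (linear b (≤-reflexive f ⊹ ≤-reflexive y+z) (solve (b ▸ b′ ▸ d ▸ y ▸ z ▸ ∅) (λ b b′ d y z → d :+ d :+ (y :+ z) :+ (con 1 :+ b′) :+ b := b :+ b′ :+ (con 1 :+ (d :+ d)) :+ (y :+ z)) refl))
    (linear 0 (≤-reflexive e ⊹ ≤-reflexive f ⊹ lo ⊹ ≤-reflexive x+z ⊹ ≤-reflexive y+z) (solve (a ▸ a′ ▸ b ▸ b′ ▸ c ▸ d ▸ x ▸ y ▸ z ▸ ∅) (λ a a′ b b′ c d x y z → c :+ c :+ (d :+ d :+ (con 1 :+ (a :+ b) :+ (x :+ z :+ (y :+ z)))) :+ (con 1 :+ (a′ :+ b′)) :+ con 0 := con 1 :+ (a :+ a′) :+ (b :+ b′ :+ (z :+ (c :+ c :+ (con 1 :+ (d :+ d))))) :+ (x :+ y :+ z)) refl))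
    (λ (u , v , w) → t₂ ((linear 0 (u ⊹ ≤-reflexive (sym e)) (solve (a ▸ a′ ▸ c ▸ ∅) (λ a a′ c → c :+ (con 1 :+ (a :+ a′)) :+ c :+ con 0 := con 1 :+ a′ :+ (c :+ c) :+ a) refl)) , (linear 0 (v ⊹ ≤-reflexive (sym f)) (solve (b ▸ b′ ▸ d ▸ ∅) (λ b b′ d → d :+ (b :+ b′) :+ (con 1 :+ d) :+ con 0 := con 1 :+ b′ :+ (d :+ d) :+ b) refl))
       , (linear 0 (w ⊹ ≤-reflexive e ⊹ ≤-reflexive f) (solve (a ▸ a′ ▸ b ▸ b′ ▸ c ▸ d ▸ k ▸ ∅) (λ a a′ b b′ c d k → a′ :+ b′ :+ k :+ (c :+ c :+ (d :+ d)) :+ (con 1 :+ (a :+ b)) :+ con 0 := c :+ d :+ (con 1 :+ (a :+ a′) :+ (b :+ b′)) :+ (c :+ d :+ k)) refl))))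
    (λ (u , v , w) → t₁ ((linear 0 (u ⊹ ≤-reflexive e) (solve (a ▸ a′ ▸ c ▸ ∅) (λ a a′ c → a′ :+ (c :+ c) :+ (con 1 :+ a) :+ con 0 := c :+ (con 1 :+ (a :+ a′)) :+ c) refl)) , (linear 0 (v ⊹ ≤-reflexive f) (solve (b ▸ b′ ▸ d ▸ ∅) (λ b b′ d → b′ :+ (d :+ d) :+ (con 1 :+ b) :+ con 0 := con 1 :+ d :+ (b :+ b′) :+ d) refl))
       , (linear 0 (w ⊹ ≤-reflexive (sym e) ⊹ ≤-reflexive (sym f)) (solve (a ▸ a′ ▸ b ▸ b′ ▸ c ▸ d ▸ k ▸ ∅) (λ a a′ b b′ c d k → c :+ d :+ k :+ (con 1 :+ (a :+ a′) :+ (b :+ b′)) :+ (c :+ d) :+ con 0 := a′ :+ b′ :+ (c :+ c :+ (d :+ d)) :+ (con 1 :+ (a :+ b) :+ k)) refl))))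

-- Candidate lists as functions on the up-triangles

module Pairing where

  pairUp : List Pt → List (Fin 3) → List (Pt × Pt)
  pairUp []       cs       = []
  pairUp (u ∷ us) []       = []
  pairUp (u ∷ us) (i ∷ cs) = (u , neighbour u i) ∷ pairUp us cs

  -- The local function of pairsOf has no name of its own: the meta is solved by unification with
  -- its occurrence in pairsOf-∷, where the with-abstraction separates its parameters.
  mutual
    zipNb : List Pt → List (Fin 3) → List Pt → List (Fin 3) → List Pt
    zipNb = _

    pairsOf-∷ : ∀ u us i cs → pairsOf (u ∷ us) (i ∷ cs) ≡ (u , neighbour u i) ∷ zip us (zipNb (u ∷ us) (i ∷ cs) us cs)
    pairsOf-∷ u us i cs with u ∷ us | i ∷ cs
    ... | _ | _ = refl

  zip-zipNb : ∀ us₀ cs₀ us cs → zip us (zipNb us₀ cs₀ us cs) ≡ pairUp us cs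
  zip-zipNb us₀ cs₀ []       cs       = refl
  zip-zipNb us₀ cs₀ (u ∷ us) []       = refl
  zip-zipNb us₀ cs₀ (u ∷ us) (i ∷ cs) = cong ((u , neighbour u i) ∷_) (zip-zipNb us₀ cs₀ us cs)

  pairsOf-pairUp : ∀ us cs → pairsOf us cs ≡ pairUp us cs
  pairsOf-pairUp []       cs       = refl
  pairsOf-pairUp (u ∷ us) []       = refl
  pairsOf-pairUp (u ∷ us) (i ∷ cs) = trans (pairsOf-∷ u us i cs) (cong ((u , neighbour u i) ∷_) (zip-zipNb (u ∷ us) (i ∷ cs) us cs))

  pairUp-map : ∀ (τ : Pt → Fin 3) us → pairUp us (map τ us) ≡ map (λ u → u , neighbour u (τ u)) us
  pairUp-map τ []       = refl
  pairUp-map τ (u ∷ us) = cong ((u , neighbour u (τ u)) ∷_) (pairUp-map τ us)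

  ==ℤ-refl : ∀ i → (i D.==ℤ i) ≡ true
  ==ℤ-refl i with i ℤ.≟ i
  ... | yes _ = refl
  ... | no ne = ⊥-elim (ne refl)

  ==ℤ-sound : ∀ {i j} → (i D.==ℤ j) ≡ true → i ≡ j
  ==ℤ-sound {i} {j} e with i ℤ.≟ j
  ... | yes eq = eq
  ... | no _ with () ← e

  ==P-refl : ∀ p → (p D.==P p) ≡ true
  ==P-refl (a , b) rewrite ==ℤ-refl a | ==ℤ-refl b = refl

  ==P-sound : ∀ {p q} → (p D.==P q) ≡ true → p ≡ q
  ==P-sound {a , b} {c , d} e with a D.==ℤ c in e₁ | b D.==ℤ d in e₂
  ... | true | true = cong₂ _,_ (==ℤ-sound e₁) (==ℤ-sound e₂)

  memP⁺ : ∀ {p ps} → p ∈ ps → memP p ps ≡ true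
  memP⁺ {p} (here refl) rewrite ==P-refl p = refl
  memP⁺ {p} {q ∷ ps} (there p∈) with q D.==P p
  ... | true  = refl
  ... | false = memP⁺ p∈

  partner⁻ : ∀ (μ : Pt → Pt) us {w p} → partnerOf (map (λ u → u , μ u) us) w ≡ just p → w ∈ us × p ≡ μ w
  partner⁻ μ (u ∷ us) {w} e with u D.==P w in eq
  partner⁻ μ (u ∷ us) {w} refl | true with ==P-sound {u} {w} eq
  ... | refl = here refl , refl
  partner⁻ μ (u ∷ us) e | false with partner⁻ μ us e
  ... | w∈ , eq′ = there w∈ , eq′

  partner⁺ : ∀ (μ : Pt → Pt) us {w} → w ∈ us → partnerOf (map (λ u → u , μ u) us) w ≡ just (μ w)
  partner⁺ μ (u ∷ us) {w} w∈ with u D.==P w in eq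
  ... | true = cong (just ∘ μ) (==P-sound {u} {w} eq)
  partner⁺ μ (u ∷ us) {w} (here refl) | false with () ← trans (sym (==P-refl w)) eq
  partner⁺ μ (u ∷ us) {w} (there w∈) | false = partner⁺ μ us w∈

  eqMaybe⁻ : ∀ {r p} → eqMaybeP r (just p) ≡ true → r ≡ just p
  eqMaybe⁻ {just q} {p} e = cong just (==P-sound {q} {p} e)

  count-none : ∀ (μ : Pt → Pt) p us → (∀ {u} → u ∈ us → μ u ≢ p) → countP p (map μ us) ≡ 0
  count-none μ p []       h = refl
  count-none μ p (u ∷ us) h with μ u D.==P p in eq
  ... | true  = ⊥-elim (h (here refl) (==P-sound {μ u} {p} eq))
  ... | false = count-none μ p us (λ u∈ → h (there u∈))

  count-one : ∀ (μ : Pt → Pt) p {us u₀} → Unique us → u₀ ∈ us → μ u₀ ≡ p → (∀ {u} → u ∈ us → μ u ≡ p → u ≡ u₀) → countP p (map μ us) ≡ 1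
  count-one μ p {u ∷ us} (u∉ ∷ uq) u₀∈ e h with μ u D.==P p in eq
  ... | true  = cong suc (count-none μ p us (λ {u′} u′∈ e′ → All.lookup u∉ u′∈ (trans (h (here refl) (==P-sound {μ u} {p} eq)) (sym (h (there u′∈) e′)))))
  count-one μ p {u ∷ us} (u∉ ∷ uq) (here refl) e h | false with () ← trans (sym (trans (cong (D._==P p) e) (==P-refl p))) eq
  count-one μ p {u ∷ us} (u∉ ∷ uq) (there u₀∈) e h | false = count-one μ p uq u₀∈ e (λ u∈ → h (there u∈))

  -- Turns a candidate, a list aligned with the up-triangles, into a function of the triangle. The
  -- last clause is a default for points without an entry.
  look : List Pt → List (Fin 3) → Pt → Fin 3
  look (u ∷ us) (i ∷ cs) p with u D.==P p
  ... | true  = i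
  ... | false = look us cs p
  look _ _ p = zero

  look-map : ∀ (τ : Pt → Fin 3) us {p} → p ∈ us → look us (map τ us) p ≡ τ p
  look-map τ (u ∷ us) {p} p∈ with u D.==P p in eq
  ... | true = cong τ (==P-sound {u} {p} eq)
  look-map τ (u ∷ us) {p} (here refl) | false with () ← trans (sym (==P-refl p)) eq
  look-map τ (u ∷ us) {p} (there p∈) | false = look-map τ us p∈

  map-local : ∀ {A B : Set} {f g : A → B} us → (∀ {u} → u ∈ us → f u ≡ g u) → map f us ≡ map g us
  map-local []       h = refl
  map-local (u ∷ us) h = cong₂ _∷_ (h (here refl)) (map-local us (λ u∈ → h (there u∈)))

  map-look : ∀ {us} → Unique us → ∀ cs → length cs ≡ length us → map (look us cs) us ≡ cs
  map-look {[]}     _         []       _  = refl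
  map-look {u ∷ us} (u∉ ∷ uq) (i ∷ cs) le =
    cong₂ _∷_ first (trans (map-local us rest) (map-look uq cs (suc-injective le)))
    where
    first : look (u ∷ us) (i ∷ cs) u ≡ i
    first rewrite ==P-refl u = refl
    rest : ∀ {p} → p ∈ us → look (u ∷ us) (i ∷ cs) p ≡ look us cs p
    rest {p} p∈ with u D.==P p in eq
    ... | true  = ⊥-elim (All.lookup u∉ p∈ (==P-sound {u} {p} eq))
    ... | false = refl

  choices-sound : ∀ n {cs} → cs ∈ choices n → length cs ≡ n
  choices-sound zero    (here refl) = refl
  choices-sound (suc n) cs∈ with ∈-consAll⁻ (zero ∷ suc zero ∷ suc (suc zero) ∷ []) {λ _ → choices n} cs∈
    where open Enumeration
  ... | i , cs , _ , cs∈′ , refl = cong suc (choices-sound n cs∈′)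

  choices-complete : ∀ cs → cs ∈ choices (length cs)
  choices-complete []       = here refl
  choices-complete (i ∷ cs) = Enumeration.∈-consAll⁺ {ts = zero ∷ suc zero ∷ suc (suc zero) ∷ []} {λ _ → choices (length cs)} (direction i) (choices-complete cs)
    where
    direction : ∀ i → i ∈ zero ∷ suc zero ∷ suc (suc zero) ∷ []
    direction zero             = here refl
    direction (suc zero)       = there (here refl)
    direction (suc (suc zero)) = there (there (here refl))

  choices-unique : ∀ n → Unique (choices n)
  choices-unique zero    = [] ∷ []
  choices-unique (suc n) = ListCounting.consAll-unique {ts = zero ∷ suc zero ∷ suc (suc zero) ∷ []} {λ _ → choices n}
    (((λ ()) ∷ (λ ()) ∷ []) ∷ ((λ ()) ∷ []) ∷ [] ∷ []) (λ _ → choices-unique n)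

-- Symmetric tilings as symmetric choices of directions

module Matching (x y z k c d : ℕ) (x+z : c + c ≡ x + z) (y+z : suc (d + d) ≡ y + z)
  (cx≡ : D.cx x y z ≡ + c) (cy≡ : D.cy x y z ≡ + d) (p₀ : ℕ) (c+d : p₀ + z ≡ c + d) (k≤c : k ≤ c) where

  open LinearArithmetic
  open Pairing
  open Strip using (clash)
  open Geometry x y z k c d p₀ x+z y+z c+d k≤c
  open Reflection x y z k c d x+z y+z cx≡ cy≡ p₀ c+d k≤c

  ups downs : List Pt
  ups   = upTris x y z k
  downs = downTris x y z k

  box⁻ : ∀ {p} → p ∈ D.box x y z → ∃ λ a → ∃ λ b → p ≡ (+ a , + b)
  box⁻ p∈ with ∈-concat⁻′ (map (λ a → map (λ b → (+ a , + b)) (upTo (suc (y + z)))) (upTo (suc (x + z)))) p∈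
  ... | xs , p∈′ , xs∈ with ∈-map⁻ (λ a → map (λ b → (+ a , + b)) (upTo (suc (y + z)))) xs∈
  ...   | a , _ , refl with ∈-map⁻ (λ b → (+ a , + b)) p∈′
  ...     | b , _ , refl = a , b , refl

  box⁺ : ∀ {a b} → a ≤ x + z → b ≤ y + z → (+ a , + b) ∈ D.box x y z
  box⁺ {a} {b} a≤ b≤ = ∈-concat⁺′ (∈-map⁺ (λ b → (+ a , + b)) (∈-upTo⁺ (s≤s b≤)))
                                  (∈-map⁺ (λ a → map (λ b → (+ a , + b)) (upTo (suc (y + z)))) (∈-upTo⁺ (s≤s a≤)))

  box-unique : Unique (D.box x y z)
  box-unique = columns (upTo (suc (x + z))) (Uniqueₚ.upTo⁺ (suc (x + z)))
    where
    column : ℕ → List Pt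
    column a = map (λ b → (+ a , + b)) (upTo (suc (y + z)))
    in-column : ∀ {p} as → p ∈ concatMap column as → ∃ λ a → a ∈ as × proj₁ p ≡ + a
    in-column (a ∷ as) p∈ with ∈-++⁻ (column a) p∈
    ... | inj₁ q with ∈-map⁻ (λ b → (+ a , + b)) q
    ...   | _ , _ , refl = a , here refl , refl
    in-column (a ∷ as) p∈ | inj₂ q with in-column as q
    ... | a′ , a∈ , eq = a′ , there a∈ , eq
    columns : ∀ as → Unique as → Unique (concatMap column as)
    columns []       _         = []
    columns (a ∷ as) (a∉ ∷ uq) =
      Uniqueₚ.++⁺ (Uniqueₚ.map⁺ (λ e → ℤₚ.+-injective (cong proj₂ e)) (Uniqueₚ.upTo⁺ (suc (y + z)))) (columns as uq) disjoint
      where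
      disjoint : ∀ {p} → ¬ (p ∈ column a × p ∈ concatMap column as)
      disjoint (p∈ , q∈) with ∈-map⁻ (λ b → (+ a , + b)) p∈ | in-column as q∈
      ... | _ , _ , refl | a′ , a∈ , eq = All.lookup a∉ a∈ (ℤₚ.+-injective eq)

  ups-unique : Unique ups
  ups-unique = Uniqueₚ.filter⁺ (λ p → D.triInRegion x y z k (upVerts p) Data.Bool.≟ true) box-unique

  ups⁻ : ∀ {p} → p ∈ ups → ∃ λ a → ∃ λ b → p ≡ (+ a , + b) × Up a b
  ups⁻ {p} p∈ with ∈-filter⁻ (λ p → D.triInRegion x y z k (upVerts p) Data.Bool.≟ true) {xs = D.box x y z} p∈
  ... | p∈′ , e with box⁻ p∈′
  ...   | a , b , refl = a , b , refl , up⁻ e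

  ups⁺ : ∀ {a b} → Up a b → (+ a , + b) ∈ ups
  ups⁺ {a} {b} u = ∈-filter⁺ (λ p → D.triInRegion x y z k (upVerts p) Data.Bool.≟ true) (box⁺ {a} {b} (<⇒≤ (Up.a< u)) (<⇒≤ (Up.b< u))) (up⁺ {a} {b} u)

  downs⁻ : ∀ {p} → p ∈ downs → ∃ λ a → ∃ λ b → p ≡ (+ a , + b) × Dn a b
  downs⁻ {p} p∈ with ∈-filter⁻ (λ p → D.triInRegion x y z k (downVerts p) Data.Bool.≟ true) {xs = D.box x y z} p∈
  ... | p∈′ , e with box⁻ p∈′
  ...   | a , b , refl = a , b , refl , dn⁻ e

  downs⁺ : ∀ {a b} → Dn a b → (+ a , + b) ∈ downs
  downs⁺ {a} {b} u = ∈-filter⁺ (λ p → D.triInRegion x y z k (downVerts p) Data.Bool.≟ true) (box⁺ {a} {b} (<⇒≤ (Dn.a< u)) (<⇒≤ (Dn.b< u))) (dn⁺ {a} {b} u)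

  rot-≡ : ∀ p q → rotTri x y z (p , q) ≡ ((+ c ℤ.+ + c ℤ.- ℤ.1ℤ) ℤ.- p , (+ d ℤ.+ + d) ℤ.- q)
  rot-≡ p q = cong₂ (λ C D → ((C ℤ.+ C ℤ.- ℤ.1ℤ) ℤ.- p , (D ℤ.+ D) ℤ.- q)) cx≡ cy≡

  rot⁺ : ∀ {a b a′ b′} → suc (a + a′) ≡ c + c → b + b′ ≡ d + d → rotTri x y z (+ a , + b) ≡ (+ a′ , + b′)
  rot⁺ {a} {b} {a′} {b′} e f = trans (rot-≡ (+ a) (+ b)) (cong₂ _,_
    (trans (cong (λ t → + t ℤ.- ℤ.1ℤ ℤ.- + a) (sym e)) (first (+ a) (+ a′)))
    (trans (cong (λ t → + t ℤ.- + b) (sym f)) (second (+ b) (+ b′))))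
    where
    first : ∀ a a′ → ℤ.1ℤ ℤ.+ (a ℤ.+ a′) ℤ.- ℤ.1ℤ ℤ.- a ≡ a′
    first = ℤ-Ring.solve-∀
    second : ∀ b b′ → b ℤ.+ b′ ℤ.- b ≡ b′
    second = ℤ-Ring.solve-∀

  partner-rot⁻ : ∀ {a b a′ b′} i → rotTri x y z (neighbour (+ a , + b) i) ≡ (+ a′ , + b′) → Partner i a b a′ b′
  partner-rot⁻ {a} {b} {a′} {b′} i e = go i (trans (sym (uncurried i)) e)
    where
    uncurried : ∀ i → rotTri x y z (neighbour (+ a , + b) i)
                ≡ ((+ c ℤ.+ + c ℤ.- ℤ.1ℤ) ℤ.- proj₁ (neighbour (+ a , + b) i) , (+ d ℤ.+ + d) ℤ.- proj₂ (neighbour (+ a , + b) i))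
    uncurried i = rot-≡ (proj₁ (neighbour (+ a , + b) i)) (proj₂ (neighbour (+ a , + b) i))
    first : ∀ a a′ C → C ℤ.- ℤ.1ℤ ℤ.- a ≡ a′ → ℤ.1ℤ ℤ.+ (a ℤ.+ a′) ≡ C
    first a a′ C e = trans (cong (λ t → ℤ.1ℤ ℤ.+ (a ℤ.+ t)) (sym e)) (ring a C)
      where
      ring : ∀ a C → ℤ.1ℤ ℤ.+ (a ℤ.+ (C ℤ.- ℤ.1ℤ ℤ.- a)) ≡ C
      ring = ℤ-Ring.solve-∀
    first′ : ∀ a a′ C → C ℤ.- ℤ.1ℤ ℤ.- (a ℤ.- ℤ.1ℤ) ≡ a′ → a ℤ.+ a′ ≡ C
    first′ a a′ C e = trans (cong (λ t → a ℤ.+ t) (sym e)) (ring a C)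
      where
      ring : ∀ a C → a ℤ.+ (C ℤ.- ℤ.1ℤ ℤ.- (a ℤ.- ℤ.1ℤ)) ≡ C
      ring = ℤ-Ring.solve-∀
    second : ∀ b b′ D → D ℤ.- b ≡ b′ → b ℤ.+ b′ ≡ D
    second b b′ D e = trans (cong (λ t → b ℤ.+ t) (sym e)) (ring b D)
      where
      ring : ∀ b D → b ℤ.+ (D ℤ.- b) ≡ D
      ring = ℤ-Ring.solve-∀
    second′ : ∀ b b′ D → D ℤ.- (b ℤ.- ℤ.1ℤ) ≡ b′ → b ℤ.+ b′ ≡ ℤ.1ℤ ℤ.+ D
    second′ b b′ D e = trans (cong (λ t → b ℤ.+ t) (sym e)) (ring b D)
      where
      ring : ∀ b D → b ℤ.+ (D ℤ.- (b ℤ.- ℤ.1ℤ)) ≡ ℤ.1ℤ ℤ.+ D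
      ring = ℤ-Ring.solve-∀
    go : ∀ i → ((+ c ℤ.+ + c ℤ.- ℤ.1ℤ) ℤ.- proj₁ (neighbour (+ a , + b) i) , (+ d ℤ.+ + d) ℤ.- proj₂ (neighbour (+ a , + b) i)) ≡ (+ a′ , + b′) →
         Partner i a b a′ b′
    go zero             e = partner₀ (ℤₚ.+-injective (first (+ a) (+ a′) (+ (c + c)) (cong proj₁ e))) (ℤₚ.+-injective (second (+ b) (+ b′) (+ (d + d)) (cong proj₂ e)))
    go (suc zero)       e = partner₁ (ℤₚ.+-injective (first′ (+ a) (+ a′) (+ (c + c)) (cong proj₁ e))) (ℤₚ.+-injective (second (+ b) (+ b′) (+ (d + d)) (cong proj₂ e)))
    go (suc (suc zero)) e = partner₂ (ℤₚ.+-injective (first (+ a) (+ a′) (+ (c + c)) (cong proj₁ e))) (ℤₚ.+-injective (second′ (+ b) (+ b′) (+ (d + d)) (cong proj₂ e)))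

  neighbour⁺ : ∀ {i a b a′ b′ a″ b″} → Partner i a b a′ b′ → suc (a′ + a″) ≡ c + c → b′ + b″ ≡ d + d → neighbour (+ a , + b) i ≡ (+ a″ , + b″)
  neighbour⁺ {a = a} {b} {a′} {b′} {a″} {b″} (partner₀ e f) g h = cong₂ (λ s t → + s , + t) a≡ b≡
    where
    a≡ : a ≡ a″
    a≡ = (≤-antisym (linear 0 (≤-reflexive e ⊹ ≤-reflexive (sym g)) (solve (a ▸ a′ ▸ a″ ▸ c ▸ ∅) (λ a a′ a″ c → c :+ c :+ (con 1 :+ (a′ :+ a″)) :+ a :+ con 0 := con 1 :+ (a :+ a′) :+ (c :+ c) :+ a″) refl)) (linear 0 (≤-reflexive (sym e) ⊹ ≤-reflexive g) (solve (a ▸ a′ ▸ a″ ▸ c ▸ ∅) (λ a a′ a″ c → con 1 :+ (a :+ a′) :+ (c :+ c) :+ a″ :+ con 0 := c :+ c :+ (con 1 :+ (a′ :+ a″)) :+ a) refl)))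
    b≡ : b ≡ b″
    b≡ = (≤-antisym (linear 0 (≤-reflexive f ⊹ ≤-reflexive (sym h)) (solve (b ▸ b′ ▸ b″ ▸ d ▸ ∅) (λ b b′ b″ d → d :+ d :+ (b′ :+ b″) :+ b :+ con 0 := b :+ b′ :+ (d :+ d) :+ b″) refl)) (linear 0 (≤-reflexive (sym f) ⊹ ≤-reflexive h) (solve (b ▸ b′ ▸ b″ ▸ d ▸ ∅) (λ b b′ b″ d → b :+ b′ :+ (d :+ d) :+ b″ :+ con 0 := d :+ d :+ (b′ :+ b″) :+ b) refl)))
  neighbour⁺ {a = a} {b} {a′} {b′} {a″} {b″} (partner₁ e f) g h = cong₂ (λ s t → + s ℤ.- ℤ.1ℤ , + t) a≡ b≡
    where
    a≡ : a ≡ suc a″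
    a≡ = (≤-antisym (linear 0 (≤-reflexive e ⊹ ≤-reflexive (sym g)) (solve (a ▸ a′ ▸ a″ ▸ c ▸ ∅) (λ a a′ a″ c → c :+ c :+ (con 1 :+ (a′ :+ a″)) :+ a :+ con 0 := a :+ a′ :+ (c :+ c) :+ (con 1 :+ a″)) refl)) (linear 0 (≤-reflexive (sym e) ⊹ ≤-reflexive g) (solve (a ▸ a′ ▸ a″ ▸ c ▸ ∅) (λ a a′ a″ c → a :+ a′ :+ (c :+ c) :+ (con 1 :+ a″) :+ con 0 := c :+ c :+ (con 1 :+ (a′ :+ a″)) :+ a) refl)))
    b≡ : b ≡ b″
    b≡ = (≤-antisym (linear 0 (≤-reflexive f ⊹ ≤-reflexive (sym h)) (solve (b ▸ b′ ▸ b″ ▸ d ▸ ∅) (λ b b′ b″ d → d :+ d :+ (b′ :+ b″) :+ b :+ con 0 := b :+ b′ :+ (d :+ d) :+ b″) refl)) (linear 0 (≤-reflexive (sym f) ⊹ ≤-reflexive h) (solve (b ▸ b′ ▸ b″ ▸ d ▸ ∅) (λ b b′ b″ d → b :+ b′ :+ (d :+ d) :+ b″ :+ con 0 := d :+ d :+ (b′ :+ b″) :+ b) refl)))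
  neighbour⁺ {a = a} {b} {a′} {b′} {a″} {b″} (partner₂ e f) g h = cong₂ (λ s t → + s , + t ℤ.- ℤ.1ℤ) a≡ b≡
    where
    a≡ : a ≡ a″
    a≡ = (≤-antisym (linear 0 (≤-reflexive e ⊹ ≤-reflexive (sym g)) (solve (a ▸ a′ ▸ a″ ▸ c ▸ ∅) (λ a a′ a″ c → c :+ c :+ (con 1 :+ (a′ :+ a″)) :+ a :+ con 0 := con 1 :+ (a :+ a′) :+ (c :+ c) :+ a″) refl)) (linear 0 (≤-reflexive (sym e) ⊹ ≤-reflexive g) (solve (a ▸ a′ ▸ a″ ▸ c ▸ ∅) (λ a a′ a″ c → con 1 :+ (a :+ a′) :+ (c :+ c) :+ a″ :+ con 0 := c :+ c :+ (con 1 :+ (a′ :+ a″)) :+ a) refl)))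
    b≡ : b ≡ suc b″
    b≡ = (≤-antisym (linear 0 (≤-reflexive f ⊹ ≤-reflexive (sym h)) (solve (b ▸ b′ ▸ b″ ▸ d ▸ ∅) (λ b b′ b″ d → con 1 :+ (d :+ d) :+ (b′ :+ b″) :+ b :+ con 0 := b :+ b′ :+ (d :+ d) :+ (con 1 :+ b″)) refl)) (linear 0 (≤-reflexive (sym f) ⊹ ≤-reflexive h) (solve (b ▸ b′ ▸ b″ ▸ d ▸ ∅) (λ b b′ b″ d → b :+ b′ :+ (d :+ d) :+ (con 1 :+ b″) :+ con 0 := con 1 :+ (d :+ d) :+ (b′ :+ b″) :+ b) refl)))

  partner-sym : ∀ {i a b a′ b′} → Partner i a b a′ b′ → Partner i a′ b′ a b
  partner-sym {a = a} {b} {a′} {b′} (partner₀ e f) = partner₀ (trans (cong suc (+-comm a′ a)) e) (trans (+-comm b′ b) f)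
  partner-sym {a = a} {b} {a′} {b′} (partner₁ e f) = partner₁ (trans (+-comm a′ a) e) (trans (+-comm b′ b) f)
  partner-sym {a = a} {b} {a′} {b′} (partner₂ e f) = partner₂ (trans (cong suc (+-comm a′ a)) e) (trans (+-comm b′ b) f)

  -- The direction can be read off the sums a + a′ and b + b′, which differ for the three cases.
  partner-direction : ∀ {i j a b a′ b′} → Partner i a b a′ b′ → Partner j a b a′ b′ → i ≡ j
  partner-direction (partner₀ _ _) (partner₀ _ _) = refl
  partner-direction (partner₁ _ _) (partner₁ _ _) = refl
  partner-direction (partner₂ _ _) (partner₂ _ _) = refl
  partner-direction (partner₀ e _) (partner₁ e′ _) = ⊥-elim (1+n≢n (trans e (sym e′)))
  partner-direction (partner₁ e _) (partner₀ e′ _) = ⊥-elim (1+n≢n (trans e′ (sym e)))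
  partner-direction (partner₁ e _) (partner₂ e′ _) = ⊥-elim (1+n≢n (trans e′ (sym e)))
  partner-direction (partner₂ e _) (partner₁ e′ _) = ⊥-elim (1+n≢n (trans e (sym e′)))
  partner-direction (partner₀ _ f) (partner₂ _ f′) = ⊥-elim (1+n≢n (trans (sym f′) f))
  partner-direction (partner₂ _ f) (partner₀ _ f′) = ⊥-elim (1+n≢n (trans (sym f) f′))

  partner-unique : ∀ {i a b a₁ b₁ a₂ b₂} → Partner i a b a₁ b₁ → Partner i a b a₂ b₂ → a₁ ≡ a₂ × b₁ ≡ b₂
  partner-unique {a = a} {b} (partner₀ e f) (partner₀ e′ f′) = +-cancelˡ-≡ a _ _ (suc-injective (trans e (sym e′))) , +-cancelˡ-≡ b _ _ (trans f (sym f′))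
  partner-unique {a = a} {b} (partner₁ e f) (partner₁ e′ f′) = +-cancelˡ-≡ a _ _ (trans e (sym e′)) , +-cancelˡ-≡ b _ _ (trans f (sym f′))
  partner-unique {a = a} {b} (partner₂ e f) (partner₂ e′ f′) = +-cancelˡ-≡ a _ _ (suc-injective (trans e (sym e′))) , +-cancelˡ-≡ b _ _ (trans f (sym f′))

  opposite : ∀ {a b} → a < x + z → b < y + z → ∃ λ a′ → ∃ λ b′ → suc (a + a′) ≡ c + c × b + b′ ≡ d + d
  opposite {a} {b} a< b< = c + c ∸ suc a , d + d ∸ b , m+[n∸m]≡n a≤ , m+[n∸m]≡n b≤
    where
    a≤ : suc a ≤ c + c
    a≤ = (linear 0 (a< ⊹ ≤-reflexive (sym x+z)) (solve (a ▸ c ▸ x ▸ z ▸ ∅) (λ a c x z → x :+ z :+ (c :+ c) :+ (con 1 :+ a) :+ con 0 := con 1 :+ a :+ (x :+ z) :+ (c :+ c)) refl))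
    b≤ : b ≤ d + d
    b≤ = (linear 0 (b< ⊹ ≤-reflexive (sym y+z)) (solve (b ▸ d ▸ y ▸ z ▸ ∅) (λ b d y z → y :+ z :+ (con 1 :+ (d :+ d)) :+ b :+ con 0 := con 1 :+ b :+ (y :+ z) :+ (d :+ d)) refl))

  Valid : List (Pt × Pt) → Set
  Valid prs = (isTiling x y z k prs ∧ isSymmetric x y z prs) ≡ true

  module _ (τ : Pt → Fin 3) where

    private
      μ : Pt → Pt
      μ u = neighbour u (τ u)

      prs : List (Pt × Pt)
      prs = map (λ u → u , μ u) ups

      σ : ℕ → ℕ → Fin 3
      σ a b = τ (+ a , + b)

    -- The symmetry test says that the image w of the partner of u is an up-triangle whose own
    -- partner is the image of u. Thus u is the rotated partner of w, and the two have the same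
    -- direction.
    valid⇒symmetric : Valid prs → Symmetric σ
    valid⇒symmetric v {a} {b} u = go (partner⁻ μ ups (eqMaybe⁻ (all⁻ prs (proj₂ (∧⁻ v)) (∈-map⁺ (λ u → u , μ u) (ups⁺ u)))))
      where
      go : rotTri x y z (μ (+ a , + b)) ∈ ups × rotTri x y z (+ a , + b) ≡ μ (rotTri x y z (μ (+ a , + b))) →
           ∃ λ a′ → ∃ λ b′ → Partner (σ a b) a b a′ b′ × Up a′ b′ × σ a′ b′ ≡ σ a b
      go (w∈ , e) = step (ups⁻ w∈)
        where
        step : (∃ λ a′ → ∃ λ b′ → rotTri x y z (μ (+ a , + b)) ≡ (+ a′ , + b′) × Up a′ b′) →
               ∃ λ a′ → ∃ λ b′ → Partner (σ a b) a b a′ b′ × Up a′ b′ × σ a′ b′ ≡ σ a b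
        step (a′ , b′ , w≡ , u′) = a′ , b′ , pr , u′ , sym (partner-direction pr pr′)
          where
          pr : Partner (σ a b) a b a′ b′
          pr = partner-rot⁻ (σ a b) w≡
          pr′ : Partner (σ a′ b′) a b a′ b′
          pr′ = partner-sym (partner-rot⁻ {a′} {b′} {a} {b} (σ a′ b′)
                  (trans (cong (rotTri x y z) (trans (cong μ (sym w≡)) (sym e))) (involution (opposite (Up.a< u) (Up.b< u)))))
            where
            involution : (∃ λ a₁ → ∃ λ b₁ → suc (a + a₁) ≡ c + c × b + b₁ ≡ d + d) → rotTri x y z (rotTri x y z (+ a , + b)) ≡ (+ a , + b)
            involution (a₁ , b₁ , e₁ , f₁) =
              trans (cong (rotTri x y z) (rot⁺ {a} {b} {a₁} {b₁} e₁ f₁)) (rot⁺ {a₁} {b₁} {a} {b} (trans (cong suc (+-comm a₁ a)) e₁) (trans (+-comm b₁ b) f₁))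

    -- A chosen down-triangle is the image of an up-triangle of the region, so it lies in the
    -- region. Conversely a down-triangle is covered by the image of the lozenge at its own image,
    -- and by no other since the rotated partner determines its up-triangle.
    symmetric⇒valid : Symmetric σ → Valid prs
    symmetric⇒valid sy = ∧⁺ (∧⁺ (all⁺ prs in-region) (all⁺ downs covered)) (all⁺ prs mirrored)
      where
      matched : ∀ {a b} → Up a b → ∃ λ a′ → ∃ λ b′ → ∃ λ a″ → ∃ λ b″ →
                Partner (σ a b) a b a′ b′ × Up a′ b′ × σ a′ b′ ≡ σ a b × suc (a′ + a″) ≡ c + c × b′ + b″ ≡ d + d × μ (+ a , + b) ≡ (+ a″ , + b″)
      matched u with sy u
      ... | a′ , b′ , pr , u′ , s with opposite (Up.a< u′) (Up.b< u′)
      ...   | a″ , b″ , e , f = a′ , b′ , a″ , b″ , pr , u′ , s , e , f , neighbour⁺ pr e f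
      in-region : ∀ {pr} → pr ∈ prs → memP (proj₂ pr) downs ≡ true
      in-region pr∈ with ∈-map⁻ (λ u → u , μ u) pr∈
      ... | u , u∈ , refl with ups⁻ u∈
      ...   | a , b , refl , w with matched w
      ...     | a′ , b′ , a″ , b″ , _ , u′ , _ , e , f , m≡ = memP⁺ (subst (_∈ downs) (sym m≡) (downs⁺ (up→dn e f u′)))
      mirrored : ∀ {pr} → pr ∈ prs → eqMaybeP (partnerOf prs (rotTri x y z (proj₂ pr))) (just (rotTri x y z (proj₁ pr))) ≡ true
      mirrored pr∈ with ∈-map⁻ (λ u → u , μ u) pr∈
      ... | u , u∈ , refl with ups⁻ u∈
      ...   | a , b , refl , w with matched w
      ...     | a′ , b′ , a″ , b″ , pr , u′ , s , e , f , m≡ with opposite (Up.a< w) (Up.b< w)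
      ...       | a₁ , b₁ , e₁ , f₁ =
        trans (cong (λ r → eqMaybeP r (just (rotTri x y z (+ a , + b))))
                (trans (cong (partnerOf prs) (trans (cong (rotTri x y z) m≡) (rot⁺ {a″} {b″} {a′} {b′} (trans (cong suc (+-comm a″ a′)) e) (trans (+-comm b″ b′) f))))
                (trans (partner⁺ μ ups (ups⁺ u′))
                       (cong just (trans (cong (neighbour (+ a′ , + b′)) s)
                                  (trans (neighbour⁺ (partner-sym pr) e₁ f₁) (sym (rot⁺ {a} {b} {a₁} {b₁} e₁ f₁))))))))
              (==P-refl (rotTri x y z (+ a , + b)))
      covered : ∀ {p} → p ∈ downs → (countP p (map proj₂ prs) ≡ᵇ 1) ≡ true
      covered {p} p∈ with downs⁻ p∈
      ... | a″ , b″ , refl , w with opposite (Dn.a< w) (Dn.b< w)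
      ...   | a′ , b′ , e , f with sy (dn→up e f w)
      ...     | a , b , pr , u , s =
        trans (cong (λ l → countP (+ a″ , + b″) l ≡ᵇ 1) (sym (map-∘ {g = proj₂} {f = λ u → u , μ u} ups)))
              (cong (_≡ᵇ 1) (count-one μ (+ a″ , + b″) ups-unique (ups⁺ u) here≡ only))
        where
        e′ : suc (a′ + a″) ≡ c + c
        e′ = trans (cong suc (+-comm a′ a″)) e
        f′ : b′ + b″ ≡ d + d
        f′ = trans (+-comm b′ b″) f
        here≡ : μ (+ a , + b) ≡ (+ a″ , + b″)
        here≡ = trans (cong (neighbour (+ a , + b)) s) (neighbour⁺ (partner-sym pr) e′ f′)
        only : ∀ {v} → v ∈ ups → μ v ≡ (+ a″ , + b″) → v ≡ (+ a , + b)
        only v∈ m≡ with ups⁻ v∈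
        ... | a₁ , b₁ , refl , u₁ with sy u₁
        ...   | a₂ , b₂ , pr₁ , u₂ , s₁ with partner-unique (partner-rot⁻ {a₁} {b₁} {a′} {b′} (σ a₁ b₁) (trans (cong (rotTri x y z) m≡) (rot⁺ {a″} {b″} {a′} {b′} e f))) pr₁
        ...     | refl , refl with partner-unique pr (subst (λ i → Partner i a′ b′ a₁ b₁) (sym s₁) (partner-sym pr₁))
        ...       | refl , refl = refl

-- Patterns as indexed families of rows

module Stacks where

  open Summation
  open Enumeration
  open ListCounting
  open GelfandTsetlin using (patterns)

  nth : List (List ℕ) → ℕ → List ℕ
  nth []      j       = []
  nth (t ∷ ρ) zero    = t
  nth (t ∷ ρ) (suc j) = nth ρ j

  nth-applyUpTo : ∀ (f : ℕ → List ℕ) {n j} → j < n → nth (applyUpTo f n) j ≡ f j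
  nth-applyUpTo f {suc n} {zero}  _  = refl
  nth-applyUpTo f {suc n} {suc j} lt = nth-applyUpTo (λ i → f (suc i)) (s≤s⁻¹ lt)

  applyUpTo-nth : ∀ {f : ℕ → List ℕ} {n} ρ → length ρ ≡ n → (∀ {j} → j < n → f j ≡ nth ρ j) → applyUpTo f n ≡ ρ
  applyUpTo-nth []      refl h = refl
  applyUpTo-nth (t ∷ ρ) refl h = cong₂ _∷_ (h (s≤s z≤n)) (applyUpTo-nth ρ refl (λ lt → h (s≤s lt)))

  patterns⁺ : ∀ n (f : ℕ → List ℕ) → (∀ {j} → j < n → f (suc j) ∈ inter (f j)) → applyUpTo (λ j → f (suc j)) n ∈ patterns n (f 0)
  patterns⁺ zero    f h = here refl
  patterns⁺ (suc n) f h = ∈-consAll⁺ (h (s≤s z≤n)) (patterns⁺ n (λ j → f (suc j)) (λ lt → h (s≤s lt)))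

  patterns⁻ : ∀ n {s ρ} → ρ ∈ patterns n s → length ρ ≡ n × (∀ {j} → j < n → nth ρ j ∈ inter (nth (s ∷ ρ) j))
  patterns⁻ zero    (here refl) = refl , λ ()
  patterns⁻ (suc n) {s} ρ∈ with ∈-consAll⁻ (inter s) ρ∈
  ... | t , ρ , t∈ , ρ∈′ , refl = cong suc (proj₁ (patterns⁻ n ρ∈′)) , step
    where
    step : ∀ {j} → j < suc n → nth (t ∷ ρ) j ∈ inter (nth (s ∷ t ∷ ρ) j)
    step {zero}  _  = t∈
    step {suc j} lt = proj₂ (patterns⁻ n ρ∈′) (s≤s⁻¹ lt)

  patterns-unique : ∀ n s → Unique (patterns n s)
  patterns-unique zero    s = AllPairs._∷_ All.[] AllPairs.[]
  patterns-unique (suc n) s = consAll-unique (inter-unique s) (patterns-unique n)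

-- The bijection between symmetric tilings and patterns

module TilingCount (m q k e₁ e₂ x y z c d N c₀ p₀ : ℕ)
  (x≡ : x ≡ m + e₁ + (m + e₁) + k) (y≡ : y ≡ suc (q + q + k)) (z≡ : z ≡ m + e₂ + (m + e₂) + k)
  (c≡ : c ≡ m + e₁ + (m + e₂) + k) (d≡ : d ≡ q + (m + e₂) + k)
  (N≡ : N ≡ m + (q + k)) (c₀≡ : c₀ ≡ e₁ + (m + q)) (p₀≡ : p₀ ≡ c₀ + k)
  (one-sided : e₁ ≡ 0 ⊎ e₂ ≡ 0) (cx≡ : D.cx x y z ≡ + c) (cy≡ : D.cy x y z ≡ + d) where

  open Summation
  open Enumeration
  open ListCounting
  open GelfandTsetlin using (patterns)
  open Strip
  open Stacks
  open Pairing using (look; look-map; map-look; map-local; pairUp-map; pairsOf-pairUp; choices-sound; choices-complete; choices-unique)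
  open TopRow m q k e₁ e₂ x y z c d N c₀ p₀ x≡ y≡ z≡ c≡ d≡ N≡ c₀≡ p₀≡ one-sided
  open Geometry x y z k c d p₀ x+z y+z c+d k≤c
  open DecodedRows x y z k c d p₀ x+z y+z c+d k≤c
  open EncodedRows x y z k c d p₀ x+z y+z c+d k≤c
  open Matching x y z k c d x+z y+z cx≡ cy≡ p₀ c+d k≤c

  row : (ℕ → ℕ → Fin 3) → ℕ → List ℕ
  row = Colours.row

  module _ (τ : ℕ → ℕ → Fin 3) (sy : Symmetric τ) where

    open Colours τ hiding (row)
    open Decode τ sy using (top-1)

    row-bound : ∀ l → l ≡ c → ∀ {p} → p ∈ row τ l → p < y + c
    row-bound (suc l) e {p} p∈ = subst (λ n → p < y + n) e (subst (p <_) (sym (+-suc y l)) (s≤s (proj₁ (∈-row⁻ p∈))))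

    row-holes : ∀ l → l ≡ c → ∀ {p} → p < y + c → ¬ Seg c p → p ∈ row τ l
    row-holes zero    e {p} lt ¬s = ⊥-elim (¬s (subst (λ n → Seg n p) e (seg-first (subst (p <_) (trans (cong (λ n → y + n) (sym e)) (+-identityʳ y)) lt))))
    row-holes (suc l) e {p} lt ¬s = ∈-row⁺ (s≤s⁻¹ (subst (p <_) (trans (cong (λ n → y + n) (sym e)) (+-suc y l)) lt)) (κ̂-hole (λ s → ¬s (subst (λ n → Seg n p) e s)))

    row-mirror : ∀ l → l ≡ c → ∀ {p p′} → p + p′ ≡ p₀ + p₀ → p ∈ row τ l → Seg c p → p′ ∈ row τ l × Seg c p′
    row-mirror (suc l) e {p} {p′} pp p∈ s = ∈-row⁺ (s≤s⁻¹ (subst (p′ <_) (trans (cong (λ n → y + n) (sym e)) (+-suc y l)) (Seg.in< (proj₁ t)))) (trans (cong (λ n → κ̂ n p′) e) (proj₂ t)) , proj₁ t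
      where
      t : Seg c p′ × κ̂ c p′ ≡ 1F
      t = top-1 (subst (0 <_) e (s≤s z≤n)) pp s (trans (cong (λ n → κ̂ n p) (sym e)) (proj₂ (∈-row⁻ p∈)))

    balanced-row : Balanced (row τ c)
    balanced-row = record
      { sorted = row-sorted c
      ; size   = row-length τ sy ≤-refl
      ; bound  = row-bound c refl
      ; holes  = row-holes c refl
      ; mirror = row-mirror c refl
      }

    -- A tiling is determined by its rows: by `chain` the colours in each strip are those defined by
    -- its two rows, and `locate` places every up-triangle in a strip, directly or through its
    -- image.
    colouring-row : ∀ {r} → (∀ {l} → l ≤ c → r l ≡ row τ l) → ∀ {a b} → Up a b → Colouring.τ r a b ≡ τ a b
    colouring-row {r} h {a} {b} u = go (locate u)
      where
      go : (∃ λ p → a < c × a + b ≡ z + p × Seg a p) ⊎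
           (∃ λ l → ∃ λ p → l < c × a + suc l ≡ c + c × b + (z + p) ≡ suc l + (d + d) × Seg (suc l) p) → Colouring.τ r a b ≡ τ a b
      go (inj₁ (p , a<c , e , s)) =
        trans (Colouring.τ-left r a<c e) (trans (cong₂ (λ s t → χD s t p) (h a<c) (h (<⇒≤ a<c)))
              (trans (sym (proj₁ (proj₂ (chain τ sy a<c)) (Seg.in< s))) (χ̂-seg e s)))
      go (inj₂ (l , p , l<c , f , g , s)) =
        trans (Colouring.τ-right r f g l<c) (trans (cong₂ (λ s t → κD s t p) (h l<c) (h (<⇒≤ l<c)))
              (trans (sym (proj₂ (proj₂ (chain τ sy l<c)) (s≤s⁻¹ (subst (p <_) (+-suc y l) (Seg.in< s))))) (κ̂-seg f g s)))

  module _ {r : ℕ → List ℕ} (rows : Rows r) where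

    open Encode r rows using (full-at; at; module Full)
    open Full
    open Colouring r using (τ-right)

    -- At positions in the region colour 1 marks exactly the row entries; missing positions are
    -- entries of both rows.
    row-colouring : ∀ {τ} → (∀ {a b} → Up a b → τ a b ≡ Colouring.τ r a b) → ∀ {l} → l ≤ c → row τ l ≡ r l
    row-colouring h {zero}  _  = sym (Rows.bottom rows)
    row-colouring {τ} h {suc l} le = sorted-≡ (row-sorted (suc l)) (fsorted (full-at le)) forward backward
      where
      open Colours τ hiding (row)
      colour : ∀ {p} → Seg (suc l) p → κ̂ (suc l) p ≡ κD (r (suc l)) (r l) p
      colour {p} s = go (rightUp (s≤s z≤n) le s)
        where
        go : (∃ λ a → ∃ λ b → a + suc l ≡ c + c × b + (z + p) ≡ suc l + (d + d) × Up a b) → κ̂ (suc l) p ≡ κD (r (suc l)) (r l) p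
        go (a , b , f , g , u) = trans (κ̂-seg f g s) (trans (h u) (τ-right f g le))
      forward : ∀ {p} → p ∈ row τ (suc l) → p ∈ r (suc l)
      forward {p} p∈ = go (seg? (suc l) p)
        where
        go : Dec (Seg (suc l) p) → p ∈ r (suc l)
        go (yes s) = AtD.κ⇒ (at le p) (trans (sym (colour s)) (proj₂ (∈-row⁻ p∈)))
        go (no ¬s) = fholes (full-at le) (subst (p <_) (sym (+-suc y l)) (s≤s (proj₁ (∈-row⁻ p∈)))) ¬s
      backward : ∀ {p} → p ∈ r (suc l) → p ∈ row τ (suc l)
      backward {p} p∈ = ∈-row⁺ (s≤s⁻¹ (subst (p <_) (+-suc y l) (fbound (full-at le) p∈))) (go (seg? (suc l) p))
        where
        go : Dec (Seg (suc l) p) → κ̂ (suc l) p ≡ 1F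
        go (yes s) = trans (colour s) (AtD.κ⇐ (at le p) p∈)
        go (no ¬s) = κ̂-hole ¬s

  -- A pattern lists its rows from the middle line leftwards, whereas `Rows` numbers them from the
  -- left side of the hexagon.
  rowsOf : List ℕ → List (List ℕ) → ℕ → List ℕ
  rowsOf s ρ l = nth (s ∷ ρ) (c ∸ l)

  ∸-step : ∀ {l} → l < c → c ∸ l ≡ suc (c ∸ suc l)
  ∸-step {l} lt = +-cancelʳ-≡ l (c ∸ l) (suc (c ∸ suc l)) (trans (m∸n+n≡m (<⇒≤ lt)) (trans (sym (m∸n+n≡m lt)) (+-suc (c ∸ suc l) l)))

  rows-rowsOf : ∀ {C ρ} → C ∈ subs m 0 (m + q) → ρ ∈ patterns c (topRow k C) → Rows (rowsOf (topRow k C) ρ)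
  rows-rowsOf {C} {ρ} C∈ ρ∈ = record
    { chain  = chained
    -- The last row has c entries and each further row one fewer, so row 0 is empty.
    ; bottom = empty (trans (lengths c 0 (+-identityʳ c)) refl)
    ; sorted = subst Sorted (sym top≡) sorted
    ; bound  = λ {p} p∈ → bound (subst (p ∈_) top≡ p∈)
    ; holes  = λ {p} lt ¬s → subst (p ∈_) (sym top≡) (holes lt ¬s)
    ; mirror = λ {p} {p′} pp p∈ s → let (q∈ , s′) = mirror pp (subst (p ∈_) top≡ p∈) s in subst (p′ ∈_) (sym top≡) q∈ , s′
    }
    where
    open Balanced (balanced-topRow C∈)
    r : ℕ → List ℕ
    r = rowsOf (topRow k C) ρ
    top≡ : r c ≡ topRow k C
    top≡ = cong (nth (topRow k C ∷ ρ)) (n∸n≡0 c)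
    chained : ∀ {a} → a < c → r a ∈ inter (r (suc a))
    chained {a} lt = subst (λ j → nth (topRow k C ∷ ρ) j ∈ inter (r (suc a))) (sym (∸-step lt))
                       (proj₂ (patterns⁻ c ρ∈) (subst (_≤ c) (∸-step lt) (m∸n≤m c a)))
    shorter : ∀ s {t n} → t ∈ inter s → length s ≡ suc n → length t ≡ n
    shorter (s ∷ ss) t∈ e = trans (proj₁ (inter-sound s ss t∈)) (suc-injective e)
    lengths : ∀ e l → e + l ≡ c → length (r l) ≡ l
    lengths zero    l refl = trans (cong length top≡) size
    lengths (suc e) l eq   = shorter (r (suc l)) (chained (subst (l <_) eq (s≤s (m≤n+m l e)))) (lengths e (suc l) (trans (+-suc e l) eq))
    empty : ∀ {t : List ℕ} → length t ≡ 0 → t ≡ []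
    empty {[]} _ = refl

  -- The up-triangles of the region have natural coordinates; the other clauses are defaults.
  lift : (ℕ → ℕ → Fin 3) → Pt → Fin 3
  lift t (+ a , + b) = t a b
  lift t (+ _ , -[1+ _ ]) = 0F
  lift t (-[1+ _ ] , _)   = 0F

  direction : List (Fin 3) → ℕ → ℕ → Fin 3
  direction cs a b = look ups cs (+ a , + b)

  decode : List (Fin 3) → List (List ℕ)
  decode cs = pairsIn (row (direction cs) c) ∷ applyUpTo (λ j → row (direction cs) (c ∸ suc j)) c

  encode : List (List ℕ) → List (Fin 3)
  encode []      = []
  encode (C ∷ ρ) = map (lift (Colouring.τ (rowsOf (topRow k C) ρ))) ups

  -- The top row is represented by the index set of its pairs, placed in front of the remaining
  -- rows.
  Pattern : List (List (List ℕ))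
  Pattern = consAll (subs m 0 (m + q)) (λ C → patterns c (topRow k C))

  tiling? : ∀ cs → Dec ((D.isTiling x y z k (D.pairsOf ups cs) Data.Bool.∧ D.isSymmetric x y z (D.pairsOf ups cs)) ≡ true)
  tiling? cs = _ Data.Bool.≟ true

  tilings : List (List (Fin 3))
  tilings = filter tiling? (choices (length ups))

  pairs-map : ∀ τ → D.pairsOf ups (map τ ups) ≡ map (λ u → u , neighbour u (τ u)) ups
  pairs-map τ = trans (pairsOf-pairUp ups (map τ ups)) (pairUp-map τ ups)

  decode-encode : ∀ {cs} → cs ∈ tilings → decode cs ∈ Pattern × encode (decode cs) ≡ cs
  decode-encode {cs} cs∈ =
    ∈-consAll⁺ {ts = subs m 0 (m + q)} C∈subs
      (subst (λ s → applyUpTo (λ j → row τ (c ∸ suc j)) c ∈ patterns c s) S≡top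
             (patterns⁺ c (λ j → row τ (c ∸ j)) (λ {j} lt → subst (λ l → row τ (c ∸ suc j) ∈ inter (row τ l)) (sym (∸-step lt))
                                                                  (proj₁ (chain τ sy (≤-trans (≤-reflexive (sym (∸-step lt))) (m∸n≤m c j))))))) ,
    trans (map-local ups agree) (map-look ups-unique cs len)
    where
    τ : ℕ → ℕ → Fin 3
    τ = direction cs
    len : length cs ≡ length ups
    len = choices-sound (length ups) (proj₁ (∈-filter⁻ tiling? {xs = choices (length ups)} cs∈))
    valid : Valid (map (λ u → u , neighbour u (look ups cs u)) ups)
    valid = subst Valid (trans (cong (D.pairsOf ups) (sym (map-look ups-unique cs len))) (pairs-map (look ups cs)))
              (proj₂ (∈-filter⁻ tiling? {xs = choices (length ups)} cs∈))
    sy : Symmetric τ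
    sy = valid⇒symmetric (look ups cs) valid
    open DecodeTop (row τ c) (balanced-row τ sy) using (C∈subs; S≡top)
    rows-row : ∀ {l} → l ≤ c → rowsOf (topRow k (pairsIn (row τ c))) (applyUpTo (λ j → row τ (c ∸ suc j)) c) l ≡ row τ l
    rows-row {l} le = go (c ∸ l) refl
      where
      go : ∀ j → c ∸ l ≡ j → nth (topRow k (pairsIn (row τ c)) ∷ applyUpTo (λ j → row τ (c ∸ suc j)) c) j ≡ row τ l
      go zero    e = trans (sym S≡top) (cong (row τ) (≤-antisym (m∸n≡0⇒m≤n e) le))
      go (suc j) e = trans (nth-applyUpTo (λ j → row τ (c ∸ suc j)) (subst (_≤ c) e (m∸n≤m c l)))
                           (cong (row τ) (trans (cong (c ∸_) (sym e)) (m∸[m∸n]≡n le)))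
    agree : ∀ {u} → u ∈ ups → lift (Colouring.τ (rowsOf (topRow k (pairsIn (row τ c))) (applyUpTo (λ j → row τ (c ∸ suc j)) c))) u ≡ look ups cs u
    agree u∈ = go (ups⁻ u∈)
      where
      go : ∀ {u} → (∃ λ a → ∃ λ b → u ≡ (+ a , + b) × Up a b) →
           lift (Colouring.τ (rowsOf (topRow k (pairsIn (row τ c))) (applyUpTo (λ j → row τ (c ∸ suc j)) c))) u ≡ look ups cs u
      go (a , b , refl , w) = colouring-row τ sy rows-row w

  encode-decode : ∀ {C ρ} → C ∈ subs m 0 (m + q) → ρ ∈ patterns c (topRow k C) → encode (C ∷ ρ) ∈ tilings × decode (encode (C ∷ ρ)) ≡ C ∷ ρ
  encode-decode {C} {ρ} C∈ ρ∈ =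
    ∈-filter⁺ tiling? (subst (λ n → map colour ups ∈ choices n) (length-map colour ups) (choices-complete (map colour ups)))
      (subst Valid (sym (pairs-map colour)) (symmetric⇒valid colour (Encode.symmetric r rows))) ,
    cong₂ _∷_ (trans (cong pairsIn (trans (same ≤-refl) (cong (nth (topRow k C ∷ ρ)) (n∸n≡0 c)))) (pairsIn-topRow C∈))
      (applyUpTo-nth ρ (proj₁ (patterns⁻ c ρ∈)) (λ {j} lt → trans (same (m∸n≤m c (suc j))) (cong (nth (topRow k C ∷ ρ)) (m∸[m∸n]≡n lt))))
    where
    r : ℕ → List ℕ
    r = rowsOf (topRow k C) ρ
    rows : Rows r
    rows = rows-rowsOf C∈ ρ∈
    colour : Pt → Fin 3
    colour = lift (Colouring.τ r)
    same : ∀ {l} → l ≤ c → row (direction (map colour ups)) l ≡ r l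
    same = row-colouring rows (λ u → look-map colour ups (ups⁺ u))

  tilings-patterns : McsBowtie x y z k ≡ length Pattern
  tilings-patterns = bijection-length decode encode {tilings} {Pattern}
    (Uniqueₚ.filter⁺ tiling? (choices-unique (length ups)))
    (consAll-unique (subs-unique m 0 (m + q)) (λ C → patterns-unique c (topRow k C)))
    decode-encode back
    where
    back : ∀ {ps} → ps ∈ Pattern → encode ps ∈ tilings × decode (encode ps) ≡ ps
    back {ps} ps∈ = go (∈-consAll⁻ (subs m 0 (m + q)) ps∈)
      where
      go : (∃ λ C → ∃ λ ρ → C ∈ subs m 0 (m + q) × ρ ∈ patterns c (topRow k C) × ps ≡ C ∷ ρ) → encode ps ∈ tilings × decode (encode ps) ≡ ps
      go (C , ρ , C∈ , ρ∈ , refl) = encode-decode C∈ ρ∈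

-- The parity hypotheses and the two cases of the formula

module Conclusion where

  open Summation
  open Enumeration
  open GelfandTsetlin
  open CountFormula
  import Defs as D
  open import Defs using (McsBowtie; prodQ; poch; P; _//_)
  open import Data.Integer as ℤ using (ℤ; +_; 1ℤ)
  open import Data.Integer.Properties using (pos-*; +-injective)
  open import Data.List using (List; length)
  open import Data.Nat using (ℕ; suc; _+_; _*_; _∸_; _/_; _%_; _≤_; s≤s⁻¹)
  open import Data.Nat.DivMod using (m≡m%n+[m/n]*n; m*n/n≡m)
  open import Data.Nat.Properties
  open import Data.Nat.Tactic.RingSolver using (solve-∀)
  open import Data.Product using (_,_; ∃)
  open import Data.Rational as ℚ using (ℚ)
  open import Data.Sum using (_⊎_; inj₁; inj₂)
  open import Relation.Binary.PropositionalEquality using (_≡_; refl; sym; trans; cong; subst; subst₂)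

  half : ∀ n → (n + n) / 2 ≡ n
  half n = trans (cong (_/ 2) (double n)) (m*n/n≡m n 2)
    where
    double : ∀ n → n + n ≡ n * 2
    double = solve-∀

  odd : ∀ n → n % 2 ≡ 1 → ∃ λ a → n ≡ suc (a + a)
  odd n e = n / 2 , trans (m≡m%n+[m/n]*n n 2) (trans (cong (_+ n / 2 * 2) e) (double (n / 2)))
    where
    double : ∀ a → 1 + a * 2 ≡ suc (a + a)
    double = solve-∀

  -- The difference x - k is that of two odd numbers, 2a + 1 and 2b + 1, so its half is a - b.
  even-excess : ∀ {x k y} → k ≤ x → (∃ λ a → x + y ≡ suc (a + a)) → (∃ λ b → k + y ≡ suc (b + b)) → ∃ λ h → x ≡ h + h + k
  even-excess {x} {k} {y} k≤x (a , ea) (b , eb) = a ∸ b , +-cancelʳ-≡ y x (a ∸ b + (a ∸ b) + k)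
    (trans ea (trans (cong (λ t → suc (t + t)) (sym (m∸n+n≡m b≤a))) (trans (regroup (a ∸ b) b) (trans (cong (λ t → a ∸ b + (a ∸ b) + t) (sym eb)) (sym (+-assoc (a ∸ b + (a ∸ b)) k y))))))
    where
    b≤a : b ≤ a
    b≤a = ≮⇒≥ (λ a<b → <⇒≱ (+-mono-< a<b a<b) (s≤s⁻¹ (subst₂ _≤_ eb ea (+-monoˡ-≤ y k≤x))))
    regroup : ∀ h b → suc (h + b + (h + b)) ≡ h + h + suc (b + b)
    regroup = solve-∀

  -- From k + y = 2b + 1 follows y = 2 (b - k) + 1 + k, and k ≤ y gives k ≤ b.
  odd-excess : ∀ {k y} → k ≤ y → (∃ λ b → k + y ≡ suc (b + b)) → ∃ λ q → y ≡ suc (q + q + k)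
  odd-excess {k} {y} k≤y (b , eb) = b ∸ k , +-cancelˡ-≡ k y (suc (b ∸ k + (b ∸ k) + k))
    (trans eb (trans (cong (λ t → suc (t + t)) (sym (m∸n+n≡m k≤b))) (regroup (b ∸ k) k)))
    where
    k≤b : k ≤ b
    k≤b = ≮⇒≥ (λ b<k → <⇒≱ (subst (_≤ k + y) (cong suc (+-suc b b)) (+-mono-≤ b<k (≤-trans b<k k≤y))) (≤-reflexive eb))
    regroup : ∀ q k → suc (q + k + (q + k)) ≡ k + suc (q + q + k)
    regroup = solve-∀

  length-consAll : ∀ {A : Set} ts (g : A → List (List A)) → + length (consAll ts g) ≡ sumOver (λ t → + length (g t)) ts
  length-consAll ts g = trans (length-sum (consAll ts g)) (trans (sum-consAll (λ _ → 1ℤ) ts g) (sum-cong (λ t → sym (length-sum (g t))) ts))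

  module Count (m q k e₁ e₂ : ℕ) (one-sided : e₁ ≡ 0 ⊎ e₂ ≡ 0) where

    open Rows m q k e₁ e₂

    x y z d : ℕ
    x = m + e₁ + (m + e₁) + k
    y = suc (q + q + k)
    z = m + e₂ + (m + e₂) + k
    d = q + (m + e₂) + k

    -- Rows grow by one entry per line, so the length of the last row is the abscissa of the middle
    -- line.
    size≡ : size ≡ m + e₁ + (m + e₂) + k
    size≡ = ring m k e₁ e₂
      where
      ring : ∀ m k e₁ e₂ → e₁ + (m + m + k + e₂) ≡ m + e₁ + (m + e₂) + k
      ring = solve-∀

    open TopRow m q k e₁ e₂ x y z size d N c₀ p₀ refl refl refl size≡ refl refl refl refl one-sided using (x+z; y+z; topRow-sorted; pairs-of-subs)

    tilings-total : + McsBowtie x y z k ≡ patternTotal m q k e₁ e₂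
    tilings-total = trans (cong (λ n → + n) (TilingCount.tilings-patterns m q k e₁ e₂ x y z size d N c₀ p₀ refl refl refl size≡ refl refl refl refl one-sided cx≡ cy≡))
                          (length-consAll (subs m 0 (m + q)) (λ C → patterns size (top C)))
      where
      cx≡ : D.cx x y z ≡ + size
      cx≡ = cong (λ n → + n) (trans (cong (_/ 2) (sym x+z)) (half size))
      cy≡ : D.cy x y z ≡ + d
      cy≡ = cong (λ n → + n) (trans (cong (λ n → (n ∸ 1) / 2) (sym y+z)) (half d))

    sorted-tops : SortedTops m q k e₁ e₂
    sorted-tops {C} C∈ = topRow-sorted k C (n≤1+n k) (pairs-of-subs C∈)

  -- The claim cleared of denominators; here `x` and `z` stand for the halves of the differences of
  -- the side-lengths and k.
  Formula : (M x z q k : ℕ) → Set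
  Formula M x z q k = M * PP 0 z X * PP 0 k q * PP k q z * PP k X z ≡ PP k z X * PP x k q * PP (x + k) q z * PP (x + k) X z
    where X = suc (q + k)

  pos-*⁴ : ∀ a b c d → + (a * b * c * d) ≡ + a ℤ.* + b ℤ.* + c ℤ.* + d
  pos-*⁴ a b c d = trans (pos-* (a * b * c) d) (cong (ℤ._* + d) (trans (pos-* (a * b) c) (cong (ℤ._* + c) (pos-* a b))))

  pos-*⁵ : ∀ a b c d e → + (a * b * c * d * e) ≡ + a ℤ.* + b ℤ.* + c ℤ.* + d ℤ.* + e
  pos-*⁵ a b c d e = trans (pos-* (a * b * c * d) e) (cong (ℤ._* + e) (pos-*⁴ a b c d))

  descend : ∀ {M x z q k} {T : ℤ} → + M ≡ T →
            (let X = suc (q + k) in T ℤ.* PPℤ 0 z X ℤ.* PPℤ 0 k q ℤ.* PPℤ k q z ℤ.* PPℤ k X z ≡ PPℤ k z X ℤ.* PPℤ x k q ℤ.* PPℤ (x + k) q z ℤ.* PPℤ (x + k) X z) →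
            Formula M x z q k
  descend {M} {x} {z} {q} {k} refl e = +-injective (trans (pos-*⁵ M (PP 0 z X) (PP 0 k q) (PP k q z) (PP k X z))
      (trans e (sym (pos-*⁴ (PP k z X) (PP x k q) (PP (x + k) q z) (PP (x + k) X z)))))
    where X = suc (q + k)

  -- The number of pairs is the smaller of the two halves, and their difference is the number of
  -- forced positions, at the end belonging to the larger one.
  formula : ∀ x z q k → Formula (McsBowtie (x + x + k) (suc (q + q + k)) (z + z + k) k) x z q k
  formula x z q k = go (≤-total z x)
    where
    wide : ∀ e → Formula (McsBowtie (z + e + (z + e) + k) (suc (q + q + k)) (z + z + k) k) (z + e) z q k
    wide e = descend {x = z + e} {z} {q} {k} (trans (cong (λ t → + McsBowtie (z + e + (z + e) + k) (suc (q + q + k)) (t + t + k) k) (sym (+-identityʳ z))) tilings-total)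
               (subst (λ t → patternTotal z q k e 0 ℤ.* PPℤ 0 z X ℤ.* PPℤ 0 k q ℤ.* PPℤ k q z ℤ.* PPℤ k X z ≡ PPℤ k z X ℤ.* PPℤ (z + e) k q ℤ.* PPℤ t q z ℤ.* PPℤ t X z) (swap z k e)
                      (total-wide z q k e sorted-tops))
      where
      open Count z q k e 0 (inj₂ refl) using (tilings-total; sorted-tops)
      X = suc (q + k)
      swap : ∀ z k e → z + k + e ≡ z + e + k
      swap = solve-∀
    narrow : ∀ e → Formula (McsBowtie (x + x + k) (suc (q + q + k)) (x + e + (x + e) + k) k) x (x + e) q k
    narrow e = descend {x = x} {x + e} {q} {k} (trans (cong (λ t → + McsBowtie (t + t + k) (suc (q + q + k)) (x + e + (x + e) + k) k) (sym (+-identityʳ x))) tilings-total)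
                 (total-narrow x q k e sorted-tops)
      where open Count x q k 0 e (inj₁ refl) using (tilings-total; sorted-tops)
    go : z ≤ x ⊎ x ≤ z → Formula (McsBowtie (x + x + k) (suc (q + q + k)) (z + z + k) k) x z q k
    go (inj₁ le) = subst (λ t → Formula (McsBowtie (t + t + k) (suc (q + q + k)) (z + z + k) k) t z q k) (m+[n∸m]≡n le) (wide (x ∸ z))
    go (inj₂ le) = subst (λ t → Formula (McsBowtie (x + x + k) (suc (q + q + k)) (t + t + k) k) x t q k) (m+[n∸m]≡n le) (narrow (z ∸ x))

  -- The right-hand side as a function of its halved parameters, so that all divisions by two can be
  -- rewritten by one congruence.
  closedForm : (X z k q x x′ : ℕ) → ℚ
  closedForm X z k q x x′ =
    P X z k ℚ.* prodQ q (λ i → poch (x + i) k // poch i k)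
            ℚ.* prodQ z (λ i → (poch (x′ + i) q // poch (k + i) q) ℚ.* (poch (x′ + i) X // poch (k + i) X))

  closedForm-cong : ∀ {X X₁ z z₁ q q₁ x x₁ x′ x₁′} k → X ≡ X₁ → z ≡ z₁ → q ≡ q₁ → x ≡ x₁ → x′ ≡ x₁′ →
                    closedForm X z k q x x′ ≡ closedForm X₁ z₁ k q₁ x₁ x₁′
  closedForm-cong k refl refl refl refl refl = refl

  bowtie-formula : ∀ x y z k → k ≤ x → k ≤ y → k ≤ z → (x + y) % 2 ≡ 1 → (z + y) % 2 ≡ 1 → (k + y) % 2 ≡ 1 →
    McsBowtie x y z k // 1 ≡ closedForm ((y + k + 1) / 2) ((z ∸ k) / 2) k ((y ∸ k ∸ 1) / 2) ((x ∸ k) / 2) ((x + k) / 2)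
  bowtie-formula x y z k k≤x k≤y k≤z ox oz ok =
    go (even-excess k≤x (odd (x + y) ox) eb) (even-excess k≤z (odd (z + y) oz) eb) (odd-excess k≤y eb)
    where
    eb = odd (k + y) ok
    go : (∃ λ h → x ≡ h + h + k) → (∃ λ h → z ≡ h + h + k) → (∃ λ q → y ≡ suc (q + q + k)) →
         McsBowtie x y z k // 1 ≡ closedForm ((y + k + 1) / 2) ((z ∸ k) / 2) k ((y ∸ k ∸ 1) / 2) ((x ∸ k) / 2) ((x + k) / 2)
    go (a , refl) (b , refl) (q , refl) =
      trans (Ratios.ratio-formula (McsBowtie (a + a + k) (suc (q + q + k)) (b + b + k) k) a b q k (formula a b q k))
            (closedForm-cong k (sym (trans (cong (_/ 2) (ring₁ q k)) (half (suc (q + k))))) (sym (trans (cong (_/ 2) (m+n∸n≡m (b + b) k)) (half b)))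
                               (sym (trans (cong (λ n → (n ∸ 1) / 2) (m+n∸n≡m (suc (q + q)) k)) (half q)))
                               (sym (trans (cong (_/ 2) (m+n∸n≡m (a + a) k)) (half a))) (sym (trans (cong (_/ 2) (ring₂ a k)) (half (a + k)))))
      where
      ring₁ : ∀ q k → suc (q + q + k) + k + 1 ≡ suc (q + k) + suc (q + k)
      ring₁ = solve-∀
      ring₂ : ∀ a k → a + a + k + k ≡ a + k + (a + k)
      ring₂ = solve-∀

open import Defs
open import Data.Nat using (ℕ; _+_; _∸_; _/_; _%_; _≤_)
open import Data.Integer using (+_)
open import Data.Rational using (ℚ; _*_) renaming (_/_ to _÷_)
open import Relation.Binary.PropositionalEquality using (_≡_)

theorem5 : (x y z k : ℕ) → k ≤ x → k ≤ y → k ≤ z →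
    (x + y) % 2 ≡ 1 → (z + y) % 2 ≡ 1 → (k + y) % 2 ≡ 1 →
    (+ McsBowtie x y z k) ÷ 1
    ≡ P ((y + k + 1) / 2) ((z ∸ k) / 2) k
    * prodQ ((y ∸ k ∸ 1) / 2)
    (λ i → poch ((x ∸ k) / 2 + i) k // poch i k)
    * prodQ ((z ∸ k) / 2)
    (λ i → (poch ((x + k) / 2 + i) ((y ∸ k ∸ 1) / 2)
    // poch (k + i) ((y ∸ k ∸ 1) / 2))
    * (poch ((x + k) / 2 + i) ((y + k + 1) / 2)
    // poch (k + i) ((y + k + 1) / 2)))
theorem5 = Conclusion.bowtie-formula
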